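{- Let $p\ge 4$ and $n>(2p-2)^2$, and let $\lambda\vdash n$. Then $s_{(n-p,p)}\ast s_\lambda$ is multiplicity free if and only if $\lambda$ is one of $(n)$, $(1^n)$, $(n-1,1)$, $(2,1^{n-2})$.
   Context: For $\lambda,\mu\vdash n$, the Kronecker product is $s_\lambda\ast s_\mu=\sum_{\nu\vdash n}g_{\lambda,\mu,\nu}s_\nu$, where $g_{\lambda,\mu,\nu}$ is the multiplicity of the irreducible $S_n$-character $\chi^\nu$ in the pointwise product $\chi^\lambda\chi^\mu$. A symmetric function is multiplicity free if every coefficient in its expansion in Schur functions is $0$ or $1$. -}

module Defs where

open import Data.Bool using (Bool; true; false; if_then_else_; _∧_; not)
open import Data.Nat using (_≟_; ℕ; zero; suc; _+_; _*_; _∸_; _^_; _≤_; _<_; _⊓_; _≡ᵇ_; _<ᵇ_; _≤ᵇ_; NonZero; _!)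
open import Data.Nat.Properties using (m*n≢0; m^n≢0; _!≢0)
open import Data.List using (List; []; _∷_; map; length; concatMap; applyUpTo; upTo)
open import Data.Nat.ListAction using (sum)
open import Data.Bool.ListAction using (any)
open import Data.List.Relation.Unary.All using (All)
open import Data.List.Relation.Unary.Linked using (Linked)
open import Data.Integer using (ℤ; +_; -_) renaming (_*_ to _*ℤ_; _+_ to _+ℤ_)
open import Data.Rational using (ℚ; 0ℚ; 1ℚ; _/_) renaming (_+_ to _+ℚ_)
open import Relation.Binary.PropositionalEquality using (_≡_)
open import Data.Product using (_×_)
open import Data.Sum using (_⊎_)
open import Relation.Nullary.Decidable using (⌊_⌋)
open import Relation.Unary using (Pred)

IsPartition : ℕ → List ℕ → Set
IsPartition n l = (sum l ≡ n) × (All (λ x → 0 < x) l × Linked (λ a b → b ≤ a) l)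

partsLE : ℕ → ℕ → ℕ → List (List ℕ)
partsLE _        _ zero    = [] ∷ []
partsLE zero     _ (suc n) = []
partsLE (suc f)  m (suc n) =
  concatMap (λ k → map (k ∷_) (partsLE f k (suc n ∸ k))) (applyUpTo suc (m ⊓ suc n))

partitions : ℕ → List (List ℕ)
partitions n = partsLE n n n

-- Irreducible characters of S_n via the Murnaghan–Nakayama rule,
-- using beta-sets: λ = (λ₁ ≥ … ≥ λ_ℓ) ↦ {λ_i + ℓ - i}.  Removing a rim
-- hook of length r corresponds to replacing b by b - r (b - r ∉ B), with
-- sign (-1)^(#{c ∈ B : b - r < c < b}).

betasAux : List ℕ → ℕ → List ℕ
betasAux []       _ = []
betasAux (x ∷ xs) k = (x + (k ∸ 1)) ∷ betasAux xs (k ∸ 1)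

betas : List ℕ → List ℕ
betas l = betasAux l (length l)

memb : ℕ → List ℕ → Bool
memb x B = any (λ c → c ≡ᵇ x) B

replaceβ : ℕ → ℕ → List ℕ → List ℕ
replaceβ b b' []       = []
replaceβ b b' (c ∷ cs) = if c ≡ᵇ b then b' ∷ replaceβ b b' cs else c ∷ replaceβ b b' cs

countᵇ : (ℕ → Bool) → List ℕ → ℕ
countᵇ P []       = 0
countᵇ P (x ∷ xs) = if P x then suc (countᵇ P xs) else countᵇ P xs

isEven : ℕ → Bool
isEven zero          = true
isEven (suc zero)    = false
isEven (suc (suc n)) = isEven n

signβ : ℕ → ℕ → List ℕ → ℤ
signβ b r B =
  if isEven (countᵇ (λ c → ((b ∸ r) <ᵇ c) ∧ (c <ᵇ b)) B) then + 1 else - (+ 1)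

sumℤ : List ℤ → ℤ
sumℤ []       = + 0
sumℤ (x ∷ xs) = x +ℤ sumℤ xs

chiβ : List ℕ → List ℕ → ℤ
chiβ B []      = + 1
chiβ B (r ∷ ρ) = sumℤ (map term B)
  where
  term : ℕ → ℤ
  term b = if (r ≤ᵇ b) ∧ not (memb (b ∸ r) B)
           then signβ b r B *ℤ chiβ (replaceβ b (b ∸ r) B) ρ
           else + 0

χ : List ℕ → List ℕ → ℤ
χ λ' ρ = chiβ (betas λ') ρ

-- z_ρ = ∏_i i^{m_i} m_i!  (centraliser order), so |class ρ| = n!/z_ρ.

zFactor : List ℕ → ℕ → ℕ
zFactor ρ j = suc j ^ countᵇ (λ x → x ≡ᵇ suc j) ρ * (countᵇ (λ x → x ≡ᵇ suc j) ρ) !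

zProd : List ℕ → List ℕ → ℕ
zProd ρ []       = 1
zProd ρ (j ∷ js) = zFactor ρ j * zProd ρ js

zProd≢0 : ∀ ρ js → NonZero (zProd ρ js)
zProd≢0 ρ []       = _
zProd≢0 ρ (j ∷ js) =
  let c = countᵇ (λ x → x ≡ᵇ suc j) ρ in
  m*n≢0 (zFactor ρ j) (zProd ρ js)
    {{m*n≢0 (suc j ^ c) (c !) {{m^n≢0 (suc j) c}} {{c !≢0}}}} {{zProd≢0 ρ js}}

z : List ℕ → ℕ
z ρ = zProd ρ (upTo (sum ρ))

z≢0 : ∀ ρ → NonZero (z ρ)
z≢0 ρ = zProd≢0 ρ (upTo (sum ρ))

sumℚ : List ℚ → ℚ
sumℚ []       = 0ℚ
sumℚ (x ∷ xs) = x +ℚ sumℚ xs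

-- Kronecker coefficient g_{λ,μ,ν} = ⟨χ^λ χ^μ, χ^ν⟩
--   = (1/n!) Σ_{σ ∈ S_n} χ^λ(σ) χ^μ(σ) χ^ν(σ) = Σ_{ρ ⊢ n} χ^λ(ρ)χ^μ(ρ)χ^ν(ρ) / z_ρ
-- (characters of S_n are real, so no conjugation is needed).

kron : ℕ → List ℕ → List ℕ → List ℕ → ℚ
kron n λ' μ ν =
  sumℚ (map (λ ρ → _/_ (χ λ' ρ *ℤ χ μ ρ *ℤ χ ν ρ) (z ρ) {{z≢0 ρ}}) (partitions n))

MultiplicityFree : ℕ → List ℕ → List ℕ → Set
MultiplicityFree n λ' μ =
  ∀ ν → IsPartition n ν → (kron n λ' μ ν ≡ 0ℚ) ⊎ (kron n λ' μ ν ≡ 1ℚ)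

{-# OPTIONS --safe #-}
-- Partitions are encoded by beta-lists, and Frobenius' formula identifies the Murnaghan–Nakayama
-- characters with the coefficients X A ρ of antisymmetric functions.  Let N_k(λ, ν) be the inner
-- product of the restrictions of χ^λ and χ^ν to S_k × S_{n-k}.
-- As χ^(n-p,p) is the difference of the permutation characters on p- and (p-1)-subsets, the
-- Kronecker coefficient is N_p(λ, ν) - N_{p-1}(λ, ν), and the Cauchy identity writes N_k as a sum
-- over nonnegative integer matrices with total k.
--
-- Conjugating λ only permutes the coefficients, so λ may be assumed at least as wide as long; then
-- n > (2p-2)² makes λ_1 large.  If λ is neither (n) nor (n-1,1), one chooses ν with |λ ∩ ν| = n - (p-1):
-- boxes forming a horizontal strip of size p-1 move to or from the first row, or to a new last row.
-- Then N_{p-1} = 1, while N_p ≥ 3 because an additional box can be removed in several places.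
-- Rectangles have a single corner; there ν gets a new last row of size p-2, which reduces the
-- coefficient to that of (·,2) with the square of a partition having two corners.
-- For (n-1,1) itself the coefficient counts the common subdiagrams of μ and ν with one box removed.

module Submission where

open import Defs
open import Data.Bool as Boolean using (Bool; true; false; if_then_else_; _∧_; _∨_; not)
import Data.Bool.Properties as Boolₚ
open import Data.Nat using (ℕ; zero; suc; _+_; _*_; _∸_; _^_; _!; _⊓_; _≤_; _<_; _≡ᵇ_; _<ᵇ_; _≤ᵇ_; z≤n; s≤s; NonZero)
import Data.Nat.Properties as ℕₚ
open import Data.Nat.ListAction using (sum)
open import Data.Nat.ListAction.Properties using (sum-++)
open import Data.Nat.Solver using (module +-*-Solver)
open import Data.Integer as ℤ using (ℤ; -_) renaming (+_ to pos; _*_ to _*ℤ_)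
import Data.Integer.Properties as ℤₚ
open import Data.Rational as ℚ using (ℚ) renaming (_≤_ to _≤ℚ_)
import Data.Rational.Properties as ℚₚ₀
import Data.Rational.Unnormalised as ℚᵘ
import Data.Rational.Unnormalised.Properties as ℚᵘₚ
open import Data.List using (List; []; _∷_; map; length; concatMap; _++_; replicate; applyUpTo; upTo; _∷ʳ_)
import Data.List.Properties as Listₚ
open import Data.List.Membership.Propositional using (_∈_; find)
import Data.List.Membership.Propositional.Properties as ∈ₚ
import Data.List.Membership.DecPropositional as DecMembership
open import Data.List.Relation.Unary.Any using (here; there)
open import Data.List.Relation.Unary.All as All using (All; []; _∷_)
import Data.List.Relation.Unary.All.Properties as Allₚ
open import Data.List.Relation.Unary.AllPairs using ([]; _∷_)
open import Data.List.Relation.Unary.Linked using (Linked; []; [-]; _∷_)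
open import Data.List.Relation.Unary.Unique.Propositional using (Unique)
import Data.List.Relation.Unary.Unique.Propositional.Properties as Uniqueₚ
open import Data.List.Relation.Binary.Pointwise as PW using (Pointwise; []; _∷_)
open import Data.Sum using (_⊎_; inj₁; inj₂; [_,_]′)
open import Data.Product using (_×_; _,_; proj₁; proj₂; ∃; Σ)
open import Data.Empty using (⊥; ⊥-elim)
open import Function.Bundles using (_⇔_; mk⇔)
open import Algebra.Properties.Group ℚₚ₀.+-0-group using (⁻¹-involutive)
open import Relation.Nullary using (Dec; yes; no; ¬_)
open import Relation.Nullary.Decidable using (toWitnessFalse)
open import Relation.Binary.Definitions using (tri<; tri≈; tri>)
open import Relation.Binary.PropositionalEquality using (_≡_; _≢_; refl; sym; trans; cong; cong₂; subst; subst₂; module ≡-Reasoning)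
open ≡-Reasoning
open +-*-Solver using (solve; _:=_; _:+_; _:*_; con)

-- Lists are treated as exponent vectors, sorted or not. The functions of them that matter change
-- sign under transpositions, so they vanish on repetitions and are determined by strict lists: an
-- illegal removal of boxes cancels by itself. The operators `T`, `hS` and `NS` stand for p_r, h_k
-- and the degree-p part of the Cauchy kernel; class averages are compared with kernels because both
-- obey a Newton recursion after multiplication by the degree.
--
-- Put Q = p - 1, so the bound on n is (2Q)^2. A partition at least as wide as long with first row
-- at most 2Q has at most (2Q)^2 boxes. If the first row exceeds the second by more than 2Q, then Q
-- boxes can leave it with one more box still removable. Otherwise the bound makes the second row
-- longer than Q, and Q boxes can be taken from the rows below the first. Since |λ ∩ ν| = n - Q, a
-- contributing matrix must spend Q units on the excess of ν, which leaves one free unit in N_p.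
--
-- The condition p ≥ 4 enters with rectangles: cutting p - 2 boxes off the last row must allow two
-- boxes to be removed from the row above it.

private variable
  Ix Jx : Set

infixl 6 _+ℚ_
infixl 7 _*ℚ_
infix  8 -ℚ_

-- The operations of ℚ are kept opaque so that they never unfold during unification.
opaque
  0ℚ 1ℚ : ℚ
  0ℚ = ℚ.0ℚ
  1ℚ = ℚ.1ℚ
  _+ℚ_ _*ℚ_ : ℚ → ℚ → ℚ
  _+ℚ_ = ℚ._+_
  _*ℚ_ = ℚ._*_
  -ℚ_ : ℚ → ℚ
  -ℚ_ = ℚ.-_

module ℚₚ where
  open ℚₚ₀ public using (≤-refl; ≤-trans; ≤-reflexive; ≤-antisym)
  opaque
    unfolding 0ℚ
    +-assoc : ∀ x y z → x +ℚ y +ℚ z ≡ x +ℚ (y +ℚ z)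
    +-assoc = ℚₚ₀.+-assoc
    +-comm : ∀ x y → x +ℚ y ≡ y +ℚ x
    +-comm = ℚₚ₀.+-comm
    +-identityˡ : ∀ x → 0ℚ +ℚ x ≡ x
    +-identityˡ = ℚₚ₀.+-identityˡ
    +-identityʳ : ∀ x → x +ℚ 0ℚ ≡ x
    +-identityʳ = ℚₚ₀.+-identityʳ
    +-inverseˡ : ∀ x → -ℚ x +ℚ x ≡ 0ℚ
    +-inverseˡ = ℚₚ₀.+-inverseˡ
    +-inverseʳ : ∀ x → x +ℚ -ℚ x ≡ 0ℚ
    +-inverseʳ = ℚₚ₀.+-inverseʳ
    neg-distrib-+ : ∀ x y → -ℚ (x +ℚ y) ≡ -ℚ x +ℚ -ℚ y
    neg-distrib-+ = ℚₚ₀.neg-distrib-+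
    neg-zero : -ℚ 0ℚ ≡ 0ℚ
    neg-zero = refl
    neg-involutive : ∀ x → -ℚ -ℚ x ≡ x
    neg-involutive = ⁻¹-involutive
    neg-distribˡ-* : ∀ x y → -ℚ (x *ℚ y) ≡ -ℚ x *ℚ y
    neg-distribˡ-* = ℚₚ₀.neg-distribˡ-*
    neg-distribʳ-* : ∀ x y → -ℚ (x *ℚ y) ≡ x *ℚ -ℚ y
    neg-distribʳ-* = ℚₚ₀.neg-distribʳ-*
    *-assoc : ∀ x y z → x *ℚ y *ℚ z ≡ x *ℚ (y *ℚ z)
    *-assoc = ℚₚ₀.*-assoc
    *-comm : ∀ x y → x *ℚ y ≡ y *ℚ x
    *-comm = ℚₚ₀.*-comm
    *-identityˡ : ∀ x → 1ℚ *ℚ x ≡ x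
    *-identityˡ = ℚₚ₀.*-identityˡ
    *-identityʳ : ∀ x → x *ℚ 1ℚ ≡ x
    *-identityʳ = ℚₚ₀.*-identityʳ
    *-zeroˡ : ∀ x → 0ℚ *ℚ x ≡ 0ℚ
    *-zeroˡ = ℚₚ₀.*-zeroˡ
    *-zeroʳ : ∀ x → x *ℚ 0ℚ ≡ 0ℚ
    *-zeroʳ = ℚₚ₀.*-zeroʳ
    *-distribˡ-+ : ∀ x y z → x *ℚ (y +ℚ z) ≡ x *ℚ y +ℚ x *ℚ z
    *-distribˡ-+ = ℚₚ₀.*-distribˡ-+
    *-distribʳ-+ : ∀ x y z → (y +ℚ z) *ℚ x ≡ y *ℚ x +ℚ z *ℚ x
    *-distribʳ-+ = ℚₚ₀.*-distribʳ-+
    +-mono-≤ : ∀ {x y u v} → x ≤ℚ y → u ≤ℚ v → x +ℚ u ≤ℚ y +ℚ v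
    +-mono-≤ = ℚₚ₀.+-mono-≤
    +-≥0 : ∀ {x y} → 0ℚ ≤ℚ x → 0ℚ ≤ℚ y → 0ℚ ≤ℚ x +ℚ y
    +-≥0 = ℚₚ₀.+-mono-≤
    0≤1 : 0ℚ ≤ℚ 1ℚ
    0≤1 = ℚₚ₀.nonNegative⁻¹ 1ℚ

+-zeroˡ : ∀ {x} y → x ≡ 0ℚ → x +ℚ y ≡ y
+-zeroˡ y refl = ℚₚ.+-identityˡ y

+-zeroʳ : ∀ x {y} → y ≡ 0ℚ → x +ℚ y ≡ x
+-zeroʳ x refl = ℚₚ.+-identityʳ x

interchange : ∀ a b c d → (a +ℚ b) +ℚ (c +ℚ d) ≡ (a +ℚ c) +ℚ (b +ℚ d)
interchange a b c d = begin
  (a +ℚ b) +ℚ (c +ℚ d)   ≡⟨ ℚₚ.+-assoc a b _ ⟩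
  a +ℚ (b +ℚ (c +ℚ d))   ≡⟨ cong (a +ℚ_) (trans (sym (ℚₚ.+-assoc b c d)) (trans (cong (_+ℚ d) (ℚₚ.+-comm b c)) (ℚₚ.+-assoc c b d))) ⟩
  a +ℚ (c +ℚ (b +ℚ d))   ≡⟨ sym (ℚₚ.+-assoc a c _) ⟩
  (a +ℚ c) +ℚ (b +ℚ d)   ∎

-- Finite sums of rational numbers

∑ : List Ix → (Ix → ℚ) → ℚ
∑ []       f = 0ℚ
∑ (x ∷ xs) f = f x +ℚ ∑ xs f

∑-cong-∈ : (xs : List Ix) {f g : Ix → ℚ} → (∀ {x} → x ∈ xs → f x ≡ g x) → ∑ xs f ≡ ∑ xs g
∑-cong-∈ []       h = refl
∑-cong-∈ (x ∷ xs) h = cong₂ _+ℚ_ (h (here refl)) (∑-cong-∈ xs (λ i → h (there i)))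

∑-cong : (xs : List Ix) {f g : Ix → ℚ} → (∀ x → f x ≡ g x) → ∑ xs f ≡ ∑ xs g
∑-cong xs h = ∑-cong-∈ xs (λ {x} _ → h x)

∑-zero : (xs : List Ix) → ∑ xs (λ _ → 0ℚ) ≡ 0ℚ
∑-zero []       = refl
∑-zero (x ∷ xs) = trans (ℚₚ.+-identityˡ _) (∑-zero xs)

∑-0 : (xs : List Ix) {f : Ix → ℚ} → (∀ {x} → x ∈ xs → f x ≡ 0ℚ) → ∑ xs f ≡ 0ℚ
∑-0 xs h = trans (∑-cong-∈ xs h) (∑-zero xs)

∑-++ : (xs ys : List Ix) (f : Ix → ℚ) → ∑ (xs ++ ys) f ≡ ∑ xs f +ℚ ∑ ys f
∑-++ []       ys f = sym (ℚₚ.+-identityˡ _)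
∑-++ (x ∷ xs) ys f = trans (cong (f x +ℚ_) (∑-++ xs ys f)) (sym (ℚₚ.+-assoc (f x) _ _))

∑-map : (h : Ix → Jx) (xs : List Ix) (f : Jx → ℚ) → ∑ (map h xs) f ≡ ∑ xs (λ x → f (h x))
∑-map h []       f = refl
∑-map h (x ∷ xs) f = cong (f (h x) +ℚ_) (∑-map h xs f)

∑-concatMap : (h : Ix → List Jx) (xs : List Ix) (f : Jx → ℚ) →
              ∑ (concatMap h xs) f ≡ ∑ xs (λ x → ∑ (h x) f)
∑-concatMap h []       f = refl
∑-concatMap h (x ∷ xs) f = trans (∑-++ (h x) _ f) (cong (∑ (h x) f +ℚ_) (∑-concatMap h xs f))

∑-+ : (xs : List Ix) (f g : Ix → ℚ) → ∑ xs (λ x → f x +ℚ g x) ≡ ∑ xs f +ℚ ∑ xs g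
∑-+ []       f g = sym (ℚₚ.+-identityˡ _)
∑-+ (x ∷ xs) f g = trans (cong (f x +ℚ g x +ℚ_) (∑-+ xs f g)) (interchange (f x) (g x) _ _)

∑-*ˡ : (c : ℚ) (xs : List Ix) (f : Ix → ℚ) → c *ℚ ∑ xs f ≡ ∑ xs (λ x → c *ℚ f x)
∑-*ˡ c []       f = ℚₚ.*-zeroʳ c
∑-*ˡ c (x ∷ xs) f = trans (ℚₚ.*-distribˡ-+ c (f x) _) (cong (c *ℚ f x +ℚ_) (∑-*ˡ c xs f))

∑-*ʳ : (c : ℚ) (xs : List Ix) (f : Ix → ℚ) → ∑ xs f *ℚ c ≡ ∑ xs (λ x → f x *ℚ c)
∑-*ʳ c xs f = trans (ℚₚ.*-comm _ c) (trans (∑-*ˡ c xs f) (∑-cong xs (λ x → ℚₚ.*-comm c (f x))))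

∑-neg : (xs : List Ix) (f : Ix → ℚ) → ∑ xs (λ x → -ℚ f x) ≡ -ℚ ∑ xs f
∑-neg []       f = sym ℚₚ.neg-zero
∑-neg (x ∷ xs) f = trans (cong (-ℚ f x +ℚ_) (∑-neg xs f)) (sym (ℚₚ.neg-distrib-+ (f x) _))

∑-swap : (xs : List Ix) (ys : List Jx) (f : Ix → Jx → ℚ) →
         ∑ xs (λ x → ∑ ys (f x)) ≡ ∑ ys (λ y → ∑ xs (λ x → f x y))
∑-swap []       ys f = sym (∑-zero ys)
∑-swap (x ∷ xs) ys f = trans (cong (∑ ys (f x) +ℚ_) (∑-swap xs ys f)) (sym (∑-+ ys (f x) _))

∑-≥0 : (xs : List Ix) {f : Ix → ℚ} → (∀ {x} → x ∈ xs → 0ℚ ≤ℚ f x) → 0ℚ ≤ℚ ∑ xs f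
∑-≥0 []       h = ℚₚ.≤-refl
∑-≥0 (x ∷ xs) h = ℚₚ.+-≥0 (h (here refl)) (∑-≥0 xs (λ i → h (there i)))

∑-single : (x : Ix) (f : Ix → ℚ) → ∑ (x ∷ []) f ≡ f x
∑-single x f = ℚₚ.+-identityʳ (f x)

fromℕ : ℕ → ℚ
fromℕ zero    = 0ℚ
fromℕ (suc n) = 1ℚ +ℚ fromℕ n

fromℕ-+ : ∀ m n → fromℕ (m + n) ≡ fromℕ m +ℚ fromℕ n
fromℕ-+ zero    n = sym (ℚₚ.+-identityˡ _)
fromℕ-+ (suc m) n = trans (cong (1ℚ +ℚ_) (fromℕ-+ m n)) (sym (ℚₚ.+-assoc 1ℚ (fromℕ m) (fromℕ n)))

fromℕ-* : ∀ m n → fromℕ (m * n) ≡ fromℕ m *ℚ fromℕ n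
fromℕ-* zero    n = sym (ℚₚ.*-zeroˡ (fromℕ n))
fromℕ-* (suc m) n = begin
  fromℕ (n + m * n)                        ≡⟨ fromℕ-+ n (m * n) ⟩
  fromℕ n +ℚ fromℕ (m * n)                 ≡⟨ cong₂ _+ℚ_ (sym (ℚₚ.*-identityˡ _)) (fromℕ-* m n) ⟩
  1ℚ *ℚ fromℕ n +ℚ fromℕ m *ℚ fromℕ n      ≡⟨ sym (ℚₚ.*-distribʳ-+ (fromℕ n) 1ℚ (fromℕ m)) ⟩
  (1ℚ +ℚ fromℕ m) *ℚ fromℕ n               ∎

fromℕ≥0 : ∀ n → 0ℚ ≤ℚ fromℕ n
fromℕ≥0 zero    = ℚₚ.≤-refl
fromℕ≥0 (suc n) = ℚₚ.+-≥0 ℚₚ.0≤1 (fromℕ≥0 n)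

fromℕ-mono : ∀ {m n} → m ≤ n → fromℕ m ≤ℚ fromℕ n
fromℕ-mono {n = n} z≤n = fromℕ≥0 n
fromℕ-mono (s≤s h)     = ℚₚ.+-mono-≤ (ℚₚ.≤-refl {1ℚ}) (fromℕ-mono h)

-- Sums over pairs with a given total

anti : ℕ → List (ℕ × ℕ)
anti zero    = (0 , 0) ∷ []
anti (suc k) = (0 , suc k) ∷ map (λ cd → suc (proj₁ cd) , proj₂ cd) (anti k)

-- The range of Newton's identities: the first entry is the index of a power sum and therefore
-- positive.
anti⁺ : ℕ → List (ℕ × ℕ)
anti⁺ zero    = []
anti⁺ (suc k) = map (λ cd → suc (proj₁ cd) , proj₂ cd) (anti k)

opaque
  ∑anti ∑anti⁺ : ℕ → (ℕ → ℕ → ℚ) → ℚ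
  ∑anti k g = ∑ (anti k) (λ cd → g (proj₁ cd) (proj₂ cd))
  ∑anti⁺ k g = ∑ (anti⁺ k) (λ cd → g (proj₁ cd) (proj₂ cd))

  ∑anti-0 : ∀ g → ∑anti 0 g ≡ g 0 0
  ∑anti-0 g = ℚₚ.+-identityʳ _

  ∑anti⁺-0 : ∀ g → ∑anti⁺ 0 g ≡ 0ℚ
  ∑anti⁺-0 g = refl

  ∑anti-suc : ∀ k g → ∑anti (suc k) g ≡ g 0 (suc k) +ℚ ∑anti k (λ c d → g (suc c) d)
  ∑anti-suc k g = cong (g 0 (suc k) +ℚ_) (∑-map _ (anti k) _)

  ∑anti⁺-suc : ∀ k g → ∑anti⁺ (suc k) g ≡ ∑anti k (λ c d → g (suc c) d)
  ∑anti⁺-suc k g = ∑-map _ (anti k) _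

  ∑anti-+ : ∀ k g h → ∑anti k (λ c d → g c d +ℚ h c d) ≡ ∑anti k g +ℚ ∑anti k h
  ∑anti-+ k g h = ∑-+ (anti k) _ _

  ∑anti⁺-+ : ∀ k g h → ∑anti⁺ k (λ c d → g c d +ℚ h c d) ≡ ∑anti⁺ k g +ℚ ∑anti⁺ k h
  ∑anti⁺-+ k g h = ∑-+ (anti⁺ k) _ _

  ∑anti-*ˡ : ∀ x k g → x *ℚ ∑anti k g ≡ ∑anti k (λ c d → x *ℚ g c d)
  ∑anti-*ˡ x k g = ∑-*ˡ x (anti k) _

  ∑anti⁺-*ˡ : ∀ x k g → x *ℚ ∑anti⁺ k g ≡ ∑anti⁺ k (λ c d → x *ℚ g c d)
  ∑anti⁺-*ˡ x k g = ∑-*ˡ x (anti⁺ k) _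

  ∑-∑anti : (xs : List Ix) → ∀ k (g : Ix → ℕ → ℕ → ℚ) → ∑ xs (λ x → ∑anti k (g x)) ≡ ∑anti k (λ c d → ∑ xs (λ x → g x c d))
  ∑-∑anti xs k g = ∑-swap xs (anti k) (λ x cd → g x (proj₁ cd) (proj₂ cd))

  ∑-∑anti⁺ : (xs : List Ix) → ∀ k (g : Ix → ℕ → ℕ → ℚ) → ∑ xs (λ x → ∑anti⁺ k (g x)) ≡ ∑anti⁺ k (λ c d → ∑ xs (λ x → g x c d))
  ∑-∑anti⁺ xs k g = ∑-swap xs (anti⁺ k) (λ x cd → g x (proj₁ cd) (proj₂ cd))

  ∑-anti : ∀ k (f : ℕ × ℕ → ℚ) → ∑ (anti k) f ≡ ∑anti k (λ c d → f (c , d))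
  ∑-anti k f = refl

∑anti-cong : ∀ k {g h : ℕ → ℕ → ℚ} → (∀ c d → c + d ≡ k → g c d ≡ h c d) → ∑anti k g ≡ ∑anti k h
∑anti-cong zero    {g} {h} e = trans (∑anti-0 g) (trans (e 0 0 refl) (sym (∑anti-0 h)))
∑anti-cong (suc k) {g} {h} e =
  trans (∑anti-suc k g) (trans (cong₂ _+ℚ_ (e 0 (suc k) refl) (∑anti-cong k (λ c d q → e (suc c) d (cong suc q))))
    (sym (∑anti-suc k h)))

∑anti-cong′ : ∀ k {g h : ℕ → ℕ → ℚ} → (∀ c d → g c d ≡ h c d) → ∑anti k g ≡ ∑anti k h
∑anti-cong′ k e = ∑anti-cong k (λ c d _ → e c d)

∑anti⁺-cong : ∀ k {g h : ℕ → ℕ → ℚ} → (∀ c d → suc c + d ≡ k → g (suc c) d ≡ h (suc c) d) → ∑anti⁺ k g ≡ ∑anti⁺ k h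
∑anti⁺-cong zero    {g} {h} e = trans (∑anti⁺-0 g) (sym (∑anti⁺-0 h))
∑anti⁺-cong (suc k) {g} {h} e =
  trans (∑anti⁺-suc k g) (trans (∑anti-cong k (λ c d q → e c d (cong suc q))) (sym (∑anti⁺-suc k h)))

∑anti⁺-cong′ : ∀ k {g h : ℕ → ℕ → ℚ} → (∀ c d → g c d ≡ h c d) → ∑anti⁺ k g ≡ ∑anti⁺ k h
∑anti⁺-cong′ k e = ∑anti⁺-cong k (λ c d _ → e (suc c) d)

∑anti-snoc : ∀ k g → ∑anti (suc k) g ≡ ∑anti k (λ c d → g c (suc d)) +ℚ g (suc k) 0
∑anti-snoc zero    g = trans (∑anti-suc 0 g) (cong₂ _+ℚ_ (sym (∑anti-0 _)) (∑anti-0 _))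
∑anti-snoc (suc k) g = begin
  ∑anti (suc (suc k)) g                                             ≡⟨ ∑anti-suc (suc k) g ⟩
  g 0 (suc (suc k)) +ℚ ∑anti (suc k) (λ c d → g (suc c) d)          ≡⟨ cong (g 0 (suc (suc k)) +ℚ_) (∑anti-snoc k _) ⟩
  g 0 (suc (suc k)) +ℚ (∑anti k (λ c d → g (suc c) (suc d)) +ℚ g (suc (suc k)) 0)
                                                                    ≡⟨ sym (ℚₚ.+-assoc (g 0 (suc (suc k))) _ _) ⟩
  g 0 (suc (suc k)) +ℚ ∑anti k (λ c d → g (suc c) (suc d)) +ℚ g (suc (suc k)) 0
                                                                    ≡⟨ cong (_+ℚ g (suc (suc k)) 0) (sym (∑anti-suc k (λ c d → g c (suc d)))) ⟩
  ∑anti (suc k) (λ c d → g c (suc d)) +ℚ g (suc (suc k)) 0          ∎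

∑anti-comm : ∀ k g → ∑anti k g ≡ ∑anti k (λ c d → g d c)
∑anti-comm zero    g = trans (∑anti-0 _) (sym (∑anti-0 _))
∑anti-comm (suc k) g = begin
  ∑anti (suc k) g                                         ≡⟨ ∑anti-suc k g ⟩
  g 0 (suc k) +ℚ ∑anti k (λ c d → g (suc c) d)            ≡⟨ cong (g 0 (suc k) +ℚ_) (∑anti-comm k _) ⟩
  g 0 (suc k) +ℚ ∑anti k (λ c d → g (suc d) c)            ≡⟨ ℚₚ.+-comm (g 0 (suc k)) _ ⟩
  ∑anti k (λ c d → g (suc d) c) +ℚ g 0 (suc k)            ≡⟨ sym (∑anti-snoc k (λ c d → g d c)) ⟩
  ∑anti (suc k) (λ c d → g d c)                           ∎

∑anti-assoc : ∀ k (g : ℕ → ℕ → ℕ → ℚ) →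
  ∑anti k (λ c d → ∑anti c (λ r e → g r e d)) ≡ ∑anti k (λ r m → ∑anti m (λ e d → g r e d))
∑anti-assoc zero    g = trans (∑anti-0 _) (trans (∑anti-0 _) (sym (trans (∑anti-0 _) (∑anti-0 _))))
∑anti-assoc (suc k) g = begin
  ∑anti (suc k) (λ c d → ∑anti c (λ r e → g r e d))
    ≡⟨ ∑anti-suc k _ ⟩
  ∑anti 0 (λ r e → g r e (suc k)) +ℚ ∑anti k (λ c d → ∑anti (suc c) (λ r e → g r e d))
    ≡⟨ cong₂ _+ℚ_ (∑anti-0 _) (trans (∑anti-cong′ k (λ c d → ∑anti-suc c _)) (∑anti-+ k _ _)) ⟩
  g 0 0 (suc k) +ℚ (∑anti k (λ c d → g 0 (suc c) d) +ℚ ∑anti k (λ c d → ∑anti c (λ r e → g (suc r) e d)))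
    ≡⟨ sym (ℚₚ.+-assoc (g 0 0 (suc k)) _ _) ⟩
  g 0 0 (suc k) +ℚ ∑anti k (λ c d → g 0 (suc c) d) +ℚ ∑anti k (λ c d → ∑anti c (λ r e → g (suc r) e d))
    ≡⟨ cong₂ _+ℚ_ (sym (∑anti-suc k (g 0))) (∑anti-assoc k (λ r → g (suc r))) ⟩
  ∑anti (suc k) (g 0) +ℚ ∑anti k (λ r m → ∑anti m (λ e d → g (suc r) e d))
    ≡⟨ sym (∑anti-suc k (λ r m → ∑anti m (λ e d → g r e d))) ⟩
  ∑anti (suc k) (λ r m → ∑anti m (λ e d → g r e d)) ∎

∑anti-assoc⁺ˡ : ∀ k (g : ℕ → ℕ → ℕ → ℚ) →
  ∑anti k (λ c d → ∑anti⁺ c (λ r e → g r e d)) ≡ ∑anti⁺ k (λ r m → ∑anti m (λ e d → g r e d))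
∑anti-assoc⁺ˡ zero    g = trans (∑anti-0 _) (trans (∑anti⁺-0 _) (sym (∑anti⁺-0 _)))
∑anti-assoc⁺ˡ (suc k) g = begin
  ∑anti (suc k) (λ c d → ∑anti⁺ c (λ r e → g r e d))              ≡⟨ ∑anti-suc k _ ⟩
  ∑anti⁺ 0 (λ r e → g r e (suc k)) +ℚ ∑anti k (λ c d → ∑anti⁺ (suc c) (λ r e → g r e d))
    ≡⟨ +-zeroˡ _ (∑anti⁺-0 _) ⟩
  ∑anti k (λ c d → ∑anti⁺ (suc c) (λ r e → g r e d))              ≡⟨ ∑anti-cong′ k (λ c d → ∑anti⁺-suc c _) ⟩
  ∑anti k (λ c d → ∑anti c (λ r e → g (suc r) e d))               ≡⟨ ∑anti-assoc k (λ r → g (suc r)) ⟩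
  ∑anti k (λ r m → ∑anti m (λ e d → g (suc r) e d))               ≡⟨ sym (∑anti⁺-suc k (λ r m → ∑anti m (λ e d → g r e d))) ⟩
  ∑anti⁺ (suc k) (λ r m → ∑anti m (λ e d → g r e d))              ∎

∑anti-assoc⁺ʳ : ∀ k (g : ℕ → ℕ → ℕ → ℚ) →
  ∑anti k (λ c d → ∑anti⁺ d (λ r e → g c r e)) ≡ ∑anti⁺ k (λ r m → ∑anti m (λ c e → g c r e))
∑anti-assoc⁺ʳ k g = begin
  ∑anti k (λ c d → ∑anti⁺ d (λ r e → g c r e))       ≡⟨ ∑anti-comm k _ ⟩
  ∑anti k (λ d c → ∑anti⁺ d (λ r e → g c r e))       ≡⟨ ∑anti-assoc⁺ˡ k (λ r e c → g c r e) ⟩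
  ∑anti⁺ k (λ r m → ∑anti m (λ e c → g c r e))       ≡⟨ ∑anti⁺-cong′ k (λ r m → ∑anti-comm m _) ⟩
  ∑anti⁺ k (λ r m → ∑anti m (λ c e → g c r e))       ∎

-- Product rule for Newton's identities k h_k = Σ p_r h_{k-r}.
newton-product : ∀ k {t : ℕ → ℕ → ℚ} {u v : ℕ → ℕ → ℕ → ℚ} →
  (∀ c d → fromℕ c *ℚ t c d ≡ ∑anti⁺ c (λ r e → u r e d)) →
  (∀ c d → fromℕ d *ℚ t c d ≡ ∑anti⁺ d (λ r e → v c r e)) →
  fromℕ k *ℚ ∑anti k t ≡
    ∑anti⁺ k (λ r m → ∑anti m (λ e d → u r e d) +ℚ ∑anti m (λ c e → v c r e))
newton-product k {t} {u} {v} hu hv = begin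
  fromℕ k *ℚ ∑anti k t
    ≡⟨ ∑anti-*ˡ (fromℕ k) k t ⟩
  ∑anti k (λ c d → fromℕ k *ℚ t c d)
    ≡⟨ ∑anti-cong k (λ c d e → trans (cong (_*ℚ t c d) (trans (cong fromℕ (sym e)) (fromℕ-+ c d)))
         (ℚₚ.*-distribʳ-+ (t c d) (fromℕ c) (fromℕ d))) ⟩
  ∑anti k (λ c d → fromℕ c *ℚ t c d +ℚ fromℕ d *ℚ t c d)
    ≡⟨ ∑anti-cong′ k (λ c d → cong₂ _+ℚ_ (hu c d) (hv c d)) ⟩
  ∑anti k (λ c d → ∑anti⁺ c (λ r e → u r e d) +ℚ ∑anti⁺ d (λ r e → v c r e))
    ≡⟨ ∑anti-+ k _ _ ⟩
  ∑anti k (λ c d → ∑anti⁺ c (λ r e → u r e d)) +ℚ ∑anti k (λ c d → ∑anti⁺ d (λ r e → v c r e))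
    ≡⟨ cong₂ _+ℚ_ (∑anti-assoc⁺ˡ k u) (∑anti-assoc⁺ʳ k v) ⟩
  ∑anti⁺ k (λ r m → ∑anti m (λ e d → u r e d)) +ℚ ∑anti⁺ k (λ r m → ∑anti m (λ c e → v c r e))
    ≡⟨ sym (∑anti⁺-+ k _ _) ⟩
  ∑anti⁺ k (λ r m → ∑anti m (λ e d → u r e d) +ℚ ∑anti m (λ c e → v c r e)) ∎

-- Lowering operators and Newton's identities

-- Subtraction as a list with at most one element, so that a sum over it drops the impossible
-- subtractions.
sub : ℕ → ℕ → List ℕ
sub zero    a       = a ∷ []
sub (suc r) zero    = []
sub (suc r) (suc a) = sub r a

∑sub-sub : ∀ r s a f → ∑ (sub r a) (λ a' → ∑ (sub s a') f) ≡ ∑ (sub (r + s) a) f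
∑sub-sub zero    s a       f = ∑-single a (λ a' → ∑ (sub s a') f)
∑sub-sub (suc r) s zero    f = refl
∑sub-sub (suc r) s (suc a) f = ∑sub-sub r s a f

∑sub-comm : ∀ r s a f → ∑ (sub r a) (λ a' → ∑ (sub s a') f) ≡ ∑ (sub s a) (λ a' → ∑ (sub r a') f)
∑sub-comm r s a f = trans (∑sub-sub r s a f) (trans (cong (λ x → ∑ (sub x a) f) (ℕₚ.+-comm r s)) (sym (∑sub-sub s r a f)))

sub-∈ : ∀ r a {x} → x ∈ sub r a → x + r ≡ a
sub-∈ zero    a       (here refl) = ℕₚ.+-identityʳ a
sub-∈ (suc r) (suc a) i           = trans (ℕₚ.+-suc _ r) (cong suc (sub-∈ r a i))

sub-+ : ∀ r a → sub r (r + a) ≡ a ∷ []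
sub-+ zero    a = refl
sub-+ (suc r) a = sub-+ r a

sub-empty : ∀ {r a} → a < r → sub r a ≡ []
sub-empty {suc r} {zero}  _       = refl
sub-empty {suc r} {suc a} (s≤s h) = sub-empty h

-- Newton's identity for a single variable: both sides are k copies of y^k.
newton-sub : ∀ k a f → fromℕ k *ℚ ∑ (sub k a) f ≡ ∑anti⁺ k (λ r e → ∑ (sub r a) (λ a' → ∑ (sub e a') f))
newton-sub k a f = trans (count k) (∑anti⁺-cong k (λ c d e → trans (cong (λ x → ∑ (sub x a) f) (sym e)) (sym (∑sub-sub (suc c) d a f))))
  where
  countA : ∀ k x → fromℕ (suc k) *ℚ x ≡ ∑anti k (λ _ _ → x)
  countA zero    x = trans (cong (_*ℚ x) (ℚₚ.+-identityʳ 1ℚ)) (trans (ℚₚ.*-identityˡ x) (sym (∑anti-0 _)))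
  countA (suc k) x = begin
    (1ℚ +ℚ fromℕ (suc k)) *ℚ x            ≡⟨ ℚₚ.*-distribʳ-+ x 1ℚ (fromℕ (suc k)) ⟩
    1ℚ *ℚ x +ℚ fromℕ (suc k) *ℚ x         ≡⟨ cong₂ _+ℚ_ (ℚₚ.*-identityˡ x) (countA k x) ⟩
    x +ℚ ∑anti k (λ _ _ → x)              ≡⟨ sym (∑anti-suc k (λ _ _ → x)) ⟩
    ∑anti (suc k) (λ _ _ → x)             ∎
  count : ∀ k → fromℕ k *ℚ ∑ (sub k a) f ≡ ∑anti⁺ k (λ _ _ → ∑ (sub k a) f)
  count zero    = trans (ℚₚ.*-zeroˡ (∑ (sub 0 a) f)) (sym (∑anti⁺-0 _))
  count (suc k) = trans (countA k _) (sym (∑anti⁺-suc k _))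

-- T r realises the power sum p_r in the operators lowering the entries of a list.
T : ℕ → List ℕ → List (List ℕ)
T r []      = []
T r (a ∷ A) = map (_∷ A) (sub r a) ++ map (a ∷_) (T r A)

∑T : ∀ r a A f → ∑ (T r (a ∷ A)) f ≡ ∑ (sub r a) (λ a' → f (a' ∷ A)) +ℚ ∑ (T r A) (λ A' → f (a ∷ A'))
∑T r a A f = trans (∑-++ (map (_∷ A) (sub r a)) _ f) (cong₂ _+ℚ_ (∑-map _ (sub r a) f) (∑-map _ (T r A) f))

∑T-comm : ∀ r s A f → ∑ (T r A) (λ A' → ∑ (T s A') f) ≡ ∑ (T s A) (λ A' → ∑ (T r A') f)
∑T-comm r s []      f = refl
∑T-comm r s (a ∷ A) f = begin
  ∑ (T r (a ∷ A)) (λ A' → ∑ (T s A') f)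
    ≡⟨ expand r s ⟩
  (∑ (sub r a) (λ a' → ∑ (sub s a') (λ a″ → f (a″ ∷ A))) +ℚ ∑ (sub r a) (λ a' → ∑ (T s A) (λ A' → f (a' ∷ A')))) +ℚ
  (∑ (T r A) (λ A' → ∑ (sub s a) (λ a' → f (a' ∷ A'))) +ℚ ∑ (T r A) (λ A' → ∑ (T s A') (λ A″ → f (a ∷ A″))))
    ≡⟨ cong₂ _+ℚ_ (cong₂ _+ℚ_ (∑sub-comm r s a _) (∑-swap (sub r a) (T s A) _))
                  (cong₂ _+ℚ_ (∑-swap (T r A) (sub s a) _) (∑T-comm r s A (λ A″ → f (a ∷ A″)))) ⟩
  (∑ (sub s a) (λ a' → ∑ (sub r a') (λ a″ → f (a″ ∷ A))) +ℚ ∑ (T s A) (λ A' → ∑ (sub r a) (λ a' → f (a' ∷ A')))) +ℚ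
  (∑ (sub s a) (λ a' → ∑ (T r A) (λ A' → f (a' ∷ A'))) +ℚ ∑ (T s A) (λ A' → ∑ (T r A') (λ A″ → f (a ∷ A″))))
    ≡⟨ interchange _ _ _ _ ⟩
  (∑ (sub s a) (λ a' → ∑ (sub r a') (λ a″ → f (a″ ∷ A))) +ℚ ∑ (sub s a) (λ a' → ∑ (T r A) (λ A' → f (a' ∷ A')))) +ℚ
  (∑ (T s A) (λ A' → ∑ (sub r a) (λ a' → f (a' ∷ A'))) +ℚ ∑ (T s A) (λ A' → ∑ (T r A') (λ A″ → f (a ∷ A″))))
    ≡⟨ sym (expand s r) ⟩
  ∑ (T s (a ∷ A)) (λ A' → ∑ (T r A') f) ∎
  where
  expand : ∀ r s → ∑ (T r (a ∷ A)) (λ A' → ∑ (T s A') f) ≡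
    (∑ (sub r a) (λ a' → ∑ (sub s a') (λ a″ → f (a″ ∷ A))) +ℚ ∑ (sub r a) (λ a' → ∑ (T s A) (λ A' → f (a' ∷ A')))) +ℚ
    (∑ (T r A) (λ A' → ∑ (sub s a) (λ a' → f (a' ∷ A'))) +ℚ ∑ (T r A) (λ A' → ∑ (T s A') (λ A″ → f (a ∷ A″))))
  expand r s = trans (∑T r a A _) (cong₂ _+ℚ_
    (trans (∑-cong (sub r a) (λ a' → ∑T s a' A f)) (∑-+ (sub r a) _ _))
    (trans (∑-cong (T r A) (λ A' → ∑T s a A' f)) (∑-+ (T r A) _ _)))

-- hS k A lists the ways of lowering the entries of A by k in total:
-- it realises the complete homogeneous polynomial h_k in the lowering operators.
hS : ℕ → List ℕ → List (List ℕ)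
hS k       (a ∷ A) =
  concatMap (λ cd → concatMap (λ a' → map (a' ∷_) (hS (proj₂ cd) A)) (sub (proj₁ cd) a)) (anti k)
hS zero    []      = [] ∷ []
hS (suc k) []      = []

∑hS : ∀ k a A f → ∑ (hS k (a ∷ A)) f ≡
      ∑anti k (λ c d → ∑ (sub c a) (λ a' → ∑ (hS d A) (λ C → f (a' ∷ C))))
∑hS k a A f = trans (∑-concatMap _ (anti k) f) (trans (∑-anti k _)
  (∑anti-cong′ k (λ c d → trans (∑-concatMap _ (sub c a) f) (∑-cong (sub c a) (λ a' → ∑-map _ (hS d A) f)))))

-- Multiplications by h_k and p_r commute, since subtractions from the entries may be made in any
-- order.
∑hS-T : ∀ k r A f → ∑ (hS k A) (λ C → ∑ (T r C) f) ≡ ∑ (T r A) (λ A' → ∑ (hS k A') f)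
∑hS-T zero    r []      f = ∑-single [] (λ C → ∑ (T r C) f)
∑hS-T (suc k) r []      f = refl
∑hS-T k       r (a ∷ A) f = begin
  ∑ (hS k (a ∷ A)) (λ C → ∑ (T r C) f)
    ≡⟨ ∑hS k a A _ ⟩
  ∑anti k (λ c d → ∑ (sub c a) (λ a' → ∑ (hS d A) (λ C → ∑ (T r (a' ∷ C)) f)))
    ≡⟨ ∑anti-cong′ k (λ c d → trans (∑-cong (sub c a) (λ a' → trans (∑-cong (hS d A) (λ C → ∑T r a' C f))
         (trans (∑-+ (hS d A) _ _) (cong₂ _+ℚ_ (∑-swap (hS d A) (sub r a') _) (∑hS-T d r A _)))))
         (∑-+ (sub c a) _ _)) ⟩
  ∑anti k (λ c d → ∑ (sub c a) (λ a' → ∑ (sub r a') (λ a″ → ∑ (hS d A) (λ C → f (a″ ∷ C)))) +ℚ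
                   ∑ (sub c a) (λ a' → ∑ (T r A) (λ A' → ∑ (hS d A') (λ C → f (a' ∷ C)))))
    ≡⟨ ∑anti-cong′ k (λ c d → cong₂ _+ℚ_ (∑sub-comm c r a _) (∑-swap (sub c a) (T r A) _)) ⟩
  ∑anti k (λ c d → ∑ (sub r a) (λ a' → ∑ (sub c a') (λ a″ → ∑ (hS d A) (λ C → f (a″ ∷ C)))) +ℚ
                   ∑ (T r A) (λ A' → ∑ (sub c a) (λ a' → ∑ (hS d A') (λ C → f (a' ∷ C)))))
    ≡⟨ ∑anti-+ k _ _ ⟩
  _ ≡⟨ cong₂ _+ℚ_ (sym (∑-∑anti (sub r a) k (λ a' c d → ∑ (sub c a') (λ a″ → ∑ (hS d A) (λ C → f (a″ ∷ C))))))
                  (sym (∑-∑anti (T r A) k (λ A' c d → ∑ (sub c a) (λ a' → ∑ (hS d A') (λ C → f (a' ∷ C)))))) ⟩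
  ∑ (sub r a) (λ a' → ∑anti k (λ c d → ∑ (sub c a') (λ a″ → ∑ (hS d A) (λ C → f (a″ ∷ C))))) +ℚ
  ∑ (T r A) (λ A' → ∑anti k (λ c d → ∑ (sub c a) (λ a' → ∑ (hS d A') (λ C → f (a' ∷ C)))))
    ≡⟨ cong₂ _+ℚ_ (∑-cong (sub r a) (λ a' → sym (∑hS k a' A f))) (∑-cong (T r A) (λ A' → sym (∑hS k a A' f))) ⟩
  ∑ (sub r a) (λ a' → ∑ (hS k (a' ∷ A)) f) +ℚ ∑ (T r A) (λ A' → ∑ (hS k (a ∷ A')) f)
    ≡⟨ sym (∑T r a A _) ⟩
  ∑ (T r (a ∷ A)) (λ A' → ∑ (hS k A') f) ∎

-- Newton's identity k h_k = Σ p_r h_{k-r}, proved one variable at a time: `newton-product` joins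
-- the first entry to the rest.
newton-hS : ∀ k A f → fromℕ k *ℚ ∑ (hS k A) f ≡ ∑anti⁺ k (λ r d → ∑ (T r A) (λ A' → ∑ (hS d A') f))
newton-hS zero    []      f = trans (ℚₚ.*-zeroˡ _) (sym (∑anti⁺-0 _))
newton-hS (suc k) []      f = trans (ℚₚ.*-zeroʳ _) (sym (trans (∑anti⁺-suc k _) (zeros k)))
  where
  zeros : ∀ k → ∑anti k (λ _ _ → 0ℚ) ≡ 0ℚ
  zeros zero    = ∑anti-0 _
  zeros (suc k) = trans (∑anti-suc k _) (trans (+-zeroˡ _ refl) (zeros k))
newton-hS k       (a ∷ A) f = begin
  fromℕ k *ℚ ∑ (hS k (a ∷ A)) f
    ≡⟨ cong (fromℕ k *ℚ_) (∑hS k a A f) ⟩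
  fromℕ k *ℚ ∑anti k (λ c d → ∑ (sub c a) (λ a' → ∑ (hS d A) (λ C → f (a' ∷ C))))
    ≡⟨ newton-product k (λ c d → newton-sub c a (λ a' → ∑ (hS d A) (λ C → f (a' ∷ C))))
         (λ c d → trans (∑-*ˡ (fromℕ d) (sub c a) _)
           (trans (∑-cong (sub c a) (λ a' → newton-hS d A (λ C → f (a' ∷ C))))
             (∑-∑anti⁺ (sub c a) d (λ a' r e → ∑ (T r A) (λ A' → ∑ (hS e A') (λ C → f (a' ∷ C))))))) ⟩
  ∑anti⁺ k (λ r m → ∑anti m (λ e d → ∑ (sub r a) (λ a' → ∑ (sub e a') (λ a″ → ∑ (hS d A) (λ C → f (a″ ∷ C))))) +ℚ
                    ∑anti m (λ c e → ∑ (sub c a) (λ a' → ∑ (T r A) (λ A' → ∑ (hS e A') (λ C → f (a' ∷ C))))))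
    ≡⟨ ∑anti⁺-cong′ k (λ r m → cong₂ _+ℚ_
         (trans (sym (∑-∑anti (sub r a) m (λ a' e d → ∑ (sub e a') (λ a″ → ∑ (hS d A) (λ C → f (a″ ∷ C))))))
           (∑-cong (sub r a) (λ a' → sym (∑hS m a' A f))))
         (trans (∑anti-cong′ m (λ c e → ∑-swap (sub c a) (T r A) _))
           (trans (sym (∑-∑anti (T r A) m (λ A' c e → ∑ (sub c a) (λ a' → ∑ (hS e A') (λ C → f (a' ∷ C))))))
             (∑-cong (T r A) (λ A' → sym (∑hS m a A' f)))))) ⟩
  ∑anti⁺ k (λ r m → ∑ (sub r a) (λ a' → ∑ (hS m (a' ∷ A)) f) +ℚ ∑ (T r A) (λ A' → ∑ (hS m (a ∷ A')) f))
    ≡⟨ ∑anti⁺-cong′ k (λ r m → sym (∑T r a A _)) ⟩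
  ∑anti⁺ k (λ r m → ∑ (T r (a ∷ A)) (λ A' → ∑ (hS m A') f)) ∎

-- NS p A B lists the results of subtracting the row sums of M from A and its column sums from B,
-- for all nonnegative integer matrices M with total p; M is built column by column.
NS : ℕ → List ℕ → List ℕ → List (List ℕ × List ℕ)
NS p       A (b ∷ B) =
  concatMap (λ km → concatMap (λ b' → concatMap (λ C →
    map (λ CB → proj₁ CB , b' ∷ proj₂ CB) (NS (proj₂ km) C B)) (hS (proj₁ km) A)) (sub (proj₁ km) b)) (anti p)
NS zero    A []      = (A , []) ∷ []
NS (suc p) A []      = []

NSum : ℕ → List ℕ → List ℕ → (List ℕ → List ℕ → ℚ) → ℚ
NSum p A B F = ∑ (NS p A B) (λ CB → F (proj₁ CB) (proj₂ CB))

NSum-[] : ∀ A F → NSum 0 A [] F ≡ F A []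
NSum-[] A F = ℚₚ.+-identityʳ _

NSum-∷ : ∀ p A b B F → NSum p A (b ∷ B) F ≡
  ∑anti p (λ k m → ∑ (sub k b) (λ b' → ∑ (hS k A) (λ C → NSum m C B (λ C' B' → F C' (b' ∷ B')))))
NSum-∷ p A b B F = trans (∑-concatMap _ (anti p) _) (trans (∑-anti p _)
  (∑anti-cong′ p (λ k m → trans (∑-concatMap _ (sub k b) _) (∑-cong (sub k b) (λ b' →
    trans (∑-concatMap _ (hS k A) _) (∑-cong (hS k A) (λ C → ∑-map _ (NS m C B) _)))))))

-- Newton's identity in the variables x_i y_j, whose power sums are p_r(x) p_r(y). `column` treats
-- the variables that belong to the first entry of `B`, `rest` the others.
newton-NS : ∀ p A B F → fromℕ p *ℚ NSum p A B F ≡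
  ∑anti⁺ p (λ r m → ∑ (T r A) (λ A' → ∑ (T r B) (λ B' → NSum m A' B' F)))
newton-NS zero    A []      F = trans (ℚₚ.*-zeroˡ _) (sym (∑anti⁺-0 _))
newton-NS (suc p) A []      F = trans (ℚₚ.*-zeroʳ _) (sym (trans (∑anti⁺-cong′ (suc p) (λ r m → ∑-zero (T r A)))
  (trans (sym (newton-hS (suc p) [] (λ _ → 0ℚ))) (ℚₚ.*-zeroʳ _))))
newton-NS p       A (b ∷ B) F = begin
  fromℕ p *ℚ NSum p A (b ∷ B) F
    ≡⟨ cong (fromℕ p *ℚ_) (NSum-∷ p A b B F) ⟩
  fromℕ p *ℚ ∑anti p (λ k m → ∑ (sub k b) (λ b' → ∑ (hS k A) (λ C → NSum m C B (Fᵇ b'))))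
    ≡⟨ newton-product p column rest ⟩
  ∑anti⁺ p (λ r m →
    ∑anti m (λ e d → ∑ (sub r b) (λ b₁ → ∑ (sub e b₁) (λ b' → ∑ (T r A) (λ A' → ∑ (hS e A') (λ C → NSum d C B (Fᵇ b')))))) +ℚ
    ∑anti m (λ k e → ∑ (sub k b) (λ b' → ∑ (T r A) (λ A' → ∑ (hS k A') (λ C → ∑ (T r B) (λ B₁ → NSum e C B₁ (Fᵇ b')))))))
    ≡⟨ ∑anti⁺-cong′ p (λ r m → cong₂ _+ℚ_ (left r m) (right r m)) ⟩
  ∑anti⁺ p (λ r m →
    ∑ (T r A) (λ A' → ∑ (sub r b) (λ b₁ → NSum m A' (b₁ ∷ B) F)) +ℚ
    ∑ (T r A) (λ A' → ∑ (T r B) (λ B₁ → NSum m A' (b ∷ B₁) F)))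
    ≡⟨ ∑anti⁺-cong′ p (λ r m → trans (sym (∑-+ (T r A) _ _)) (∑-cong (T r A) (λ A' → sym (∑T r b B _)))) ⟩
  ∑anti⁺ p (λ r m → ∑ (T r A) (λ A' → ∑ (T r (b ∷ B)) (λ B' → NSum m A' B' F))) ∎
  where
  Fᵇ : ℕ → List ℕ → List ℕ → ℚ
  Fᵇ b' C' B' = F C' (b' ∷ B')
  column : ∀ k m → fromℕ k *ℚ ∑ (sub k b) (λ b' → ∑ (hS k A) (λ C → NSum m C B (Fᵇ b'))) ≡
    ∑anti⁺ k (λ r e → ∑ (sub r b) (λ b₁ → ∑ (sub e b₁) (λ b' → ∑ (T r A) (λ A' → ∑ (hS e A') (λ C → NSum m C B (Fᵇ b'))))))
  column k m = trans (∑-*ˡ (fromℕ k) (sub k b) _)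
    (trans (∑-cong (sub k b) (λ b' → newton-hS k A _))
    (trans (∑-∑anti⁺ (sub k b) k (λ b' r e → ∑ (T r A) (λ A' → ∑ (hS e A') (λ C → NSum m C B (Fᵇ b')))))
      (∑anti⁺-cong k (λ c d q → trans (cong (λ x → ∑ (sub x b) _) (sym q)) (sym (∑sub-sub (suc c) d b _))))))
  rest : ∀ k m → fromℕ m *ℚ ∑ (sub k b) (λ b' → ∑ (hS k A) (λ C → NSum m C B (Fᵇ b'))) ≡
    ∑anti⁺ m (λ r e → ∑ (sub k b) (λ b' → ∑ (T r A) (λ A' → ∑ (hS k A') (λ C → ∑ (T r B) (λ B₁ → NSum e C B₁ (Fᵇ b'))))))
  rest k m = trans (∑-*ˡ (fromℕ m) (sub k b) _)
    (trans (∑-cong (sub k b) (λ b' → trans (∑-*ˡ (fromℕ m) (hS k A) _)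
      (trans (∑-cong (hS k A) (λ C → newton-NS m C B (Fᵇ b')))
      (trans (∑-∑anti⁺ (hS k A) m (λ C r e → ∑ (T r C) (λ C₁ → ∑ (T r B) (λ B₁ → NSum e C₁ B₁ (Fᵇ b')))))
        (∑anti⁺-cong′ m (λ r e → ∑hS-T k r A _))))))
      (∑-∑anti⁺ (sub k b) m (λ b' r e → ∑ (T r A) (λ A' → ∑ (hS k A') (λ C → ∑ (T r B) (λ B₁ → NSum e C B₁ (Fᵇ b')))))))
  left : ∀ r m → ∑anti m (λ e d → ∑ (sub r b) (λ b₁ → ∑ (sub e b₁) (λ b' → ∑ (T r A) (λ A' → ∑ (hS e A') (λ C → NSum d C B (Fᵇ b')))))) ≡
    ∑ (T r A) (λ A' → ∑ (sub r b) (λ b₁ → NSum m A' (b₁ ∷ B) F))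
  left r m = begin
    ∑anti m (λ e d → ∑ (sub r b) (λ b₁ → ∑ (sub e b₁) (λ b' → ∑ (T r A) (λ A' → ∑ (hS e A') (λ C → NSum d C B (Fᵇ b'))))))
      ≡⟨ ∑anti-cong′ m (λ e d → trans (∑-cong (sub r b) (λ b₁ → ∑-swap (sub e b₁) (T r A) _)) (∑-swap (sub r b) (T r A) _)) ⟩
    ∑anti m (λ e d → ∑ (T r A) (λ A' → ∑ (sub r b) (λ b₁ → ∑ (sub e b₁) (λ b' → ∑ (hS e A') (λ C → NSum d C B (Fᵇ b'))))))
      ≡⟨ sym (∑-∑anti (T r A) m (λ A' e d → ∑ (sub r b) (λ b₁ → ∑ (sub e b₁) (λ b' → ∑ (hS e A') (λ C → NSum d C B (Fᵇ b')))))) ⟩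
    ∑ (T r A) (λ A' → ∑anti m (λ e d → ∑ (sub r b) (λ b₁ → ∑ (sub e b₁) (λ b' → ∑ (hS e A') (λ C → NSum d C B (Fᵇ b'))))))
      ≡⟨ ∑-cong (T r A) (λ A' → sym (∑-∑anti (sub r b) m (λ b₁ e d → ∑ (sub e b₁) (λ b' → ∑ (hS e A') (λ C → NSum d C B (Fᵇ b')))))) ⟩
    ∑ (T r A) (λ A' → ∑ (sub r b) (λ b₁ → ∑anti m (λ e d → ∑ (sub e b₁) (λ b' → ∑ (hS e A') (λ C → NSum d C B (Fᵇ b'))))))
      ≡⟨ ∑-cong (T r A) (λ A' → ∑-cong (sub r b) (λ b₁ → sym (NSum-∷ m A' b₁ B F))) ⟩
    ∑ (T r A) (λ A' → ∑ (sub r b) (λ b₁ → NSum m A' (b₁ ∷ B) F)) ∎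
  right : ∀ r m → ∑anti m (λ k e → ∑ (sub k b) (λ b' → ∑ (T r A) (λ A' → ∑ (hS k A') (λ C → ∑ (T r B) (λ B₁ → NSum e C B₁ (Fᵇ b')))))) ≡
    ∑ (T r A) (λ A' → ∑ (T r B) (λ B₁ → NSum m A' (b ∷ B₁) F))
  right r m = begin
    ∑anti m (λ k e → ∑ (sub k b) (λ b' → ∑ (T r A) (λ A' → ∑ (hS k A') (λ C → ∑ (T r B) (λ B₁ → NSum e C B₁ (Fᵇ b'))))))
      ≡⟨ ∑anti-cong′ m (λ k e → trans (∑-swap (sub k b) (T r A) _) (∑-cong (T r A) (λ A' →
           trans (∑-cong (sub k b) (λ b' → ∑-swap (hS k A') (T r B) _)) (∑-swap (sub k b) (T r B) _)))) ⟩
    ∑anti m (λ k e → ∑ (T r A) (λ A' → ∑ (T r B) (λ B₁ → ∑ (sub k b) (λ b' → ∑ (hS k A') (λ C → NSum e C B₁ (Fᵇ b'))))))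
      ≡⟨ sym (∑-∑anti (T r A) m (λ A' k e → ∑ (T r B) (λ B₁ → ∑ (sub k b) (λ b' → ∑ (hS k A') (λ C → NSum e C B₁ (Fᵇ b')))))) ⟩
    ∑ (T r A) (λ A' → ∑anti m (λ k e → ∑ (T r B) (λ B₁ → ∑ (sub k b) (λ b' → ∑ (hS k A') (λ C → NSum e C B₁ (Fᵇ b'))))))
      ≡⟨ ∑-cong (T r A) (λ A' → trans (sym (∑-∑anti (T r B) m (λ B₁ k e → ∑ (sub k b) (λ b' → ∑ (hS k A') (λ C → NSum e C B₁ (Fᵇ b'))))))
           (∑-cong (T r B) (λ B₁ → sym (NSum-∷ m A' b B₁ F)))) ⟩
    ∑ (T r A) (λ A' → ∑ (T r B) (λ B₁ → NSum m A' (b ∷ B₁) F)) ∎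

-- Centraliser orders and class averages

count-++ : ∀ P xs ys → countᵇ P (xs ++ ys) ≡ countᵇ P xs + countᵇ P ys
count-++ P []       ys = refl
count-++ P (x ∷ xs) ys with P x
... | true  = cong suc (count-++ P xs ys)
... | false = count-++ P xs ys

≡ᵇ-refl : ∀ n → (n ≡ᵇ n) ≡ true
≡ᵇ-refl zero    = refl
≡ᵇ-refl (suc n) = ≡ᵇ-refl n

≡ᵇ-≢ : ∀ {m n} → m ≢ n → (m ≡ᵇ n) ≡ false
≡ᵇ-≢ {zero}  {zero}  h = ⊥-elim (h refl)
≡ᵇ-≢ {zero}  {suc n} h = refl
≡ᵇ-≢ {suc m} {zero}  h = refl
≡ᵇ-≢ {suc m} {suc n} h = ≡ᵇ-≢ (λ e → h (cong suc e))

count-none : ∀ {k} ρ → All (_< k) ρ → countᵇ (λ x → x ≡ᵇ k) ρ ≡ 0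
count-none []      []       = refl
count-none (x ∷ ρ) (h ∷ hs) rewrite ≡ᵇ-≢ (ℕₚ.<⇒≢ h) = count-none ρ hs

count-replicate : ∀ c k → countᵇ (λ x → x ≡ᵇ k) (replicate c k) ≡ c
count-replicate zero    k = refl
count-replicate (suc c) k rewrite ≡ᵇ-refl k = cong suc (count-replicate c k)

count-replicate-≢ : ∀ c {k j} → k ≢ j → countᵇ (λ x → x ≡ᵇ j) (replicate c k) ≡ 0
count-replicate-≢ zero    h = refl
count-replicate-≢ (suc c) h rewrite ≡ᵇ-≢ h = count-replicate-≢ c h

zProd-∷ʳ : ∀ ρ js j → zProd ρ (js ∷ʳ j) ≡ zProd ρ js * zFactor ρ j
zProd-∷ʳ ρ []       j = ℕₚ.*-comm (zFactor ρ j) 1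
zProd-∷ʳ ρ (i ∷ js) j = trans (cong (zFactor ρ i *_) (zProd-∷ʳ ρ js j)) (sym (ℕₚ.*-assoc (zFactor ρ i) _ _))

zUpTo-suc : ∀ ρ N → zProd ρ (upTo (suc N)) ≡ zProd ρ (upTo N) * zFactor ρ N
zUpTo-suc ρ N = trans (cong (zProd ρ) (sym (Listₚ.applyUpTo-∷ʳ (λ i → i) N))) (zProd-∷ʳ ρ (upTo N) N)

zUpTo-extend : ∀ ρ K → All (_≤ K) ρ → ∀ d → zProd ρ (upTo (d + K)) ≡ zProd ρ (upTo K)
zUpTo-extend ρ K h zero    = refl
zUpTo-extend ρ K h (suc d) = trans (zUpTo-suc ρ (d + K)) (trans (cong₂ _*_ (zUpTo-extend ρ K h d) one) (ℕₚ.*-identityʳ _))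
  where
  one : zFactor ρ (d + K) ≡ 1
  one rewrite count-none {suc (d + K)} ρ (All.map (λ x≤K → s≤s (ℕₚ.≤-trans x≤K (ℕₚ.m≤n+m K d))) h) = refl

All-≤-sum : ∀ ρ → All (_≤ sum ρ) ρ
All-≤-sum []      = []
All-≤-sum (x ∷ ρ) = ℕₚ.m≤m+n x _ ∷ All.map (λ h → ℕₚ.≤-trans h (ℕₚ.m≤n+m _ x)) (All-≤-sum ρ)

-- Part sizes above every entry have multiplicity zero and contribute the factor 1, so the product
-- may stop at any bound on the parts.
zUpTo : ∀ ρ K → All (_≤ K) ρ → zProd ρ (upTo K) ≡ z ρ
zUpTo ρ K h with ℕₚ.≤-total K (sum ρ)
... | inj₁ K≤s = sym (trans (cong (λ x → zProd ρ (upTo x)) (sym (ℕₚ.m∸n+n≡m K≤s))) (zUpTo-extend ρ K h (sum ρ ∸ K)))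
... | inj₂ s≤K = trans (cong (λ x → zProd ρ (upTo x)) (sym (ℕₚ.m∸n+n≡m s≤K))) (zUpTo-extend ρ (sum ρ) (All-≤-sum ρ) (K ∸ sum ρ))

-- Prefixing copies of a size larger than all parts leaves the other multiplicities unchanged. This
-- makes weights multiplicative when partitions are sorted by the multiplicity of their largest
-- part.
z-replicate : ∀ m c ρ → All (_≤ m) ρ → z (replicate c (suc m) ++ ρ) ≡ (suc m ^ c * c !) * z ρ
z-replicate m c ρ h = begin
  z σ                                            ≡⟨ sym (zUpTo σ (suc m) (Allₚ.++⁺ (Allₚ.replicate⁺ c ℕₚ.≤-refl) (All.map ℕₚ.m≤n⇒m≤1+n h))) ⟩
  zProd σ (upTo (suc m))                         ≡⟨ zUpTo-suc σ m ⟩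
  zProd σ (upTo m) * zFactor σ m                 ≡⟨ cong₂ _*_ (below m ℕₚ.≤-refl) top ⟩
  zProd ρ (upTo m) * (suc m ^ c * c !)           ≡⟨ cong (_* (suc m ^ c * c !)) (zUpTo ρ m h) ⟩
  z ρ * (suc m ^ c * c !)                        ≡⟨ ℕₚ.*-comm (z ρ) _ ⟩
  (suc m ^ c * c !) * z ρ                        ∎
  where
  σ = replicate c (suc m) ++ ρ
  top : zFactor σ m ≡ suc m ^ c * c !
  top rewrite count-++ (λ x → x ≡ᵇ suc m) (replicate c (suc m)) ρ | count-replicate c (suc m)
            | count-none {suc m} ρ (All.map s≤s h) | ℕₚ.+-identityʳ c = refl
  below : ∀ K → K ≤ m → zProd σ (upTo K) ≡ zProd ρ (upTo K)
  below zero    _ = refl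
  below (suc K) K<m = trans (zUpTo-suc σ K) (trans (cong₂ _*_ (below K (ℕₚ.<⇒≤ K<m)) eq) (sym (zUpTo-suc ρ K)))
    where
    eq : zFactor σ K ≡ zFactor ρ K
    eq rewrite count-++ (λ x → x ≡ᵇ suc K) (replicate c (suc m)) ρ
             | count-replicate-≢ c {suc m} {suc K} (λ e → ℕₚ.<⇒≢ K<m (sym (ℕₚ.suc-injective e))) = refl

ι : ℤ → ℚ
ι i = i ℚ./ 1

recip : (d : ℕ) .{{_ : NonZero d}} → ℚ
recip d = (pos 1) ℚ./ d

opaque
  unfolding 0ℚ

  private
    /-via-ᵘ : ∀ i d .{{_ : NonZero d}} → ℚ.toℚᵘ (i ℚ./ d) ℚᵘ.≃ (i ℚᵘ./ d)
    /-via-ᵘ i (suc d) = ℚₚ₀.toℚᵘ-fromℚᵘ (i ℚᵘ./ suc d)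

  ι-+ : ∀ i j → ι (i ℤ.+ j) ≡ ι i +ℚ ι j
  ι-+ i j = ℚₚ₀.toℚᵘ-injective (ℚᵘₚ.≃-trans (/-via-ᵘ (i ℤ.+ j) 1)
    (ℚᵘₚ.≃-trans (ℚᵘ.*≡* (cong (ℤ._* (pos 1)) (cong₂ ℤ._+_ (sym (ℤₚ.*-identityʳ i)) (sym (ℤₚ.*-identityʳ j)))))
    (ℚᵘₚ.≃-sym (ℚᵘₚ.≃-trans (ℚₚ₀.toℚᵘ-homo-+ (ι i) (ι j)) (ℚᵘₚ.+-cong (/-via-ᵘ i 1) (/-via-ᵘ j 1))))))

  ι-* : ∀ i j → ι (i ℤ.* j) ≡ ι i *ℚ ι j
  ι-* i j = ℚₚ₀.toℚᵘ-injective (ℚᵘₚ.≃-trans (/-via-ᵘ (i ℤ.* j) 1)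
    (ℚᵘₚ.≃-sym (ℚᵘₚ.≃-trans (ℚₚ₀.toℚᵘ-homo-* (ι i) (ι j)) (ℚᵘₚ.*-cong (/-via-ᵘ i 1) (/-via-ᵘ j 1)))))

  ι-neg : ∀ i → ι (ℤ.- i) ≡ -ℚ ι i
  ι-neg i = ℚₚ₀.toℚᵘ-injective (ℚᵘₚ.≃-trans (/-via-ᵘ (ℤ.- i) 1)
    (ℚᵘₚ.≃-sym (ℚᵘₚ.≃-trans (ℚₚ₀.toℚᵘ-homo‿- (ι i)) (ℚᵘₚ.-‿cong (/-via-ᵘ i 1)))))

  ι-0 : ι (pos 0) ≡ 0ℚ
  ι-0 = refl

  ι-1 : ι (pos 1) ≡ 1ℚ
  ι-1 = refl

  /-recip : ∀ i d .{{_ : NonZero d}} → i ℚ./ d ≡ ι i *ℚ recip d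
  /-recip i d@(suc _) = ℚₚ₀.toℚᵘ-injective (ℚᵘₚ.≃-trans (/-via-ᵘ i d)
    (ℚᵘₚ.≃-trans (ℚᵘ.*≡* (cong₂ ℤ._*_ (sym (ℤₚ.*-identityʳ i)) (cong pos (ℕₚ.+-identityʳ d))))
    (ℚᵘₚ.≃-sym (ℚᵘₚ.≃-trans (ℚₚ₀.toℚᵘ-homo-* (ι i) (recip d)) (ℚᵘₚ.*-cong (/-via-ᵘ i 1) (/-via-ᵘ (pos 1) d))))))

  d/d≡1 : ∀ d .{{_ : NonZero d}} → (pos d) ℚ./ d ≡ 1ℚ
  d/d≡1 d@(suc _) = ℚₚ₀.toℚᵘ-injective (ℚᵘₚ.≃-trans (/-via-ᵘ (pos d) d)
    (ℚᵘ.*≡* (trans (ℤₚ.*-identityʳ (pos d)) (sym (ℤₚ.*-identityˡ (pos d))))))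

ι-fromℕ : ∀ n → ι (pos n) ≡ fromℕ n
ι-fromℕ zero    = ι-0
ι-fromℕ (suc n) = trans (ι-+ (pos 1) (pos n)) (cong₂ _+ℚ_ ι-1 (ι-fromℕ n))

recip-inverse : ∀ d .{{_ : NonZero d}} → fromℕ d *ℚ recip d ≡ 1ℚ
recip-inverse d = trans (cong (_*ℚ recip d) (sym (ι-fromℕ d))) (trans (sym (/-recip (pos d) d)) (d/d≡1 d))

recip-unique : ∀ d .{{_ : NonZero d}} x → fromℕ d *ℚ x ≡ 1ℚ → x ≡ recip d
recip-unique d x h = begin
  x                              ≡⟨ sym (ℚₚ.*-identityˡ x) ⟩
  1ℚ *ℚ x                        ≡⟨ cong (_*ℚ x) (trans (sym (recip-inverse d)) (ℚₚ.*-comm _ _)) ⟩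
  recip d *ℚ fromℕ d *ℚ x        ≡⟨ ℚₚ.*-assoc (recip d) _ x ⟩
  recip d *ℚ (fromℕ d *ℚ x)      ≡⟨ cong (recip d *ℚ_) h ⟩
  recip d *ℚ 1ℚ                  ≡⟨ ℚₚ.*-identityʳ _ ⟩
  recip d                        ∎

fromℕ-cancel : ∀ n x y → fromℕ (suc n) *ℚ x ≡ fromℕ (suc n) *ℚ y → x ≡ y
fromℕ-cancel n x y h = trans (sym (undo x)) (trans (cong (recip (suc n) *ℚ_) h) (undo y))
  where
  undo : ∀ x → recip (suc n) *ℚ (fromℕ (suc n) *ℚ x) ≡ x
  undo x = trans (sym (ℚₚ.*-assoc (recip (suc n)) _ x)) (trans (cong (_*ℚ x) (trans (ℚₚ.*-comm _ _) (recip-inverse (suc n)))) (ℚₚ.*-identityˡ x))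

recip-* : ∀ a b c .{{_ : NonZero a}} .{{_ : NonZero b}} .{{_ : NonZero c}} → a * b ≡ c → recip c ≡ recip a *ℚ recip b
recip-* a b c refl = sym (recip-unique c (recip a *ℚ recip b) (begin
  fromℕ (a * b) *ℚ (recip a *ℚ recip b)             ≡⟨ cong (_*ℚ (recip a *ℚ recip b)) (fromℕ-* a b) ⟩
  fromℕ a *ℚ fromℕ b *ℚ (recip a *ℚ recip b)        ≡⟨ ℚₚ.*-assoc (fromℕ a) _ _ ⟩
  fromℕ a *ℚ (fromℕ b *ℚ (recip a *ℚ recip b))      ≡⟨ cong (fromℕ a *ℚ_) (trans (sym (ℚₚ.*-assoc (fromℕ b) _ _)) (trans (cong (_*ℚ recip b) (ℚₚ.*-comm (fromℕ b) _)) (ℚₚ.*-assoc (recip a) _ _))) ⟩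
  fromℕ a *ℚ (recip a *ℚ (fromℕ b *ℚ recip b))      ≡⟨ cong (λ t → fromℕ a *ℚ (recip a *ℚ t)) (recip-inverse b) ⟩
  fromℕ a *ℚ (recip a *ℚ 1ℚ)                        ≡⟨ cong (fromℕ a *ℚ_) (ℚₚ.*-identityʳ _) ⟩
  fromℕ a *ℚ recip a                                ≡⟨ recip-inverse a ⟩
  1ℚ                                                ∎))

wt : List ℕ → ℚ
wt ρ = recip (z ρ) {{z≢0 ρ}}

-- The share of 1 / z_ρ that belongs to `c` parts of size `suc m`.
uwt : ℕ → ℕ → ℚ
uwt m c = recip (suc m ^ c * c !) {{nz}}
  where nz = ℕₚ.m*n≢0 (suc m ^ c) (c !) {{ℕₚ.m^n≢0 (suc m) c}} {{c ℕₚ.!≢0}}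

w-replicate : ∀ m c ρ → All (_≤ m) ρ → wt (replicate c (suc m) ++ ρ) ≡ uwt m c *ℚ wt ρ
w-replicate m c ρ h = recip-* (suc m ^ c * c !) (z ρ) (z (replicate c (suc m) ++ ρ))
  {{ℕₚ.m*n≢0 (suc m ^ c) (c !) {{ℕₚ.m^n≢0 (suc m) c}} {{c ℕₚ.!≢0}}}} {{z≢0 ρ}} {{z≢0 (replicate c (suc m) ++ ρ)}}
  (sym (z-replicate m c ρ h))

u-zero : ∀ m → uwt m 0 ≡ 1ℚ
u-zero m = sym (recip-unique 1 1ℚ (trans (ℚₚ.*-identityʳ _) (ℚₚ.+-identityʳ 1ℚ)))

-- Weighting by the boxes in the parts of size `suc m` amounts to deleting one of these parts; this
-- drives the recursion `SM-rec`.
u-suc : ∀ m c → fromℕ (suc c * suc m) *ℚ uwt m (suc c) ≡ uwt m c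
u-suc m c = recip-unique d {{nz}} _ (begin
  fromℕ d *ℚ (fromℕ (suc c * suc m) *ℚ uwt m (suc c))   ≡⟨ sym (ℚₚ.*-assoc (fromℕ d) _ _) ⟩
  fromℕ d *ℚ fromℕ (suc c * suc m) *ℚ uwt m (suc c)     ≡⟨ cong (_*ℚ uwt m (suc c)) (trans (sym (fromℕ-* d _)) (cong fromℕ eq)) ⟩
  fromℕ (suc m ^ suc c * (suc c) !) *ℚ uwt m (suc c)    ≡⟨ recip-inverse _ {{nz'}} ⟩
  1ℚ ∎)
  where
  d = suc m ^ c * c !
  nz = ℕₚ.m*n≢0 (suc m ^ c) (c !) {{ℕₚ.m^n≢0 (suc m) c}} {{c ℕₚ.!≢0}}
  nz' = ℕₚ.m*n≢0 (suc m ^ suc c) ((suc c) !) {{ℕₚ.m^n≢0 (suc m) (suc c)}} {{(suc c) ℕₚ.!≢0}}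
  eq : d * (suc c * suc m) ≡ suc m ^ suc c * (suc c) !
  eq = trans (ℕₚ.*-comm d _) (trans (cong (_* d) (ℕₚ.*-comm (suc c) (suc m))) (trans (ℕₚ.*-assoc (suc m) (suc c) d)
        (trans (cong (suc m *_) (trans (sym (ℕₚ.*-assoc (suc c) (suc m ^ c) (c !))) (trans (cong (_* c !) (ℕₚ.*-comm (suc c) (suc m ^ c))) (ℕₚ.*-assoc (suc m ^ c) (suc c) (c !)))))
          (sym (ℕₚ.*-assoc (suc m) (suc m ^ c) _)))))

opaque
  S : ℕ → (List ℕ → ℚ) → ℚ
  S n F = ∑ (partitions n) (λ ρ → wt ρ *ℚ F ρ)

rng : ℕ → List ℕ
rng zero    = []
rng (suc N) = 0 ∷ map suc (rng N)

opaque
  ∑< : ℕ → (ℕ → ℚ) → ℚ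
  ∑< N f = ∑ (rng N) f

  ∑<-zero : ∀ f → ∑< 0 f ≡ 0ℚ
  ∑<-zero f = refl

  ∑<-suc : ∀ N f → ∑< (suc N) f ≡ f 0 +ℚ ∑< N (λ i → f (suc i))
  ∑<-suc N f = cong (f 0 +ℚ_) (∑-map suc (rng N) f)

  ∑<-cong : ∀ N {f g : ℕ → ℚ} → (∀ i → f i ≡ g i) → ∑< N f ≡ ∑< N g
  ∑<-cong N h = ∑-cong (rng N) h

  ∑<-+ : ∀ N f g → ∑< N (λ i → f i +ℚ g i) ≡ ∑< N f +ℚ ∑< N g
  ∑<-+ N f g = ∑-+ (rng N) f g

  ∑<-*ˡ : ∀ x N f → x *ℚ ∑< N f ≡ ∑< N (λ i → x *ℚ f i)
  ∑<-*ˡ x N f = ∑-*ˡ x (rng N) f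

  ∑-∑< : ∀ {V : Set} (xs : List V) N (f : V → ℕ → ℚ) → ∑ xs (λ x → ∑< N (f x)) ≡ ∑< N (λ i → ∑ xs (λ x → f x i))
  ∑-∑< xs N f = ∑-swap xs (rng N) f

  ∑<-∑< : ∀ M N (f : ℕ → ℕ → ℚ) → ∑< M (λ i → ∑< N (f i)) ≡ ∑< N (λ j → ∑< M (λ i → f i j))
  ∑<-∑< M N f = ∑-swap (rng M) (rng N) f

∑<-snoc : ∀ N f → ∑< (suc N) f ≡ ∑< N f +ℚ f N
∑<-snoc zero    f = trans (∑<-suc 0 f) (trans (+-zeroʳ (f 0) (∑<-zero _)) (sym (+-zeroˡ (f 0) (∑<-zero _))))
∑<-snoc (suc N) f = begin
  ∑< (suc (suc N)) f                                ≡⟨ ∑<-suc (suc N) f ⟩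
  f 0 +ℚ ∑< (suc N) (λ i → f (suc i))               ≡⟨ cong (f 0 +ℚ_) (∑<-snoc N _) ⟩
  f 0 +ℚ (∑< N (λ i → f (suc i)) +ℚ f (suc N))      ≡⟨ sym (ℚₚ.+-assoc (f 0) _ _) ⟩
  f 0 +ℚ ∑< N (λ i → f (suc i)) +ℚ f (suc N)        ≡⟨ cong (_+ℚ f (suc N)) (sym (∑<-suc N f)) ⟩
  ∑< (suc N) f +ℚ f (suc N)                         ∎

∑<-0 : ∀ N {f : ℕ → ℚ} → (∀ i → f i ≡ 0ℚ) → ∑< N f ≡ 0ℚ
∑<-0 zero    h = ∑<-zero _
∑<-0 (suc N) h = trans (∑<-suc N _) (trans (+-zeroˡ _ (h 0)) (∑<-0 N (λ i → h (suc i))))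

∑anti-∑< : ∀ k g → ∑anti k g ≡ ∑< (suc k) (λ c → ∑ (sub c k) (g c))
∑anti-∑< zero    g = trans (∑anti-0 g) (sym (trans (∑<-suc 0 _) (trans (+-zeroʳ _ (∑<-zero _)) (ℚₚ.+-identityʳ _))))
∑anti-∑< (suc k) g = trans (∑anti-suc k g) (trans (cong₂ _+ℚ_ (sym (ℚₚ.+-identityʳ _)) (∑anti-∑< k (λ c → g (suc c))))
  (sym (∑<-suc (suc k) _)))

-- SM m n F is the sum of F ρ / z ρ over the partitions ρ of n with parts at most m,
-- organised by the multiplicity c of the largest allowed part; N bounds the multiplicities.
module _ (N : ℕ) where
  SM : ℕ → ℕ → (List ℕ → ℚ) → ℚ
  SM zero    zero    F = F []
  SM zero    (suc n) F = 0ℚ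
  SM (suc m) n       F =
    ∑< N (λ c → ∑ (sub (c * suc m) n) (λ n' → uwt m c *ℚ SM m n' (λ σ → F (replicate c (suc m) ++ σ))))

  SM-cong : ∀ m n {F G : List ℕ → ℚ} → (∀ ρ → F ρ ≡ G ρ) → SM m n F ≡ SM m n G
  SM-cong zero    zero    h = h []
  SM-cong zero    (suc n) h = refl
  SM-cong (suc m) n       h = ∑<-cong N (λ c → ∑-cong (sub (c * suc m) n) (λ n' → cong (uwt m c *ℚ_) (SM-cong m n' (λ σ → h _))))

Symm : (List ℕ → ℚ) → Set
Symm F = ∀ P r s Q → F (P ++ r ∷ s ∷ Q) ≡ F (P ++ s ∷ r ∷ Q)

Symm-∷ : ∀ {F} → Symm F → ∀ r → Symm (λ σ → F (r ∷ σ))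
Symm-∷ h r P = h (r ∷ P)

Symm-++ : ∀ {F} → Symm F → ∀ R → Symm (λ σ → F (R ++ σ))
Symm-++ h []      = h
Symm-++ {F} h (x ∷ R) = Symm-++ {λ σ → F (x ∷ σ)} (Symm-∷ {F} h x) R

Symm-move : ∀ {F} → Symm F → ∀ R r σ → F (R ++ r ∷ σ) ≡ F (r ∷ R ++ σ)
Symm-move h []      r σ = refl
Symm-move {F} h (x ∷ R) r σ = trans (Symm-move {λ σ → F (x ∷ σ)} (Symm-∷ {F} h x) R r σ) (h [] x r (R ++ σ))

-- The factor `n` is the sum of all parts. The share of the largest allowed size deletes one copy of
-- it by `u-suc`; the remaining share is handled by induction on `m`, and symmetry of `F` moves the
-- deleted part to the front.
SM-rec : ∀ N m n F → Symm F → n < N → fromℕ n *ℚ SM N m n F ≡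
  ∑< m (λ r → ∑ (sub (suc r) n) (λ n' → SM N m n' (λ σ → F (suc r ∷ σ))))
SM-rec N zero    zero    F h _ = trans (ℚₚ.*-zeroˡ _) (sym (∑<-zero _))
SM-rec N zero    (suc n) F h _ = trans (ℚₚ.*-zeroʳ _) (sym (∑<-zero _))
SM-rec N@(suc N') (suc m) n F h (s≤s n≤N') = begin
  fromℕ n *ℚ SM N (suc m) n F
    ≡⟨ ∑<-*ˡ (fromℕ n) N _ ⟩
  ∑< N (λ c → fromℕ n *ℚ ∑ (sub (c * M) n) (λ n' → uwt m c *ℚ SM N m n' (F' c)))
    ≡⟨ ∑<-cong N (λ c → trans (∑-*ˡ (fromℕ n) (sub (c * M) n) _) (trans (∑-cong-∈ (sub (c * M) n) (split c)) (∑-+ (sub (c * M) n) _ _))) ⟩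
  ∑< N (λ c → ∑ (sub (c * M) n) (λ n' → fromℕ (c * M) *ℚ uwt m c *ℚ SM N m n' (F' c)) +ℚ
              ∑ (sub (c * M) n) (λ n' → uwt m c *ℚ (fromℕ n' *ℚ SM N m n' (F' c))))
    ≡⟨ ∑<-+ N _ _ ⟩
  _ ≡⟨ cong₂ _+ℚ_ largest others ⟩
  ∑ (sub M n) (λ n' → SM N M n' (λ σ → F (M ∷ σ))) +ℚ
  ∑< m (λ r → ∑ (sub (suc r) n) (λ n' → SM N M n' (λ σ → F (suc r ∷ σ))))
    ≡⟨ ℚₚ.+-comm _ _ ⟩
  _ ≡⟨ sym (∑<-snoc m _) ⟩
  ∑< (suc m) (λ r → ∑ (sub (suc r) n) (λ n' → SM N M n' (λ σ → F (suc r ∷ σ)))) ∎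
  where
  M = suc m
  F' : ℕ → List ℕ → ℚ
  F' c σ = F (replicate c M ++ σ)
  split : ∀ c {n'} → n' ∈ sub (c * M) n → fromℕ n *ℚ (uwt m c *ℚ SM N m n' (F' c)) ≡
    fromℕ (c * M) *ℚ uwt m c *ℚ SM N m n' (F' c) +ℚ uwt m c *ℚ (fromℕ n' *ℚ SM N m n' (F' c))
  split c {n'} i = begin
    fromℕ n *ℚ (uwt m c *ℚ x)                                 ≡⟨ cong (λ t → fromℕ t *ℚ (uwt m c *ℚ x)) (trans (sym (sub-∈ (c * M) n i)) (ℕₚ.+-comm n' _)) ⟩
    fromℕ (c * M + n') *ℚ (uwt m c *ℚ x)                      ≡⟨ cong (_*ℚ (uwt m c *ℚ x)) (fromℕ-+ (c * M) n') ⟩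
    (fromℕ (c * M) +ℚ fromℕ n') *ℚ (uwt m c *ℚ x)             ≡⟨ ℚₚ.*-distribʳ-+ _ _ _ ⟩
    fromℕ (c * M) *ℚ (uwt m c *ℚ x) +ℚ fromℕ n' *ℚ (uwt m c *ℚ x)
      ≡⟨ cong₂ _+ℚ_ (sym (ℚₚ.*-assoc _ _ _)) (trans (sym (ℚₚ.*-assoc (fromℕ n') _ _)) (trans (cong (_*ℚ x) (ℚₚ.*-comm (fromℕ n') _)) (ℚₚ.*-assoc (uwt m c) _ _))) ⟩
    fromℕ (c * M) *ℚ uwt m c *ℚ x +ℚ uwt m c *ℚ (fromℕ n' *ℚ x) ∎
    where x = SM N m n' (F' c)
  term : ℕ → ℕ → ℚ
  term c n₁ = ∑ (sub (c * M) n₁) (λ n' → uwt m c *ℚ SM N m n' (λ σ → F (M ∷ replicate c M ++ σ)))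
  largest : ∑< N (λ c → ∑ (sub (c * M) n) (λ n' → fromℕ (c * M) *ℚ uwt m c *ℚ SM N m n' (F' c))) ≡
            ∑ (sub M n) (λ n' → SM N M n' (λ σ → F (M ∷ σ)))
  largest = begin
    ∑< N (λ c → ∑ (sub (c * M) n) (λ n' → fromℕ (c * M) *ℚ uwt m c *ℚ SM N m n' (F' c)))
      ≡⟨ ∑<-suc N' _ ⟩
    _ ≡⟨ +-zeroˡ _ (trans (ℚₚ.+-identityʳ _) (trans (cong (_*ℚ SM N m n (F' 0)) (ℚₚ.*-zeroˡ _)) (ℚₚ.*-zeroˡ _))) ⟩
    ∑< N' (λ c → ∑ (sub (suc c * M) n) (λ n' → fromℕ (suc c * M) *ℚ uwt m (suc c) *ℚ SM N m n' (F' (suc c))))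
      ≡⟨ ∑<-cong N' (λ c → trans (∑-cong (sub (suc c * M) n) (λ n' → cong (_*ℚ SM N m n' (F' (suc c))) (u-suc m c)))
           (sym (∑sub-sub M (c * M) n _))) ⟩
    ∑< N' (λ c → ∑ (sub M n) (term c))
      -- The term with `N'` further copies is empty because `n₁ < N' * M`; adding it restores the
      -- full range `N`.
      ≡⟨ sym (+-zeroʳ _ (∑-0 (sub M n) (λ {n₁} i → cong (λ l → ∑ l (λ n' → uwt m N' *ℚ SM N m n' (λ σ → F (M ∷ replicate N' M ++ σ)))) (sub-empty (small i))))) ⟩
    ∑< N' (λ c → ∑ (sub M n) (term c)) +ℚ ∑ (sub M n) (term N')
      ≡⟨ sym (∑<-snoc N' (λ c → ∑ (sub M n) (term c))) ⟩
    ∑< N (λ c → ∑ (sub M n) (term c))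
      ≡⟨ sym (∑-∑< (sub M n) N (λ n' c → term c n')) ⟩
    ∑ (sub M n) (λ n' → SM N M n' (λ σ → F (M ∷ σ))) ∎
    where
    small : ∀ {n₁} → n₁ ∈ sub M n → n₁ < N' * M
    small {n₁} i = ℕₚ.<-≤-trans (subst (suc n₁ ≤_) (sub-∈ M n i) (subst (_≤ n₁ + M) (ℕₚ.+-comm n₁ 1) (ℕₚ.+-monoʳ-≤ n₁ (s≤s z≤n))))
                      (ℕₚ.≤-trans n≤N' (subst (_≤ N' * M) (ℕₚ.*-identityʳ N') (ℕₚ.*-monoʳ-≤ N' (s≤s z≤n))))
  others : ∑< N (λ c → ∑ (sub (c * M) n) (λ n' → uwt m c *ℚ (fromℕ n' *ℚ SM N m n' (F' c)))) ≡
           ∑< m (λ r → ∑ (sub (suc r) n) (λ n' → SM N M n' (λ σ → F (suc r ∷ σ))))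
  others = begin
    ∑< N (λ c → ∑ (sub (c * M) n) (λ n' → uwt m c *ℚ (fromℕ n' *ℚ SM N m n' (F' c))))
      ≡⟨ ∑<-cong N (λ c → trans (∑-cong-∈ (sub (c * M) n) (λ {n'} i →
           trans (cong (uwt m c *ℚ_) (SM-rec N m n' (F' c) (Symm-++ {F} h (replicate c M))
             (s≤s (ℕₚ.≤-trans (subst (n' ≤_) (sub-∈ (c * M) n i) (ℕₚ.m≤m+n n' _)) n≤N'))))
           (trans (∑<-*ˡ (uwt m c) m _) (∑<-cong m (λ r → trans (∑-*ˡ (uwt m c) (sub (suc r) n') _)
             (∑-cong (sub (suc r) n') (λ n″ → cong (uwt m c *ℚ_) (SM-cong N m n″ (λ σ → Symm-move {F} h (replicate c M) (suc r) σ)))))))))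
           (trans (∑-∑< (sub (c * M) n) m _) (∑<-cong m (λ r → ∑sub-comm (c * M) (suc r) n (λ n″ → uwt m c *ℚ SM N m n″ (λ σ → F (suc r ∷ replicate c M ++ σ))))))) ⟩
    ∑< N (λ c → ∑< m (λ r → ∑ (sub (suc r) n) (λ n' → ∑ (sub (c * M) n') (λ n″ → uwt m c *ℚ SM N m n″ (λ σ → F (suc r ∷ replicate c M ++ σ))))))
      ≡⟨ ∑<-∑< N m _ ⟩
    ∑< m (λ r → ∑< N (λ c → ∑ (sub (suc r) n) (λ n' → ∑ (sub (c * M) n') (λ n″ → uwt m c *ℚ SM N m n″ (λ σ → F (suc r ∷ replicate c M ++ σ))))))
      ≡⟨ ∑<-cong m (λ r → sym (∑-∑< (sub (suc r) n) N _)) ⟩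
    ∑< m (λ r → ∑ (sub (suc r) n) (λ n' → SM N M n' (λ σ → F (suc r ∷ σ)))) ∎

partsLE-∷ : ∀ f m n (g : List ℕ → ℚ) → n ≤ f →
  ∑ (partsLE f (suc m) n) g ≡
  ∑ (partsLE f m n) g +ℚ ∑ (sub (suc m) n) (λ n' → ∑ (partsLE (f ∸ 1) (suc m) n') (λ σ → g (suc m ∷ σ)))
partsLE-∷ f       m zero    g _ = sym (ℚₚ.+-identityʳ _)
partsLE-∷ (suc f) m (suc n) g _ with suc m ℕₚ.≤? suc n
... | yes M≤n = begin
  ∑ (concatMap h (applyUpTo suc (suc m ⊓ suc n))) g        ≡⟨ cong (λ k → ∑ (concatMap h (applyUpTo suc k)) g) (ℕₚ.m≤n⇒m⊓n≡m M≤n) ⟩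
  ∑ (concatMap h (applyUpTo suc (suc m))) g                ≡⟨ cong (λ l → ∑ (concatMap h l) g) (sym (Listₚ.applyUpTo-∷ʳ suc m)) ⟩
  ∑ (concatMap h (applyUpTo suc m ++ suc m ∷ [])) g        ≡⟨ ∑-concatMap h (applyUpTo suc m ++ suc m ∷ []) g ⟩
  ∑ (applyUpTo suc m ++ suc m ∷ []) (λ k → ∑ (h k) g)      ≡⟨ ∑-++ (applyUpTo suc m) _ _ ⟩
  ∑ (applyUpTo suc m) (λ k → ∑ (h k) g) +ℚ ∑ (suc m ∷ []) (λ k → ∑ (h k) g)
    ≡⟨ cong₂ _+ℚ_ (sym (∑-concatMap h (applyUpTo suc m) g)) (trans (ℚₚ.+-identityʳ _) (∑-map _ (partsLE f (suc m) (suc n ∸ suc m)) g)) ⟩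
  ∑ (concatMap h (applyUpTo suc m)) g +ℚ ∑ (partsLE f (suc m) (suc n ∸ suc m)) (λ σ → g (suc m ∷ σ))
    ≡⟨ cong₂ _+ℚ_ (cong (λ k → ∑ (concatMap h (applyUpTo suc k)) g) (sym (ℕₚ.m≤n⇒m⊓n≡m (ℕₚ.≤-trans (ℕₚ.n≤1+n m) M≤n))))
         (sym (trans (cong (λ x → ∑ x (λ n' → ∑ (partsLE f (suc m) n') (λ σ → g (suc m ∷ σ)))) (trans (cong (sub (suc m)) (sym (ℕₚ.m+[n∸m]≡n M≤n))) (sub-+ (suc m) _))) (ℚₚ.+-identityʳ _))) ⟩
  _ ∎
  where
  h : ℕ → List (List ℕ)
  h k = map (k ∷_) (partsLE f k (suc n ∸ k))
... | no M≰n = begin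
  ∑ (concatMap h (applyUpTo suc (suc m ⊓ suc n))) g        ≡⟨ cong (λ k → ∑ (concatMap h (applyUpTo suc k)) g) (trans (ℕₚ.m≥n⇒m⊓n≡n (ℕₚ.<⇒≤ n<M)) (sym (ℕₚ.m≥n⇒m⊓n≡n (ℕₚ.≤-pred n<M)))) ⟩
  ∑ (concatMap h (applyUpTo suc (m ⊓ suc n))) g            ≡⟨ sym (+-zeroʳ _ (cong (λ l → ∑ l _) (sub-empty n<M))) ⟩
  _ ∎
  where
  h : ℕ → List (List ℕ)
  h k = map (k ∷_) (partsLE f k (suc n ∸ k))
  n<M = ℕₚ.≰⇒> M≰n

partsLE-0 : ∀ f n → partsLE f 0 (suc n) ≡ []
partsLE-0 zero    n = refl
partsLE-0 (suc f) n = refl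

partsLE-∈ : ∀ f m n {ρ} → ρ ∈ partsLE f m n → All (_≤ m) ρ × All (0 <_) ρ × n ≡ sum ρ
partsLE-∈ f       m zero    (here refl) = [] , [] , refl
partsLE-∈ (suc f) m (suc n) i with ∈ₚ.∈-concatMap⁻ (λ k → map (k ∷_) (partsLE f k (suc n ∸ k))) {xs = applyUpTo suc (m ⊓ suc n)} i
... | j with find j
... | k , k∈ , ρ∈ with ∈ₚ.∈-map⁻ (k ∷_) ρ∈ | ∈ₚ.∈-applyUpTo⁻ suc k∈
... | σ , σ∈ , refl | k' , k'<  , refl with partsLE-∈ f (suc k') (suc n ∸ suc k') σ∈
... | a , b , c = (k≤m ∷ All.map (λ h → ℕₚ.≤-trans h k≤m) a) , (s≤s z≤n ∷ b) ,
       trans (sym (ℕₚ.m+[n∸m]≡n (ℕₚ.≤-trans k'< (ℕₚ.m⊓n≤n m (suc n))))) (cong (suc k' +_) c)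
  where k≤m = ℕₚ.≤-trans k'< (ℕₚ.m⊓n≤m m (suc n))

replicate-∷ : ∀ c (x : ℕ) σ → replicate c x ++ x ∷ σ ≡ replicate (suc c) x ++ σ
replicate-∷ zero    x σ = refl
replicate-∷ (suc c) x σ = cong (x ∷_) (replicate-∷ c x σ)

-- Passes from the enumeration part by part to the one by multiplicities: `go` has already split off
-- `c` copies of the largest allowed part, and `tail` splits off one more.
partsLE-SM : ∀ N m f n (F : List ℕ → ℚ) → n ≤ f → n < N → ∑ (partsLE f m n) (λ ρ → wt ρ *ℚ F ρ) ≡ SM N m n F
partsLE-SM N zero    f zero    F _ _ = trans (ℚₚ.+-identityʳ _) (trans (cong (_*ℚ F []) w[]) (ℚₚ.*-identityˡ _))
  where
  w[] : wt [] ≡ 1ℚ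
  w[] = sym (recip-unique 1 1ℚ (trans (ℚₚ.*-identityʳ _) (ℚₚ.+-identityʳ 1ℚ)))
partsLE-SM N zero    f (suc n) F _ _ = cong (λ l → ∑ l (λ ρ → wt ρ *ℚ F ρ)) (partsLE-0 f n)
partsLE-SM N (suc m) f n       F n≤f n<N = go f N n 0 n≤f n<N ℕₚ.≤-refl
  where
  M = suc m
  go : ∀ f N' n c → n ≤ f → n < N' → N' ≤ N →
    ∑ (partsLE f M n) (λ ρ → wt (replicate c M ++ ρ) *ℚ F (replicate c M ++ ρ)) ≡
    ∑< N' (λ j → ∑ (sub (j * M) n) (λ n' → uwt m (c + j) *ℚ SM N m n' (λ σ → F (replicate (c + j) M ++ σ))))
  tail : ∀ f N' n c → n ≤ f → n ≤ N' → N' ≤ N →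
    ∑ (sub M n) (λ n' → ∑ (partsLE (f ∸ 1) M n') (λ σ → wt (replicate c M ++ M ∷ σ) *ℚ F (replicate c M ++ M ∷ σ))) ≡
    ∑< N' (λ j → ∑ (sub (suc j * M) n) (λ n' → uwt m (c + suc j) *ℚ SM N m n' (λ σ → F (replicate (c + suc j) M ++ σ))))
  go f (suc N') n c n≤f (s≤s n≤N') N'<N = begin
    ∑ (partsLE f M n) (λ ρ → wt (replicate c M ++ ρ) *ℚ F (replicate c M ++ ρ))
      ≡⟨ partsLE-∷ f m n _ n≤f ⟩
    _ ≡⟨ cong₂ _+ℚ_ first (tail f N' n c n≤f n≤N' (ℕₚ.<⇒≤ N'<N)) ⟩
    _ ≡⟨ sym (∑<-suc N' _) ⟩
    ∑< (suc N') (λ j → ∑ (sub (j * M) n) (λ n' → uwt m (c + j) *ℚ SM N m n' (λ σ → F (replicate (c + j) M ++ σ)))) ∎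
    where
    first : ∑ (partsLE f m n) (λ ρ → wt (replicate c M ++ ρ) *ℚ F (replicate c M ++ ρ)) ≡
            ∑ (n ∷ []) (λ n' → uwt m (c + 0) *ℚ SM N m n' (λ σ → F (replicate (c + 0) M ++ σ)))
    first = begin
      ∑ (partsLE f m n) (λ ρ → wt (replicate c M ++ ρ) *ℚ F (replicate c M ++ ρ))
        ≡⟨ ∑-cong-∈ (partsLE f m n) (λ {ρ} i → trans (cong (_*ℚ F (replicate c M ++ ρ)) (w-replicate m c ρ (proj₁ (partsLE-∈ f m n i)))) (ℚₚ.*-assoc (uwt m c) _ _)) ⟩
      ∑ (partsLE f m n) (λ ρ → uwt m c *ℚ (wt ρ *ℚ F (replicate c M ++ ρ)))
        ≡⟨ sym (∑-*ˡ (uwt m c) (partsLE f m n) _) ⟩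
      uwt m c *ℚ ∑ (partsLE f m n) (λ ρ → wt ρ *ℚ F (replicate c M ++ ρ))
        ≡⟨ cong (uwt m c *ℚ_) (partsLE-SM N m f n (λ σ → F (replicate c M ++ σ)) n≤f (ℕₚ.<-≤-trans (s≤s n≤N') N'<N)) ⟩
      uwt m c *ℚ SM N m n (λ σ → F (replicate c M ++ σ))
        ≡⟨ cong (λ t → uwt m t *ℚ SM N m n (λ σ → F (replicate t M ++ σ))) (sym (ℕₚ.+-identityʳ c)) ⟩
      uwt m (c + 0) *ℚ SM N m n (λ σ → F (replicate (c + 0) M ++ σ))
        ≡⟨ sym (ℚₚ.+-identityʳ _) ⟩
      _ ∎
  tail f N' zero c _ _ _ = sym (∑<-0 N' (λ j → refl))
  tail (suc f) N' n@(suc n₀) c (s≤s n₀≤f) n≤N' N'≤N = begin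
    ∑ (sub M n) (λ n' → ∑ (partsLE f M n') (λ σ → wt (replicate c M ++ M ∷ σ) *ℚ F (replicate c M ++ M ∷ σ)))
      ≡⟨ ∑-cong-∈ (sub M n) (λ {n'} i → trans (∑-cong (partsLE f M n') (λ σ → cong (λ l → wt l *ℚ F l) (replicate-∷ c M σ)))
           (trans (go f N' n' (suc c) (ℕₚ.≤-trans (small i) n₀≤f) (ℕₚ.≤-trans (s≤s (small i)) n≤N') N'≤N)
             (∑<-cong N' (λ j → cong (λ t → ∑ (sub (j * M) n') (λ n″ → uwt m t *ℚ SM N m n″ (λ σ → F (replicate t M ++ σ)))) (sym (ℕₚ.+-suc c j)))))) ⟩
    ∑ (sub M n) (λ n' → ∑< N' (λ j → ∑ (sub (j * M) n') (λ n″ → uwt m (c + suc j) *ℚ SM N m n″ (λ σ → F (replicate (c + suc j) M ++ σ)))))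
      ≡⟨ ∑-∑< (sub M n) N' _ ⟩
    _ ≡⟨ ∑<-cong N' (λ j → ∑sub-sub M (j * M) n _) ⟩
    ∑< N' (λ j → ∑ (sub (suc j * M) n) (λ n' → uwt m (c + suc j) *ℚ SM N m n' (λ σ → F (replicate (c + suc j) M ++ σ)))) ∎
    where
    small : ∀ {n'} → n' ∈ sub M n → n' ≤ n₀
    small {n'} i = ℕₚ.≤-pred (subst (suc n' ≤_) (sub-∈ M n i) (subst (_≤ n' + M) (ℕₚ.+-comm n' 1) (ℕₚ.+-monoʳ-≤ n' (s≤s z≤n))))

SM-large : ∀ N m d n F → n ≤ m → n < N → SM N (d + m) n F ≡ SM N m n F
SM-large N       m zero    n F _ _ = refl
SM-large N@(suc N') m (suc d) n F n≤m n<N = begin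
  SM N (suc d + m) n F
    ≡⟨ ∑<-suc N' _ ⟩
  ∑ (n ∷ []) (λ n' → uwt (d + m) 0 *ℚ SM N (d + m) n' F) +ℚ _
    ≡⟨ +-zeroʳ _ (∑<-0 N' (λ c → cong (λ l → ∑ l _) (sub-empty {suc c * suc (d + m)} (s≤s (ℕₚ.≤-trans n≤m (ℕₚ.≤-trans (ℕₚ.m≤n+m m d) (ℕₚ.m≤m+n _ _))))))) ⟩
  _ ≡⟨ ℚₚ.+-identityʳ _ ⟩
  uwt (d + m) 0 *ℚ SM N (d + m) n F
    ≡⟨ trans (cong (_*ℚ SM N (d + m) n F) (u-zero (d + m))) (ℚₚ.*-identityˡ _) ⟩
  SM N (d + m) n F
    ≡⟨ SM-large N m d n F n≤m n<N ⟩
  SM N m n F ∎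

opaque
  unfolding S

  S-SM : ∀ N n F → n < N → S n F ≡ SM N n n F
  S-SM N n F h = partsLE-SM N n n n F ℕₚ.≤-refl h

-- Averaging over the length r of the cycle through a fixed point.
S-rec : ∀ n F → Symm F → fromℕ n *ℚ S n F ≡ ∑anti⁺ n (λ r m → S m (λ σ → F (r ∷ σ)))
S-rec zero    F h = trans (ℚₚ.*-zeroˡ _) (sym (∑anti⁺-0 _))
S-rec (suc k) F h = begin
  fromℕ n *ℚ S n F
    ≡⟨ cong (fromℕ n *ℚ_) (S-SM (suc n) n F ℕₚ.≤-refl) ⟩
  fromℕ n *ℚ SM (suc n) n n F
    ≡⟨ SM-rec (suc n) n n F h ℕₚ.≤-refl ⟩
  ∑< n (λ r → ∑ (sub (suc r) n) (λ n' → SM (suc n) n n' (λ σ → F (suc r ∷ σ))))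
    ≡⟨ ∑<-cong n (λ r → ∑-cong-∈ (sub (suc r) n) (λ {n'} i → back r n' (subst (n' ≤_) (sub-∈ (suc r) n i) (ℕₚ.m≤m+n n' _)))) ⟩
  ∑< n (λ r → ∑ (sub (suc r) n) (λ n' → S n' (λ σ → F (suc r ∷ σ))))
    ≡⟨ sym (∑anti-∑< k _) ⟩
  ∑anti k (λ r m → S m (λ σ → F (suc r ∷ σ)))
    ≡⟨ sym (∑anti⁺-suc k _) ⟩
  ∑anti⁺ n (λ r m → S m (λ σ → F (r ∷ σ))) ∎
  where
  n = suc k
  back : ∀ r n' → n' ≤ n → SM (suc n) n n' (λ σ → F (suc r ∷ σ)) ≡ S n' (λ σ → F (suc r ∷ σ))
  back r n' n'≤n = trans (cong (λ t → SM (suc n) t n' (λ σ → F (suc r ∷ σ))) (sym (ℕₚ.m∸n+n≡m n'≤n)))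
    (trans (SM-large (suc n) n' (n ∸ n') n' _ ℕₚ.≤-refl (s≤s n'≤n)) (sym (S-SM (suc n) n' _ (s≤s n'≤n))))

S-0 : ∀ F → S 0 F ≡ F []
S-0 F = S-SM 1 0 F (s≤s z≤n)

opaque
  unfolding S

  S-cong : ∀ n {F G : List ℕ → ℚ} → (∀ ρ → F ρ ≡ G ρ) → S n F ≡ S n G
  S-cong n h = ∑-cong (partitions n) (λ ρ → cong (wt ρ *ℚ_) (h ρ))

  S-cong-∈ : ∀ n {F G : List ℕ → ℚ} → (∀ ρ → sum ρ ≡ n → All (0 <_) ρ → F ρ ≡ G ρ) → S n F ≡ S n G
  S-cong-∈ n h = ∑-cong-∈ (partitions n) (λ {ρ} i → cong (wt ρ *ℚ_)
    (h ρ (sym (proj₂ (proj₂ (partsLE-∈ n n n i)))) (proj₁ (proj₂ (partsLE-∈ n n n i)))))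

  S-+ : ∀ n F G → S n (λ ρ → F ρ +ℚ G ρ) ≡ S n F +ℚ S n G
  S-+ n F G = trans (∑-cong (partitions n) (λ ρ → ℚₚ.*-distribˡ-+ (wt ρ) _ _)) (∑-+ (partitions n) _ _)

  S-*ˡ : ∀ x n F → x *ℚ S n F ≡ S n (λ ρ → x *ℚ F ρ)
  S-*ˡ x n F = trans (∑-*ˡ x (partitions n) _) (∑-cong (partitions n) (λ ρ →
    trans (sym (ℚₚ.*-assoc x (wt ρ) _)) (trans (cong (_*ℚ F ρ) (ℚₚ.*-comm x (wt ρ))) (ℚₚ.*-assoc (wt ρ) x _))))

  S-neg : ∀ n F → S n (λ ρ → -ℚ F ρ) ≡ -ℚ S n F
  S-neg n F = trans (∑-cong (partitions n) (λ ρ → sym (ℚₚ.neg-distribʳ-* (wt ρ) _))) (∑-neg (partitions n) _)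

  S-zero : ∀ n → S n (λ _ → 0ℚ) ≡ 0ℚ
  S-zero n = ∑-0 (partitions n) (λ {ρ} _ → ℚₚ.*-zeroʳ (wt ρ))

  S-∑ : ∀ {V : Set} n (xs : List V) (F : V → List ℕ → ℚ) → S n (λ ρ → ∑ xs (λ x → F x ρ)) ≡ ∑ xs (λ x → S n (F x))
  S-∑ n xs F = trans (∑-cong (partitions n) (λ ρ → ∑-*ˡ (wt ρ) xs _)) (∑-swap (partitions n) xs _)

  S-∑anti⁺ : ∀ n k (F : ℕ → ℕ → List ℕ → ℚ) → S n (λ ρ → ∑anti⁺ k (λ c d → F c d ρ)) ≡ ∑anti⁺ k (λ c d → S n (F c d))
  S-∑anti⁺ n k F = trans (∑-cong (partitions n) (λ ρ → ∑anti⁺-*ˡ (wt ρ) k _)) (∑-∑anti⁺ (partitions n) k _)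

-- Antisymmetric functions of lists

-- Adjacent transpositions suffice because they generate all permutations.
Anti : (List ℕ → ℚ) → Set
Anti f = ∀ P a b Q → f (P ++ a ∷ b ∷ Q) ≡ -ℚ f (P ++ b ∷ a ∷ Q)

Anti-∷ : ∀ {f} → Anti f → ∀ x → Anti (λ A → f (x ∷ A))
Anti-∷ h x P = h (x ∷ P)

Anti-++ : ∀ {f} → Anti f → ∀ R → Anti (λ A → f (R ++ A))
Anti-++ {f} h R P a b Q = subst₂ (λ x y → f x ≡ -ℚ f y) (Listₚ.++-assoc R P _) (Listₚ.++-assoc R P _) (h (R ++ P) a b Q)

x≡-x⇒x≡0 : ∀ x → x ≡ -ℚ x → x ≡ 0ℚ
x≡-x⇒x≡0 x h = fromℕ-cancel 1 x 0ℚ (begin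
  fromℕ 2 *ℚ x                 ≡⟨ cong (_*ℚ x) (cong (1ℚ +ℚ_) (ℚₚ.+-identityʳ 1ℚ)) ⟩
  (1ℚ +ℚ 1ℚ) *ℚ x              ≡⟨ ℚₚ.*-distribʳ-+ x 1ℚ 1ℚ ⟩
  1ℚ *ℚ x +ℚ 1ℚ *ℚ x           ≡⟨ cong₂ _+ℚ_ (ℚₚ.*-identityˡ x) (trans (ℚₚ.*-identityˡ x) h) ⟩
  x +ℚ -ℚ x                    ≡⟨ ℚₚ.+-inverseʳ x ⟩
  0ℚ                           ≡⟨ sym (ℚₚ.*-zeroʳ _) ⟩
  fromℕ 2 *ℚ 0ℚ                ∎)

neg≡0 : ∀ {x} → x ≡ 0ℚ → -ℚ x ≡ 0ℚ
neg≡0 refl = ℚₚ.neg-zero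

-- Transpositions bring the equal entries together, where the value is its own negative.
Anti-dup : ∀ {f} → Anti f → ∀ P a Q R → f (P ++ a ∷ Q ++ a ∷ R) ≡ 0ℚ
Anti-dup {f} h P a []      R = x≡-x⇒x≡0 _ (h P a a R)
Anti-dup {f} h P a (b ∷ Q) R = trans (h P a b (Q ++ a ∷ R)) (neg≡0
  (trans (cong f (sym (Listₚ.++-assoc P (b ∷ []) _))) (Anti-dup {f} h (P ++ b ∷ []) a Q R)))

-- Power sums are symmetric, so multiplication by one preserves antisymmetry.
∑T-Anti : ∀ r {f} → Anti f → Anti (λ A → ∑ (T r A) f)
∑T-Anti r {f} h []      a b Q = begin
  ∑ (T r (a ∷ b ∷ Q)) f
    ≡⟨ expand a b ⟩
  ∑ (sub r a) (λ a' → f (a' ∷ b ∷ Q)) +ℚ (∑ (sub r b) (λ b' → f (a ∷ b' ∷ Q)) +ℚ ∑ (T r Q) (λ Q' → f (a ∷ b ∷ Q')))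
    ≡⟨ cong₂ _+ℚ_ (trans (∑-cong (sub r a) (λ a' → h [] a' b Q)) (∑-neg (sub r a) _))
         (cong₂ _+ℚ_ (trans (∑-cong (sub r b) (λ b' → h [] a b' Q)) (∑-neg (sub r b) _))
                     (trans (∑-cong (T r Q) (λ Q' → h [] a b Q')) (∑-neg (T r Q) _))) ⟩
  -ℚ x +ℚ (-ℚ y +ℚ -ℚ v)
    ≡⟨ cong (-ℚ x +ℚ_) (sym (ℚₚ.neg-distrib-+ y v)) ⟩
  -ℚ x +ℚ -ℚ (y +ℚ v)
    ≡⟨ sym (ℚₚ.neg-distrib-+ x (y +ℚ v)) ⟩
  -ℚ (x +ℚ (y +ℚ v))
    ≡⟨ cong -ℚ_ (trans (sym (ℚₚ.+-assoc x y v)) (trans (cong (_+ℚ v) (ℚₚ.+-comm x y)) (ℚₚ.+-assoc y x v))) ⟩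
  -ℚ (y +ℚ (x +ℚ v))
    ≡⟨ cong -ℚ_ (sym (expand b a)) ⟩
  -ℚ ∑ (T r (b ∷ a ∷ Q)) f ∎
  where
  x = ∑ (sub r a) (λ a' → f (b ∷ a' ∷ Q))
  y = ∑ (sub r b) (λ b' → f (b' ∷ a ∷ Q))
  v = ∑ (T r Q) (λ Q' → f (b ∷ a ∷ Q'))
  expand : ∀ a b → ∑ (T r (a ∷ b ∷ Q)) f ≡ ∑ (sub r a) (λ a' → f (a' ∷ b ∷ Q)) +ℚ
    (∑ (sub r b) (λ b' → f (a ∷ b' ∷ Q)) +ℚ ∑ (T r Q) (λ Q' → f (a ∷ b ∷ Q')))
  expand a b = trans (∑T r a (b ∷ Q) f) (cong (∑ (sub r a) (λ a' → f (a' ∷ b ∷ Q)) +ℚ_) (∑T r b Q _))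
∑T-Anti r {f} h (p ∷ P) a b Q = begin
  ∑ (T r (p ∷ P ++ a ∷ b ∷ Q)) f
    ≡⟨ ∑T r p _ f ⟩
  _ ≡⟨ cong₂ _+ℚ_ (trans (∑-cong (sub r p) (λ p' → h (p' ∷ P) a b Q)) (∑-neg (sub r p) _))
         (∑T-Anti r {λ A → f (p ∷ A)} (Anti-∷ {f} h p) P a b Q) ⟩
  _ ≡⟨ sym (ℚₚ.neg-distrib-+ _ _) ⟩
  _ ≡⟨ cong -ℚ_ (sym (∑T r p _ f)) ⟩
  -ℚ ∑ (T r (p ∷ P ++ b ∷ a ∷ Q)) f ∎

∑hS-Anti : ∀ k {f} → Anti f → Anti (λ A → ∑ (hS k A) f)
∑hS-Anti k {f} h [] a b Q = begin
  ∑ (hS k (a ∷ b ∷ Q)) f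
    ≡⟨ expand a b f ⟩
  ∑anti k (λ c d → ∑anti d (λ c' d' → ∑ (sub c a) (λ a' → ∑ (sub c' b) (λ b' → ∑ (hS d' Q) (λ C → f (a' ∷ b' ∷ C))))))
    ≡⟨ sym (∑anti-assoc k (λ c c' d' → ∑ (sub c a) (λ a' → ∑ (sub c' b) (λ b' → ∑ (hS d' Q) (λ C → f (a' ∷ b' ∷ C)))))) ⟩
  ∑anti k (λ x d' → ∑anti x (λ c c' → ∑ (sub c a) (λ a' → ∑ (sub c' b) (λ b' → ∑ (hS d' Q) (λ C → f (a' ∷ b' ∷ C))))))
    ≡⟨ ∑anti-cong′ k (λ x d' → trans (∑anti-comm x _) (∑anti-cong′ x (λ c c' →
         trans (∑-swap (sub c' a) (sub c b) _) (trans (∑-cong (sub c b) (λ b' → trans (∑-cong (sub c' a) (λ a' →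
           trans (∑-cong (hS d' Q) (λ C → h [] a' b' C)) (∑-neg (hS d' Q) _))) (∑-neg (sub c' a) _))) (∑-neg (sub c b) _))))) ⟩
  ∑anti k (λ x d' → ∑anti x (λ c c' → -ℚ ∑ (sub c b) (λ b' → ∑ (sub c' a) (λ a' → ∑ (hS d' Q) (λ C → f (b' ∷ a' ∷ C))))))
    ≡⟨ trans (∑anti-cong′ k (λ x d' → ∑anti-neg x _)) (∑anti-neg k _) ⟩
  -ℚ ∑anti k (λ x d' → ∑anti x (λ c c' → ∑ (sub c b) (λ b' → ∑ (sub c' a) (λ a' → ∑ (hS d' Q) (λ C → f (b' ∷ a' ∷ C))))))
    ≡⟨ cong -ℚ_ (∑anti-assoc k (λ c c' d' → ∑ (sub c b) (λ b' → ∑ (sub c' a) (λ a' → ∑ (hS d' Q) (λ C → f (b' ∷ a' ∷ C)))))) ⟩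
  _ ≡⟨ cong -ℚ_ (sym (expand b a f)) ⟩
  -ℚ ∑ (hS k (b ∷ a ∷ Q)) f ∎
  where
  ∑anti-neg : ∀ k g → ∑anti k (λ c d → -ℚ g c d) ≡ -ℚ ∑anti k g
  ∑anti-neg k g = trans (∑anti-cong′ k (λ c d → sym (ℚₚ.*-identityˡ _))) (trans (∑anti-cong′ k (λ c d → sym (ℚₚ.neg-distribʳ-* 1ℚ (g c d))))
    (trans (∑anti-cong′ k (λ c d → ℚₚ.neg-distribˡ-* 1ℚ (g c d))) (trans (sym (∑anti-*ˡ (-ℚ 1ℚ) k g))
      (trans (sym (ℚₚ.neg-distribˡ-* 1ℚ _)) (cong -ℚ_ (ℚₚ.*-identityˡ _))))))
  expand : ∀ a b f → ∑ (hS k (a ∷ b ∷ Q)) f ≡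
    ∑anti k (λ c d → ∑anti d (λ c' d' → ∑ (sub c a) (λ a' → ∑ (sub c' b) (λ b' → ∑ (hS d' Q) (λ C → f (a' ∷ b' ∷ C))))))
  expand a b f = trans (∑hS k a (b ∷ Q) f) (∑anti-cong′ k (λ c d →
    trans (∑-cong (sub c a) (λ a' → ∑hS d b Q _)) (∑-∑anti (sub c a) d _)))
∑hS-Anti k {f} h (p ∷ P) a b Q = begin
  ∑ (hS k (p ∷ P ++ a ∷ b ∷ Q)) f
    ≡⟨ ∑hS k p (P ++ a ∷ b ∷ Q) f ⟩
  _ ≡⟨ ∑anti-cong′ k (λ c d → trans (∑-cong (sub c p) (λ p' → ∑hS-Anti d {λ A → f (p' ∷ A)} (Anti-∷ {f} h p') P a b Q)) (∑-neg (sub c p) _)) ⟩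
  ∑anti k (λ c d → -ℚ ∑ (sub c p) (λ p' → ∑ (hS d (P ++ b ∷ a ∷ Q)) (λ C → f (p' ∷ C))))
    ≡⟨ ∑anti-cong′ k (λ c d → sym (neg1 _)) ⟩
  _ ≡⟨ sym (∑anti-*ˡ (-ℚ 1ℚ) k _) ⟩
  _ ≡⟨ neg1 _ ⟩
  _ ≡⟨ cong -ℚ_ (sym (∑hS k p (P ++ b ∷ a ∷ Q) f)) ⟩
  -ℚ ∑ (hS k (p ∷ P ++ b ∷ a ∷ Q)) f ∎
  where
  neg1 : ∀ x → -ℚ 1ℚ *ℚ x ≡ -ℚ x
  neg1 x = trans (sym (ℚₚ.neg-distribˡ-* 1ℚ x)) (cong -ℚ_ (ℚₚ.*-identityˡ x))

sg : ℕ → ℕ → ℚ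
sg zero    zero    = 0ℚ
sg zero    (suc b) = -ℚ 1ℚ
sg (suc a) zero    = 1ℚ
sg (suc a) (suc b) = sg a b

sg-neg : ∀ a b → sg a b ≡ -ℚ sg b a
sg-neg zero    zero    = sym ℚₚ.neg-zero
sg-neg zero    (suc b) = refl
sg-neg (suc a) zero    = sym (ℚₚ.neg-involutive 1ℚ)
sg-neg (suc a) (suc b) = sg-neg a b

sgs : ℕ → List ℕ → ℚ
sgs b []      = 1ℚ
sgs b (c ∷ B) = sg b c *ℚ sgs b B

-- The sign of the Vandermonde product ∏_{i<j} (A_i - A_j).
vs : List ℕ → ℚ
vs []      = 1ℚ
vs (b ∷ B) = sgs b B *ℚ vs B

-- The degree 0 + 1 + ... + (n - 1) of the Vandermonde determinant. A beta-list with `n` entries of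
-- a partition of m therefore has sum `m + tri n`.
tri : ℕ → ℕ
tri zero    = 0
tri (suc n) = n + tri n

-- The coefficient of x^A in the Vandermonde determinant.
e : List ℕ → ℚ
e A = if sum A ≡ᵇ tri (length A) then vs A else 0ℚ

sgs-swap : ∀ x P a b Q → sgs x (P ++ a ∷ b ∷ Q) ≡ sgs x (P ++ b ∷ a ∷ Q)
sgs-swap x []      a b Q = trans (sym (ℚₚ.*-assoc (sg x a) (sg x b) _)) (trans (cong (_*ℚ sgs x Q) (ℚₚ.*-comm (sg x a) (sg x b))) (ℚₚ.*-assoc (sg x b) (sg x a) _))
sgs-swap x (p ∷ P) a b Q = cong (sg x p *ℚ_) (sgs-swap x P a b Q)

vs-Anti : Anti vs
vs-Anti []      a b Q = begin
  sg a b *ℚ sgs a Q *ℚ (sgs b Q *ℚ vs Q)       ≡⟨ cong (λ t → t *ℚ sgs a Q *ℚ (sgs b Q *ℚ vs Q)) (sg-neg a b) ⟩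
  -ℚ sg b a *ℚ sgs a Q *ℚ (sgs b Q *ℚ vs Q)    ≡⟨ cong (_*ℚ (sgs b Q *ℚ vs Q)) (sym (ℚₚ.neg-distribˡ-* (sg b a) _)) ⟩
  -ℚ (sg b a *ℚ sgs a Q) *ℚ (sgs b Q *ℚ vs Q)  ≡⟨ sym (ℚₚ.neg-distribˡ-* (sg b a *ℚ sgs a Q) _) ⟩
  -ℚ (sg b a *ℚ sgs a Q *ℚ (sgs b Q *ℚ vs Q))  ≡⟨ cong -ℚ_ (trans (ℚₚ.*-assoc (sg b a) _ _) (trans (cong (sg b a *ℚ_)
      (trans (sym (ℚₚ.*-assoc (sgs a Q) _ _)) (trans (cong (_*ℚ vs Q) (ℚₚ.*-comm (sgs a Q) _)) (ℚₚ.*-assoc (sgs b Q) _ _)))) (sym (ℚₚ.*-assoc (sg b a) _ _)))) ⟩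
  -ℚ (sg b a *ℚ sgs b Q *ℚ (sgs a Q *ℚ vs Q))  ∎
vs-Anti (p ∷ P) a b Q = trans (cong₂ _*ℚ_ (sgs-swap p P a b Q) (vs-Anti P a b Q)) (sym (ℚₚ.neg-distribʳ-* _ _))

sum-swap : ∀ P a b Q → sum (P ++ a ∷ b ∷ Q) ≡ sum (P ++ b ∷ a ∷ Q)
sum-swap []      a b Q = trans (sym (ℕₚ.+-assoc a b _)) (trans (cong (_+ sum Q) (ℕₚ.+-comm a b)) (ℕₚ.+-assoc b a _))
sum-swap (p ∷ P) a b Q = cong (p +_) (sum-swap P a b Q)

length-swap : ∀ P (a b : ℕ) Q → length (P ++ a ∷ b ∷ Q) ≡ length (P ++ b ∷ a ∷ Q)
length-swap []      a b Q = refl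
length-swap (p ∷ P) a b Q = cong suc (length-swap P a b Q)

e-Anti : Anti e
e-Anti P a b Q rewrite sum-swap P a b Q | length-swap P a b Q with sum (P ++ b ∷ a ∷ Q) ≡ᵇ tri (length (P ++ b ∷ a ∷ Q))
... | true  = vs-Anti P a b Q
... | false = sym ℚₚ.neg-zero

-- Frobenius' formula: X A ρ is the coefficient of x^A in the product of p_ρ and the Vandermonde determinant.
X : List ℕ → List ℕ → ℚ
X A []      = e A
X A (r ∷ ρ) = ∑ (T r A) (λ A' → X A' ρ)

X-Anti : ∀ ρ → Anti (λ A → X A ρ)
X-Anti []      = e-Anti
X-Anti (r ∷ ρ) = ∑T-Anti r {λ A → X A ρ} (X-Anti ρ)

X-Symm : ∀ A → Symm (X A)
X-Symm A []      r s Q = ∑T-comm r s A (λ A' → X A' Q)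
X-Symm A (p ∷ P) r s Q = ∑-cong (T p A) (λ A' → X-Symm A' P r s Q)

-- The operator p_σ(x) p_σ(y): each part of `σ` lowers one entry of `A` and one entry of `B`.
Tw : List ℕ → (List ℕ → List ℕ → ℚ) → List ℕ → List ℕ → ℚ
Tw []      F A B = F A B
Tw (r ∷ σ) F A B = ∑ (T r A) (λ A' → ∑ (T r B) (λ B' → Tw σ F A' B'))

Tw-cong : ∀ σ {F G : List ℕ → List ℕ → ℚ} → (∀ A B → F A B ≡ G A B) → ∀ A B → Tw σ F A B ≡ Tw σ G A B
Tw-cong []      h A B = h A B
Tw-cong (r ∷ σ) h A B = ∑-cong (T r A) (λ A' → ∑-cong (T r B) (λ B' → Tw-cong σ h A' B'))

Tw-Symm : ∀ F A B → Symm (λ σ → Tw σ F A B)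
Tw-Symm F A B []      r s Q = begin
  ∑ (T r A) (λ A₁ → ∑ (T r B) (λ B₁ → ∑ (T s A₁) (λ A₂ → ∑ (T s B₁) (λ B₂ → Tw Q F A₂ B₂))))
    ≡⟨ ∑-cong (T r A) (λ A₁ → ∑-swap (T r B) (T s A₁) _) ⟩
  ∑ (T r A) (λ A₁ → ∑ (T s A₁) (λ A₂ → ∑ (T r B) (λ B₁ → ∑ (T s B₁) (λ B₂ → Tw Q F A₂ B₂))))
    ≡⟨ ∑T-comm r s A _ ⟩
  ∑ (T s A) (λ A₁ → ∑ (T r A₁) (λ A₂ → ∑ (T r B) (λ B₁ → ∑ (T s B₁) (λ B₂ → Tw Q F A₂ B₂))))
    ≡⟨ ∑-cong (T s A) (λ A₁ → trans (∑-cong (T r A₁) (λ A₂ → ∑T-comm r s B (λ B₂ → Tw Q F A₂ B₂))) (∑-swap (T r A₁) (T s B) _)) ⟩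
  ∑ (T s A) (λ A₁ → ∑ (T s B) (λ B₁ → ∑ (T r A₁) (λ A₂ → ∑ (T r B₁) (λ B₂ → Tw Q F A₂ B₂)))) ∎
Tw-Symm F A B (p ∷ P) r s Q = ∑-cong (T p A) (λ A' → ∑-cong (T p B) (λ B' → Tw-Symm F A' B' P r s Q))

X*X : ∀ σ A B → X A σ *ℚ X B σ ≡ Tw σ (λ A' B' → e A' *ℚ e B') A B
X*X []      A B = refl
X*X (r ∷ σ) A B = trans (∑-*ʳ _ (T r A) _) (∑-cong (T r A) (λ A' →
  trans (∑-*ˡ _ (T r B) _) (∑-cong (T r B) (λ B' → X*X σ A' B'))))

Tw-++ : ∀ σ τ F A B → Tw (σ ++ τ) F A B ≡ Tw σ (Tw τ F) A B
Tw-++ []      τ F A B = refl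
Tw-++ (r ∷ σ) τ F A B = ∑-cong (T r A) (λ A' → ∑-cong (T r B) (λ B' → Tw-++ σ τ F A' B'))

S-Tw : ∀ m σ (G : List ℕ → List ℕ → List ℕ → ℚ) A B →
  S m (λ τ → Tw σ (G τ) A B) ≡ Tw σ (λ A' B' → S m (λ τ → G τ A' B')) A B
S-Tw m []      G A B = refl
S-Tw m (r ∷ σ) G A B = trans (S-∑ m (T r A) _) (∑-cong (T r A) (λ A' →
  trans (S-∑ m (T r B) _) (∑-cong (T r B) (λ B' → S-Tw m σ G A' B'))))

∑hS-0 : ∀ A f → ∑ (hS 0 A) f ≡ f A
∑hS-0 []      f = ℚₚ.+-identityʳ _
∑hS-0 (a ∷ A) f = trans (∑hS 0 a A f) (trans (∑anti-0 _) (trans (ℚₚ.+-identityʳ _) (∑hS-0 A _)))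

NSum-0 : ∀ A B F → NSum 0 A B F ≡ F A B
NSum-0 A []      F = NSum-[] A F
NSum-0 A (b ∷ B) F = trans (NSum-∷ 0 A b B F) (trans (∑anti-0 _) (trans (ℚₚ.+-identityʳ _) (trans (∑hS-0 A _) (NSum-0 A B _))))

NSum-1 : ∀ A B F → NSum 1 A B F ≡ ∑ (T 1 A) (λ A' → ∑ (T 1 B) (λ B' → F A' B'))
NSum-1 A B F = begin
  NSum 1 A B F                           ≡⟨ sym (ℚₚ.*-identityˡ _) ⟩
  1ℚ *ℚ NSum 1 A B F                     ≡⟨ cong (_*ℚ NSum 1 A B F) (sym (ℚₚ.+-identityʳ 1ℚ)) ⟩
  fromℕ 1 *ℚ NSum 1 A B F                ≡⟨ newton-NS 1 A B F ⟩
  _                                      ≡⟨ trans (∑anti⁺-suc 0 _) (∑anti-0 _) ⟩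
  ∑ (T 1 A) (λ A' → ∑ (T 1 B) (λ B' → NSum 0 A' B' F)) ≡⟨ ∑-cong (T 1 A) (λ A' → ∑-cong (T 1 B) (λ B' → NSum-0 A' B' F)) ⟩
  _ ∎

-- The Cauchy identity Σ_σ p_σ(x) p_σ(y) / z_σ = ∏ 1/(1 - x_i y_j)
S-NSum : ∀ N p F A B → p ≤ N → S p (λ σ → Tw σ F A B) ≡ NSum p A B F
S-NSum N       zero    F A B _       = trans (S-0 _) (sym (NSum-0 A B F))
-- Both sides satisfy p N_p = Σ p_r(x) p_r(y) N_{p-r}: the left one by `S-rec`, the right one by
-- Newton's identity. `N` bounds the depth of the recursion.
S-NSum (suc N) (suc p) F A B (s≤s h) = fromℕ-cancel p _ _ (begin
  fromℕ (suc p) *ℚ S (suc p) (λ σ → Tw σ F A B)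
    ≡⟨ S-rec (suc p) _ (Tw-Symm F A B) ⟩
  ∑anti⁺ (suc p) (λ r m → S m (λ σ → ∑ (T r A) (λ A' → ∑ (T r B) (λ B' → Tw σ F A' B'))))
    ≡⟨ ∑anti⁺-cong (suc p) (λ c d q → trans (S-∑ d (T (suc c) A) _) (∑-cong (T (suc c) A) (λ A' →
         trans (S-∑ d (T (suc c) B) _) (∑-cong (T (suc c) B) (λ B' →
           S-NSum N d F A' B' (ℕₚ.≤-trans (subst (d ≤_) (ℕₚ.suc-injective q) (ℕₚ.m≤n+m d c)) h)))))) ⟩
  ∑anti⁺ (suc p) (λ r m → ∑ (T r A) (λ A' → ∑ (T r B) (λ B' → NSum m A' B' F)))
    ≡⟨ sym (newton-NS (suc p) A B F) ⟩
  fromℕ (suc p) *ℚ NSum (suc p) A B F ∎)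

-- π ρ k counts the k-subsets fixed by a permutation of cycle type ρ.
π : List ℕ → ℕ → ℚ
π []      zero    = 1ℚ
π []      (suc k) = 0ℚ
π (r ∷ ρ) k       = π ρ k +ℚ ∑ (sub r k) (π ρ)

π-Symm : ∀ k → Symm (λ ρ → π ρ k)
π-Symm k []      r s Q = begin
  (π Q k +ℚ ∑ (sub s k) (π Q)) +ℚ ∑ (sub r k) (λ k' → π Q k' +ℚ ∑ (sub s k') (π Q))
    ≡⟨ cong (_ +ℚ_) (∑-+ (sub r k) _ _) ⟩
  (π Q k +ℚ ∑ (sub s k) (π Q)) +ℚ (∑ (sub r k) (π Q) +ℚ ∑ (sub r k) (λ k' → ∑ (sub s k') (π Q)))
    ≡⟨ interchange _ _ _ _ ⟩
  (π Q k +ℚ ∑ (sub r k) (π Q)) +ℚ (∑ (sub s k) (π Q) +ℚ ∑ (sub r k) (λ k' → ∑ (sub s k') (π Q)))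
    ≡⟨ cong (λ t → (π Q k +ℚ ∑ (sub r k) (π Q)) +ℚ (∑ (sub s k) (π Q) +ℚ t)) (∑sub-comm r s k _) ⟩
  (π Q k +ℚ ∑ (sub r k) (π Q)) +ℚ (∑ (sub s k) (π Q) +ℚ ∑ (sub s k) (λ k' → ∑ (sub r k') (π Q)))
    ≡⟨ cong (_ +ℚ_) (sym (∑-+ (sub s k) _ _)) ⟩
  (π Q k +ℚ ∑ (sub r k) (π Q)) +ℚ ∑ (sub s k) (λ k' → π Q k' +ℚ ∑ (sub r k') (π Q)) ∎
π-Symm k (p ∷ P) r s Q = cong₂ _+ℚ_ (π-Symm k P r s Q) (∑-cong (sub p k) (λ k' → π-Symm k' P r s Q))

π-large : ∀ ρ k → sum ρ < k → π ρ k ≡ 0ℚ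
π-large []      (suc k) _ = refl
π-large (r ∷ ρ) k       h = trans (cong₂ _+ℚ_ (π-large ρ k (ℕₚ.≤-<-trans (ℕₚ.m≤n+m _ r) h))
  (∑-0 (sub r k) (λ {k'} i → π-large ρ k' (ℕₚ.+-cancelʳ-< r (sum ρ) k' (subst₂ _<_ (ℕₚ.+-comm r _) (sym (sub-∈ r k i)) h)))))
  (ℚₚ.+-identityʳ 0ℚ)

∑anti⁺-snoc : ∀ N g → ∑anti⁺ (suc N) g ≡ ∑anti⁺ N (λ r d → g r (suc d)) +ℚ g (suc N) 0
∑anti⁺-snoc zero    g = trans (∑anti⁺-suc 0 g) (trans (∑anti-0 _) (sym (+-zeroˡ _ (∑anti⁺-0 _))))
∑anti⁺-snoc (suc N) g = trans (∑anti⁺-suc (suc N) g) (trans (∑anti-snoc N _) (cong (_+ℚ g (suc (suc N)) 0) (sym (∑anti⁺-suc N _))))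

∑anti⁺-shift : ∀ k m g → (∀ r n → n < k → g r n ≡ 0ℚ) → ∑anti⁺ (k + m) g ≡ ∑anti⁺ m (λ r m' → g r (k + m'))
∑anti⁺-shift zero    m g h = refl
∑anti⁺-shift (suc k) m g h = trans (∑anti⁺-snoc (k + m) g) (trans (+-zeroʳ _ (h _ 0 (s≤s z≤n)))
  (∑anti⁺-shift k m (λ r d → g r (suc d)) (λ r n n<k → h r (suc n) (s≤s n<k))))

∑anti-sub : ∀ k m (g : ℕ → ℕ → ℕ → ℚ) →
  ∑anti (k + m) (λ c n → ∑ (sub c k) (λ k' → g c k' n)) ≡ ∑anti k (λ c k' → g c k' (k' + m))
∑anti-sub zero    zero    g = trans (∑anti-0 _) (trans (ℚₚ.+-identityʳ _) (sym (∑anti-0 _)))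
∑anti-sub zero    (suc m) g = trans (∑anti-suc m _) (trans (+-zeroʳ _ (trans (∑anti-cong′ m (λ _ _ → sym (ℚₚ.*-zeroˡ 0ℚ)))
  (trans (sym (∑anti-*ˡ 0ℚ m (λ _ _ → 0ℚ))) (ℚₚ.*-zeroˡ _)))) (trans (ℚₚ.+-identityʳ _) (sym (∑anti-0 _))))
∑anti-sub (suc k) m       g = trans (∑anti-suc (k + m) _) (trans (cong₂ _+ℚ_ (ℚₚ.+-identityʳ _) (∑anti-sub k m (λ c → g (suc c)))) (sym (∑anti-suc k _)))

∑anti⁺-sub : ∀ k m (g : ℕ → ℕ → ℕ → ℚ) →
  ∑anti⁺ (k + m) (λ c n → ∑ (sub c k) (λ k' → g c k' n)) ≡ ∑anti⁺ k (λ c k' → g c k' (k' + m))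
∑anti⁺-sub zero    m g = trans (∑anti⁺-cong m (λ c d _ → sym (ℚₚ.*-zeroˡ 0ℚ))) (trans (sym (∑anti⁺-*ˡ 0ℚ m (λ _ _ → 0ℚ))) (trans (ℚₚ.*-zeroˡ _) (sym (∑anti⁺-0 _))))
∑anti⁺-sub (suc k) m g = trans (∑anti⁺-suc (k + m) _) (trans (∑anti-sub k m (λ c → g (suc c))) (sym (∑anti⁺-suc k _)))

-- Averaging against the permutation character on k-subsets restricts to S_k × S_m.
S-π : ∀ N k m G → Symm G → k + m ≤ N → S (k + m) (λ ρ → π ρ k *ℚ G ρ) ≡ S k (λ σ → S m (λ τ → G (σ ++ τ)))
S-π N zero zero G h _ = trans (S-0 _) (trans (ℚₚ.*-identityˡ _) (sym (trans (S-0 _) (S-0 _))))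
S-π zero (suc k) m G h ()
S-π zero zero (suc m) G h ()
S-π (suc N) k m G h k+m≤N with k + m in eq
... | zero rewrite ℕₚ.m+n≡0⇒m≡0 k eq | ℕₚ.m+n≡0⇒n≡0 k eq = trans (S-0 _) (trans (ℚₚ.*-identityˡ _) (sym (trans (S-0 _) (S-0 _))))
-- The marked cycle lies outside or inside the fixed `k`-subset. With `R` the claimed value, the two
-- cases give `m` and `k` copies of `R`, together the degree `k + m` times `R`.
... | suc n = fromℕ-cancel n _ _ (begin
  fromℕ (suc n) *ℚ S (suc n) (λ ρ → π ρ k *ℚ G ρ)
    ≡⟨ S-rec (suc n) _ (λ P r s Q → cong₂ _*ℚ_ (π-Symm k P r s Q) (h P r s Q)) ⟩
  ∑anti⁺ (suc n) (λ r n' → S n' (λ ρ → (π ρ k +ℚ ∑ (sub r k) (π ρ)) *ℚ G (r ∷ ρ)))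
    ≡⟨ ∑anti⁺-cong′ (suc n) (λ r n' → trans (S-cong n' (λ ρ → trans (ℚₚ.*-distribʳ-+ (G (r ∷ ρ)) _ _)
         (cong (π ρ k *ℚ G (r ∷ ρ) +ℚ_) (∑-*ʳ (G (r ∷ ρ)) (sub r k) (π ρ))))) (trans (S-+ n' _ _)
         (cong (S n' (λ ρ → π ρ k *ℚ G (r ∷ ρ)) +ℚ_) (S-∑ n' (sub r k) _)))) ⟩
  ∑anti⁺ (suc n) (λ r n' → S n' (λ ρ → π ρ k *ℚ G (r ∷ ρ)) +ℚ ∑ (sub r k) (λ k' → S n' (λ ρ → π ρ k' *ℚ G (r ∷ ρ))))
    ≡⟨ ∑anti⁺-+ (suc n) _ _ ⟩
  ∑anti⁺ (suc n) (λ r n' → S n' (λ ρ → π ρ k *ℚ G (r ∷ ρ))) +ℚ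
  ∑anti⁺ (suc n) (λ r n' → ∑ (sub r k) (λ k' → S n' (λ ρ → π ρ k' *ℚ G (r ∷ ρ))))
    ≡⟨ cong₂ _+ℚ_
        (trans (cong (λ t → ∑anti⁺ t (λ r n' → S n' (λ ρ → π ρ k *ℚ G (r ∷ ρ)))) (sym eq)) (∑anti⁺-shift k m _ vanish))
        (trans (cong (λ t → ∑anti⁺ t (λ r n' → ∑ (sub r k) (λ k' → S n' (λ ρ → π ρ k' *ℚ G (r ∷ ρ))))) (sym eq)) (∑anti⁺-sub k m _)) ⟩
  ∑anti⁺ m (λ r m' → S (k + m') (λ ρ → π ρ k *ℚ G (r ∷ ρ))) +ℚ
  ∑anti⁺ k (λ r k' → S (k' + m) (λ ρ → π ρ k' *ℚ G (r ∷ ρ)))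
    ≡⟨ cong₂ _+ℚ_
        (∑anti⁺-cong m (λ c d q → S-π N k d (λ ρ → G (suc c ∷ ρ)) (Symm-∷ {G} h (suc c)) (bound₁ c d q)))
        (∑anti⁺-cong k (λ c d q → S-π N d m (λ ρ → G (suc c ∷ ρ)) (Symm-∷ {G} h (suc c)) (bound₂ c d q))) ⟩
  ∑anti⁺ m (λ r m' → S k (λ σ → S m' (λ τ → G (r ∷ σ ++ τ)))) +ℚ
  ∑anti⁺ k (λ r k' → S k' (λ σ → S m (λ τ → G (r ∷ σ ++ τ))))
    ≡⟨ cong₂ _+ℚ_ (trans (sym (S-∑anti⁺ k m (λ r m' σ → S m' (λ τ → G (r ∷ σ ++ τ)))))
         (trans (S-cong k (λ σ → trans (∑anti⁺-cong′ m (λ r m' → S-cong m' (λ τ → sym (Symm-move {G} h σ r τ)))) (sym (S-rec m _ (Symm-++ {G} h σ))))) (sym (S-*ˡ (fromℕ m) k _))))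
         (sym (S-rec k _ (λ P r s Q → S-cong m (λ τ → subst₂ (λ x y → G x ≡ G y) (sym (Listₚ.++-assoc P _ τ)) (sym (Listₚ.++-assoc P _ τ)) (h P r s (Q ++ τ)))))) ⟩
  fromℕ m *ℚ R +ℚ fromℕ k *ℚ R
    ≡⟨ trans (sym (ℚₚ.*-distribʳ-+ R (fromℕ m) (fromℕ k))) (cong (_*ℚ R) (trans (sym (fromℕ-+ m k)) (cong fromℕ (trans (ℕₚ.+-comm m k) eq)))) ⟩
  fromℕ (suc n) *ℚ R ∎)
  where
  R = S k (λ σ → S m (λ τ → G (σ ++ τ)))
  vanish : ∀ r n' → n' < k → S n' (λ ρ → π ρ k *ℚ G (r ∷ ρ)) ≡ 0ℚ
  vanish r n' n'<k = trans (S-cong-∈ n' (λ ρ s _ → trans (cong (_*ℚ G (r ∷ ρ)) (π-large ρ k (subst (_< k) (sym s) n'<k))) (ℚₚ.*-zeroˡ _))) (S-zero n')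
  n≤N : n ≤ N
  n≤N = ℕₚ.≤-pred k+m≤N
  bound₁ : ∀ c d → suc c + d ≡ m → k + d ≤ N
  bound₁ c d refl = ℕₚ.≤-trans (ℕₚ.≤-trans (ℕₚ.+-monoʳ-≤ k (ℕₚ.m≤n+m d c)) (ℕₚ.≤-reflexive (ℕₚ.suc-injective (trans (sym (ℕₚ.+-suc k (c + d))) eq)))) n≤N
  bound₂ : ∀ c d → suc c + d ≡ k → d + m ≤ N
  bound₂ c d refl = ℕₚ.≤-trans (ℕₚ.≤-trans (ℕₚ.+-monoˡ-≤ m (ℕₚ.m≤n+m d c)) (ℕₚ.≤-reflexive (ℕₚ.suc-injective eq))) n≤N

-- Inner products and restriction to Young subgroups

I : ℕ → List ℕ → List ℕ → ℚ
I m A B = S m (λ ρ → X A ρ *ℚ X B ρ)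

I-NSum : ∀ m A B → I m A B ≡ NSum m A B (λ A' B' → e A' *ℚ e B')
I-NSum m A B = trans (S-cong m (λ ρ → X*X ρ A B)) (S-NSum m m _ A B ℕₚ.≤-refl)

-- The quantity N_k: averaging over S_k turns p_σ(x) p_σ(y) into the Cauchy kernel, and averaging
-- over S_m leaves the inner product of the lowered lists.
S-π-XX : ∀ k m A B → S (k + m) (λ ρ → π ρ k *ℚ (X A ρ *ℚ X B ρ)) ≡ NSum k A B (I m)
S-π-XX k m A B = begin
  S (k + m) (λ ρ → π ρ k *ℚ (X A ρ *ℚ X B ρ))
    ≡⟨ S-π (k + m) k m (λ ρ → X A ρ *ℚ X B ρ) (λ P r s Q → cong₂ _*ℚ_ (X-Symm A P r s Q) (X-Symm B P r s Q)) ℕₚ.≤-refl ⟩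
  S k (λ σ → S m (λ τ → X A (σ ++ τ) *ℚ X B (σ ++ τ)))
    ≡⟨ S-cong k (λ σ → trans (S-cong m (λ τ → trans (X*X (σ ++ τ) A B) (Tw-++ σ τ _ A B))) (trans (S-Tw m σ _ A B)
         (Tw-cong σ (λ A' B' → S-cong m (λ τ → sym (X*X τ A' B'))) A B))) ⟩
  S k (λ σ → Tw σ (I m) A B)
    ≡⟨ S-NSum k k (I m) A B ℕₚ.≤-refl ⟩
  NSum k A B (I m) ∎

I-sym : ∀ m A B → I m A B ≡ I m B A
I-sym m A B = S-cong m (λ ρ → ℚₚ.*-comm _ _)

I-Antiʳ : ∀ m A → Anti (I m A)
I-Antiʳ m A P a b Q = trans (S-cong m (λ ρ → trans (cong (X A ρ *ℚ_) (X-Anti ρ P a b Q)) (sym (ℚₚ.neg-distribʳ-* _ _)))) (S-neg m _)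

I-Antiˡ : ∀ m B → Anti (λ A → I m A B)
I-Antiˡ m B P a b Q = trans (I-sym m _ B) (trans (I-Antiʳ m B P a b Q) (cong -ℚ_ (I-sym m B _)))

-- Reduction of antisymmetric functions to strict lists

Strict : List ℕ → Set
Strict = Linked (λ a b → b < a)

tail-Strict : ∀ {a A} → Strict (a ∷ A) → Strict A
tail-Strict [-]     = []
tail-Strict (_ ∷ h) = h

Strict-head : ∀ {a A} → Strict (a ∷ A) → All (_< a) A
Strict-head [-]     = []
Strict-head (h ∷ s) = h ∷ All.map (λ q → ℕₚ.<-trans q h) (Strict-head s)

Strict-∷ : ∀ {a A} → All (_< a) A → Strict A → Strict (a ∷ A)
Strict-∷ {A = []}     _       _ = [-]
Strict-∷ {A = x ∷ A} (h ∷ _) s = h ∷ s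

-- One step of insertion sort: passing a larger entry only changes the sign, and meeting an equal
-- one gives zero.
Anti-insert : ∀ {f} → Anti f → (P : ℕ → Set) → ∀ x ys → P x → Strict ys → All P ys →
  (∀ A → Strict A → All P A → length A ≡ suc (length ys) → f A ≡ 0ℚ) → f (x ∷ ys) ≡ 0ℚ
Anti-insert {f} anti P x []       px s p h = h (x ∷ []) [-] (px ∷ []) refl
Anti-insert {f} anti P x (y ∷ ys) px s (py ∷ p) h with ℕₚ.<-cmp x y
... | tri> _ _ y<x = h (x ∷ y ∷ ys) (y<x ∷ s) (px ∷ py ∷ p) refl
... | tri≈ _ refl _ = Anti-dup {f} anti [] x [] ys
... | tri< x<y _ _ = trans (anti [] x y ys) (neg≡0
  (Anti-insert {λ A → f (y ∷ A)} (Anti-∷ {f} anti y) (λ z → P z × z < y) x ys (px , x<y) (tail-Strict s) (All.zip (p , Strict-head s))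
    (λ A s' p' l → h (y ∷ A) (Strict-∷ (All.map proj₂ p') s') (py ∷ All.map proj₁ p') (cong suc l))))

-- Insertion sort reduces every list to a strict one or to one with a repetition. The predicate `P`
-- on entries is preserved, since sorting only permutes them.
Anti-vanish : ∀ {f} → Anti f → (P : ℕ → Set) → ∀ L →
  (∀ A → Strict A → All P A → length A ≡ L → f A ≡ 0ℚ) → ∀ A → All P A → length A ≡ L → f A ≡ 0ℚ
Anti-vanish {f} anti P zero    h []      p l = h [] [] [] refl
Anti-vanish {f} anti P (suc L) h (x ∷ A) (px ∷ p) l =
  Anti-vanish {λ ys → f (x ∷ ys)} (Anti-∷ {f} anti x) P L
    (λ ys s q l' → Anti-insert {f} anti P x ys px s q (λ zs s' q' l″ → h zs s' q' (trans l″ (cong suc l')))) A p (ℕₚ.suc-injective l)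

Strict-length : ∀ {a A} → Strict (a ∷ A) → length A ≤ a
Strict-length [-]     = z≤n
Strict-length (h ∷ s) = ℕₚ.≤-trans (s≤s (Strict-length s)) h

Strict-sum : ∀ {A} → Strict A → tri (length A) ≤ sum A
Strict-sum {[]}    _ = z≤n
Strict-sum {a ∷ A} s = ℕₚ.+-mono-≤ (Strict-length s) (Strict-sum (tail-Strict s))

<ᵇ-true : ∀ {m n} → m < n → (m <ᵇ n) ≡ true
<ᵇ-true {zero}  {suc n} _       = refl
<ᵇ-true {suc m} {suc n} (s≤s h) = <ᵇ-true h

<ᵇ-false : ∀ {m n} → n ≤ m → (m <ᵇ n) ≡ false
<ᵇ-false {m}     {zero}  _       = refl
<ᵇ-false {suc m} {suc n} (s≤s h) = <ᵇ-false h

-- A nonzero sign needs distinct entries, which sum to at least 0 + 1 + ... . Guarding `vs` by the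
-- symmetric condition on the sum keeps it antisymmetric and makes it vanish on strict lists.
vs-small : ∀ A → sum A < tri (length A) → vs A ≡ 0ℚ
vs-small A h = trans (cong (λ b → if b then vs A else 0ℚ) (sym (<ᵇ-true h)))
  (Anti-vanish {λ A → if sum A <ᵇ tri (length A) then vs A else 0ℚ} anti-g (λ _ → ℕ) (length A)
    (λ A' s _ _ → cong (λ b → if b then vs A' else 0ℚ) (<ᵇ-false (Strict-sum s))) A (All.universal (λ x → x) A) refl)
  where
  anti-g : Anti (λ A → if sum A <ᵇ tri (length A) then vs A else 0ℚ)
  anti-g P a b Q rewrite sum-swap P a b Q | length-swap P a b Q with sum (P ++ b ∷ a ∷ Q) <ᵇ tri (length (P ++ b ∷ a ∷ Q))
  ... | true  = vs-Anti P a b Q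
  ... | false = sym ℚₚ.neg-zero

e-value : ∀ A → sum A ≡ tri (length A) → e A ≡ vs A
e-value A h = cong (λ b → if b then vs A else 0ℚ) (trans (cong (_≡ᵇ tri (length A)) h) (≡ᵇ-refl (tri (length A))))

e-zero : ∀ A → sum A ≢ tri (length A) → e A ≡ 0ℚ
e-zero A h = cong (λ b → if b then vs A else 0ℚ) (≡ᵇ-≢ h)

-- The Vandermonde determinant has degree `length B` in its first variable; a larger exponent leaves
-- too little for the others.
e-large : ∀ b B → length B < b → e (b ∷ B) ≡ 0ℚ
e-large b B h with b + sum B ℕₚ.≟ length B + tri (length B)
... | no ne  = e-zero (b ∷ B) ne
... | yes eq = trans (e-value (b ∷ B) eq) (trans (cong (sgs b B *ℚ_) (vs-small B
  (ℕₚ.+-cancelˡ-< (length B) _ _ (ℕₚ.<-≤-trans (ℕₚ.+-monoˡ-< (sum B) h) (ℕₚ.≤-reflexive eq))))) (ℚₚ.*-zeroʳ _))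

sg-1 : ∀ {a b} → b < a → sg a b ≡ 1ℚ
sg-1 {suc a} {zero}  _       = refl
sg-1 {suc a} {suc b} (s≤s h) = sg-1 h

sgs-1 : ∀ {a} B → All (_< a) B → sgs a B ≡ 1ℚ
sgs-1 []      []       = refl
sgs-1 (b ∷ B) (h ∷ hs) = trans (cong₂ _*ℚ_ (sg-1 h) (sgs-1 B hs)) (ℚₚ.*-identityˡ 1ℚ)

-- The leading coefficient of the Vandermonde determinant in its first variable is the determinant
-- of the others. The difference of both sides is antisymmetric, so strict lists suffice.
e-top : ∀ B → e (length B ∷ B) ≡ e B
e-top B = begin
  e (length B ∷ B)                      ≡⟨ sym (ℚₚ.+-identityʳ _) ⟩
  e (length B ∷ B) +ℚ 0ℚ                ≡⟨ cong (e (length B ∷ B) +ℚ_) (sym (ℚₚ.+-inverseˡ (e B))) ⟩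
  e (length B ∷ B) +ℚ (-ℚ e B +ℚ e B)   ≡⟨ sym (ℚₚ.+-assoc _ _ _) ⟩
  e (length B ∷ B) +ℚ -ℚ e B +ℚ e B     ≡⟨ +-zeroˡ (e B) (Anti-vanish {g} anti-g (λ _ → ℕ) (length B) strict B (All.universal (λ x → x) B) refl) ⟩
  e B                                   ∎
  where
  g : List ℕ → ℚ
  g B = e (length B ∷ B) +ℚ -ℚ e B
  anti-g : Anti g
  anti-g P a b Q = trans (cong₂ (λ x y → x +ℚ -ℚ y)
    (trans (cong (λ l → e (l ∷ P ++ a ∷ b ∷ Q)) (length-swap P a b Q)) (e-Anti (length (P ++ b ∷ a ∷ Q) ∷ P) a b Q)) (e-Anti P a b Q))
    (sym (ℚₚ.neg-distrib-+ _ _))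
  strict : ∀ A → Strict A → All (λ _ → ℕ) A → length A ≡ length B → g A ≡ 0ℚ
  strict A s _ _ with sum A ℕₚ.≟ tri (length A)
  ... | no ne  = trans (cong₂ (λ x y → x +ℚ -ℚ y) (e-zero (length A ∷ A) (λ q → ne (ℕₚ.+-cancelˡ-≡ (length A) _ _ q))) (e-zero A ne)) (ℚₚ.+-inverseʳ 0ℚ)
  ... | yes eq = trans (cong₂ (λ x y → x +ℚ -ℚ y) (trans (e-value (length A ∷ A) (cong (length A +_) eq))
      (trans (cong (_*ℚ vs A) (sgs-1 A (entries A s eq))) (ℚₚ.*-identityˡ _))) (e-value A eq)) (ℚₚ.+-inverseʳ (vs A))
    where
    entries : ∀ A → Strict A → sum A ≡ tri (length A) → All (_< length A) A
    entries []      _ _  = []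
    entries (a ∷ A) s eq = a<L ∷ All.map (λ q → ℕₚ.<-trans q a<L) (Strict-head s)
      where
      a<L : a < suc (length A)
      a<L = s≤s (ℕₚ.+-cancelʳ-≤ (tri (length A)) a (length A) (ℕₚ.≤-trans (ℕₚ.+-monoʳ-≤ a (Strict-sum (tail-Strict s))) (ℕₚ.≤-reflexive eq)))

-- The Pieri rule

-- On beta-lists, Itl A C says that A / C is a horizontal strip.
data Itl : List ℕ → List ℕ → Set where
  []   : Itl [] []
  [_]  : ∀ {a c} → c ≤ a → Itl (a ∷ []) (c ∷ [])
  cons : ∀ {a a' A c c' C} → c ≤ a → a' < c → Itl (a' ∷ A) (c' ∷ C) → Itl (a ∷ a' ∷ A) (c ∷ c' ∷ C)

Itl-head : ∀ {a A c C} → Itl (a ∷ A) (c ∷ C) → c ≤ a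
Itl-head [ h ]        = h
Itl-head (cons h _ _) = h

Itl-Strict : ∀ {A C} → Itl A C → Strict C
Itl-Strict []           = []
Itl-Strict [ _ ]        = [-]
Itl-Strict (cons _ h i) = ℕₚ.≤-<-trans (Itl-head i) h ∷ Itl-Strict i

Itl-length : ∀ {A C} → Itl A C → length A ≡ length C
Itl-length []           = refl
Itl-length [ _ ]        = refl
Itl-length (cons _ _ i) = cong suc (Itl-length i)

pS : ℕ → List ℕ → List (List ℕ)
pS k       (a ∷ a' ∷ A) =
  concatMap (λ cd → if a' <ᵇ a ∸ proj₁ cd then map (a ∸ proj₁ cd ∷_) (pS (proj₂ cd) (a' ∷ A)) else []) (anti k)
pS k       (a ∷ [])     = map (_∷ []) (sub k a)
pS zero    []           = [] ∷ []
pS (suc k) []           = []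

∑-if : ∀ {V : Set} b (xs : List V) f → ∑ (if b then xs else []) f ≡ (if b then ∑ xs f else 0ℚ)
∑-if true  xs f = refl
∑-if false xs f = refl

∑pS : ∀ k a a' A f → ∑ (pS k (a ∷ a' ∷ A)) f ≡
  ∑anti k (λ c d → if a' <ᵇ a ∸ c then ∑ (pS d (a' ∷ A)) (λ C → f (a ∸ c ∷ C)) else 0ℚ)
∑pS k a a' A f = trans (∑-concatMap _ (anti k) f) (trans (∑-anti k _) (∑anti-cong′ k (λ c d →
  trans (∑-if (a' <ᵇ a ∸ c) _ f) (cong (λ t → if a' <ᵇ a ∸ c then t else 0ℚ) (∑-map _ (pS d (a' ∷ A)) f)))))

∑anti-zero : ∀ k {g : ℕ → ℕ → ℚ} → (∀ c d → c + d ≡ k → g c d ≡ 0ℚ) → ∑anti k g ≡ 0ℚ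
∑anti-zero k {g} h = trans (∑anti-cong k (λ c d q → trans (h c d q) (sym (ℚₚ.*-zeroˡ 0ℚ))))
  (trans (sym (∑anti-*ˡ 0ℚ k (λ _ _ → 0ℚ))) (ℚₚ.*-zeroˡ _))

∑anti-only : ∀ k c₀ d₀ (g : ℕ → ℕ → ℚ) → c₀ + d₀ ≡ k → (∀ c d → c + d ≡ k → c ≢ c₀ → g c d ≡ 0ℚ) → ∑anti k g ≡ g c₀ d₀
∑anti-only zero    zero    zero g refl h = ∑anti-0 g
∑anti-only (suc k) zero    d₀   g refl h = trans (∑anti-suc k g) (+-zeroʳ _ (∑anti-zero k (λ c d q → h (suc c) d (cong suc q) λ ())))
∑anti-only (suc k) (suc c₀) d₀  g eq   h = trans (∑anti-suc k g) (trans (+-zeroˡ _ (h 0 (suc k) refl λ ()))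
  (∑anti-only k c₀ d₀ (λ c d → g (suc c) d) (ℕₚ.suc-injective eq) (λ c d q ne → h (suc c) d (cong suc q) (λ e → ne (ℕₚ.suc-injective e)))))

-- Lowering `t + a'` either stays above `a'`, or first uses `t` to reach `a'` and then lowers `a'`
-- further.
row-split : ∀ t k a' (G : ℕ → ℕ → ℚ) → ∑anti k (λ c d → ∑ (sub c (t + a')) (G d)) ≡
  ∑anti k (λ c d → if a' <ᵇ t + a' ∸ c then G d (t + a' ∸ c) else 0ℚ) +ℚ
  ∑ (sub t k) (λ k' → ∑anti k' (λ c d → ∑ (sub c a') (G d)))
row-split zero    k       a' G = sym (trans (+-zeroˡ _ (∑anti-zero k (λ c d _ →
  cong (λ b → if b then G d (a' ∸ c) else 0ℚ) (<ᵇ-false (ℕₚ.m∸n≤m a' c))))) (ℚₚ.+-identityʳ _))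
row-split (suc t) zero    a' G = trans (∑anti-0 _) (trans (ℚₚ.+-identityʳ _) (sym (trans (ℚₚ.+-identityʳ _)
  (trans (∑anti-0 _) (cong (λ b → if b then G 0 (suc (t + a')) else 0ℚ) (<ᵇ-true (s≤s (ℕₚ.m≤n+m a' t))))))))
row-split (suc t) (suc k) a' G = begin
  ∑anti (suc k) (λ c d → ∑ (sub c (suc t + a')) (G d))
    ≡⟨ ∑anti-suc k _ ⟩
  _ ≡⟨ cong₂ _+ℚ_ (trans (ℚₚ.+-identityʳ _) (sym (cong (λ b → if b then G (suc k) (suc (t + a')) else 0ℚ) (<ᵇ-true (s≤s (ℕₚ.m≤n+m a' t))))))
         (row-split t k a' G) ⟩
  _ ≡⟨ sym (ℚₚ.+-assoc _ _ _) ⟩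
  _ ≡⟨ cong (_+ℚ ∑ (sub t k) (λ k' → ∑anti k' (λ c d → ∑ (sub c a') (G d)))) (sym (∑anti-suc k _)) ⟩
  _ ∎

-- By `row-split` the terms in which the first entry falls to `a'` or below form some h_{k'} applied
-- to a list containing `a'` twice, hence cancel. What survives is the interlacing condition.
pieri : ∀ k A {f} → Strict A → Anti f → ∑ (hS k A) f ≡ ∑ (pS k A) f
pieri zero    []           s anti = refl
pieri (suc k) []           s anti = refl
pieri k       (a ∷ [])     {f} s anti = trans (∑hS k a [] f) (trans (∑anti-only k k 0 _ (ℕₚ.+-identityʳ k) off)
  (trans (∑-cong (sub k a) (λ a' → ℚₚ.+-identityʳ _)) (sym (∑-map _ (sub k a) f))))
  where
  off : ∀ c d → c + d ≡ k → c ≢ k → ∑ (sub c a) (λ a' → ∑ (hS d []) (λ C → f (a' ∷ C))) ≡ 0ℚ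
  off c zero    q ne = ⊥-elim (ne (trans (sym (ℕₚ.+-identityʳ c)) q))
  off c (suc d) q ne = ∑-zero (sub c a)
pieri k       (a ∷ a' ∷ A) {f} s@(a'<a ∷ s') anti = begin
  ∑ (hS k (a ∷ a' ∷ A)) f
    ≡⟨ ∑hS k a (a' ∷ A) f ⟩
  ∑anti k (λ c d → ∑ (sub c a) (G d))
    ≡⟨ cong (λ x → ∑anti k (λ c d → ∑ (sub c x) (G d))) (sym a≡) ⟩
  ∑anti k (λ c d → ∑ (sub c (t + a')) (G d))
    ≡⟨ row-split t k a' G ⟩
  _ ≡⟨ +-zeroʳ _ (∑-0 (sub t k) (λ {k'} _ → trans (sym (∑hS k' a' (a' ∷ A) f)) (Anti-dup {λ A → ∑ (hS k' A) f} (∑hS-Anti k' {f} anti) [] a' [] A))) ⟩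
  ∑anti k (λ c d → if a' <ᵇ t + a' ∸ c then G d (t + a' ∸ c) else 0ℚ)
    ≡⟨ cong (λ x → ∑anti k (λ c d → if a' <ᵇ x ∸ c then G d (x ∸ c) else 0ℚ)) a≡ ⟩
  ∑anti k (λ c d → if a' <ᵇ a ∸ c then G d (a ∸ c) else 0ℚ)
    ≡⟨ ∑anti-cong′ k (λ c d → cong (λ y → if a' <ᵇ a ∸ c then y else 0ℚ) (pieri d (a' ∷ A) {λ C → f (a ∸ c ∷ C)} s' (Anti-∷ {f} anti (a ∸ c)))) ⟩
  _ ≡⟨ sym (∑pS k a a' A f) ⟩
  ∑ (pS k (a ∷ a' ∷ A)) f ∎
  where
  t = a ∸ a'
  a≡ : t + a' ≡ a
  a≡ = ℕₚ.m∸n+n≡m (ℕₚ.<⇒≤ a'<a)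
  G : ℕ → ℕ → ℚ
  G d x = ∑ (hS d (a' ∷ A)) (λ C → f (x ∷ C))

∑pS-cong : ∀ k A {f g : List ℕ → ℚ} → (∀ C → Itl A C → sum C + k ≡ sum A → f C ≡ g C) → ∑ (pS k A) f ≡ ∑ (pS k A) g
∑pS-cong zero    []           h = cong (_+ℚ 0ℚ) (h [] [] refl)
∑pS-cong (suc k) []           h = refl
∑pS-cong k       (a ∷ [])     h = trans (∑-map _ (sub k a) _) (trans (∑-cong-∈ (sub k a) (λ {x} i →
  h (x ∷ []) [ subst (x ≤_) (sub-∈ k a i) (ℕₚ.m≤m+n x k) ]
    (trans (cong (_+ k) (ℕₚ.+-identityʳ x)) (trans (sub-∈ k a i) (sym (ℕₚ.+-identityʳ a)))))) (sym (∑-map _ (sub k a) _)))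
∑pS-cong k       (a ∷ a' ∷ A) {f} {g} h = trans (∑pS k a a' A f) (trans (∑anti-cong k (inner (λ d → ∑pS-cong d (a' ∷ A)))) (sym (∑pS k a a' A g)))
  where
  inner : (∀ d {f g : List ℕ → ℚ} → (∀ C → Itl (a' ∷ A) C → sum C + d ≡ sum (a' ∷ A) → f C ≡ g C) → ∑ (pS d (a' ∷ A)) f ≡ ∑ (pS d (a' ∷ A)) g) →
    ∀ c d → c + d ≡ k →
    (if a' <ᵇ a ∸ c then ∑ (pS d (a' ∷ A)) (λ C → f (a ∸ c ∷ C)) else 0ℚ) ≡
    (if a' <ᵇ a ∸ c then ∑ (pS d (a' ∷ A)) (λ C → g (a ∸ c ∷ C)) else 0ℚ)
  inner ih c d q with a' ℕₚ.<? a ∸ c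
  ... | no ¬lt rewrite <ᵇ-false (ℕₚ.≮⇒≥ ¬lt) = refl
  ... | yes lt rewrite <ᵇ-true lt = ih d (λ { (c' ∷ C) i s → h (a ∸ c ∷ c' ∷ C) (cons (ℕₚ.m∸n≤m a c) lt i) (total (sum (c' ∷ C)) s) })
    where
    c≤a : c ≤ a
    c≤a = ℕₚ.<⇒≤ (ℕₚ.m∸n≢0⇒n<m (λ z → ℕₚ.n≮0 (subst (a' <_) z lt)))
    total : ∀ S' → S' + d ≡ sum (a' ∷ A) → a ∸ c + S' + k ≡ a + sum (a' ∷ A)
    total S' s = begin
      a ∸ c + S' + k              ≡⟨ cong (a ∸ c + S' +_) (sym q) ⟩
      a ∸ c + S' + (c + d)        ≡⟨ ℕinter (a ∸ c) S' c d ⟩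
      (a ∸ c + c) + (S' + d)      ≡⟨ cong₂ _+_ (ℕₚ.m∸n+n≡m c≤a) s ⟩
      a + sum (a' ∷ A)            ∎
      where
      ℕinter : ∀ x y u v → x + y + (u + v) ≡ (x + u) + (y + v)
      ℕinter x y u v = trans (ℕₚ.+-assoc x y _) (trans (cong (x +_) (trans (sym (ℕₚ.+-assoc y u v)) (trans (cong (_+ v) (ℕₚ.+-comm y u)) (ℕₚ.+-assoc u y v)))) (sym (ℕₚ.+-assoc x u _)))

∑pS-only : ∀ k A C₀ (g : List ℕ → ℚ) → Itl A C₀ → sum C₀ + k ≡ sum A →
  (∀ C → Itl A C → sum C + k ≡ sum A → C ≢ C₀ → g C ≡ 0ℚ) → ∑ (pS k A) g ≡ g C₀
∑pS-only zero    []           .[] g [] s h = ℚₚ.+-identityʳ _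
∑pS-only (suc k) []           .[] g [] () h
∑pS-only k       (a ∷ [])     (c ∷ []) g [ c≤a ] s h = trans (∑-map _ (sub k a) g)
  (trans (cong (λ x → ∑ x (λ y → g (y ∷ []))) (trans (cong (sub k) a≡) (sub-+ k c))) (ℚₚ.+-identityʳ _))
  where
  a≡ : a ≡ k + c
  a≡ = trans (sym (ℕₚ.+-identityʳ a)) (trans (sym s) (trans (ℕₚ.+-comm (c + 0) k) (cong (k +_) (ℕₚ.+-identityʳ c))))
∑pS-only k       (a ∷ a' ∷ A) (x ∷ x' ∷ C₀) g (cons x≤a a'<x i) s h =
  trans (∑pS k a a' A g) (trans (∑anti-only k c₀ d₀ _ cd off)
    (trans (cong (λ b → if b then ∑ (pS d₀ (a' ∷ A)) (λ C → g (a ∸ c₀ ∷ C)) else 0ℚ) (trans (cong (a' <ᵇ_) x≡) (<ᵇ-true a'<x)))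
    (trans (cong (λ y → ∑ (pS d₀ (a' ∷ A)) (λ C → g (y ∷ C))) x≡)
      (∑pS-only d₀ (a' ∷ A) (x' ∷ C₀) (λ C → g (x ∷ C)) i s₀
        (λ { (y ∷ C) i' s' ne → h (x ∷ y ∷ C) (cons x≤a a'<x i') (total (sum (y ∷ C)) s') (λ { refl → ne refl }) })))))
  where
  c₀ = a ∸ x
  d₀ = sum (a' ∷ A) ∸ sum (x' ∷ C₀)
  x≡ : a ∸ c₀ ≡ x
  x≡ = ℕₚ.m∸[m∸n]≡n x≤a
  Itl-sum : ∀ {A C} → Itl A C → sum C ≤ sum A
  Itl-sum []           = z≤n
  Itl-sum [ h ]        = ℕₚ.+-monoˡ-≤ 0 h
  Itl-sum (cons h _ i) = ℕₚ.+-mono-≤ h (Itl-sum i)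
  s₀ : sum (x' ∷ C₀) + d₀ ≡ sum (a' ∷ A)
  s₀ = ℕₚ.m+[n∸m]≡n (Itl-sum i)
  ℕinter : ∀ x y u v → (x + u) + (y + v) ≡ x + y + (u + v)
  ℕinter x y u v = sym (trans (ℕₚ.+-assoc x y _) (trans (cong (x +_) (trans (sym (ℕₚ.+-assoc y u v)) (trans (cong (_+ v) (ℕₚ.+-comm y u)) (ℕₚ.+-assoc u y v)))) (sym (ℕₚ.+-assoc x u _))))
  total : ∀ S' → S' + d₀ ≡ sum (a' ∷ A) → x + S' + k ≡ a + sum (a' ∷ A)
  cd : c₀ + d₀ ≡ k
  cd = ℕₚ.+-cancelˡ-≡ (x + sum (x' ∷ C₀)) _ _ (trans (sym (ℕinter x (sum (x' ∷ C₀)) c₀ d₀)) (trans (cong₂ _+_ (ℕₚ.m+[n∸m]≡n x≤a) s₀) (sym s)))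
  total S' q = trans (cong (x + S' +_) (sym cd)) (trans (sym (ℕinter x S' c₀ d₀)) (cong₂ _+_ (ℕₚ.m+[n∸m]≡n x≤a) q))
  off : ∀ c d → c + d ≡ k → c ≢ c₀ → (if a' <ᵇ a ∸ c then ∑ (pS d (a' ∷ A)) (λ C → g (a ∸ c ∷ C)) else 0ℚ) ≡ 0ℚ
  off c d q ne with a' ℕₚ.<? a ∸ c
  ... | no ¬lt rewrite <ᵇ-false (ℕₚ.≮⇒≥ ¬lt) = refl
  ... | yes lt rewrite <ᵇ-true lt = trans (∑pS-cong d (a' ∷ A) (λ { (y ∷ C) i' s' →
            h (a ∸ c ∷ y ∷ C) (cons (ℕₚ.m∸n≤m a c) lt i')
              (trans (cong (a ∸ c + sum (y ∷ C) +_) (sym q)) (trans (sym (ℕinter (a ∸ c) (sum (y ∷ C)) c d)) (cong₂ _+_ (ℕₚ.m∸n+n≡m c≤a) s')))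
              (λ e → ne (trans (sym (ℕₚ.m∸[m∸n]≡n c≤a)) (cong (a ∸_) (Listₚ.∷-injectiveˡ e)))) }))
          (∑-zero (pS d (a' ∷ A)))
    where
    c≤a : c ≤ a
    c≤a = ℕₚ.<⇒≤ (ℕₚ.m∸n≢0⇒n<m (λ z → ℕₚ.n≮0 (subst (a' <_) z lt)))

_≼_ : List ℕ → List ℕ → Set
_≼_ = Pointwise _≤_

≼-refl : ∀ {A} → A ≼ A
≼-refl = PW.refl ℕₚ.≤-refl

≼-trans : ∀ {A B C} → A ≼ B → B ≼ C → A ≼ C
≼-trans = PW.transitive ℕₚ.≤-trans

sub-≤ : ∀ r a {x} → x ∈ sub r a → x ≤ a
sub-≤ r a {x} i = subst (x ≤_) (sub-∈ r a i) (ℕₚ.m≤m+n x r)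

∑hS-cong : ∀ k A {f g : List ℕ → ℚ} → (∀ C → C ≼ A → f C ≡ g C) → ∑ (hS k A) f ≡ ∑ (hS k A) g
∑hS-cong zero    []      h = cong (_+ℚ 0ℚ) (h [] [])
∑hS-cong (suc k) []      h = refl
∑hS-cong k       (a ∷ A) {f} {g} h = trans (∑hS k a A f) (trans (∑anti-cong′ k (λ c d →
  ∑-cong-∈ (sub c a) (λ {a'} i → ∑hS-cong d A (λ C C≼ → h (a' ∷ C) (sub-≤ c a i ∷ C≼))))) (sym (∑hS k a A g)))

NSum-cong : ∀ p A B {F G : List ℕ → List ℕ → ℚ} → (∀ C D → C ≼ A → D ≼ B → F C D ≡ G C D) → NSum p A B F ≡ NSum p A B G
NSum-cong zero    A []      h = cong (_+ℚ 0ℚ) (h A [] ≼-refl [])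
NSum-cong (suc p) A []      h = refl
NSum-cong p       A (b ∷ B) {F} {G} h = trans (NSum-∷ p A b B F) (trans (∑anti-cong′ p (λ k m →
  ∑-cong-∈ (sub k b) (λ {b'} i → ∑hS-cong k A (λ C C≼ → NSum-cong m C B (λ C' D C'≼ D≼ → h C' (b' ∷ D) (≼-trans C'≼ C≼) (sub-≤ k b i ∷ D≼))))))
  (sym (NSum-∷ p A b B G)))

NSum-0s : ∀ p A B {F : List ℕ → List ℕ → ℚ} → (∀ C D → C ≼ A → D ≼ B → F C D ≡ 0ℚ) → NSum p A B F ≡ 0ℚ
NSum-0s p A B h = trans (NSum-cong p A B h) (∑-zero (NS p A B))

NSum-Antiˡ : ∀ p B {F : List ℕ → List ℕ → ℚ} → (∀ D → Anti (λ A → F A D)) → Anti (λ A → NSum p A B F)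
NSum-Antiˡ zero    []      {F} h P a b Q = trans (NSum-[] (P ++ a ∷ b ∷ Q) F) (trans (h [] P a b Q) (cong -ℚ_ (sym (NSum-[] (P ++ b ∷ a ∷ Q) F))))
NSum-Antiˡ (suc p) []      {F} h P a b Q = sym ℚₚ.neg-zero
NSum-Antiˡ p       (d ∷ B) {F} h P a b Q = begin
  NSum p (P ++ a ∷ b ∷ Q) (d ∷ B) F
    ≡⟨ NSum-∷ p (P ++ a ∷ b ∷ Q) d B F ⟩
  _ ≡⟨ ∑anti-cong′ p (λ k m → trans (∑-cong (sub k d) (λ d' → ∑hS-Anti k {λ C → NSum m C B (λ C' D → F C' (d' ∷ D))}
         (NSum-Antiˡ m B {λ C' D → F C' (d' ∷ D)} (λ D → h (d' ∷ D))) P a b Q)) (∑-neg (sub k d) _)) ⟩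
  ∑anti p (λ k m → -ℚ ∑ (sub k d) (λ d' → ∑ (hS k (P ++ b ∷ a ∷ Q)) (λ C → NSum m C B (λ C' D → F C' (d' ∷ D)))))
    ≡⟨ ∑anti-cong′ p (λ k m → sym (neg1 _)) ⟩
  _ ≡⟨ sym (∑anti-*ˡ (-ℚ 1ℚ) p _) ⟩
  _ ≡⟨ neg1 _ ⟩
  _ ≡⟨ cong -ℚ_ (sym (NSum-∷ p (P ++ b ∷ a ∷ Q) d B F)) ⟩
  -ℚ NSum p (P ++ b ∷ a ∷ Q) (d ∷ B) F ∎
  where
  neg1 : ∀ x → -ℚ 1ℚ *ℚ x ≡ -ℚ x
  neg1 x = trans (sym (ℚₚ.neg-distribˡ-* 1ℚ x)) (cong -ℚ_ (ℚₚ.*-identityˡ x))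

-- Appending an empty row to a beta-list

pad : List ℕ → List ℕ
pad A = map suc A ++ 0 ∷ []

sum-pad : ∀ A → sum (pad A) ≡ length A + sum A
sum-pad []      = refl
sum-pad (a ∷ A) = cong suc (trans (cong (a +_) (sum-pad A)) (trans (sym (ℕₚ.+-assoc a _ _)) (trans (cong (_+ sum A) (ℕₚ.+-comm a _)) (ℕₚ.+-assoc (length A) a _))))

length-pad : ∀ A → length (pad A) ≡ suc (length A)
length-pad []      = refl
length-pad (a ∷ A) = cong suc (length-pad A)

sgs-pad : ∀ a A → sgs (suc a) (pad A) ≡ sgs a A
sgs-pad a []      = ℚₚ.*-identityˡ 1ℚ
sgs-pad a (b ∷ A) = cong (sg a b *ℚ_) (sgs-pad a A)

vs-pad : ∀ A → vs (pad A) ≡ vs A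
vs-pad []      = ℚₚ.*-identityˡ 1ℚ
vs-pad (a ∷ A) = cong₂ _*ℚ_ (sgs-pad a A) (vs-pad A)

e-pad : ∀ A → e (pad A) ≡ e A
e-pad A with sum A ℕₚ.≟ tri (length A)
... | yes eq = trans (e-value (pad A) (trans (sum-pad A) (trans (cong (length A +_) eq) (cong tri (sym (length-pad A)))))) (trans (vs-pad A) (sym (e-value A eq)))
... | no ne  = trans (e-zero (pad A) (λ q → ne (ℕₚ.+-cancelˡ-≡ (length A) _ _ (trans (sym (sum-pad A)) (trans q (cong tri (length-pad A))))))) (sym (e-zero A ne))

∑sub-suc : ∀ r a g → g 0 ≡ 0ℚ → ∑ (sub r a) g ≡ ∑ (sub (suc r) a) (λ a' → g (suc a'))
∑sub-suc zero    zero    g h = trans (ℚₚ.+-identityʳ _) h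
∑sub-suc zero    (suc a) g h = refl
∑sub-suc (suc r) zero    g h = refl
∑sub-suc (suc r) (suc a) g h = ∑sub-suc r a g h

∑T-pad : ∀ r A {f} → Anti f → ∑ (T (suc r) (pad A)) f ≡ ∑ (T (suc r) A) (λ A' → f (pad A'))
∑T-pad r []      {f} af = refl
∑T-pad r (a ∷ A) {f} af = trans (∑T (suc r) (suc a) (pad A) f)
  (trans (cong₂ _+ℚ_ (∑sub-suc r a (λ a' → f (a' ∷ pad A)) (Anti-dup {f} af [] 0 (map suc A) []))
                     (∑T-pad r A {λ A → f (suc a ∷ A)} (Anti-∷ {f} af (suc a))))
    (sym (∑T (suc r) a A _)))

-- A positive cycle length cannot lower the new entry 0, and lowering another entry to 0 creates a
-- repetition.
X-pad : ∀ ρ A → All (0 <_) ρ → X (pad A) ρ ≡ X A ρ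
X-pad []          A []      = e-pad A
X-pad (suc r ∷ ρ) A (_ ∷ h) = trans (∑T-pad r A {λ A → X A ρ} (X-Anti ρ)) (∑-cong (T (suc r) A) (λ A' → X-pad ρ A' h))

I-padˡ : ∀ m A B → I m (pad A) B ≡ I m A B
I-padˡ m A B = S-cong-∈ m (λ ρ _ h → cong (_*ℚ X B ρ) (X-pad ρ A h))

I-padʳ : ∀ m A B → I m A (pad B) ≡ I m A B
I-padʳ m A B = S-cong-∈ m (λ ρ _ h → cong (X A ρ *ℚ_) (X-pad ρ B h))

-- Orthogonality

-- In terms of partitions: a horizontal strip takes at most one box from each column, so its size is
-- at most the first row `a - length A`.
Itl-max : ∀ {a A C} → Itl (a ∷ A) C → sum (a ∷ A) + length A ≤ sum C + a
Itl-max {a} {.[]} {c ∷ .[]} [ h ] = subst₂ _≤_ (sym (ℕₚ.+-identityʳ (a + 0))) (cong (_+ a) (sym (ℕₚ.+-identityʳ c)))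
  (subst (_≤ c + a) (sym (ℕₚ.+-identityʳ a)) (ℕₚ.m≤n+m a c))
Itl-max {a} {a' ∷ A} {c ∷ C} (cons c≤a a'<c i) = subst₂ _≤_
  (solve 3 (λ a s l → a :+ (con 1 :+ (s :+ l)) := a :+ s :+ (con 1 :+ l)) refl a (sum (a' ∷ A)) (length A))
  (solve 3 (λ a c s → a :+ (c :+ s) := c :+ s :+ a) refl a c (sum C))
  (ℕₚ.+-monoʳ-≤ a (ℕₚ.≤-trans (s≤s (Itl-max i)) (subst (_≤ c + sum C)
    (solve 2 (λ a' s → con 1 :+ a' :+ s := con 1 :+ (s :+ a')) refl a' (sum C)) (ℕₚ.+-monoˡ-≤ (sum C) a'<c))))

-- A strip of maximal size takes the lowest box of every column. The rows move up by one, which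
-- deletes the first row and leaves an empty last one.
Itl-max-unique : ∀ {a A C} → Itl (a ∷ A) C → sum C + a ≡ sum (a ∷ A) + length A → C ≡ pad A
Itl-max-unique {a} {.[]} {c ∷ .[]} [ h ] eq = cong (_∷ []) (ℕₚ.+-cancelʳ-≡ a c 0
  (trans (cong (_+ a) (sym (ℕₚ.+-identityʳ c))) (trans eq (trans (ℕₚ.+-identityʳ _) (ℕₚ.+-identityʳ a)))))
Itl-max-unique {a} {a' ∷ A} {c ∷ C} (cons c≤a a'<c i) eq = cong₂ _∷_ c≡ (Itl-max-unique i (sym tl))
  where
  s = sum (a' ∷ A) + length A
  eq' : c + sum C ≡ suc s
  eq' = ℕₚ.+-cancelʳ-≡ a _ _ (trans eq (trans (trans (ℕₚ.+-assoc a _ _) (ℕₚ.+-comm a _)) (cong (_+ a) (ℕₚ.+-suc (sum (a' ∷ A)) (length A)))))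
  c≤ : c ≤ suc a'
  c≤ = ℕₚ.+-cancelʳ-≤ (sum C) c (suc a') (ℕₚ.≤-trans (ℕₚ.≤-reflexive eq') (s≤s (ℕₚ.≤-trans (Itl-max i) (ℕₚ.≤-reflexive (ℕₚ.+-comm (sum C) a')))))
  c≡ : c ≡ suc a'
  c≡ = ℕₚ.≤-antisym c≤ a'<c
  tl : s ≡ sum C + a'
  tl = ℕₚ.suc-injective (trans (sym eq') (trans (cong (_+ sum C) c≡) (cong suc (ℕₚ.+-comm a' (sum C)))))

Itl-pad : ∀ {a A} → Strict (a ∷ A) → Itl (a ∷ A) (pad A)
Itl-pad [-]                     = [ z≤n ]
Itl-pad {a} {a' ∷ []}     (h ∷ s) = cons h ℕₚ.≤-refl (Itl-pad s)
Itl-pad {a} {a' ∷ x ∷ A}  (h ∷ s) = cons h ℕₚ.≤-refl (Itl-pad s)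

-- The part of the inner product in which the first entry of the second list loses `k` units and
-- ends at `b'`, the `k` units being spread over `A`.
column : ℕ → ℕ → ℕ → List ℕ → List ℕ → ℚ
column k d b' A B = ∑ (hS k A) (λ C → NSum d C B (λ C' B' → e C' *ℚ e (b' ∷ B')))

column-e : ∀ k d b' A B → length B < b' → column k d b' A B ≡ 0ℚ
column-e k d b' A B h = trans (∑-cong (hS k A) (λ C → NSum-0s d C B (λ C' B' _ B'≼ →
  trans (cong (e C' *ℚ_) (e-large b' B' (subst (_< b') (sym (PW.Pointwise-length B'≼)) h))) (ℚₚ.*-zeroʳ _)))) (∑-zero (hS k A))

column-pieri : ∀ k d b' A B → Strict A → column k d b' A B ≡ ∑ (pS k A) (λ C → NSum d C B (λ C' B' → e C' *ℚ e (b' ∷ B')))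
column-pieri k d b' A B s = pieri k A {λ C → NSum d C B (λ C' B' → e C' *ℚ e (b' ∷ B'))} s
  (NSum-Antiˡ d B {λ C' B' → e C' *ℚ e (b' ∷ B')} (λ D P x y Q → trans (cong (_*ℚ e (b' ∷ D)) (e-Anti P x y Q)) (sym (ℚₚ.neg-distribˡ-* _ _))))

Itl-removed : ∀ {a A C} k → Itl (a ∷ A) C → sum C + k ≡ sum (a ∷ A) → k + length A ≤ a
Itl-removed {a} {A} {C} k i s = ℕₚ.+-cancelˡ-≤ (sum C) _ _ (ℕₚ.≤-trans (ℕₚ.≤-reflexive (trans (sym (ℕₚ.+-assoc (sum C) k _)) (cong (_+ length A) s))) (Itl-max i))

column-k : ∀ k d b' a A B → Strict (a ∷ A) → a < k + length A → column k d b' (a ∷ A) B ≡ 0ℚ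
column-k k d b' a A B s h = trans (column-pieri k d b' (a ∷ A) B s)
  (trans (∑pS-cong k (a ∷ A) (λ C i q → ⊥-elim (ℕₚ.<⇒≱ h (Itl-removed k i q)))) (∑-zero (pS k (a ∷ A))))

I-head : ∀ m a A b B → I m (a ∷ A) (b ∷ B) ≡ ∑anti m (λ k d → ∑ (sub k b) (λ b' → column k d b' (a ∷ A) B))
I-head m a A b B = trans (I-NSum m (a ∷ A) (b ∷ B)) (NSum-∷ m (a ∷ A) b B _)

-- A nonzero term needs `b' ≤ length B` by the degree of the Vandermonde determinant and
-- `k ≤ a - length A` by the Pieri rule; together they force `b ≤ a`.
I-head-< : ∀ m a A b B → Strict (a ∷ A) → length A ≡ length B → a < b → I m (a ∷ A) (b ∷ B) ≡ 0ℚ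
I-head-< m a A b B s l a<b = trans (I-head m a A b B) (∑anti-zero m (λ k d _ → ∑-0 (sub k b) (λ {b'} i → go k d b' (sub-∈ k b i))))
  where
  go : ∀ k d b' → b' + k ≡ b → column k d b' (a ∷ A) B ≡ 0ℚ
  go k d b' q with length B ℕₚ.<? b'
  ... | yes h = column-e k d b' (a ∷ A) B h
  ... | no ¬h = column-k k d b' a A B s (ℕₚ.<-≤-trans a<b (ℕₚ.≤-trans (ℕₚ.≤-reflexive (trans (sym q) (ℕₚ.+-comm b' k)))
                  (ℕₚ.+-monoʳ-≤ k (ℕₚ.≤-trans (ℕₚ.≮⇒≥ ¬h) (ℕₚ.≤-reflexive (sym l))))))

-- With equal heads both bounds of `I-head-<` are attained. The only strip is the maximal one, which
-- deletes the first row of `A`, and `e-top` deletes that of `B`: orthogonality follows row by row.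
I-head-≡ : ∀ m a A B → Strict (a ∷ A) → length A ≡ length B → sum (a ∷ A) ≡ m + tri (suc (length A)) →
  Σ ℕ λ d → sum A ≡ d + tri (length A) × I m (a ∷ A) (a ∷ B) ≡ I d A B
I-head-≡ m a A B s l sm = d , sA , (begin
  I m (a ∷ A) (a ∷ B)
    ≡⟨ I-head m a A a B ⟩
  ∑anti m (λ k d → ∑ (sub k a) (λ b' → column k d b' (a ∷ A) B))
    ≡⟨ ∑anti-only m t d _ td off ⟩
  ∑ (sub t a) (λ b' → column t d b' (a ∷ A) B)
    ≡⟨ cong (λ x → ∑ x (λ b' → column t d b' (a ∷ A) B)) (trans (cong (sub t) (sym tL)) (sub-+ t L)) ⟩
  column t d L (a ∷ A) B +ℚ 0ℚ
    ≡⟨ ℚₚ.+-identityʳ _ ⟩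
  column t d L (a ∷ A) B
    ≡⟨ column-pieri t d L (a ∷ A) B s ⟩
  ∑ (pS t (a ∷ A)) (λ C → NSum d C B (λ C' B' → e C' *ℚ e (L ∷ B')))
    ≡⟨ ∑pS-only t (a ∷ A) (pad A) _ (Itl-pad s) padsum (λ C i q ne → ⊥-elim (ne (Itl-max-unique i (uniq C q)))) ⟩
  NSum d (pad A) B (λ C' B' → e C' *ℚ e (L ∷ B'))
    ≡⟨ NSum-cong d (pad A) B (λ C' B' _ B'≼ → cong (e C' *ℚ_) (trans (cong (λ y → e (y ∷ B')) (trans l (sym (PW.Pointwise-length B'≼)))) (e-top B'))) ⟩
  NSum d (pad A) B (λ C' B' → e C' *ℚ e B')
    ≡⟨ sym (I-NSum d (pad A) B) ⟩
  I d (pad A) B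
    ≡⟨ I-padˡ d A B ⟩
  I d A B ∎)
  where
  L = length A
  t = a ∸ L
  d = sum A ∸ tri L
  tL : t + L ≡ a
  tL = ℕₚ.m∸n+n≡m (Strict-length s)
  sA : sum A ≡ d + tri L
  sA = sym (ℕₚ.m∸n+n≡m (Strict-sum (tail-Strict s)))
  td : t + d ≡ m
  td = ℕₚ.+-cancelʳ-≡ (L + tri L) (t + d) m (trans (trans (ℕₚ.+-assoc t d _) (trans (cong (t +_) (trans (sym (ℕₚ.+-assoc d L _)) (trans (cong (_+ tri L) (ℕₚ.+-comm d L)) (ℕₚ.+-assoc L d _)))) (sym (ℕₚ.+-assoc t L _))))
         (trans (cong₂ _+_ tL (sym sA)) sm))
  padsum : sum (pad A) + t ≡ sum (a ∷ A)
  padsum = trans (cong (_+ t) (sum-pad A)) (trans (ℕₚ.+-comm _ t) (trans (sym (ℕₚ.+-assoc t L _)) (cong (_+ sum A) tL)))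
  uniq : ∀ C → sum C + t ≡ sum (a ∷ A) → sum C + a ≡ sum (a ∷ A) + L
  uniq C q = trans (cong (sum C +_) (sym tL)) (trans (sym (ℕₚ.+-assoc (sum C) t L)) (cong (_+ L) q))
  off : ∀ k d → k + d ≡ m → k ≢ t → ∑ (sub k a) (λ b' → column k d b' (a ∷ A) B) ≡ 0ℚ
  off k d' _ ne = ∑-0 (sub k a) (λ {b'} i → go b' (sub-∈ k a i))
    where
    go : ∀ b' → b' + k ≡ a → column k d' b' (a ∷ A) B ≡ 0ℚ
    go b' q with ℕₚ.<-cmp k t
    ... | tri≈ _ k≡t _ = ⊥-elim (ne k≡t)
    ... | tri> _ _ t<k = column-k k d' b' a A B s (subst (_< k + L) tL (ℕₚ.+-monoˡ-< L t<k))
    ... | tri< k<t _ _ = column-e k d' b' (a ∷ A) B (ℕₚ.+-cancelʳ-< k (length B) b'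
            (subst₂ _<_ (trans (ℕₚ.+-comm k L) (cong (_+ k) l)) (trans tL (sym q)) (ℕₚ.+-monoˡ-< L k<t)))

I-refl : ∀ m A → Strict A → sum A ≡ m + tri (length A) → I m A A ≡ 1ℚ
I-refl m []      s sm with ℕₚ.m+n≡0⇒m≡0 m (sym sm)
... | refl = trans (S-0 _) (ℚₚ.*-identityˡ 1ℚ)
I-refl m (a ∷ A) s sm with I-head-≡ m a A A s refl sm
... | d , sA , eq = trans eq (I-refl d A (tail-Strict s) sA)

I-≢ : ∀ m A B → Strict A → Strict B → length A ≡ length B → sum A ≡ m + tri (length A) → A ≢ B → I m A B ≡ 0ℚ
I-≢ m []      []      _ _  _ _  ne = ⊥-elim (ne refl)
I-≢ m (a ∷ A) (b ∷ B) s s' l sm ne with ℕₚ.<-cmp a b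
... | tri< a<b _ _ = I-head-< m a A b B s (ℕₚ.suc-injective l) a<b
... | tri> _ _ b<a = trans (I-sym m (a ∷ A) (b ∷ B)) (I-head-< m b B a A s' (sym (ℕₚ.suc-injective l)) b<a)
... | tri≈ _ refl _ with I-head-≡ m a A B s (ℕₚ.suc-injective l) sm
... | d , sA , eq = trans eq (I-≢ d A B (tail-Strict s) (tail-Strict s') (ℕₚ.suc-injective l) sA (λ q → ne (cong (a ∷_) q)))

-- Murnaghan–Nakayama and Frobenius

Unique-mid : ∀ P {b : ℕ} {Q} → Unique (P ++ b ∷ Q) → All (_≢ b) P × All (_≢ b) Q
Unique-mid []      (h ∷ _) = [] , All.map (λ ne e → ne (sym e)) h
Unique-mid (p ∷ P) (h ∷ U) = (All.head (Allₚ.++⁻ʳ P h) ∷ proj₁ (Unique-mid P U)) , proj₂ (Unique-mid P U)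

Unique-replace : ∀ P {b b' : ℕ} {Q} → Unique (P ++ b ∷ Q) → All (_≢ b') P → All (_≢ b') Q → Unique (P ++ b' ∷ Q)
Unique-replace []      (h ∷ U) hp hq        = All.map (λ ne e → ne (sym e)) hq ∷ U
Unique-replace (p ∷ P) (h ∷ U) (hp ∷ hps) hq =
  Allₚ.++⁺ (Allₚ.++⁻ˡ P h) (hp ∷ All.tail (Allₚ.++⁻ʳ P h)) ∷ Unique-replace P U hps hq

flip : ℕ → ℕ → ℕ → ℚ
flip b' b c = if (b' <ᵇ c) ∧ (c <ᵇ b) then -ℚ 1ℚ else 1ℚ

flips : ℕ → ℕ → List ℕ → ℚ
flips b' b []      = 1ℚ
flips b' b (c ∷ B) = flip b' b c *ℚ flips b' b B

sg-m1 : ∀ {a b} → a < b → sg a b ≡ -ℚ 1ℚ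
sg-m1 {a} {b} h = trans (sg-neg a b) (cong -ℚ_ (sg-1 h))

neg-* : ∀ x → -ℚ 1ℚ *ℚ x ≡ -ℚ x
neg-* x = trans (sym (ℚₚ.neg-distribˡ-* 1ℚ x)) (cong -ℚ_ (ℚₚ.*-identityˡ x))

sg-flip : ∀ {b' b c} → b' < b → c ≢ b → c ≢ b' → sg b' c ≡ sg b c *ℚ flip b' b c
sg-flip {b'} {b} {c} b'<b c≢b c≢b' with ℕₚ.<-cmp c b' | ℕₚ.<-cmp c b
... | tri≈ _ q _ | _ = ⊥-elim (c≢b' q)
... | _ | tri≈ _ q _ = ⊥-elim (c≢b q)
... | tri< c<b' _ _ | tri< c<b _ _ rewrite <ᵇ-false (ℕₚ.<⇒≤ c<b') = trans (sg-1 c<b') (sym (trans (ℚₚ.*-identityʳ _) (sg-1 c<b)))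
... | tri< c<b' _ _ | tri> _ _ b<c = ⊥-elim (ℕₚ.<-asym b<c (ℕₚ.<-trans c<b' b'<b))
... | tri> _ _ b'<c | tri< c<b _ _ rewrite <ᵇ-true b'<c | <ᵇ-true c<b = trans (sg-m1 b'<c) (sym (trans (cong (_*ℚ -ℚ 1ℚ) (sg-1 c<b)) (ℚₚ.*-identityˡ _)))
... | tri> _ _ b'<c | tri> _ _ b<c rewrite <ᵇ-true b'<c | <ᵇ-false (ℕₚ.<⇒≤ b<c) = trans (sg-m1 b'<c) (sym (trans (ℚₚ.*-identityʳ _) (sg-m1 b<c)))

sgs-flip : ∀ {b' b} Q → b' < b → All (_≢ b) Q → All (_≢ b') Q → sgs b' Q ≡ sgs b Q *ℚ flips b' b Q
sgs-flip []      h []       []         = sym (ℚₚ.*-identityˡ 1ℚ)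
sgs-flip {b'} {b} (c ∷ Q) h (n ∷ ns) (n' ∷ ns') = trans (cong₂ _*ℚ_ (sg-flip h n n') (sgs-flip Q h ns ns')) (exch (sg b c) (flip b' b c) (sgs b Q) (flips b' b Q))
  where
  exch : ∀ x y u v → x *ℚ y *ℚ (u *ℚ v) ≡ x *ℚ u *ℚ (y *ℚ v)
  exch x y u v = trans (ℚₚ.*-assoc x y _) (trans (cong (x *ℚ_) (trans (sym (ℚₚ.*-assoc y u v)) (trans (cong (_*ℚ v) (ℚₚ.*-comm y u)) (ℚₚ.*-assoc u y v)))) (sym (ℚₚ.*-assoc x u _)))

-- Moving an entry from `b` to `b'` changes its order exactly with the entries strictly in between,
-- whose number is the leg length in the Murnaghan-Nakayama rule.
vs-flip : ∀ {b' b} P Q → b' < b → All (_≢ b) P → All (_≢ b') P → All (_≢ b) Q → All (_≢ b') Q →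
  vs (P ++ b' ∷ Q) ≡ vs (P ++ b ∷ Q) *ℚ flips b' b (P ++ Q)
vs-flip {b'} {b} [] Q h _ _ nq nq' = trans (cong (_*ℚ vs Q) (sgs-flip Q h nq nq'))
  (trans (ℚₚ.*-assoc (sgs b Q) _ _) (trans (cong (sgs b Q *ℚ_) (ℚₚ.*-comm _ _)) (sym (ℚₚ.*-assoc (sgs b Q) _ _))))
vs-flip {b'} {b} (p ∷ P) Q h (n ∷ np) (n' ∷ np') nq nq' = begin
  sgs p (P ++ b' ∷ Q) *ℚ vs (P ++ b' ∷ Q)
    ≡⟨ cong₂ _*ℚ_ (one P) (vs-flip P Q h np np' nq nq') ⟩
  (sgs p (P ++ b ∷ Q) *ℚ flip b' b p) *ℚ (vs (P ++ b ∷ Q) *ℚ flips b' b (P ++ Q))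
    ≡⟨ exch _ _ _ _ ⟩
  (sgs p (P ++ b ∷ Q) *ℚ vs (P ++ b ∷ Q)) *ℚ (flip b' b p *ℚ flips b' b (P ++ Q)) ∎
  where
  exch : ∀ x y u v → x *ℚ y *ℚ (u *ℚ v) ≡ x *ℚ u *ℚ (y *ℚ v)
  exch x y u v = trans (ℚₚ.*-assoc x y _) (trans (cong (x *ℚ_) (trans (sym (ℚₚ.*-assoc y u v)) (trans (cong (_*ℚ v) (ℚₚ.*-comm y u)) (ℚₚ.*-assoc u y v)))) (sym (ℚₚ.*-assoc x u _)))
  pair : sg p b' ≡ sg p b *ℚ flip b' b p
  pair = trans (sg-neg p b') (trans (cong -ℚ_ (sg-flip h n n')) (trans (ℚₚ.neg-distribˡ-* _ _) (cong (_*ℚ flip b' b p) (sym (sg-neg p b)))))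
  one : ∀ P → sgs p (P ++ b' ∷ Q) ≡ sgs p (P ++ b ∷ Q) *ℚ flip b' b p
  one []      = trans (cong (_*ℚ sgs p Q) pair) (trans (ℚₚ.*-assoc _ _ _) (trans (cong (sg p b *ℚ_) (ℚₚ.*-comm _ _)) (sym (ℚₚ.*-assoc _ _ _))))
  one (x ∷ P) = trans (cong (sg p x *ℚ_) (one P)) (sym (ℚₚ.*-assoc _ _ _))

isEven-suc : ∀ n → isEven (suc n) ≡ not (isEven n)
isEven-suc zero          = refl
isEven-suc (suc zero)    = refl
isEven-suc (suc (suc n)) = isEven-suc n

pm : Bool → ℤ
pm b = if b then pos 1 else - (pos 1)

ι-pm : ∀ b → ι (pm (not b)) ≡ -ℚ ι (pm b)
ι-pm true  = ι-neg (pos 1)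
ι-pm false = sym (trans (cong -ℚ_ (ι-neg (pos 1))) (ℚₚ.neg-involutive _))

flips-sign : ∀ b' b B → ι (pm (isEven (countᵇ (λ c → (b' <ᵇ c) ∧ (c <ᵇ b)) B))) ≡ flips b' b B
flips-sign b' b []      = ι-1
flips-sign b' b (c ∷ B) with (b' <ᵇ c) ∧ (c <ᵇ b)
... | true  = trans (cong (λ x → ι (pm x)) (isEven-suc (countᵇ _ B))) (trans (ι-pm (isEven (countᵇ (λ c → (b' <ᵇ c) ∧ (c <ᵇ b)) B))) (trans (cong -ℚ_ (flips-sign b' b B)) (sym (neg-* _))))
... | false = trans (flips-sign b' b B) (sym (ℚₚ.*-identityˡ _))

flips-mid : ∀ b' b P Q → flips b' b (P ++ b ∷ Q) ≡ flips b' b (P ++ Q)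
flips-mid b' b []      Q = trans (cong (_*ℚ flips b' b Q) self) (ℚₚ.*-identityˡ _)
  where
  self : flip b' b b ≡ 1ℚ
  self rewrite <ᵇ-false (ℕₚ.≤-refl {b}) with b' <ᵇ b
  ... | true  = refl
  ... | false = refl
flips-mid b' b (p ∷ P) Q = cong (flip b' b p *ℚ_) (flips-mid b' b P Q)

replaceβ-none : ∀ b b' Q → All (_≢ b) Q → replaceβ b b' Q ≡ Q
replaceβ-none b b' []      []       = refl
replaceβ-none b b' (c ∷ Q) (n ∷ ns) rewrite ≡ᵇ-≢ n = cong (c ∷_) (replaceβ-none b b' Q ns)

replaceβ-mid : ∀ b b' P Q → All (_≢ b) P → All (_≢ b) Q → replaceβ b b' (P ++ b ∷ Q) ≡ P ++ b' ∷ Q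
replaceβ-mid b b' []      Q []       nq rewrite ≡ᵇ-refl b = cong (b' ∷_) (replaceβ-none b b' Q nq)
replaceβ-mid b b' (p ∷ P) Q (n ∷ np) nq rewrite ≡ᵇ-≢ n = cong (p ∷_) (replaceβ-mid b b' P Q np nq)

memb-∉ : ∀ x B → memb x B ≡ false → All (_≢ x) B
memb-∉ x []      _ = []
memb-∉ x (c ∷ B) h with c ≡ᵇ x in eq
... | false = (λ { refl → case-false (trans (sym (≡ᵇ-refl c)) eq) }) ∷ memb-∉ x B h
  where
  case-false : true ≡ false → ⊥
  case-false ()

memb-∈ : ∀ x B → memb x B ≡ true → ∃ λ P → ∃ λ Q → B ≡ P ++ x ∷ Q
memb-∈ x (c ∷ B) h with c ≡ᵇ x in eq
... | true  = [] , B , cong (_∷ B) (ℕₚ.≡ᵇ⇒≡ c x (subst Boolean.T (sym eq) _))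
... | false with memb-∈ x B h
... | P , Q , q = c ∷ P , Q , cong (c ∷_) q

Anti-dup-∈ : ∀ {f} → Anti f → ∀ P x Q → ∀ b → b ≢ x → (∃ λ P' → ∃ λ Q' → P ++ b ∷ Q ≡ P' ++ x ∷ Q') → f (P ++ x ∷ Q) ≡ 0ℚ
Anti-dup-∈ {f} af []      x Q b ne ([] , Q' , q)     = ⊥-elim (ne (Listₚ.∷-injectiveˡ q))
Anti-dup-∈ {f} af []      x Q b ne (_ ∷ P' , Q' , q) = trans (cong (λ l → f (x ∷ l)) (Listₚ.∷-injectiveʳ q)) (Anti-dup {f} af [] x P' Q')
Anti-dup-∈ {f} af (p ∷ P) x Q b ne ([] , Q' , q)     = trans (cong (λ y → f (y ∷ P ++ x ∷ Q)) (Listₚ.∷-injectiveˡ q)) (Anti-dup {f} af [] x P Q)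
Anti-dup-∈ {f} af (p ∷ P) x Q b ne (_ ∷ P' , Q' , q) = Anti-dup-∈ {λ A → f (p ∷ A)} (Anti-∷ {f} af p) P x Q b ne (P' , Q' , Listₚ.∷-injectiveʳ q)

ι-sumℤ : ∀ {V : Set} (t : V → ℤ) xs → ι (sumℤ (map t xs)) ≡ ∑ xs (λ x → ι (t x))
ι-sumℤ t []       = ι-0
ι-sumℤ t (x ∷ xs) = trans (ι-+ (t x) _) (cong (ι (t x) +ℚ_) (ι-sumℤ t xs))

≤ᵇ-true : ∀ {m n} → m ≤ n → (m ≤ᵇ n) ≡ true
≤ᵇ-true {zero}  _ = refl
≤ᵇ-true {suc m} h = <ᵇ-true h

≤ᵇ-false : ∀ {m n} → n < m → (m ≤ᵇ n) ≡ false
≤ᵇ-false {suc m} (s≤s h) = <ᵇ-false h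

-- `replaceβ` leaves the list unsorted, hence the factor `vs B`: its change under a move is the
-- Murnaghan-Nakayama sign.
chiβ-X : ∀ ρ B → All (0 <_) ρ → Unique B → sum B ≡ sum ρ + tri (length B) → vs B *ℚ ι (chiβ B ρ) ≡ X B ρ
chiβ-X []      B _        U s = trans (cong (vs B *ℚ_) ι-1) (trans (ℚₚ.*-identityʳ _) (sym (e-value B s)))
chiβ-X (r ∷ ρ) B (0<r ∷ h) U s = begin
  vs B *ℚ ι (chiβ B (r ∷ ρ))          ≡⟨ cong (vs B *ℚ_) (ι-sumℤ term B) ⟩
  vs B *ℚ ∑ B (λ b → ι (term b))      ≡⟨ ∑-*ˡ (vs B) B _ ⟩
  ∑ B (λ b → vs B *ℚ ι (term b))      ≡⟨ sym (go [] B refl) ⟩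
  ∑ (T r B) (λ B' → X B' ρ)           ∎
  where
  term : ℕ → ℤ
  term b = if (r ≤ᵇ b) ∧ not (memb (b ∸ r) B)
           then signβ b r B *ℤ chiβ (replaceβ b (b ∸ r) B) ρ
           else pos 0
  position : ∀ P b Q → P ++ b ∷ Q ≡ B → ∑ (sub r b) (λ b' → X (P ++ b' ∷ Q) ρ) ≡ vs B *ℚ ι (term b)
  position P b Q refl with r ℕₚ.≤? b
  ... | no r≰b rewrite ≤ᵇ-false (ℕₚ.≰⇒> r≰b) = trans (cong (λ l → ∑ l (λ b' → X (P ++ b' ∷ Q) ρ)) (sub-empty (ℕₚ.≰⇒> r≰b)))
                   (sym (trans (cong (vs B *ℚ_) ι-0) (ℚₚ.*-zeroʳ _)))
  ... | yes r≤b rewrite ≤ᵇ-true r≤b with memb (b ∸ r) (P ++ b ∷ Q) in eq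
  -- The target is occupied: the rule omits the move, and the repeated entry annihilates the
  -- corresponding coefficient.
  ... | true = trans single (trans (Anti-dup-∈ {λ A → X A ρ} (X-Anti ρ) P (b ∸ r) Q b (λ q → ℕₚ.<⇒≢ b'<b (sym q)) (memb-∈ (b ∸ r) (P ++ b ∷ Q) eq))
                   (sym (trans (cong (vs B *ℚ_) ι-0) (ℚₚ.*-zeroʳ _))))
    where
    b'<b : b ∸ r < b
    b'<b = ℕₚ.∸-monoʳ-< 0<r r≤b
    single : ∑ (sub r b) (λ b' → X (P ++ b' ∷ Q) ρ) ≡ X (P ++ (b ∸ r) ∷ Q) ρ
    single = trans (cong (λ l → ∑ l (λ b' → X (P ++ b' ∷ Q) ρ)) (trans (cong (sub r) (sym (ℕₚ.m+[n∸m]≡n r≤b))) (sub-+ r (b ∸ r)))) (ℚₚ.+-identityʳ _)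
  ... | false = begin
    ∑ (sub r b) (λ b' → X (P ++ b' ∷ Q) ρ)                          ≡⟨ single ⟩
    X (P ++ b' ∷ Q) ρ                                               ≡⟨ sym (chiβ-X ρ (P ++ b' ∷ Q) h (Unique-replace P U nP' nQ') newsum) ⟩
    vs (P ++ b' ∷ Q) *ℚ ι (chiβ (P ++ b' ∷ Q) ρ)                    ≡⟨ cong₂ _*ℚ_ (vs-flip P Q b'<b nP nP' nQ nQ') (cong (λ l → ι (chiβ l ρ)) (sym (replaceβ-mid b b' P Q nP nQ))) ⟩
    (vs B *ℚ flips b' b (P ++ Q)) *ℚ ι (chiβ (replaceβ b b' B) ρ)   ≡⟨ cong (λ t → (vs B *ℚ t) *ℚ ι (chiβ (replaceβ b b' B) ρ)) (trans (sym (flips-mid b' b P Q)) (sym (flips-sign b' b B))) ⟩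
    (vs B *ℚ ι (signβ b r B)) *ℚ ι (chiβ (replaceβ b b' B) ρ)       ≡⟨ ℚₚ.*-assoc (vs B) _ _ ⟩
    vs B *ℚ (ι (signβ b r B) *ℚ ι (chiβ (replaceβ b b' B) ρ))       ≡⟨ cong (vs B *ℚ_) (sym (ι-* (signβ b r B) _)) ⟩
    vs B *ℚ ι (signβ b r B *ℤ chiβ (replaceβ b b' B) ρ)             ∎
    where
    b' = b ∸ r
    b'<b : b' < b
    b'<b = ℕₚ.∸-monoʳ-< 0<r r≤b
    single : ∑ (sub r b) (λ b' → X (P ++ b' ∷ Q) ρ) ≡ X (P ++ b' ∷ Q) ρ
    single = trans (cong (λ l → ∑ l (λ b' → X (P ++ b' ∷ Q) ρ)) (trans (cong (sub r) (sym (ℕₚ.m+[n∸m]≡n r≤b))) (sub-+ r (b ∸ r)))) (ℚₚ.+-identityʳ _)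
    nB' = memb-∉ b' (P ++ b ∷ Q) eq
    nP' = Allₚ.++⁻ˡ P nB'
    nQ' = All.tail (Allₚ.++⁻ʳ P nB')
    nP = proj₁ (Unique-mid P U)
    nQ = proj₂ (Unique-mid P U)
    newsum : sum (P ++ b' ∷ Q) ≡ sum ρ + tri (length (P ++ b' ∷ Q))
    newsum = ℕₚ.+-cancelˡ-≡ r _ _ (begin
      r + sum (P ++ b' ∷ Q)            ≡⟨ cong (r +_) (sum-++ P (b' ∷ Q)) ⟩
      r + (sum P + (b' + sum Q))       ≡⟨ solve 4 (λ r p b q → r :+ (p :+ (b :+ q)) := p :+ ((r :+ b) :+ q)) refl r (sum P) b' (sum Q) ⟩
      sum P + ((r + b') + sum Q)       ≡⟨ cong (λ t → sum P + (t + sum Q)) (ℕₚ.m+[n∸m]≡n r≤b) ⟩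
      sum P + (b + sum Q)              ≡⟨ sym (sum-++ P (b ∷ Q)) ⟩
      sum (P ++ b ∷ Q)                 ≡⟨ s ⟩
      r + sum ρ + tri (length (P ++ b ∷ Q))    ≡⟨ ℕₚ.+-assoc r _ _ ⟩
      r + (sum ρ + tri (length (P ++ b ∷ Q)))  ≡⟨ cong (λ l → r + (sum ρ + tri l)) (trans (Listₚ.length-++ P) (sym (Listₚ.length-++ P))) ⟩
      r + (sum ρ + tri (length (P ++ b' ∷ Q))) ∎)
  go : ∀ P R → P ++ R ≡ B → ∑ (T r R) (λ R' → X (P ++ R') ρ) ≡ ∑ R (λ b → vs B *ℚ ι (term b))
  go P []      q = refl
  go P (b ∷ R) q = trans (∑T r b R _) (cong₂ _+ℚ_ (position P b R q)
    (trans (∑-cong (T r R) (λ R' → cong (λ l → X l ρ) (sym (Listₚ.++-assoc P (b ∷ []) R')))) (go (P ++ b ∷ []) R (trans (Listₚ.++-assoc P (b ∷ []) R) q))))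

Strict-Unique : ∀ {A} → Strict A → Unique A
Strict-Unique {[]}    _ = []
Strict-Unique {a ∷ A} s = All.map (λ h e → ℕₚ.<⇒≢ h (sym e)) (Strict-head s) ∷ Strict-Unique (tail-Strict s)

vs-Strict : ∀ {A} → Strict A → vs A ≡ 1ℚ
vs-Strict {[]}    _ = refl
vs-Strict {a ∷ A} s = trans (cong₂ _*ℚ_ (sgs-1 A (Strict-head s)) (vs-Strict (tail-Strict s))) (ℚₚ.*-identityˡ 1ℚ)

-- Beta-lists of several lengths represent one partition. Stating this through characters allows two
-- partitions to be padded to a common length.
Rep : ℕ → List ℕ → List ℕ → Set
Rep n λ' A = ∀ ρ → sum ρ ≡ n → All (0 <_) ρ → ι (χ λ' ρ) ≡ X A ρ

Rep-betas : ∀ {n} λ' → Strict (betas λ') → sum (betas λ') ≡ n + tri (length (betas λ')) → Rep n λ' (betas λ')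
Rep-betas λ' s sm ρ sρ h = trans (sym (trans (cong (_*ℚ ι (χ λ' ρ)) (vs-Strict s)) (ℚₚ.*-identityˡ _)))
  (chiβ-X ρ (betas λ') h (Strict-Unique s) (trans sm (cong (_+ tri (length (betas λ'))) (sym sρ))))

Rep-pad : ∀ {n λ' A} → Rep n λ' A → Rep n λ' (pad A)
Rep-pad {A = A} h ρ s p = trans (h ρ s p) (sym (X-pad ρ A p))

-- Two-rowed characters

π⁻ : List ℕ → ℕ → ℚ
π⁻ ρ zero    = 0ℚ
π⁻ ρ (suc k) = π ρ k

π⁻-sub : ∀ ρ r k → ∑ (sub r (suc k)) (π⁻ ρ) ≡ ∑ (sub r k) (π ρ)
π⁻-sub ρ zero          k       = refl
π⁻-sub ρ (suc zero)    zero    = ℚₚ.+-identityʳ 0ℚ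
π⁻-sub ρ (suc (suc r)) zero    = refl
π⁻-sub ρ (suc r)       (suc k) = π⁻-sub ρ r k

π⁻-∷ : ∀ r ρ k → 0 < r → π⁻ (r ∷ ρ) k ≡ π⁻ ρ k +ℚ ∑ (sub r k) (π⁻ ρ)
π⁻-∷ (suc r) ρ zero    _ = sym (ℚₚ.+-identityʳ 0ℚ)
π⁻-∷ r       ρ (suc k) _ = cong (π ρ k +ℚ_) (sym (π⁻-sub ρ r k))

-- Lowering `x` corresponds to a cycle outside the subset, lowering `y` to one inside. No order of
-- `x` and `y` is assumed, because the recursion leaves the strict lists.
X-two : ∀ ρ x y → All (0 <_) ρ → x + y ≡ suc (sum ρ) → X (x ∷ y ∷ []) ρ ≡ π ρ y +ℚ -ℚ π⁻ ρ y
X-two []      (suc zero) zero       _ q = trans (cong₂ _*ℚ_ (ℚₚ.*-identityˡ 1ℚ) (ℚₚ.*-identityˡ 1ℚ))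
  (trans (ℚₚ.*-identityˡ 1ℚ) (sym (trans (cong (1ℚ +ℚ_) ℚₚ.neg-zero) (ℚₚ.+-identityʳ 1ℚ))))
X-two []      zero       (suc zero) _ q = trans (cong₂ _*ℚ_ (ℚₚ.*-identityʳ (-ℚ 1ℚ)) (ℚₚ.*-identityˡ 1ℚ))
  (trans (ℚₚ.*-identityʳ (-ℚ 1ℚ)) (sym (ℚₚ.+-identityˡ (-ℚ 1ℚ))))
X-two (r ∷ ρ) x y (0<r ∷ h) q = begin
  ∑ (T r (x ∷ y ∷ [])) (λ A → X A ρ)
    ≡⟨ trans (∑T r x (y ∷ []) _) (cong (∑ (sub r x) (λ x' → X (x' ∷ y ∷ []) ρ) +ℚ_) (trans (∑T r y [] _) (ℚₚ.+-identityʳ _))) ⟩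
  ∑ (sub r x) (λ x' → X (x' ∷ y ∷ []) ρ) +ℚ ∑ (sub r y) (λ y' → X (x ∷ y' ∷ []) ρ)
    ≡⟨ cong₂ _+ℚ_ first (trans (∑-cong-∈ (sub r y) (λ {y'} i → X-two ρ x y' h (drop x y' (trans (cong (x +_) (sub-∈ r y i)) q))))
         (trans (∑-+ (sub r y) _ _) (cong (∑ (sub r y) (π ρ) +ℚ_) (∑-neg (sub r y) _)))) ⟩
  (π ρ y +ℚ -ℚ π⁻ ρ y) +ℚ (∑ (sub r y) (π ρ) +ℚ -ℚ ∑ (sub r y) (π⁻ ρ))
    ≡⟨ interchange _ _ _ _ ⟩
  (π ρ y +ℚ ∑ (sub r y) (π ρ)) +ℚ (-ℚ π⁻ ρ y +ℚ -ℚ ∑ (sub r y) (π⁻ ρ))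
    ≡⟨ cong (π (r ∷ ρ) y +ℚ_) (trans (sym (ℚₚ.neg-distrib-+ _ _)) (cong -ℚ_ (sym (π⁻-∷ r ρ y 0<r)))) ⟩
  π (r ∷ ρ) y +ℚ -ℚ π⁻ (r ∷ ρ) y ∎
  where
  drop : ∀ u v → u + (v + r) ≡ suc (r + sum ρ) → u + v ≡ suc (sum ρ)
  drop u v q = ℕₚ.+-cancelʳ-≡ r _ _ (trans (ℕₚ.+-assoc u v r) (trans q (cong suc (ℕₚ.+-comm r _))))
  first : ∑ (sub r x) (λ x' → X (x' ∷ y ∷ []) ρ) ≡ π ρ y +ℚ -ℚ π⁻ ρ y
  first with r ℕₚ.≤? x
  ... | yes r≤x = trans (cong (λ l → ∑ l (λ x' → X (x' ∷ y ∷ []) ρ)) (trans (cong (sub r) (sym (ℕₚ.m+[n∸m]≡n r≤x))) (sub-+ r (x ∸ r))))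
      (trans (ℚₚ.+-identityʳ _) (X-two ρ (x ∸ r) y h (trans (ℕₚ.+-comm (x ∸ r) y) (drop y (x ∸ r) (trans (cong (y +_) (ℕₚ.m∸n+n≡m r≤x)) (trans (ℕₚ.+-comm y x) q))))))
  -- Here `y` exceeds `suc (sum ρ)`, so there are no subsets of size `y` or `y - 1` and both sides
  -- are zero.
  ... | no r≰x = trans (cong (λ l → ∑ l (λ x' → X (x' ∷ y ∷ []) ρ)) (sub-empty (ℕₚ.≰⇒> r≰x)))
      (sym (trans (cong₂ (λ a b → a +ℚ -ℚ b) (π-large ρ y (ℕₚ.<-trans (ℕₚ.n<1+n _) big)) (small y big)) (ℚₚ.+-inverseʳ 0ℚ)))
    where
    big : suc (sum ρ) < y
    big = ℕₚ.+-cancelˡ-< x _ _ (ℕₚ.<-≤-trans (ℕₚ.+-monoˡ-< (suc (sum ρ)) (ℕₚ.≰⇒> r≰x)) (ℕₚ.≤-reflexive (trans (ℕₚ.+-suc r _) (sym q))))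
    small : ∀ y → suc (sum ρ) < y → π⁻ ρ y ≡ 0ℚ
    small (suc y) (s≤s b) = π-large ρ y b

opaque
  unfolding S 0ℚ

  kron-S : ∀ n λ' μ ν → kron n λ' μ ν ≡ S n (λ ρ → ι (χ λ' ρ) *ℚ (ι (χ μ ρ) *ℚ ι (χ ν ρ)))
  kron-S n λ' μ ν = go (partitions n)
    where
    go : ∀ xs → sumℚ (map (λ ρ → ℚ._/_ (χ λ' ρ *ℤ χ μ ρ *ℤ χ ν ρ) (z ρ) {{z≢0 ρ}}) xs) ≡
              ∑ xs (λ ρ → wt ρ *ℚ (ι (χ λ' ρ) *ℚ (ι (χ μ ρ) *ℚ ι (χ ν ρ))))
    go []       = refl
    go (ρ ∷ xs) = cong₂ _+ℚ_ (trans (/-recip (χ λ' ρ *ℤ χ μ ρ *ℤ χ ν ρ) (z ρ) {{z≢0 ρ}})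
      (trans (ℚₚ.*-comm _ (wt ρ)) (cong (wt ρ *ℚ_) (trans (ι-* (χ λ' ρ *ℤ χ μ ρ) (χ ν ρ)) (trans (cong (_*ℚ ι (χ ν ρ)) (ι-* (χ λ' ρ) (χ μ ρ))) (ℚₚ.*-assoc (ι (χ λ' ρ)) _ _)))))) (go xs)

kron-NSum : ∀ q m λ' ν A B → Rep (suc q + m) λ' A → Rep (suc q + m) ν B →
  Strict (suc m ∷ suc q ∷ []) →
  kron (suc q + m) (m ∷ suc q ∷ []) λ' ν ≡ NSum (suc q) A B (I m) +ℚ -ℚ NSum q A B (I (suc m))
kron-NSum q m λ' ν A B rA rB st = begin
  kron n μ λ' ν
    ≡⟨ kron-S n μ λ' ν ⟩
  S n (λ ρ → ι (χ μ ρ) *ℚ (ι (χ λ' ρ) *ℚ ι (χ ν ρ)))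
    ≡⟨ S-cong-∈ n (λ ρ s h → cong₂ _*ℚ_ (trans (rμ ρ s h) (X-two ρ (m + 1) (suc q + 0) h (trans μsum (cong suc (sym s))))) (cong₂ _*ℚ_ (rA ρ s h) (rB ρ s h))) ⟩
  S n (λ ρ → (π ρ (suc q + 0) +ℚ -ℚ π ρ (q + 0)) *ℚ (X A ρ *ℚ X B ρ))
    ≡⟨ S-cong n (λ ρ → trans (cong (λ t → (π ρ (suc t) +ℚ -ℚ π ρ t) *ℚ (X A ρ *ℚ X B ρ)) (ℕₚ.+-identityʳ q))
         (trans (ℚₚ.*-distribʳ-+ (X A ρ *ℚ X B ρ) _ _) (cong (π ρ (suc q) *ℚ (X A ρ *ℚ X B ρ) +ℚ_) (sym (ℚₚ.neg-distribˡ-* _ _))))) ⟩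
  S n (λ ρ → π ρ (suc q) *ℚ (X A ρ *ℚ X B ρ) +ℚ -ℚ (π ρ q *ℚ (X A ρ *ℚ X B ρ)))
    ≡⟨ trans (S-+ n _ _) (cong (S n (λ ρ → π ρ (suc q) *ℚ (X A ρ *ℚ X B ρ)) +ℚ_) (S-neg n _)) ⟩
  S n (λ ρ → π ρ (suc q) *ℚ (X A ρ *ℚ X B ρ)) +ℚ -ℚ S n (λ ρ → π ρ q *ℚ (X A ρ *ℚ X B ρ))
    ≡⟨ cong₂ (λ x y → x +ℚ -ℚ y) (S-π-XX (suc q) m A B)
         (trans (cong (λ k → S k (λ ρ → π ρ q *ℚ (X A ρ *ℚ X B ρ))) (sym (ℕₚ.+-suc q m))) (S-π-XX q (suc m) A B)) ⟩
  NSum (suc q) A B (I m) +ℚ -ℚ NSum q A B (I (suc m)) ∎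
  where
  n = suc q + m
  μ = m ∷ suc q ∷ []
  μsum : m + 1 + (suc q + 0) ≡ suc n
  μsum = solve 2 (λ m q → m :+ con 1 :+ (con 1 :+ q :+ con 0) := con 1 :+ (con 1 :+ q :+ m)) refl m q
  st' : Strict (betas μ)
  st' = subst₂ (λ x y → Strict (x ∷ y ∷ [])) (sym (ℕₚ.+-comm m 1)) (sym (ℕₚ.+-identityʳ (suc q))) st
  rμ : Rep n μ (betas μ)
  rμ = Rep-betas μ st' (trans (solve 2 (λ m q → m :+ con 1 :+ (con 1 :+ q :+ con 0 :+ con 0) := con 1 :+ (con 1 :+ q :+ m)) refl m q) (ℕₚ.+-comm 1 n))

-- Nonnegativity and lower bounds

∑-≥₁ : (xs : List Ix) {f : Ix → ℚ} → (∀ {x} → x ∈ xs → 0ℚ ≤ℚ f x) → ∀ {x} → x ∈ xs → f x ≤ℚ ∑ xs f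
∑-≥₁ (x ∷ xs) {f} h (here refl) = ℚₚ.≤-trans (ℚₚ.≤-reflexive (sym (ℚₚ.+-identityʳ (f x)))) (ℚₚ.+-mono-≤ ℚₚ.≤-refl (∑-≥0 xs (λ i → h (there i))))
∑-≥₁ (y ∷ xs) {f} h {x} (there i) = ℚₚ.≤-trans (ℚₚ.≤-reflexive (sym (ℚₚ.+-identityˡ (f x)))) (ℚₚ.+-mono-≤ (h (here refl)) (∑-≥₁ xs (λ i → h (there i)) i))

∑-≥₂ : (xs : List Ix) {f : Ix → ℚ} → (∀ {x} → x ∈ xs → 0ℚ ≤ℚ f x) → ∀ {x y} → x ∈ xs → y ∈ xs → x ≢ y → f x +ℚ f y ≤ℚ ∑ xs f
∑-≥₂ (x ∷ xs) h (here refl) (here refl) ne = ⊥-elim (ne refl)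
∑-≥₂ (x ∷ xs) h (here refl) (there j)   ne = ℚₚ.+-mono-≤ ℚₚ.≤-refl (∑-≥₁ xs (λ i → h (there i)) j)
∑-≥₂ (y ∷ xs) {f} h {x} (there i) (here refl) ne = ℚₚ.≤-trans (ℚₚ.≤-reflexive (ℚₚ.+-comm (f x) (f y))) (ℚₚ.+-mono-≤ ℚₚ.≤-refl (∑-≥₁ xs (λ i → h (there i)) i))
∑-≥₂ (v ∷ xs) {f} h {x} {y} (there i) (there j) ne =
  ℚₚ.≤-trans (ℚₚ.≤-reflexive (sym (ℚₚ.+-identityˡ _))) (ℚₚ.+-mono-≤ (h (here refl)) (∑-≥₂ xs (λ i → h (there i)) i j ne))

∑-≥₃ : (xs : List Ix) {f : Ix → ℚ} → (∀ {x} → x ∈ xs → 0ℚ ≤ℚ f x) → ∀ {x y v} → x ∈ xs → y ∈ xs → v ∈ xs → x ≢ y → x ≢ v → y ≢ v →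
  f x +ℚ (f y +ℚ f v) ≤ℚ ∑ xs f
∑-≥₃ (_ ∷ xs) h (here refl) (here refl) _ n₁ n₂ n₃ = ⊥-elim (n₁ refl)
∑-≥₃ (_ ∷ xs) h (here refl) _ (here refl) n₁ n₂ n₃ = ⊥-elim (n₂ refl)
∑-≥₃ (_ ∷ xs) h _ (here refl) (here refl) n₁ n₂ n₃ = ⊥-elim (n₃ refl)
∑-≥₃ (_ ∷ xs) h (here refl) (there j) (there k) n₁ n₂ n₃ = ℚₚ.+-mono-≤ ℚₚ.≤-refl (∑-≥₂ xs (λ i → h (there i)) j k n₃)
∑-≥₃ (_ ∷ xs) {f} h {x} {y} {v} (there i) (here refl) (there k) n₁ n₂ n₃ =
  ℚₚ.≤-trans (ℚₚ.≤-reflexive (trans (sym (ℚₚ.+-assoc (f x) (f y) (f v))) (trans (cong (_+ℚ f v) (ℚₚ.+-comm (f x) (f y))) (ℚₚ.+-assoc (f y) (f x) (f v)))))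
    (ℚₚ.+-mono-≤ ℚₚ.≤-refl (∑-≥₂ xs (λ i → h (there i)) i k n₂))
∑-≥₃ (_ ∷ xs) {f} h {x} {y} {v} (there i) (there j) (here refl) n₁ n₂ n₃ =
  ℚₚ.≤-trans (ℚₚ.≤-reflexive (trans (sym (ℚₚ.+-assoc (f x) (f y) (f v))) (ℚₚ.+-comm _ (f v))))
    (ℚₚ.+-mono-≤ ℚₚ.≤-refl (∑-≥₂ xs (λ i → h (there i)) i j n₁))
∑-≥₃ (_ ∷ xs) {f} h (there i) (there j) (there k) n₁ n₂ n₃ =
  ℚₚ.≤-trans (ℚₚ.≤-reflexive (sym (ℚₚ.+-identityˡ _))) (ℚₚ.+-mono-≤ (h (here refl)) (∑-≥₃ xs (λ i → h (there i)) i j k n₁ n₂ n₃))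

T1-∈ : ∀ P x Q → P ++ x ∷ Q ∈ T 1 (P ++ suc x ∷ Q)
T1-∈ []      x Q = here refl
T1-∈ (p ∷ P) x Q = ∈ₚ.∈-++⁺ʳ (map (_∷ (P ++ suc x ∷ Q)) (sub 1 p)) (∈ₚ.∈-map⁺ (p ∷_) (T1-∈ P x Q))

T-∈-∷ : ∀ r a A {A'} → A' ∈ T r A → a ∷ A' ∈ T r (a ∷ A)
T-∈-∷ r a A i = ∈ₚ.∈-++⁺ʳ (map (_∷ A) (sub r a)) (∈ₚ.∈-map⁺ (a ∷_) i)

T-∈⁻ : ∀ r a A {A″} → A″ ∈ T r (a ∷ A) → (∃ λ a' → a' ∈ sub r a × A″ ≡ a' ∷ A) ⊎ (∃ λ A' → A' ∈ T r A × A″ ≡ a ∷ A')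
T-∈⁻ r a A i with ∈ₚ.∈-++⁻ (map (_∷ A) (sub r a)) i
... | inj₁ j = inj₁ (∈ₚ.∈-map⁻ (_∷ A) j)
... | inj₂ j = inj₂ (∈ₚ.∈-map⁻ (a ∷_) j)

T-sum : ∀ r A {A'} → A' ∈ T r A → sum A' + r ≡ sum A
T-sum r (a ∷ A) i with T-∈⁻ r a A i
... | inj₁ (a' , j , refl) = trans (solve 3 (λ x s r → x :+ s :+ r := x :+ r :+ s) refl a' (sum A) r) (cong (_+ sum A) (sub-∈ r a j))
... | inj₂ (A' , j , refl) = trans (ℕₚ.+-assoc a _ r) (cong (a +_) (T-sum r A j))

T-length : ∀ r A {A'} → A' ∈ T r A → length A' ≡ length A
T-length r (a ∷ A) i with T-∈⁻ r a A i
... | inj₁ (a' , j , refl) = refl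
... | inj₂ (A' , j , refl) = cong suc (T-length r A j)

T-≼ : ∀ r A {A'} → A' ∈ T r A → A' ≼ A
T-≼ r (a ∷ A) i with T-∈⁻ r a A i
... | inj₁ (a' , j , refl) = sub-≤ r a j ∷ ≼-refl
... | inj₂ (A' , j , refl) = ℕₚ.≤-refl ∷ T-≼ r A j

≼-All< : ∀ {A B x} → A ≼ B → All (_< x) B → All (_< x) A
≼-All< []       []       = []
≼-All< (h ∷ hs) (p ∷ ps) = ℕₚ.≤-<-trans h p ∷ ≼-All< hs ps

-- Removing a box from a row either gives a partition or makes two beta numbers equal, and then
-- every antisymmetric function vanishes.
T1-Strict : ∀ A → Strict A → ∀ {A'} → A' ∈ T 1 A → Strict A' ⊎ (∀ {f} → Anti f → f A' ≡ 0ℚ)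
T1-Strict (a ∷ A) s i with T-∈⁻ 1 a A i
T1-Strict (zero ∷ A)  s i | inj₁ (a' , () , refl)
T1-Strict (suc a ∷ A) s i | inj₁ (.a , here refl , refl) = headcase A s
  where
  headcase : ∀ A → Strict (suc a ∷ A) → Strict (a ∷ A) ⊎ (∀ {f} → Anti f → f (a ∷ A) ≡ 0ℚ)
  headcase []      _ = inj₁ [-]
  headcase (y ∷ A) (s≤s y≤a ∷ s) with y ℕₚ.≟ a
  ... | yes refl = inj₂ (λ {f} af → Anti-dup {f} af [] y [] A)
  ... | no ne    = inj₁ (ℕₚ.≤∧≢⇒< y≤a ne ∷ s)
... | inj₂ (A' , j , refl) with T1-Strict A (tail-Strict s) j
... | inj₁ s' = inj₁ (Strict-∷ (≼-All< (T-≼ 1 A j) (Strict-head s)) s')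
... | inj₂ z  = inj₂ (λ {f} af → z {λ A → f (a ∷ A)} (Anti-∷ {f} af a))

X-degree : ∀ ρ A → sum A ≢ sum ρ + tri (length A) → X A ρ ≡ 0ℚ
X-degree []      A ne = e-zero A ne
X-degree (r ∷ ρ) A ne = ∑-0 (T r A) (λ {A'} i → X-degree ρ A' (λ q → ne (begin
  sum A                                  ≡⟨ sym (T-sum r A i) ⟩
  sum A' + r                             ≡⟨ cong (_+ r) q ⟩
  sum ρ + tri (length A') + r            ≡⟨ solve 3 (λ s t r → s :+ t :+ r := r :+ s :+ t) refl (sum ρ) (tri (length A')) r ⟩
  r + sum ρ + tri (length A')            ≡⟨ cong (λ l → r + sum ρ + tri l) (T-length r A i) ⟩
  r + sum ρ + tri (length A)             ∎)))

I-degree : ∀ m A B → sum A ≢ m + tri (length A) → I m A B ≡ 0ℚ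
I-degree m A B ne = trans (S-cong-∈ m (λ ρ s _ → trans (cong (_*ℚ X B ρ) (X-degree ρ A (λ q → ne (trans q (cong (_+ tri (length A)) s))))) (ℚₚ.*-zeroˡ _))) (S-zero m)

I-≢′ : ∀ m A B → Strict A → Strict B → length A ≡ length B → A ≢ B → I m A B ≡ 0ℚ
I-≢′ m A B s s' l ne with sum A ℕₚ.≟ m + tri (length A)
... | yes q = I-≢ m A B s s' l q ne
... | no q  = I-degree m A B q

I-≥0 : ∀ m A B → Strict A → Strict B → length A ≡ length B → 0ℚ ≤ℚ I m A B
I-≥0 m A B s s' l with Listₚ.≡-dec ℕₚ._≟_ A B
... | no ne = ℚₚ.≤-reflexive (sym (I-≢′ m A B s s' l ne))
... | yes refl with sum A ℕₚ.≟ m + tri (length A)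
...   | yes q = ℚₚ.≤-trans ℚₚ.0≤1 (ℚₚ.≤-reflexive (sym (I-refl m A s q)))
...   | no q  = ℚₚ.≤-reflexive (sym (I-degree m A A q))

Itl-Strictˡ : ∀ {A C} → Itl A C → Strict A
Itl-Strictˡ []             = []
Itl-Strictˡ [ _ ]          = [-]
Itl-Strictˡ (cons h h' i) = ℕₚ.<-≤-trans h' h ∷ Itl-Strictˡ i

-- The hypothesis covers only horizontal strips. `f⁺` is nonnegative everywhere and agrees with `f`
-- on those, which is all that `∑pS-cong` compares.
∑pS-≥0 : ∀ k A {f : List ℕ → ℚ} → (∀ C → Itl A C → 0ℚ ≤ℚ f C) → 0ℚ ≤ℚ ∑ (pS k A) f
∑pS-≥0 k A {f} h = ℚₚ.≤-trans (∑-≥0 (pS k A) (λ {x} _ → nonneg x)) (ℚₚ.≤-reflexive (∑pS-cong k A agree))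
  where
  f⁺ : List ℕ → ℚ
  f⁺ C with 0ℚ ℚₚ₀.≤? f C
  ... | yes _ = f C
  ... | no _  = 0ℚ
  nonneg : ∀ C → 0ℚ ≤ℚ f⁺ C
  nonneg C with 0ℚ ℚₚ₀.≤? f C
  ... | yes p = p
  ... | no _  = ℚₚ.≤-refl
  agree : ∀ C → Itl A C → sum C + k ≡ sum A → f⁺ C ≡ f C
  agree C i _ with 0ℚ ℚₚ₀.≤? f C
  ... | yes _ = refl
  ... | no ¬p = ⊥-elim (¬p (h C i))

-- strip m k A C is 1 if A / C is a horizontal strip of size k, and 0 otherwise.
strip : ℕ → ℕ → List ℕ → List ℕ → ℚ
strip m k A C = ∑ (hS k A) (λ C' → I m C' C)

-- The Pieri rule lists each strip once, and orthogonality selects the one that ends in `C`.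
strip-1 : ∀ m k A C → Itl A C → sum C + k ≡ sum A → sum C ≡ m + tri (length C) → strip m k A C ≡ 1ℚ
strip-1 m k A C i s sm = trans (pieri k A {λ C' → I m C' C} (Itl-Strictˡ i) (I-Antiˡ m C))
  (trans (∑pS-only k A C (λ C' → I m C' C) i s (λ C' i' s' ne → I-≢′ m C' C (Itl-Strict i') (Itl-Strict i) (trans (sym (Itl-length i')) (Itl-length i)) ne))
    (I-refl m C (Itl-Strict i) sm))

strip-≥0 : ∀ m k A C → Strict A → Strict C → length A ≡ length C → 0ℚ ≤ℚ strip m k A C
strip-≥0 m k A C s s' l = ℚₚ.≤-trans (∑pS-≥0 k A (λ C' i → I-≥0 m C' C (Itl-Strict i) s' (trans (sym (Itl-length i)) l)))
  (ℚₚ.≤-reflexive (sym (pieri k A {λ C' → I m C' C} s (I-Antiˡ m C))))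

strip-T1-≥0 : ∀ m k A C → Strict A → Strict C → length A ≡ length C → ∀ {A' C'} → A' ∈ T 1 A → C' ∈ T 1 C → 0ℚ ≤ℚ strip m k A' C'
strip-T1-≥0 m k A C s s' l {A'} {C'} i j with T1-Strict A s i | T1-Strict C s' j
... | inj₂ z  | _       = ℚₚ.≤-reflexive (sym (z {λ A → strip m k A C'} (∑hS-Anti k {λ D → I m D C'} (I-Antiˡ m C'))))
... | inj₁ _  | inj₂ z  = ℚₚ.≤-reflexive (sym (trans (∑-cong (hS k A') (λ D → z {I m D} (I-Antiʳ m D))) (∑-zero (hS k A'))))
... | inj₁ t  | inj₁ t' = strip-≥0 m k A' C' t t' (trans (T-length 1 A i) (trans l (sym (T-length 1 C j))))

I-head-large : ∀ m C b D → length C ≡ suc (length D) → All (_< b) C → I m C (b ∷ D) ≡ 0ℚ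
I-head-large m C b D l p = Anti-vanish {λ C → I m C (b ∷ D)} (I-Antiˡ m (b ∷ D)) (_< b) (suc (length D))
  (λ { (c ∷ C) s (c<b ∷ _) l' → I-head-< m c C b D s (ℕₚ.suc-injective l') c<b }) C p l

Itl-∷-tail : ∀ {a A K} → Itl (a ∷ A) (a ∷ K) → length A ≡ length K
Itl-∷-tail i = ℕₚ.suc-injective (Itl-length i)

-- The pair (λ, ν) with ν_1 = λ_1 + q whose remaining rows K come from those of λ by removing
-- a horizontal strip of size q.  Then |λ ∩ ν| = n - q, so only matrices touching the first
-- row of ν at least q times contribute.
module FirstRow (q m a : ℕ) (A' K : List ℕ) (i : Itl (a ∷ A') (a ∷ K)) (s : sum K + q ≡ sum A')
                (sm : sum (a ∷ A') ≡ suc q + m + tri (suc (length A'))) where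

  A = a ∷ A'
  B = (a + q) ∷ K

  sA : Strict A
  sA = Itl-Strictˡ i

  sK : Strict (a ∷ K)
  sK = Itl-Strict i

  len : length A' ≡ length K
  len = Itl-∷-tail i

  term : ℕ → ℕ → ℕ → ℚ
  term m' k d = ∑ (sub k (a + q)) (λ b' → ∑ (hS k A) (λ C → NSum d C K (λ C' K' → I m' C' (b' ∷ K'))))

  -- With fewer than `q` units in its column, the first entry of ν still exceeds every entry that
  -- remains of λ.
  term-< : ∀ m' k d → k < q → term m' k d ≡ 0ℚ
  term-< m' k d k<q = ∑-0 (sub k (a + q)) (λ {b'} j → trans (∑hS-cong k A (λ C C≼ → NSum-0s d C K (λ C' K' C'≼ K'≼ →
      I-head-large m' C' b' K' (trans (PW.Pointwise-length C'≼) (trans (PW.Pointwise-length C≼) (trans (cong suc len) (cong suc (sym (PW.Pointwise-length K'≼))))))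
        (≼-All< (≼-trans C'≼ C≼) (All.map (λ h → ℕₚ.≤-<-trans h (a<b' b' (sub-∈ k (a + q) j))) (ℕₚ.≤-refl ∷ All.map ℕₚ.<⇒≤ (Strict-head sA)))))))
      (∑-zero (hS k A)))
    where
    a<b' : ∀ b' → b' + k ≡ a + q → a < b'
    a<b' b' e = ℕₚ.+-cancelʳ-< k a b' (ℕₚ.<-≤-trans (ℕₚ.+-monoʳ-< a k<q) (ℕₚ.≤-reflexive (sym e)))

  sub-q : sub q (a + q) ≡ a ∷ []
  sub-q = trans (cong (sub q) (ℕₚ.+-comm a q)) (sub-+ q a)

  N-q : NSum q A B (I (suc m)) ≡ strip (suc m) q A (a ∷ K)
  N-q = begin
    NSum q A B (I (suc m))
      ≡⟨ NSum-∷ q A (a + q) K _ ⟩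
    ∑anti q (term (suc m))
      ≡⟨ ∑anti-only q q 0 (term (suc m)) (ℕₚ.+-identityʳ q) (λ c d e ne → term-< (suc m) c d (ℕₚ.≤∧≢⇒< (subst (c ≤_) e (ℕₚ.m≤m+n c d)) ne)) ⟩
    term (suc m) q 0
      ≡⟨ trans (cong (λ l → ∑ l (λ b' → ∑ (hS q A) (λ C → NSum 0 C K (λ C' K' → I (suc m) C' (b' ∷ K'))))) sub-q) (ℚₚ.+-identityʳ _) ⟩
    ∑ (hS q A) (λ C → NSum 0 C K (λ C' K' → I (suc m) C' (a ∷ K')))
      ≡⟨ ∑-cong (hS q A) (λ C → NSum-0 C K _) ⟩
    strip (suc m) q A (a ∷ K) ∎

  -- `q` units meet the first row of ν and the free unit meets another row; the terms are sorted by
  -- the list `A″` to which this unit lowers λ.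
  lowered : List ℕ → ℚ
  lowered A″ = ∑ (T 1 K) (λ K' → strip m q A″ (a ∷ K'))

  -- All `q + 1` units meet the first row of ν.
  top : ℚ
  top = ∑ (sub (suc q) (a + q)) (λ b' → strip m (suc q) A (b' ∷ K))

  N-p : NSum (suc q) A B (I m) ≡ ∑ (T 1 A) lowered +ℚ top
  N-p = begin
    NSum (suc q) A B (I m)
      ≡⟨ NSum-∷ (suc q) A (a + q) K _ ⟩
    ∑anti (suc q) (term m)
      ≡⟨ ∑anti-snoc q (term m) ⟩
    ∑anti q (λ c d → term m c (suc d)) +ℚ term m (suc q) 0
      ≡⟨ cong₂ _+ℚ_ (trans (∑anti-only q q 0 (λ c d → term m c (suc d)) (ℕₚ.+-identityʳ q) (λ c d e ne → term-< m c (suc d) (ℕₚ.≤∧≢⇒< (subst (c ≤_) e (ℕₚ.m≤m+n c d)) ne))) middle)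
           (∑-cong (sub (suc q) (a + q)) (λ b' → ∑-cong (hS (suc q) A) (λ C → NSum-0 C K _))) ⟩
    ∑ (T 1 A) lowered +ℚ top ∎
    where
    middle : term m q 1 ≡ ∑ (T 1 A) lowered
    middle = begin
      term m q 1
        ≡⟨ trans (cong (λ l → ∑ l (λ b' → ∑ (hS q A) (λ C → NSum 1 C K (λ C' K' → I m C' (b' ∷ K'))))) sub-q) (ℚₚ.+-identityʳ _) ⟩
      ∑ (hS q A) (λ C → NSum 1 C K (λ C' K' → I m C' (a ∷ K')))
        ≡⟨ ∑-cong (hS q A) (λ C → NSum-1 C K _) ⟩
      ∑ (hS q A) (λ C → ∑ (T 1 C) (λ C' → ∑ (T 1 K) (λ K' → I m C' (a ∷ K'))))
        -- The free unit is taken before the strip, so that it is a box of λ itself.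
        ≡⟨ ∑hS-T q 1 A _ ⟩
      ∑ (T 1 A) (λ A″ → ∑ (hS q A″) (λ C → ∑ (T 1 K) (λ K' → I m C (a ∷ K'))))
        ≡⟨ ∑-cong (T 1 A) (λ A″ → ∑-swap (hS q A″) (T 1 K) _) ⟩
      ∑ (T 1 A) lowered ∎

  sum-K : sum (a ∷ K) ≡ suc m + tri (length (a ∷ K))
  sum-K = ℕₚ.+-cancelʳ-≡ q _ _ (trans (trans (ℕₚ.+-assoc a _ q) (cong (a +_) s)) (trans sm (trans (cong (λ l → suc q + m + tri (suc l)) len)
    (solve 3 (λ q m t → con 1 :+ q :+ m :+ t := con 1 :+ m :+ t :+ q) refl q m (tri (suc (length K)))))))

  D : NSum (suc q) A B (I m) +ℚ -ℚ NSum q A B (I (suc m)) ≡ ∑ (T 1 A) lowered +ℚ top +ℚ -ℚ 1ℚ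
  D = cong₂ (λ x y → x +ℚ -ℚ y) N-p (trans N-q (strip-1 (suc m) q A (a ∷ K) i (trans (ℕₚ.+-assoc a _ q) (cong (a +_) s)) sum-K))

  strip≥0 : ∀ {A″ K'} → A″ ∈ T 1 A → K' ∈ T 1 K → 0ℚ ≤ℚ strip m q A″ (a ∷ K')
  strip≥0 x y = strip-T1-≥0 m q A (a ∷ K) sA sK (cong suc len) x (T-∈-∷ 1 a K y)

  lowered≥0 : ∀ {A″} → A″ ∈ T 1 A → 0ℚ ≤ℚ lowered A″
  lowered≥0 x = ∑-≥0 (T 1 K) (strip≥0 x)

  exhibit : ∀ {A″ K'} → A″ ∈ T 1 A → K' ∈ T 1 K → Itl A″ (a ∷ K') → strip m q A″ (a ∷ K') ≡ 1ℚ
  exhibit {A″} {K'} x y j = strip-1 m q A″ (a ∷ K') j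
    (ℕₚ.+-cancelʳ-≡ 1 _ _ (trans (solve 3 (λ a k q → a :+ k :+ q :+ con 1 := a :+ (k :+ con 1 :+ q)) refl a (sum K') q)
      (trans (cong (a +_) (trans (cong (_+ q) (T-sum 1 K y)) s)) (sym (T-sum 1 A x)))))
    (ℕₚ.suc-injective (trans (sym (ℕₚ.+-comm (a + sum K') 1)) (trans (ℕₚ.+-assoc a _ 1) (trans (cong (a +_) (T-sum 1 K y)) (trans sum-K (cong (λ l → suc m + tri (suc l)) (sym (T-length 1 K y))))))))

  top≥0 : 0ℚ ≤ℚ top
  top≥0 = ∑-≥0 (sub (suc q) (a + q)) (λ {b'} j → nonneg b' (sub-∈ (suc q) (a + q) j))
    where
    nonneg : ∀ b' → b' + suc q ≡ a + q → 0ℚ ≤ℚ strip m (suc q) A (b' ∷ K)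
    nonneg b' e with T1-Strict (a ∷ K) sK {b' ∷ K} (subst (λ x → b' ∷ K ∈ T 1 (x ∷ K)) (ℕₚ.+-cancelʳ-≡ q (suc b') a (trans (sym (ℕₚ.+-suc b' q)) e)) (T1-∈ [] b' K))
    ... | inj₁ t = strip-≥0 m (suc q) A (b' ∷ K) sA t (cong suc len)
    ... | inj₂ z = ℚₚ.≤-reflexive (sym (trans (∑-cong (hS (suc q) A) (λ D → z {I m D} (I-Antiʳ m D))) (∑-zero (hS (suc q) A))))

  top-1 : ∀ b → a ≡ suc b → Itl A (b ∷ K) → top ≡ 1ℚ
  top-1 b refl j = trans (cong (λ l → ∑ l (λ b' → strip m (suc q) A (b' ∷ K))) (trans (cong (sub q) (ℕₚ.+-comm b q)) (sub-+ q b)))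
    (trans (ℚₚ.+-identityʳ _) (strip-1 m (suc q) A (b ∷ K) j
      (trans (ℕₚ.+-suc _ q) (cong suc (trans (ℕₚ.+-assoc b _ q) (cong (b +_) s))))
      (ℕₚ.suc-injective sum-K)))

-- The additional bound says that no entry of `B` loses more than `p`; in `last-row` it keeps the
-- entries of long rows positive.
NSum-cong-near : ∀ p A B {F G : List ℕ → List ℕ → ℚ} →
  (∀ C D → C ≼ A → D ≼ B → Pointwise (λ d b → b ≤ d + p) D B → F C D ≡ G C D) → NSum p A B F ≡ NSum p A B G
NSum-cong-near zero    A []      h = cong (_+ℚ 0ℚ) (h A [] ≼-refl [] [])
NSum-cong-near (suc p) A []      h = refl
NSum-cong-near p       A (b ∷ B) {F} {G} h = trans (NSum-∷ p A b B F) (trans (∑anti-cong p (λ k m e →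
  ∑-cong-∈ (sub k b) (λ {b'} i → ∑hS-cong k A (λ C C≼ → NSum-cong-near m C B (λ C' D C'≼ D≼ near →
    h C' (b' ∷ D) (≼-trans C'≼ C≼) (sub-≤ k b i ∷ D≼)
      (subst (_≤ b' + p) (sub-∈ k b i) (ℕₚ.+-monoʳ-≤ b' (subst (k ≤_) e (ℕₚ.m≤m+n k m))) ∷
       PW.map (λ {d} {b} q → ℕₚ.≤-trans q (ℕₚ.+-monoʳ-≤ d (subst (m ≤_) e (ℕₚ.m≤n+m m k)))) near))))))
  (sym (NSum-∷ p A b B G)))

sgn : ℕ → ℚ
sgn zero    = 1ℚ
sgn (suc l) = -ℚ 1ℚ *ℚ sgn l

sgn-sq : ∀ l → sgn l *ℚ sgn l ≡ 1ℚ
sgn-sq zero    = ℚₚ.*-identityˡ 1ℚ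
sgn-sq (suc l) = begin
  -ℚ 1ℚ *ℚ sgn l *ℚ (-ℚ 1ℚ *ℚ sgn l)     ≡⟨ cong₂ _*ℚ_ (neg-* (sgn l)) (neg-* (sgn l)) ⟩
  -ℚ sgn l *ℚ -ℚ sgn l                   ≡⟨ sym (ℚₚ.neg-distribˡ-* (sgn l) _) ⟩
  -ℚ (sgn l *ℚ -ℚ sgn l)                 ≡⟨ cong -ℚ_ (sym (ℚₚ.neg-distribʳ-* (sgn l) (sgn l))) ⟩
  -ℚ -ℚ (sgn l *ℚ sgn l)                 ≡⟨ ℚₚ.neg-involutive _ ⟩
  sgn l *ℚ sgn l                         ≡⟨ sgn-sq l ⟩
  1ℚ                                     ∎

Anti-rotate : ∀ {f} → Anti f → ∀ A x → f (A ++ x ∷ []) ≡ sgn (length A) *ℚ f (x ∷ A)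
Anti-rotate {f} af []      x = sym (ℚₚ.*-identityˡ _)
Anti-rotate {f} af (a ∷ A) x = begin
  f (a ∷ A ++ x ∷ [])                              ≡⟨ Anti-rotate {λ A → f (a ∷ A)} (Anti-∷ {f} af a) A x ⟩
  sgn (length A) *ℚ f (a ∷ x ∷ A)                  ≡⟨ cong (sgn (length A) *ℚ_) (af [] a x A) ⟩
  sgn (length A) *ℚ -ℚ f (x ∷ a ∷ A)               ≡⟨ sym (ℚₚ.neg-distribʳ-* _ _) ⟩
  -ℚ (sgn (length A) *ℚ f (x ∷ a ∷ A))             ≡⟨ trans (ℚₚ.neg-distribˡ-* _ _) (cong (_*ℚ f (x ∷ a ∷ A)) (sym (neg-* (sgn (length A))))) ⟩
  sgn (suc (length A)) *ℚ f (x ∷ a ∷ A)            ∎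

sgn-cancel : ∀ l x y → x ≡ sgn l *ℚ y → y ≡ sgn l *ℚ x
sgn-cancel l x y h = sym (trans (cong (sgn l *ℚ_) h) (trans (sym (ℚₚ.*-assoc (sgn l) (sgn l) y)) (trans (cong (_*ℚ y) (sgn-sq l)) (ℚₚ.*-identityˡ y))))

-- An entry lowered all the way to 0 contributes nothing, so shifting all entries by one commutes
-- with lowering them.
NSum-suc : ∀ p A B (G : List ℕ → List ℕ → ℚ) → (∀ C P Q → G C (P ++ 0 ∷ Q) ≡ 0ℚ) →
  NSum p A (map suc B) G ≡ NSum p A B (λ C D → G C (map suc D))
NSum-suc zero    A []      G h = refl
NSum-suc (suc p) A []      G h = refl
NSum-suc p       A (b ∷ B) G h = begin
  NSum p A (suc b ∷ map suc B) G
    ≡⟨ NSum-∷ p A (suc b) (map suc B) G ⟩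
  ∑anti p (λ k m → ∑ (sub k (suc b)) (λ b' → ∑ (hS k A) (λ C → NSum m C (map suc B) (λ C' D → G C' (b' ∷ D)))))
    ≡⟨ ∑anti-cong′ p (λ k m → trans (∑sub-suc k (suc b) (λ b' → ∑ (hS k A) (λ C → NSum m C (map suc B) (λ C' D → G C' (b' ∷ D))))
         (trans (∑-cong (hS k A) (λ C → NSum-0s m C (map suc B) (λ C' D _ _ → h C' [] D))) (∑-zero (hS k A))))
         (∑-cong (sub k b) (λ b' → ∑-cong (hS k A) (λ C → NSum-suc m C B (λ C' D → G C' (suc b' ∷ D)) (λ C' P Q → h C' (suc b' ∷ P) Q))))) ⟩
  ∑anti p (λ k m → ∑ (sub k b) (λ b' → ∑ (hS k A) (λ C → NSum m C B (λ C' D → G C' (suc b' ∷ map suc D)))))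
    ≡⟨ sym (NSum-∷ p A b B _) ⟩
  NSum p A (b ∷ B) (λ C D → G C (map suc D)) ∎

pad-Strict : ∀ {A} → Strict A → Strict (pad A)
pad-Strict []      = [-]
pad-Strict [-]     = s≤s z≤n ∷ [-]
pad-Strict (h ∷ s) = s≤s h ∷ pad-Strict s

-- Positive beta numbers mean that all rows of `D` are nonempty, one more than `C` can have.
-- Formally, `pad C` contains 0 and `D` does not.
I-positive : ∀ m C D → length D ≡ suc (length C) → All (0 <_) D → I m C D ≡ 0ℚ
I-positive m C D l p = Anti-vanish {λ C → I m C D} (I-Antiˡ m D) (λ _ → ℕ) (length C) (λ C' sC' _ l' →
  Anti-vanish {I m C'} (I-Antiʳ m C') (0 <_) (length D) (λ D' sD' p' l″ →
    trans (sym (I-padˡ m C' D')) (I-≢′ m (pad C') D' (pad-Strict sC') sD' (trans (length-pad C') (trans (cong suc l') (trans (sym l) (sym l″))))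
      (λ q → ℕₚ.<-irrefl refl (All.head (Allₚ.++⁻ʳ (map suc C') (subst (All (0 <_)) (sym q) p')))))) D p refl) C (All.universal (λ x → x) C) refl

-- A new last row of size y can only be matched by the empty row of A, so it acts by a horizontal strip.
last-row : ∀ m j y A κ → length A ≡ length κ → All (y + j ≤_) κ →
  NSum (y + j) A (map suc κ ++ y ∷ []) (I m) ≡ ∑ (hS y A) (λ C → NSum j C κ (I m))
last-row m j y A κ l big = begin
  NSum (y + j) A (map suc κ ++ y ∷ []) (I m)
    ≡⟨ sym (S-π-XX (y + j) m A _) ⟩
  -- `NSum` peels off the head of its second list, so the new row is rotated to the front. The sign
  -- of this rotation reappears when 0 is rotated back, and the two cancel.
  _ ≡⟨ S-cong (y + j + m) (λ ρ → trans (cong (λ t → π ρ (y + j) *ℚ (X A ρ *ℚ t)) (Anti-rotate {λ B → X B ρ} (X-Anti ρ) (map suc κ) y))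
         (move (π ρ (y + j)) (X A ρ) (sgn L) (X (y ∷ map suc κ) ρ))) ⟩
  _ ≡⟨ sym (S-*ˡ (sgn L) (y + j + m) _) ⟩
  _ ≡⟨ cong (sgn L *ℚ_) (S-π-XX (y + j) m A (y ∷ map suc κ)) ⟩
  sgn L *ℚ NSum (y + j) A (y ∷ map suc κ) (I m)
    ≡⟨ cong (sgn L *ℚ_) main ⟩
  sgn L *ℚ (sgn L *ℚ ∑ (hS y A) (λ C → NSum j C κ (I m)))
    ≡⟨ trans (sym (ℚₚ.*-assoc (sgn L) (sgn L) _)) (trans (cong (_*ℚ ∑ (hS y A) (λ C → NSum j C κ (I m))) (sgn-sq L)) (ℚₚ.*-identityˡ _)) ⟩
  ∑ (hS y A) (λ C → NSum j C κ (I m)) ∎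
  where
  L = length (map suc κ)
  move : ∀ p x s y → p *ℚ (x *ℚ (s *ℚ y)) ≡ s *ℚ (p *ℚ (x *ℚ y))
  move p x s y = trans (cong (p *ℚ_) (sw x s y)) (sw p s (x *ℚ y))
    where
    sw : ∀ a b c → a *ℚ (b *ℚ c) ≡ b *ℚ (a *ℚ c)
    sw a b c = trans (sym (ℚₚ.*-assoc a b c)) (trans (cong (_*ℚ c) (ℚₚ.*-comm a b)) (ℚₚ.*-assoc b a c))
  t : ℕ → ℕ → ℚ
  t k d = ∑ (sub k y) (λ b' → ∑ (hS k A) (λ C → NSum d C (map suc κ) (λ C' K' → I m C' (b' ∷ K'))))
  positive : ∀ d → d ≤ y + j → ∀ {κ K'} → All (y + j ≤_) κ → Pointwise (λ d' b → b ≤ d' + d) K' (map suc κ) → All (0 <_) K'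
  positive d d≤ {[]}    []       []       = []
  positive d d≤ {k ∷ κ} {k' ∷ K'} (b ∷ bs) (h ∷ hs) = ℕₚ.+-cancelʳ-< d 0 k' (ℕₚ.≤-trans (s≤s (ℕₚ.≤-trans d≤ b)) h) ∷ positive d d≤ bs hs
  -- If the new row keeps a box, all entries stay positive: those of `map suc κ` start above
  -- `y + j`. Then `I-positive` applies.
  off : ∀ k d → k + d ≡ y + j → k ≢ y → t k d ≡ 0ℚ
  off k d e ne = ∑-0 (sub k y) (λ {b'} i → trans (∑hS-cong k A (λ C C≼ → trans (NSum-cong-near d C (map suc κ) (λ C' K' C'≼ K'≼ near →
      I-positive m C' (b' ∷ K') (cong suc (trans (PW.Pointwise-length K'≼) (trans (Listₚ.length-map suc κ) (trans (sym l) (trans (sym (PW.Pointwise-length C≼)) (sym (PW.Pointwise-length C'≼)))))))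
        (nonzero b' (sub-∈ k y i) ∷ positive d (subst (d ≤_) e (ℕₚ.m≤n+m d k)) big near))) (∑-zero (NS d C (map suc κ))))) (∑-zero (hS k A)))
    where
    nonzero : ∀ b' → b' + k ≡ y → 0 < b'
    nonzero zero    q = ⊥-elim (ne q)
    nonzero (suc _) _ = s≤s z≤n
  main : NSum (y + j) A (y ∷ map suc κ) (I m) ≡ sgn L *ℚ ∑ (hS y A) (λ C → NSum j C κ (I m))
  main = begin
    NSum (y + j) A (y ∷ map suc κ) (I m)
      ≡⟨ NSum-∷ (y + j) A y (map suc κ) _ ⟩
    ∑anti (y + j) t
      ≡⟨ ∑anti-only (y + j) y j t refl off ⟩
    t y j
      ≡⟨ trans (cong (λ l → ∑ l (λ b' → ∑ (hS y A) (λ C → NSum j C (map suc κ) (λ C' K' → I m C' (b' ∷ K')))))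
           (trans (cong (sub y) (sym (ℕₚ.+-identityʳ y))) (sub-+ y 0))) (ℚₚ.+-identityʳ _) ⟩
    ∑ (hS y A) (λ C → NSum j C (map suc κ) (λ C' K' → I m C' (0 ∷ K')))
      ≡⟨ ∑-cong (hS y A) (λ C → trans (NSum-suc j C κ (λ C' K' → I m C' (0 ∷ K')) (λ C' P Q → Anti-dup {I m C'} (I-Antiʳ m C') [] 0 P Q))
           (trans (NSum-cong j C κ (λ C' D _ D≼ → trans (sgn-cancel (length (map suc D)) _ _ (Anti-rotate {I m C'} (I-Antiʳ m C') (map suc D) 0))
             (cong₂ _*ℚ_ (cong sgn (trans (Listₚ.length-map suc D) (trans (PW.Pointwise-length D≼) (sym (Listₚ.length-map suc κ))))) (I-padʳ m C' D))))
           (sym (∑-*ˡ (sgn L) (NS j C κ) _)))) ⟩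
    ∑ (hS y A) (λ C → sgn L *ℚ NSum j C κ (I m))
      ≡⟨ sym (∑-*ˡ (sgn L) (hS y A) _) ⟩
    sgn L *ℚ ∑ (hS y A) (λ C → NSum j C κ (I m)) ∎

-- The Kronecker coefficient of (m, q+1) with the two partitions represented by A and B.
D : ℕ → ℕ → List ℕ → List ℕ → ℚ
D q m A B = NSum (suc q) A B (I m) +ℚ -ℚ NSum q A B (I (suc m))

NSum-sym : ∀ k m A B → NSum k A B (I m) ≡ NSum k B A (I m)
NSum-sym k m A B = trans (sym (S-π-XX k m A B)) (trans (S-cong (k + m) (λ ρ → cong (π ρ k *ℚ_) (ℚₚ.*-comm _ _))) (S-π-XX k m B A))

D-sym : ∀ q m A B → D q m A B ≡ D q m B A
D-sym q m A B = cong₂ (λ x y → x +ℚ -ℚ y) (NSum-sym (suc q) m A B) (NSum-sym q (suc m) A B)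

-- Explicit pairs with coefficient at least two

minus-one : ∀ {x} → fromℕ 3 ≤ℚ x → fromℕ 2 ≤ℚ x +ℚ -ℚ 1ℚ
minus-one {x} h = ℚₚ.≤-trans (ℚₚ.≤-reflexive eq) (ℚₚ.+-mono-≤ h ℚₚ.≤-refl)
  where
  eq : fromℕ 2 ≡ fromℕ 3 +ℚ -ℚ 1ℚ
  eq = sym (trans (cong (_+ℚ -ℚ 1ℚ) (ℚₚ.+-comm 1ℚ (fromℕ 2))) (trans (ℚₚ.+-assoc (fromℕ 2) 1ℚ _) (+-zeroʳ (fromℕ 2) (ℚₚ.+-inverseʳ 1ℚ))))

1≤ : ∀ {x} → x ≡ 1ℚ → fromℕ 1 ≤ℚ x
1≤ refl = ℚₚ.≤-reflexive (ℚₚ.+-identityʳ 1ℚ)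

≤-add : ∀ j k {x y} → fromℕ j ≤ℚ x → fromℕ k ≤ℚ y → fromℕ (j + k) ≤ℚ x +ℚ y
≤-add j k h h' = ℚₚ.≤-trans (ℚₚ.≤-reflexive (fromℕ-+ j k)) (ℚₚ.+-mono-≤ h h')

Itl-∷ : ∀ {a c A C} → c ≤ a → All (_< c) A → Itl A C → Itl (a ∷ A) (c ∷ C)
Itl-∷ h []      []             = [ h ]
Itl-∷ h (p ∷ _) [ q ]          = cons h p [ q ]
Itl-∷ h (p ∷ _) (cons x y i)   = cons h p (cons x y i)

Itl-refl : ∀ {A} → Strict A → Itl A A
Itl-refl {[]}    s = []
Itl-refl {a ∷ A} s = Itl-∷ ℕₚ.≤-refl (Strict-head s) (Itl-refl (tail-Strict s))

Itl-++ : ∀ P {R R'} → Strict (P ++ R) → Itl R R' → Itl (P ++ R) (P ++ R')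
Itl-++ []      s i = i
Itl-++ (p ∷ P) s i = Itl-∷ ℕₚ.≤-refl (Strict-head s) (Itl-++ P (tail-Strict s) i)

Strict-++ʳ : ∀ P {R} → Strict (P ++ R) → Strict R
Strict-++ʳ []      s = s
Strict-++ʳ (p ∷ P) s = Strict-++ʳ P (tail-Strict s)

Strict-replace : ∀ P {y Q R} → Strict (P ++ y ∷ Q) → All (_≤ y) R → Strict R → Strict (P ++ R)
Strict-replace []      s h sR = sR
Strict-replace (p ∷ P) s h sR = Strict-∷ (Allₚ.++⁺ (Allₚ.++⁻ˡ P (Strict-head s))
  (All.map (λ q → ℕₚ.≤-<-trans q (All.head (Allₚ.++⁻ʳ P (Strict-head s)))) h)) (Strict-replace P (tail-Strict s) h sR)

≢-at : ∀ P {x y : ℕ} {Q R} → x ≢ y → P ++ x ∷ Q ≢ P ++ y ∷ R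
≢-at P ne e = ne (Listₚ.∷-injectiveˡ (Listₚ.++-cancelˡ P _ _ e))

n≢1+n : ∀ {n} → n ≢ suc n
n≢1+n {n} e = ℕₚ.<-irrefl e (ℕₚ.n<1+n n)

module _ (q m : ℕ) where

  -- The given partition is the second list; the first arises by moving `suc q` boxes from its first
  -- row to its second. The three units come from the second row, the last row and the first row.
  long-first-row : ∀ a b R w → let A' = (b + suc q) ∷ R ++ suc w ∷ [] in
    Strict (b ∷ R ++ suc w ∷ []) → suc (b + suc q) < a →
    sum (a ∷ A') ≡ suc (suc q) + m + tri (suc (length A')) →
    fromℕ 2 ≤ℚ D (suc q) m (a ∷ A') ((a + suc q) ∷ b ∷ R ++ suc w ∷ [])
  long-first-row (suc a) b R w st (s≤s gap) sm rewrite ℕₚ.+-suc b q =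
    ℚₚ.≤-trans (minus-one (≤-add 2 1 two (1≤ (F.top-1 a refl
      (Itl-∷ (ℕₚ.n≤1+n a) (gap ∷ All.map (λ h → ℕₚ.<-trans h (ℕₚ.≤-<-trans b≤ gap)) (Strict-head st)) rows)))))
      (ℚₚ.≤-reflexive (sym F.D))
    where
    W = R ++ suc w ∷ []
    W⁻ = R ++ w ∷ []
    b≤ : b ≤ suc (b + q)
    b≤ = ℕₚ.≤-trans (ℕₚ.m≤m+n b q) (ℕₚ.n≤1+n _)
    sW⁻ : Strict W⁻
    sW⁻ = Strict-replace R (tail-Strict st) (ℕₚ.n≤1+n w ∷ []) [-]
    W<b = Strict-head st
    W⁻<b : All (_< b) W⁻
    W⁻<b = Allₚ.++⁺ (Allₚ.++⁻ˡ R W<b) (ℕₚ.<-trans (ℕₚ.n<1+n w) (All.head (Allₚ.++⁻ʳ R W<b)) ∷ [])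
    rows : Itl (suc (b + q) ∷ W) (b ∷ W)
    rows = Itl-∷ b≤ W<b (Itl-refl (tail-Strict st))
    all< : ∀ {x W} → All (_< b) W → x ≤ suc (b + q) → All (_< suc a) (x ∷ W)
    all< p h = s≤s (ℕₚ.≤-trans h (ℕₚ.<⇒≤ gap)) ∷ All.map (λ h → ℕₚ.<-trans h (s≤s (ℕₚ.≤-trans b≤ (ℕₚ.<⇒≤ gap)))) p
    module F = FirstRow (suc q) m (suc a) (suc (b + q) ∷ W) (b ∷ W)
      (Itl-∷ ℕₚ.≤-refl (all< W<b ℕₚ.≤-refl) rows)
      (trans (solve 3 (λ b s q → b :+ s :+ (con 1 :+ q) := con 1 :+ (b :+ q) :+ s) refl b (sum W) q) refl) sm
    A₂ = suc a ∷ (b + q) ∷ W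
    Aₗ = suc a ∷ suc (b + q) ∷ W⁻
    A₂∈ : A₂ ∈ T 1 F.A
    A₂∈ = T1-∈ (suc a ∷ []) (b + q) W
    Aₗ∈ : Aₗ ∈ T 1 F.A
    Aₗ∈ = T1-∈ (suc a ∷ suc (b + q) ∷ R) w []
    K∈ : b ∷ W⁻ ∈ T 1 (b ∷ W)
    K∈ = T1-∈ (b ∷ R) w []
    two : fromℕ 2 ≤ℚ ∑ (T 1 F.A) F.lowered
    two = ℚₚ.≤-trans (≤-add 1 1
      (ℚₚ.≤-trans (1≤ (F.exhibit A₂∈ K∈ (Itl-∷ ℕₚ.≤-refl (all< W<b (ℕₚ.n≤1+n _)) (Itl-∷ (ℕₚ.m≤m+n b q) W<b (Itl-++ R (tail-Strict st) [ ℕₚ.n≤1+n w ])))))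
        (∑-≥₁ (T 1 (b ∷ W)) (F.strip≥0 A₂∈) K∈))
      (ℚₚ.≤-trans (1≤ (F.exhibit Aₗ∈ K∈ (Itl-∷ ℕₚ.≤-refl (all< W⁻<b ℕₚ.≤-refl) (Itl-∷ b≤ W⁻<b (Itl-refl sW⁻)))))
        (∑-≥₁ (T 1 (b ∷ W)) (F.strip≥0 Aₗ∈) K∈)))
      (∑-≥₂ (T 1 F.A) F.lowered≥0 A₂∈ Aₗ∈ (≢-at (suc a ∷ []) n≢1+n))

  -- A two-rowed partition lacks the nonempty third row of `long-first-row`. One of the moved boxes
  -- therefore starts a third row, and the others go to the second.
  long-first-of-two : ∀ a b → let b₂ = suc (suc b) ; A' = (b₂ + suc q) ∷ 1 ∷ [] in
    suc (b₂ + suc q) < a → sum (a ∷ A') ≡ suc (suc q) + m + 3 →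
    fromℕ 2 ≤ℚ D (suc q) m (a ∷ A') ((a + suc q) ∷ suc b₂ ∷ 0 ∷ [])
  long-first-of-two (suc a) b (s≤s gap) sm rewrite ℕₚ.+-suc b q =
    ℚₚ.≤-trans (minus-one (≤-add 2 1 two (1≤ (F.top-1 a refl
      (Itl-∷ (ℕₚ.n≤1+n a) (gap ∷ ℕₚ.≤-trans (s≤s (s≤s z≤n)) gap ∷ []) rows)))))
      (ℚₚ.≤-reflexive (sym F.D))
    where
    b₂ = suc (suc b)
    rows : Itl (suc (b₂ + q) ∷ 1 ∷ []) (suc b₂ ∷ 0 ∷ [])
    rows = cons (s≤s (ℕₚ.m≤m+n b₂ q)) (s≤s (s≤s z≤n)) [ z≤n ]
    module F = FirstRow (suc q) m (suc a) (suc (b₂ + q) ∷ 1 ∷ []) (suc b₂ ∷ 0 ∷ [])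
      (Itl-∷ ℕₚ.≤-refl (ℕₚ.m≤n⇒m≤1+n gap ∷ s≤s (ℕₚ.≤-trans (s≤s z≤n) gap) ∷ []) rows)
      (solve 2 (λ b q → con 3 :+ b :+ (con 0 :+ con 0) :+ (con 1 :+ q) := con 1 :+ (con 2 :+ b :+ q) :+ con 1) refl b q) sm
    A₂ = suc a ∷ (b₂ + q) ∷ 1 ∷ []
    A₃ = suc a ∷ suc (b₂ + q) ∷ 0 ∷ []
    A₂∈ : A₂ ∈ T 1 F.A
    A₂∈ = T1-∈ (suc a ∷ []) (b₂ + q) (1 ∷ [])
    A₃∈ : A₃ ∈ T 1 F.A
    A₃∈ = T1-∈ (suc a ∷ suc (b₂ + q) ∷ []) 0 []
    K∈ : b₂ ∷ 0 ∷ [] ∈ T 1 (suc b₂ ∷ 0 ∷ [])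
    K∈ = T1-∈ [] b₂ (0 ∷ [])
    two : fromℕ 2 ≤ℚ ∑ (T 1 F.A) F.lowered
    two = ℚₚ.≤-trans (≤-add 1 1
      (ℚₚ.≤-trans (1≤ (F.exhibit A₂∈ K∈ (cons ℕₚ.≤-refl (ℕₚ.<-trans (ℕₚ.n<1+n _) (ℕₚ.m≤n⇒m≤1+n gap)) (cons (ℕₚ.m≤m+n b₂ q) (s≤s (s≤s z≤n)) [ z≤n ]))))
        (∑-≥₁ (T 1 (suc b₂ ∷ 0 ∷ [])) (F.strip≥0 A₂∈) K∈))
      (ℚₚ.≤-trans (1≤ (F.exhibit A₃∈ K∈ (cons ℕₚ.≤-refl (ℕₚ.m≤n⇒m≤1+n gap) (cons (ℕₚ.≤-trans (ℕₚ.m≤m+n b₂ q) (ℕₚ.n≤1+n _)) (s≤s z≤n) [ z≤n ]))))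
        (∑-≥₁ (T 1 (suc b₂ ∷ 0 ∷ [])) (F.strip≥0 A₃∈) K∈)))
      (∑-≥₂ (T 1 F.A) F.lowered≥0 A₂∈ A₃∈ (≢-at (suc a ∷ []) n≢1+n))

-- A removable box in a row above the rows `R`: either in the first row `a` or in a row of `P`.
data Drop (a : ℕ) : List ℕ → List ℕ → Set where
  first : ∀ {P R} b → a ≡ suc b → All (_< b) (P ++ R) → Drop a P R
  later : ∀ {R} P₁ s P₂ → Strict (s ∷ P₂ ++ R) → Drop a (P₁ ++ suc s ∷ P₂) R

-- The excluded equality says that all rows from the first down to `u` have the same length;
-- otherwise some row above `u` is longer than its successor.
find-drop : ∀ a P u V → Strict (a ∷ P ++ u ∷ V) → a ≢ u + suc (length P) → Drop a P (u ∷ V)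
find-drop zero [] u V (() ∷ _) ne
find-drop zero (p ∷ P) u V (() ∷ _) ne
find-drop (suc a) [] u V st ne with Strict-head st
... | s≤s u≤a ∷ _ = first a refl (u<a ∷ All.map (λ h → ℕₚ.<-trans h u<a) (Strict-head (tail-Strict st)))
  where
  u<a : u < a
  u<a = ℕₚ.≤∧≢⇒< u≤a (λ e → ne (trans (cong suc (sym e)) (ℕₚ.+-comm 1 u)))
find-drop (suc a) (p ∷ P) u V st ne with Strict-head st
... | s≤s p≤a ∷ _ with p ℕₚ.≟ a
... | no p≢a = first a refl (p<a ∷ All.map (λ h → ℕₚ.<-trans h p<a) (Strict-head (tail-Strict st)))
  where
  p<a : p < a
  p<a = ℕₚ.≤∧≢⇒< p≤a p≢a
... | yes refl with find-drop p P u V (tail-Strict st) (λ e → ne (trans (cong suc e) (sym (ℕₚ.+-suc u (suc (length P))))))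
...   | first b refl h = later [] b P (Strict-∷ h (tail-Strict (tail-Strict st)))
...   | later P₁ s P₂ h = later (p ∷ P₁) s P₂ h

-- The strip that moves the rows up empties the last row, so it is still a strip after this row has
-- lost a box.
Itl-pad⁻ : ∀ v V w → Strict (v ∷ V ++ suc w ∷ []) → Itl (v ∷ V ++ w ∷ []) (pad (V ++ suc w ∷ []))
Itl-pad⁻ v []       w (h ∷ _) = cons h (ℕₚ.m≤n⇒m≤1+n (ℕₚ.n<1+n w)) [ z≤n ]
Itl-pad⁻ v (v' ∷ []) w (h ∷ st) = cons h (ℕₚ.n<1+n v') (Itl-pad⁻ v' [] w st)
Itl-pad⁻ v (v' ∷ x ∷ V) w (h ∷ st) = cons h (ℕₚ.n<1+n v') (Itl-pad⁻ v' (x ∷ V) w st)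

data LastView : List ℕ → Set where
  snoc : ∀ V w → LastView (V ++ suc w ∷ [])

last-view : ∀ v V → All (0 <_) (v ∷ V) → LastView (v ∷ V)
last-view (suc v) []      _       = snoc [] v
last-view v       (x ∷ V) (_ ∷ p) with last-view x V p
... | view = go view
  where
  go : ∀ {W} → LastView W → LastView (v ∷ W)
  go (snoc V w) = snoc (v ∷ V) w

module _ (q m a : ℕ) where

  Result : List ℕ → Set
  Result A' = ∃ λ K → Itl (a ∷ A') (a ∷ K) × sum K + suc q ≡ sum A' × fromℕ 2 ≤ℚ D (suc q) m (a ∷ A') ((a + suc q) ∷ K)

  -- The whole strip comes from the row `u + suc q`, which stays well above the next one. The free
  -- unit may meet this row in both partitions, the last row in both, or this row in λ and the last
  -- row in ν.
  wide-gap : ∀ P u v V w → let A' = P ++ (u + suc q) ∷ v ∷ V in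
    v ∷ V ≡ w → LastView w → Strict (a ∷ A') → suc v < u →
    sum (a ∷ A') ≡ suc (suc q) + m + tri (suc (length A')) → Result A'
  wide-gap P (suc u) v V .(V' ++ suc w ∷ []) eq (snoc V' w) st (s≤s v<u) sm
    rewrite ℕₚ.+-suc u q | eq =
    K , rows (suc (suc (u + q))) (suc u) st ℕₚ.≤-refl (ℕₚ.≤-trans (ℕₚ.m≤m+n (suc u) q) (ℕₚ.n≤1+n _)) (ℕₚ.n≤1+n _) (Itl-refl sW) W<u , sK ,
      ℚₚ.≤-trans (minus-one (≤-add 3 0 three F.top≥0)) (ℚₚ.≤-reflexive (sym F.D))
    where
    W = V' ++ suc w ∷ []
    W⁻ = V' ++ w ∷ []
    K = P ++ suc u ∷ W
    sW : Strict W
    sW = tail-Strict (Strict-++ʳ (a ∷ P) st)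
    sW⁻ : Strict W⁻
    sW⁻ = Strict-replace V' sW (ℕₚ.n≤1+n w ∷ []) [-]
    W≤v : All (_≤ v) W
    W≤v = subst (All (_≤ v)) eq (ℕₚ.≤-refl ∷ All.map ℕₚ.<⇒≤ (Strict-head (subst Strict (sym eq) sW)))
    W<u : All (_< u) W
    W<u = All.map (λ h → ℕₚ.≤-<-trans h v<u) W≤v
    W⁻<u : All (_< u) W⁻
    W⁻<u = Allₚ.++⁺ (Allₚ.++⁻ˡ V' W<u) (ℕₚ.<-trans (ℕₚ.n<1+n w) (All.head (Allₚ.++⁻ʳ V' W<u)) ∷ [])
    rows : ∀ x y → Strict (a ∷ P ++ suc (suc (u + q)) ∷ W) → x ≤ suc (suc (u + q)) → y ≤ x → u ≤ y → ∀ {W₁ W₂} → Itl W₁ W₂ → All (_< u) W₁ →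
      Itl (a ∷ P ++ x ∷ W₁) (a ∷ P ++ y ∷ W₂)
    rows x y st x≤ y≤ u≤y {W₁} i p = Itl-++ (a ∷ P)
      (Strict-replace (a ∷ P) st (x≤ ∷ All.map (λ h → ℕₚ.≤-trans (ℕₚ.<⇒≤ h) (ℕₚ.≤-trans u≤y (ℕₚ.≤-trans y≤ x≤))) p)
        (Strict-∷ (All.map (λ h → ℕₚ.<-≤-trans h (ℕₚ.≤-trans u≤y y≤)) p) (Itl-Strictˡ i)))
      (Itl-∷ y≤ (All.map (λ h → ℕₚ.<-≤-trans h u≤y) p) i)
    sK : sum K + suc q ≡ sum (P ++ suc (suc (u + q)) ∷ W)
    sK = trans (cong (_+ suc q) (sum-++ P _)) (trans (solve 4 (λ p u w q → p :+ (con 1 :+ u :+ w) :+ (con 1 :+ q) := p :+ (con 2 :+ (u :+ q) :+ w)) refl (sum P) u (sum W) q) (sym (sum-++ P _)))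
    module F = FirstRow (suc q) m a (P ++ suc (suc (u + q)) ∷ W) K
      (rows (suc (suc (u + q))) (suc u) st ℕₚ.≤-refl (ℕₚ.≤-trans (ℕₚ.m≤m+n (suc u) q) (ℕₚ.n≤1+n _)) (ℕₚ.n≤1+n _) (Itl-refl sW) W<u) sK sm
    Aᵣ = a ∷ P ++ suc (u + q) ∷ W
    Aₗ = a ∷ P ++ suc (suc (u + q)) ∷ W⁻
    Aᵣ∈ : Aᵣ ∈ T 1 F.A
    Aᵣ∈ = T1-∈ (a ∷ P) (suc (u + q)) W
    Aₗ∈ : Aₗ ∈ T 1 F.A
    Aₗ∈ = subst₂ (λ x y → x ∈ T 1 y) (Listₚ.++-assoc (a ∷ P) _ _) (Listₚ.++-assoc (a ∷ P) _ _) (T1-∈ ((a ∷ P) ++ suc (suc (u + q)) ∷ V') w [])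
    Kᵣ∈ : P ++ u ∷ W ∈ T 1 K
    Kᵣ∈ = T1-∈ P u W
    Kₗ∈ : P ++ suc u ∷ W⁻ ∈ T 1 K
    Kₗ∈ = subst₂ (λ x y → x ∈ T 1 y) (Listₚ.++-assoc P _ _) (Listₚ.++-assoc P _ _) (T1-∈ (P ++ suc u ∷ V') w [])
    three : fromℕ 3 ≤ℚ ∑ (T 1 F.A) F.lowered
    three = ℚₚ.≤-trans (≤-add 2 1
      (ℚₚ.≤-trans (≤-add 1 1
        (1≤ (F.exhibit Aᵣ∈ Kᵣ∈ (rows (suc (u + q)) u st (ℕₚ.n≤1+n _) (ℕₚ.≤-trans (ℕₚ.m≤m+n u q) (ℕₚ.n≤1+n _)) ℕₚ.≤-refl (Itl-refl sW) W<u)))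
        (1≤ (F.exhibit Aᵣ∈ Kₗ∈ (rows (suc (u + q)) (suc u) st (ℕₚ.n≤1+n _) (s≤s (ℕₚ.m≤m+n u q)) (ℕₚ.n≤1+n u) (Itl-++ V' sW [ ℕₚ.n≤1+n w ]) W<u))))
        (∑-≥₂ (T 1 K) (F.strip≥0 Aᵣ∈) Kᵣ∈ Kₗ∈ (≢-at P n≢1+n)))
      (ℚₚ.≤-trans (1≤ (F.exhibit Aₗ∈ Kₗ∈ (rows (suc (suc (u + q))) (suc u) st ℕₚ.≤-refl (ℕₚ.≤-trans (ℕₚ.m≤m+n (suc u) q) (ℕₚ.n≤1+n _)) (ℕₚ.n≤1+n u) (Itl-refl sW⁻) W⁻<u)))
        (∑-≥₁ (T 1 K) (F.strip≥0 Aₗ∈) Kₗ∈)))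
      (∑-≥₂ (T 1 F.A) F.lowered≥0 Aᵣ∈ Aₗ∈ (≢-at (a ∷ P) n≢1+n))

  -- Two units come from removing a box in the rows u ∷ V, a third one from a drop above row u;
  -- subtracting the unit of NSum q leaves at least two.
  module WithDrop (P : List ℕ) (u : ℕ) (V : List ℕ) (x : ℕ) (W : List ℕ)
    (st : Strict (a ∷ P ++ u ∷ V)) (i : Itl (u ∷ V) (x ∷ W)) (s : sum (x ∷ W) + suc q ≡ sum (u ∷ V))
    (sm : sum (a ∷ P ++ u ∷ V) ≡ suc (suc q) + m + tri (suc (length (P ++ u ∷ V)))) where

    K = P ++ x ∷ W

    rows : Itl (a ∷ P ++ u ∷ V) (a ∷ K)
    rows = Itl-++ (a ∷ P) st i

    sK : sum K + suc q ≡ sum (P ++ u ∷ V)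
    sK = trans (cong (_+ suc q) (sum-++ P _)) (trans (ℕₚ.+-assoc (sum P) _ _) (trans (cong (sum P +_) s) (sym (sum-++ P _))))

    module F = FirstRow (suc q) m a (P ++ u ∷ V) K rows sK sm

    -- A total of two contributed by boxes removed from the rows u ∷ V.
    Two : Set
    Two = (∃ λ R → R ∈ T 1 (u ∷ V) × fromℕ 2 ≤ℚ F.lowered (a ∷ P ++ R)) ⊎
          (∃ λ R → ∃ λ R' → R ∈ T 1 (u ∷ V) × R' ∈ T 1 (u ∷ V) × R ≢ R' × fromℕ 1 ≤ℚ F.lowered (a ∷ P ++ R) × fromℕ 1 ≤ℚ F.lowered (a ∷ P ++ R'))

    T1-++ : ∀ P {R R'} → R' ∈ T 1 R → P ++ R' ∈ T 1 (P ++ R)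
    T1-++ []      i = i
    T1-++ (p ∷ P) i = T-∈-∷ 1 p _ (T1-++ P i)

    result : Two → Drop a P (u ∷ V) → fromℕ 2 ≤ℚ D (suc q) m (a ∷ P ++ u ∷ V) ((a + suc q) ∷ K)
    -- A drop in the first row supplies the third unit as `top`. A drop in a later row supplies it
    -- by removing the same box from both partitions.
    result two (first b eq h) = ℚₚ.≤-trans (minus-one (≤-add 2 1 (both two) (1≤ (F.top-1 b eq
        (Itl-∷ (subst (b ≤_) (sym eq) (ℕₚ.n≤1+n b)) h (Itl-++ P (tail-Strict st) i)))))) (ℚₚ.≤-reflexive (sym F.D))
      where
      both : Two → fromℕ 2 ≤ℚ ∑ (T 1 F.A) F.lowered
      both (inj₁ (R , j , h)) = ℚₚ.≤-trans h (∑-≥₁ (T 1 F.A) F.lowered≥0 (T1-++ (a ∷ P) j))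
      both (inj₂ (R , R' , j , j' , ne , h , h')) = ℚₚ.≤-trans (≤-add 1 1 h h')
        (∑-≥₂ (T 1 F.A) F.lowered≥0 (T1-++ (a ∷ P) j) (T1-++ (a ∷ P) j') (λ e → ne (Listₚ.++-cancelˡ (a ∷ P) _ _ e)))
    result two (later P₁ t P₂ st') = ℚₚ.≤-trans (minus-one (≤-add 3 0 (all two) F.top≥0)) (ℚₚ.≤-reflexive (sym F.D))
      where
      As = a ∷ P₁ ++ t ∷ P₂ ++ u ∷ V
      Ks = P₁ ++ t ∷ P₂ ++ x ∷ W
      assoc : ∀ (X : List ℕ) → (P₁ ++ suc t ∷ P₂) ++ X ≡ P₁ ++ suc t ∷ P₂ ++ X
      assoc X = Listₚ.++-assoc P₁ (suc t ∷ P₂) X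
      As∈ : As ∈ T 1 F.A
      As∈ = subst (λ Y → As ∈ T 1 (a ∷ Y)) (sym (assoc (u ∷ V))) (T1-∈ (a ∷ P₁) t (P₂ ++ u ∷ V))
      Ks∈ : Ks ∈ T 1 K
      Ks∈ = subst (λ Y → Ks ∈ T 1 Y) (sym (assoc (x ∷ W))) (T1-∈ P₁ t (P₂ ++ x ∷ W))
      stA : Strict As
      stA = Strict-replace (a ∷ P₁) (subst (λ Y → Strict (a ∷ Y)) (assoc (u ∷ V)) st)
        (ℕₚ.n≤1+n t ∷ All.map (λ h → ℕₚ.≤-trans (ℕₚ.<⇒≤ h) (ℕₚ.n≤1+n t)) (Strict-head st')) st'
      itl : Itl As (a ∷ Ks)
      itl = subst₂ (λ X Y → Itl (a ∷ X) (a ∷ Y)) (Listₚ.++-assoc P₁ (t ∷ P₂) _) (Listₚ.++-assoc P₁ (t ∷ P₂) _)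
        (Itl-++ (a ∷ P₁ ++ t ∷ P₂) (subst (λ Y → Strict (a ∷ Y)) (sym (Listₚ.++-assoc P₁ (t ∷ P₂) _)) stA) i)
      one : fromℕ 1 ≤ℚ F.lowered As
      one = ℚₚ.≤-trans (1≤ (F.exhibit As∈ Ks∈ itl)) (∑-≥₁ (T 1 K) (F.strip≥0 As∈) Ks∈)
      differ : ∀ R → As ≢ a ∷ (P₁ ++ suc t ∷ P₂) ++ R
      differ R e = ≢-at (a ∷ P₁) n≢1+n (trans e (cong (a ∷_) (assoc R)))
      all : Two → fromℕ 3 ≤ℚ ∑ (T 1 F.A) F.lowered
      all (inj₁ (R , j , h)) = ℚₚ.≤-trans (≤-add 1 2 one h) (∑-≥₂ (T 1 F.A) F.lowered≥0 As∈ (T1-++ (a ∷ P₁ ++ suc t ∷ P₂) j) (differ R))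
      all (inj₂ (R , R' , j , j' , ne , h , h')) = ℚₚ.≤-trans (≤-add 1 2 one (≤-add 1 1 h h'))
        (∑-≥₃ (T 1 F.A) F.lowered≥0 As∈ (T1-++ (a ∷ P₁ ++ suc t ∷ P₂) j) (T1-++ (a ∷ P₁ ++ suc t ∷ P₂) j') (differ R) (differ R')
          (λ e → ne (Listₚ.++-cancelˡ (a ∷ P₁ ++ suc t ∷ P₂) _ _ e)))

  -- Remove the bottom boxes of the first columns: all rows below u shift up by one.
  narrow-gap : ∀ P u v V w x → let A' = P ++ suc u ∷ v ∷ V in
    V ≡ w → (v ∷ w ≡ [] ⊎ LastView (v ∷ w)) → Strict (a ∷ A') → v < x → x ≤ u →
    suc x + (length V + suc q) ≡ suc u + v →
    sum (a ∷ A') ≡ suc (suc q) + m + tri (suc (length A')) → Drop a P (suc u ∷ v ∷ V) → Result A'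
  narrow-gap P u v V .V x refl (inj₁ ()) st v<x x≤u sx sm dr
  narrow-gap P u v V .V x refl (inj₂ view) st v<x x≤u sx sm dr =
    G.K , G.rows , G.sK , G.result (inj₂ two) dr
    where
    sV : Strict (v ∷ V)
    sV = tail-Strict (Strict-++ʳ (a ∷ P) st)
    V<x : All (_< x) (v ∷ V)
    V<x = v<x ∷ All.map (λ h → ℕₚ.<-trans h v<x) (Strict-head sV)
    itl : Itl (suc u ∷ v ∷ V) (suc x ∷ pad V)
    itl = Itl-∷ (s≤s x≤u) (All.map ℕₚ.m≤n⇒m≤1+n V<x) (Itl-pad sV)
    s : sum (suc x ∷ pad V) + suc q ≡ sum (suc u ∷ v ∷ V)
    s = trans (cong (λ t → suc x + t + suc q) (sum-pad V)) (trans (solve 4 (λ x l s q → x :+ (l :+ s) :+ q := x :+ (l :+ q) :+ s) refl (suc x) (length V) (sum V) (suc q))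
          (trans (cong (_+ sum V) sx) (ℕₚ.+-assoc (suc u) v (sum V))))
    module G = WithDrop P (suc u) (v ∷ V) (suc x) (pad V) st itl s sm
    Kᵣ∈ : P ++ x ∷ pad V ∈ T 1 G.K
    Kᵣ∈ = T1-∈ P x (pad V)
    lower : ∀ {R} → R ∈ T 1 (suc u ∷ v ∷ V) → Itl R (x ∷ pad V) → All (_≤ suc u) R → fromℕ 1 ≤ℚ G.F.lowered (a ∷ P ++ R)
    lower {R} j il p = ℚₚ.≤-trans (1≤ (G.F.exhibit R∈ Kᵣ∈ (Itl-++ (a ∷ P) (Strict-replace (a ∷ P) st p (Itl-Strictˡ il)) il)))
      (∑-≥₁ (T 1 G.K) (G.F.strip≥0 R∈) Kᵣ∈)
      where
      R∈ : a ∷ P ++ R ∈ T 1 G.F.A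
      R∈ = G.T1-++ (a ∷ P) j
    two : ∃ λ R → ∃ λ R' → R ∈ T 1 (suc u ∷ v ∷ V) × R' ∈ T 1 (suc u ∷ v ∷ V) × R ≢ R' × fromℕ 1 ≤ℚ G.F.lowered (a ∷ P ++ R) × fromℕ 1 ≤ℚ G.F.lowered (a ∷ P ++ R')
    -- λ loses a box of row `u` or of its last row; in both cases the other list loses the box of
    -- row `u`.
    two = u ∷ v ∷ V , suc u ∷ proj₁ last , T1-∈ [] u (v ∷ V) , T-∈-∷ 1 (suc u) (v ∷ V) (proj₁ (proj₂ last)) , (λ e → n≢1+n (Listₚ.∷-injectiveˡ e)) ,
      lower (T1-∈ [] u (v ∷ V)) (Itl-∷ x≤u V<x (Itl-pad sV)) (ℕₚ.n≤1+n u ∷ All.map (λ h → ℕₚ.≤-trans (ℕₚ.<⇒≤ h) (ℕₚ.≤-trans x≤u (ℕₚ.n≤1+n u))) V<x) ,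
      lower (T-∈-∷ 1 (suc u) (v ∷ V) (proj₁ (proj₂ last)))
        (Itl-∷ (ℕₚ.≤-trans x≤u (ℕₚ.n≤1+n u)) (V⁻<x (proj₁ (proj₂ last))) (proj₂ (proj₂ last)))
        (ℕₚ.≤-refl ∷ All.map (λ h → ℕₚ.≤-trans (ℕₚ.<⇒≤ h) (ℕₚ.≤-trans x≤u (ℕₚ.n≤1+n u))) (V⁻<x (proj₁ (proj₂ last))))
      where
      V⁻<x : ∀ {R} → R ∈ T 1 (v ∷ V) → All (_< x) R
      V⁻<x j = ≼-All< (T-≼ 1 (v ∷ V) j) V<x
      lowered : ∀ {v V Y} → LastView Y → Y ≡ v ∷ V → Strict (v ∷ V) → ∃ λ R → R ∈ T 1 (v ∷ V) × Itl R (pad V)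
      lowered (snoc [] w)       refl st = w ∷ [] , T1-∈ [] w [] , [ z≤n ]
      lowered (snoc (v ∷ V') w) refl st = v ∷ V' ++ w ∷ [] , T1-∈ (v ∷ V') w [] , Itl-pad⁻ v V' w st
      last = lowered view refl sV

  -- The strip is cut from the last row. When λ loses one more box there, ν may lose a box of its
  -- shortened last row or of the row `y` above: two units, and the drop gives the third.
  long-last-row : ∀ P y u → let A' = P ++ y ∷ (suc u + suc q) ∷ [] in
    Strict (a ∷ A') → sum (a ∷ A') ≡ suc (suc q) + m + tri (suc (length A')) →
    Drop a (P ++ y ∷ []) ((suc u + suc q) ∷ []) → Result A'
  long-last-row P y u st sm dr rewrite ℕₚ.+-suc u q | sym (Listₚ.++-assoc P (y ∷ []) (suc (suc (u + q)) ∷ [])) =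
    G.K , G.rows , G.sK , G.result (inj₁ (suc (u + q) ∷ [] , here refl , two y st dr)) dr
    where
    Py = P ++ y ∷ []
    zᵤ = suc (suc (u + q))
    module G = WithDrop Py zᵤ [] (suc u) [] st
      [ ℕₚ.≤-trans (ℕₚ.m≤m+n (suc u) q) (ℕₚ.n≤1+n _) ]
      (solve 2 (λ u q → con 1 :+ u :+ con 0 :+ (con 1 :+ q) := con 2 :+ (u :+ q) :+ con 0) refl u q) sm
    Aₗ∈ : a ∷ Py ++ suc (u + q) ∷ [] ∈ T 1 G.F.A
    Aₗ∈ = T1-∈ (a ∷ Py) (suc (u + q)) []
    stₗ : Strict (a ∷ Py ++ suc (u + q) ∷ [])
    stₗ = Strict-replace (a ∷ Py) st (ℕₚ.n≤1+n _ ∷ []) [-]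
    two : ∀ y' → Strict (a ∷ (P ++ y ∷ []) ++ zᵤ ∷ []) → Drop a (P ++ y ∷ []) (zᵤ ∷ []) → fromℕ 2 ≤ℚ G.F.lowered (a ∷ Py ++ suc (u + q) ∷ [])
    two _ _ _ = go y refl
      where
      go : ∀ y' → y ≡ y' → fromℕ 2 ≤ℚ G.F.lowered (a ∷ Py ++ suc (u + q) ∷ [])
      go zero e = ⊥-elim (ℕₚ.n≮0 (subst (zᵤ <_) e (All.head (Strict-head (Strict-++ʳ (a ∷ P) (subst (λ Y → Strict (a ∷ Y)) (Listₚ.++-assoc P (y ∷ []) (zᵤ ∷ [])) st))))))
      go (suc y') e = ℚₚ.≤-trans (≤-add 1 1
          (1≤ (G.F.exhibit Aₗ∈ K₁∈ (Itl-++ (a ∷ Py) stₗ [ ℕₚ.≤-trans (ℕₚ.m≤m+n u q) (ℕₚ.n≤1+n _) ])))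
          (1≤ (G.F.exhibit Aₗ∈ K₂∈ itl₂)))
          (∑-≥₂ (T 1 G.K) (G.F.strip≥0 Aₗ∈) K₁∈ K₂∈ differ)
        where
        K₁∈ : Py ++ u ∷ [] ∈ T 1 G.K
        K₁∈ = T1-∈ Py u []
        K₂ = P ++ y' ∷ suc u ∷ []
        K₂∈ : K₂ ∈ T 1 G.K
        K₂∈ = subst (λ Y → K₂ ∈ T 1 Y) (trans (cong (λ t → P ++ t ∷ suc u ∷ []) (sym e)) (sym (Listₚ.++-assoc P (y ∷ []) _))) (T1-∈ P y' (suc u ∷ []))
        zᵤ<y : zᵤ < y
        zᵤ<y = All.head (Strict-head (Strict-++ʳ (a ∷ P) (subst (λ Y → Strict (a ∷ Y)) (Listₚ.++-assoc P (y ∷ []) (zᵤ ∷ [])) st)))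
        itl₂ : Itl (a ∷ Py ++ suc (u + q) ∷ []) (a ∷ K₂)
        itl₂ = subst (λ Y → Itl (a ∷ Y) (a ∷ K₂)) (sym (Listₚ.++-assoc P (y ∷ []) _))
          (Itl-++ (a ∷ P) (subst (λ Y → Strict (a ∷ Y)) (Listₚ.++-assoc P (y ∷ []) _) stₗ)
            (cons (subst (y' ≤_) (sym e) (ℕₚ.n≤1+n y')) (ℕₚ.≤-pred (subst (zᵤ <_) e zᵤ<y)) [ s≤s (ℕₚ.m≤m+n u q) ]))
        differ : Py ++ u ∷ [] ≢ K₂
        differ q' = ≢-at P (λ q″ → n≢1+n (trans (sym q″) e)) (trans (sym (Listₚ.++-assoc P (y ∷ []) _)) q')

-- With two rows there is no row `y` as in `long-last-row`, so the `suc q` boxes cut from the second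
-- row become a new third row. `last-row` absorbs it, and the free unit can be placed in three ways.
two-rows : ∀ q m x c → suc q < c → suc (c + suc q) < x → sum (x ∷ (c + suc q) ∷ []) ≡ suc (suc q) + m + 1 →
  fromℕ 2 ≤ℚ D (suc q) m (x ∷ (c + suc q) ∷ []) (suc x ∷ suc c ∷ suc q ∷ [])
two-rows q m zero    c       _       () _
two-rows q m (suc x) (suc c) q<c gap sm =
  ℚₚ.≤-trans (minus-one three) (ℚₚ.≤-reflexive (sym eq))
  where
  b = c + suc q
  A = suc x ∷ suc b ∷ []
  κ = suc x ∷ suc c ∷ []
  big : ∀ j → j ≤ suc (suc q) → All (j ≤_) κ
  big j h = ℕₚ.≤-trans h (ℕₚ.≤-trans q<c (ℕₚ.≤-trans (s≤s (ℕₚ.m≤m+n c (suc q))) (ℕₚ.≤-trans (ℕₚ.n≤1+n _) (ℕₚ.<⇒≤ gap)))) ∷ ℕₚ.≤-trans h q<c ∷ []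
  b<x : suc b < x
  b<x = ℕₚ.≤-pred gap
  N₁ : NSum (suc (suc q)) A (map suc κ ++ suc q ∷ []) (I m) ≡ ∑ (T 1 A) (λ A' → ∑ (T 1 κ) (λ κ' → strip m (suc q) A' κ'))
  N₁ = begin
    NSum (suc (suc q)) A (map suc κ ++ suc q ∷ []) (I m)
      ≡⟨ cong (λ k → NSum k A (map suc κ ++ suc q ∷ []) (I m)) (ℕₚ.+-comm 1 (suc q)) ⟩
    NSum (suc q + 1) A (map suc κ ++ suc q ∷ []) (I m)
      ≡⟨ last-row m 1 (suc q) A κ refl (big (suc q + 1) (ℕₚ.≤-reflexive (ℕₚ.+-comm (suc q) 1))) ⟩
    ∑ (hS (suc q) A) (λ C → NSum 1 C κ (I m))
      ≡⟨ ∑-cong (hS (suc q) A) (λ C → NSum-1 C κ (I m)) ⟩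
    ∑ (hS (suc q) A) (λ C → ∑ (T 1 C) (λ C' → ∑ (T 1 κ) (λ κ' → I m C' κ')))
      ≡⟨ ∑hS-T (suc q) 1 A _ ⟩
    ∑ (T 1 A) (λ A' → ∑ (hS (suc q) A') (λ C → ∑ (T 1 κ) (λ κ' → I m C κ')))
      ≡⟨ ∑-cong (T 1 A) (λ A' → ∑-swap (hS (suc q) A') (T 1 κ) (I m)) ⟩
    ∑ (T 1 A) (λ A' → ∑ (T 1 κ) (λ κ' → strip m (suc q) A' κ')) ∎
  smκ : sum κ ≡ suc m + 1
  smκ = ℕₚ.+-cancelʳ-≡ (suc q) _ _ (trans (solve 3 (λ x c q → con 1 :+ x :+ (con 1 :+ c :+ con 0) :+ (con 1 :+ q) := con 1 :+ x :+ (con 1 :+ (c :+ (con 1 :+ q)) :+ con 0)) refl x c q)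
    (trans sm (solve 2 (λ q m → con 2 :+ q :+ m :+ con 1 := con 1 :+ m :+ con 1 :+ (con 1 :+ q)) refl q m)))
  N₀ : NSum (suc q) A (map suc κ ++ suc q ∷ []) (I (suc m)) ≡ 1ℚ
  N₀ = begin
    NSum (suc q) A (map suc κ ++ suc q ∷ []) (I (suc m))
      ≡⟨ cong (λ k → NSum k A (map suc κ ++ suc q ∷ []) (I (suc m))) (sym (ℕₚ.+-identityʳ (suc q))) ⟩
    NSum (suc q + 0) A (map suc κ ++ suc q ∷ []) (I (suc m))
      ≡⟨ last-row (suc m) 0 (suc q) A κ refl (big (suc q + 0) (ℕₚ.≤-trans (ℕₚ.≤-reflexive (ℕₚ.+-identityʳ (suc q))) (ℕₚ.n≤1+n _))) ⟩
    ∑ (hS (suc q) A) (λ C → NSum 0 C κ (I (suc m)))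
      ≡⟨ ∑-cong (hS (suc q) A) (λ C → NSum-0 C κ (I (suc m))) ⟩
    strip (suc m) (suc q) A κ
      ≡⟨ strip-1 (suc m) (suc q) A κ (cons ℕₚ.≤-refl (ℕₚ.m≤n⇒m≤1+n b<x) [ s≤s (ℕₚ.m≤m+n c (suc q)) ])
           (solve 3 (λ x c q → con 1 :+ x :+ (con 1 :+ c :+ con 0) :+ (con 1 :+ q) := con 1 :+ x :+ (con 1 :+ (c :+ (con 1 :+ q)) :+ con 0)) refl x c q) smκ ⟩
    1ℚ ∎
  eq : D (suc q) m A (map suc κ ++ suc q ∷ []) ≡ ∑ (T 1 A) (λ A' → ∑ (T 1 κ) (λ κ' → strip m (suc q) A' κ')) +ℚ -ℚ 1ℚ
  eq = cong₂ (λ s t → s +ℚ -ℚ t) N₁ N₀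
  sA : Strict A
  sA = ℕₚ.m≤n⇒m≤1+n b<x ∷ [-]
  c≤b : c ≤ b
  c≤b = ℕₚ.m≤m+n c (suc q)
  sκ : Strict κ
  sκ = s≤s (ℕₚ.≤-trans (s≤s c≤b) (ℕₚ.<⇒≤ b<x)) ∷ [-]
  ≥0 : ∀ {A' κ'} → A' ∈ T 1 A → κ' ∈ T 1 κ → 0ℚ ≤ℚ strip m (suc q) A' κ'
  ≥0 = strip-T1-≥0 m (suc q) A κ sA sκ refl
  exhibit : ∀ {A' κ'} → A' ∈ T 1 A → κ' ∈ T 1 κ → Itl A' κ' → fromℕ 1 ≤ℚ strip m (suc q) A' κ'
  exhibit {A'} {κ'} i j il = 1≤ (strip-1 m (suc q) A' κ' il
    (ℕₚ.+-cancelʳ-≡ 1 _ _ (trans (solve 2 (λ k q → k :+ (con 1 :+ q) :+ con 1 := k :+ con 1 :+ (con 1 :+ q)) refl (sum κ') q) (trans (cong (_+ suc q) (T-sum 1 κ j))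
      (trans (solve 3 (λ x c q → con 1 :+ x :+ (con 1 :+ c :+ con 0) :+ (con 1 :+ q) := con 1 :+ x :+ (con 1 :+ (c :+ (con 1 :+ q)) :+ con 0)) refl x c q) (sym (T-sum 1 A i))))))
    (ℕₚ.+-cancelʳ-≡ 1 _ _ (trans (T-sum 1 κ j) (trans smκ (trans (cong (λ l → suc m + tri l) (sym (T-length 1 κ j))) (ℕₚ.+-comm 1 _))))))
  three : fromℕ 3 ≤ℚ ∑ (T 1 A) (λ A' → ∑ (T 1 κ) (λ κ' → strip m (suc q) A' κ'))
  three = ℚₚ.≤-trans (≤-add 1 2
    (ℚₚ.≤-trans (exhibit (here refl) (here refl) (cons ℕₚ.≤-refl b<x [ s≤s c≤b ])) (∑-≥₁ (T 1 κ) (≥0 (here refl)) (here refl)))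
    (ℚₚ.≤-trans (≤-add 1 1
      (exhibit (there (here refl)) (here refl) (cons (ℕₚ.n≤1+n x) (ℕₚ.<-trans (ℕₚ.n<1+n b) b<x) [ subst (suc c ≤_) (sym (ℕₚ.+-suc c q)) (s≤s (ℕₚ.m≤m+n c q)) ]))
      (exhibit (there (here refl)) (there (here refl)) (cons ℕₚ.≤-refl (ℕₚ.<-trans (ℕₚ.<-trans (ℕₚ.n<1+n b) b<x) (ℕₚ.n<1+n x)) [ c≤b ])))
      (∑-≥₂ (T 1 κ) (≥0 (there (here refl))) (here refl) (there (here refl)) (λ e → n≢1+n (Listₚ.∷-injectiveˡ e)))))
    (∑-≥₂ (T 1 A) (λ i → ∑-≥0 (T 1 κ) (≥0 i)) (here refl) (there (here refl)) (λ e → n≢1+n (Listₚ.∷-injectiveˡ e)))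

-- Rectangles

-- The beta numbers of L equal rows.
run : ℕ → ℕ → List ℕ
run zero    h = []
run (suc L) h = (h + L) ∷ run L h

run-head : ∀ L h Q → ∃ λ Q' → run L (suc h) ++ h ∷ Q ≡ (h + L) ∷ Q'
run-head zero    h Q = Q , cong (_∷ Q) (sym (ℕₚ.+-identityʳ h))
run-head (suc L) h Q = run L (suc h) ++ h ∷ Q , cong (_∷ (run L (suc h) ++ h ∷ Q)) (sym (ℕₚ.+-suc h L))

-- Inside a run, lowering by one hits the next entry; only the lowest row of a block of equal rows
-- can lose a box.
∑T1-run : ∀ L h Q {f} → Anti f → ∑ (T 1 (run L (suc h) ++ h ∷ Q)) f ≡ ∑ (T 1 (h ∷ Q)) (λ R → f (run L (suc h) ++ R))
∑T1-run zero    h Q {f} af = refl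
∑T1-run (suc L) h Q {f} af = trans (∑T 1 (suc (h + L)) (run L (suc h) ++ h ∷ Q) f)
  (trans (+-zeroˡ _ (trans (ℚₚ.+-identityʳ _) dup)) (∑T1-run L h Q {λ A → f (suc (h + L) ∷ A)} (Anti-∷ {f} af (suc (h + L)))))
  where
  dup : f ((h + L) ∷ run L (suc h) ++ h ∷ Q) ≡ 0ℚ
  dup with run-head L h Q
  ... | Q' , e rewrite e = Anti-dup {f} af [] (h + L) [] Q'

-- Lowering by two hits the entry two places further on, so dominoes come only from the two lowest
-- rows of the block.
∑T2-run : ∀ L g Q {f} → Anti f → ∑ (T 2 (run L (suc (suc g)) ++ suc g ∷ g ∷ Q)) f ≡ ∑ (T 2 (suc g ∷ g ∷ Q)) (λ R → f (run L (suc (suc g)) ++ R))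
∑T2-run zero    g Q {f} af = refl
∑T2-run (suc L) g Q {f} af = trans (∑T 2 (suc (suc (g + L))) (run L (suc (suc g)) ++ suc g ∷ g ∷ Q) f)
  (trans (+-zeroˡ _ (trans (ℚₚ.+-identityʳ _) (dup L))) (∑T2-run L g Q {λ A → f (suc (suc (g + L)) ∷ A)} (Anti-∷ {f} af (suc (suc (g + L))))))
  where
  dup : ∀ L → f ((g + L) ∷ run L (suc (suc g)) ++ suc g ∷ g ∷ Q) ≡ 0ℚ
  dup zero    = trans (cong (λ x → f (x ∷ suc g ∷ g ∷ Q)) (ℕₚ.+-identityʳ g)) (Anti-dup {f} af [] g (suc g ∷ []) Q)
  dup (suc L) with run-head L (suc g) (g ∷ Q)
  ... | Q' , e rewrite e | ℕₚ.+-suc g L = Anti-dup {f} af [] (suc (g + L)) (suc (suc (g + L)) ∷ []) Q'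

run-All : ∀ L h → All (h ≤_) (run L h)
run-All zero    h = []
run-All (suc L) h = ℕₚ.m≤m+n h L ∷ run-All L h

run-< : ∀ L h {x} → h + L ≤ x → All (_< x) (run L h)
run-< zero    h _ = []
run-< (suc L) h {x} p = subst (_≤ x) (ℕₚ.+-suc h L) p ∷ run-< L h (ℕₚ.≤-trans (ℕₚ.+-monoʳ-≤ h (ℕₚ.n≤1+n L)) p)

run-Strict : ∀ L h {R} → All (_< h) R → Strict R → Strict (run L h ++ R)
run-Strict zero    h p s = s
run-Strict (suc L) h p s = Strict-∷ (Allₚ.++⁺ (run-< L h ℕₚ.≤-refl) (All.map (λ q → ℕₚ.<-≤-trans q (ℕₚ.m≤m+n h L)) p)) (run-Strict L h p s)

Itl-run : ∀ L k C → Itl (run L (suc k) ++ k ∷ []) C → ∃ λ c → C ≡ run L (suc k) ++ c ∷ []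
Itl-run zero k (c ∷ []) [ _ ] = c , refl
Itl-run (suc zero) k (x ∷ c ∷ []) (cons x≤ k<x [ _ ]) =
  c , cong (λ t → t ∷ c ∷ []) (ℕₚ.≤-antisym x≤ (subst (_≤ x) (cong suc (sym (ℕₚ.+-identityʳ k))) k<x))
Itl-run (suc (suc L)) k (x ∷ C) (cons x≤ lt i) with Itl-run (suc L) k C i
... | c , e = c , cong₂ _∷_ (ℕₚ.≤-antisym x≤ (subst (_≤ x) (cong suc (sym (ℕₚ.+-suc k L))) lt)) e

-- A horizontal strip of a rectangle lies in its last row.
∑hS-rectangle : ∀ L c y {f} → Anti f → ∑ (hS y (run L (suc (c + y)) ++ (c + y) ∷ [])) f ≡ f (run L (suc (c + y)) ++ c ∷ [])
∑hS-rectangle L c y {f} af = trans (pieri y A {f} sA af) (∑pS-only y A (R ++ c ∷ []) f (Itl-++ R sA [ ℕₚ.m≤m+n c y ]) total unique)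
  where
  R = run L (suc (c + y))
  A = R ++ (c + y) ∷ []
  sA : Strict A
  sA = run-Strict L (suc (c + y)) (ℕₚ.≤-refl ∷ []) [-]
  total : sum (R ++ c ∷ []) + y ≡ sum A
  total = trans (cong (_+ y) (sum-++ R _)) (trans (solve 3 (λ r c y → r :+ (c :+ con 0) :+ y := r :+ (c :+ y :+ con 0)) refl (sum R) c y) (sym (sum-++ R _)))
  unique : ∀ C → Itl A C → sum C + y ≡ sum A → C ≢ R ++ c ∷ [] → f C ≡ 0ℚ
  unique C i s ne with Itl-run L (c + y) C i
  ... | c' , refl = ⊥-elim (ne (cong (λ t → R ++ t ∷ []) (ℕₚ.+-cancelʳ-≡ 0 c' c (ℕₚ.+-cancelˡ-≡ (sum R) _ _ (ℕₚ.+-cancelʳ-≡ y _ _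
          (trans (cong (_+ y) (sym (sum-++ R _))) (trans s (trans (sym total) (cong (_+ y) (sum-++ R _))))))))))

fromℕ-5 : ∀ {v w x y t} a b c d e → v ≡ fromℕ a → w ≡ fromℕ b → x ≡ fromℕ c → y ≡ fromℕ d → t ≡ fromℕ e →
  ((v +ℚ w) +ℚ (x +ℚ y)) +ℚ t ≡ fromℕ (((a + b) + (c + d)) + e)
fromℕ-5 a b c d e refl refl refl refl refl = sym (trans (fromℕ-+ (a + b + (c + d)) e) (cong (_+ℚ fromℕ e)
  (trans (fromℕ-+ (a + b) (c + d)) (cong₂ _+ℚ_ (fromℕ-+ a b) (fromℕ-+ c d)))))

∑T1-Antiˡ : ∀ κ m → Anti (λ A → ∑ (T 1 κ) (λ B → ∑ (T 1 B) (I m A)))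
∑T1-Antiˡ κ m P a b Q = trans (∑-cong (T 1 κ) (λ B → trans (∑-cong (T 1 B) (λ B' → I-Antiˡ m B' P a b Q)) (∑-neg (T 1 B) _))) (∑-neg (T 1 κ) _)

-- κ has two corners; u, v and α, β, γ, ε are obtained by removing one, respectively two boxes.
-- The two boxes of ε lie in one column.
module Corners (m : ℕ) (κ u v α β γ : List ℕ) (ε : List (List ℕ))
  (κ>1 : ∀ {f} → Anti f → ∑ (T 1 κ) f ≡ f u +ℚ f v)
  (κ>1>1 : ∀ {f} → Anti f → ∑ (T 1 κ) (λ A → ∑ (T 1 A) f) ≡ ((f α +ℚ f β) +ℚ (f β +ℚ f γ)) +ℚ ∑ ε f)
  (κ>2 : ∀ {f} → Anti f → ∑ (T 2 κ) f ≡ ((f α +ℚ 0ℚ) +ℚ (f γ +ℚ 0ℚ)) +ℚ -ℚ ∑ ε f)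
  (δ₁ : ∀ {A B} → A ∈ u ∷ v ∷ [] → B ∈ u ∷ v ∷ [] → A ≢ B → I (suc m) A B ≡ 0ℚ)
  (δ₂ : ∀ {A B} → A ∈ α ∷ β ∷ γ ∷ ε → B ∈ α ∷ β ∷ γ ∷ ε → A ≢ B → I m A B ≡ 0ℚ)
  (n₁ : ∀ {A} → A ∈ u ∷ v ∷ [] → I (suc m) A A ≡ fromℕ 1)
  (n₂ : ∀ {A} → A ∈ α ∷ β ∷ γ ∷ ε → I m A A ≡ fromℕ 1)
  (u≢v : u ≢ v) (α≢β : α ≢ β) (α≢γ : α ≢ γ) (β≢γ : β ≢ γ)
  (ε≢ : ε ≡ [] ⊎ (∃ λ x → ε ≡ x ∷ [] × α ≢ x × β ≢ x × γ ≢ x)) where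

  flipped : ∀ {A B : List ℕ} → A ≢ B → B ≢ A
  flipped ne e = ne (sym e)

  N-1 : NSum 1 κ κ (I (suc m)) ≡ fromℕ 2
  N-1 = begin
    NSum 1 κ κ (I (suc m))
      ≡⟨ NSum-1 κ κ (I (suc m)) ⟩
    ∑ (T 1 κ) (λ A → ∑ (T 1 κ) (λ B → I (suc m) A B))
      ≡⟨ ∑-cong (T 1 κ) (λ A → κ>1 {I (suc m) A} (I-Antiʳ (suc m) A)) ⟩
    ∑ (T 1 κ) (λ A → I (suc m) A u +ℚ I (suc m) A v)
      ≡⟨ ∑-+ (T 1 κ) _ _ ⟩
    _ ≡⟨ cong₂ _+ℚ_ (κ>1 {λ A → I (suc m) A u} (I-Antiˡ (suc m) u)) (κ>1 {λ A → I (suc m) A v} (I-Antiˡ (suc m) v)) ⟩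
    (I (suc m) u u +ℚ I (suc m) v u) +ℚ (I (suc m) u v +ℚ I (suc m) v v)
      ≡⟨ sym (ℚₚ.+-identityʳ _) ⟩
    _ ≡⟨ fromℕ-5 1 0 0 1 0 (n₁ u∈) (δ₁ v∈ u∈ (flipped u≢v)) (δ₁ u∈ v∈ u≢v) (n₁ v∈) refl ⟩
    fromℕ 2 ∎
    where
    u∈ : u ∈ u ∷ v ∷ []
    u∈ = here refl
    v∈ : v ∈ u ∷ v ∷ []
    v∈ = there (here refl)

  α∈ : α ∈ α ∷ β ∷ γ ∷ ε
  α∈ = here refl
  β∈ : β ∈ α ∷ β ∷ γ ∷ ε
  β∈ = there (here refl)
  γ∈ : γ ∈ α ∷ β ∷ γ ∷ ε
  γ∈ = there (there (here refl))

  -- The two terms of Newton's identity for 2 N_2 on the second list: `h` removes two boxes one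
  -- after the other, `g` a domino with the sign of its orientation.
  h g : List ℕ → ℚ
  h A = ∑ (T 1 κ) (λ B → ∑ (T 1 B) (I m A))
  g A = ∑ (T 2 κ) (I m A)

  h≡ : ∀ A → h A ≡ ((I m A α +ℚ I m A β) +ℚ (I m A β +ℚ I m A γ)) +ℚ ∑ ε (I m A)
  h≡ A = κ>1>1 {I m A} (I-Antiʳ m A)

  g≡ : ∀ A → g A ≡ ((I m A α +ℚ 0ℚ) +ℚ (I m A γ +ℚ 0ℚ)) +ℚ -ℚ ∑ ε (I m A)
  g≡ A = κ>2 {I m A} (I-Antiʳ m A)

  ε-off : ∀ {A} → A ∈ α ∷ β ∷ γ ∷ ε → All (A ≢_) ε → ∑ ε (I m A) ≡ 0ℚ
  ε-off i ne = ∑-0 ε (λ j → δ₂ i (there (there (there j))) (All.lookup ne j))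

  N-2 : (∑ ε h ≡ fromℕ 0 × -ℚ ∑ ε g ≡ fromℕ 0) ⊎ (∑ ε h ≡ fromℕ 1 × -ℚ ∑ ε g ≡ fromℕ 1) → All (α ≢_) ε → All (β ≢_) ε → All (γ ≢_) ε →
    fromℕ 4 ≤ℚ NSum 2 κ κ (I m)
  N-2 cases ≢α ≢β ≢γ = conclude cases
    where
    hα : h α ≡ fromℕ 1
    hα = trans (h≡ α) (fromℕ-5 1 0 0 0 0 (n₂ α∈) (δ₂ α∈ β∈ α≢β) (δ₂ α∈ β∈ α≢β) (δ₂ α∈ γ∈ α≢γ) (ε-off α∈ ≢α))
    hβ : h β ≡ fromℕ 2
    hβ = trans (h≡ β) (fromℕ-5 0 1 1 0 0 (δ₂ β∈ α∈ (flipped α≢β)) (n₂ β∈) (n₂ β∈) (δ₂ β∈ γ∈ β≢γ) (ε-off β∈ ≢β))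
    hγ : h γ ≡ fromℕ 1
    hγ = trans (h≡ γ) (fromℕ-5 0 0 0 1 0 (δ₂ γ∈ α∈ (flipped α≢γ)) (δ₂ γ∈ β∈ (flipped β≢γ)) (δ₂ γ∈ β∈ (flipped β≢γ)) (n₂ γ∈) (ε-off γ∈ ≢γ))
    gα : g α ≡ fromℕ 1
    gα = trans (g≡ α) (fromℕ-5 1 0 0 0 0 (n₂ α∈) refl (δ₂ α∈ γ∈ α≢γ) refl (neg≡0 (ε-off α∈ ≢α)))
    gγ : g γ ≡ fromℕ 1
    gγ = trans (g≡ γ) (fromℕ-5 0 0 1 0 0 (δ₂ γ∈ α∈ (flipped α≢γ)) refl (n₂ γ∈) refl (neg≡0 (ε-off γ∈ ≢γ)))
    -- The right side is 6 + 2 without a vertical domino and 7 + 3 with one, so N_2 is 4 or 5,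
    -- against N_1 = 2.
    double : fromℕ 2 *ℚ NSum 2 κ κ (I m) ≡ (((h α +ℚ h β) +ℚ (h β +ℚ h γ)) +ℚ ∑ ε h) +ℚ (((g α +ℚ 0ℚ) +ℚ (g γ +ℚ 0ℚ)) +ℚ -ℚ ∑ ε g)
    double = begin
      fromℕ 2 *ℚ NSum 2 κ κ (I m)
        ≡⟨ newton-NS 2 κ κ (I m) ⟩
      _ ≡⟨ trans (∑anti⁺-suc 1 _) (trans (∑anti-suc 0 _) (cong (∑ (T 1 κ) (λ A → ∑ (T 1 κ) (λ B → NSum 1 A B (I m))) +ℚ_) (∑anti-0 _))) ⟩
      ∑ (T 1 κ) (λ A → ∑ (T 1 κ) (λ B → NSum 1 A B (I m))) +ℚ ∑ (T 2 κ) (λ A → ∑ (T 2 κ) (λ B → NSum 0 A B (I m)))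
        ≡⟨ cong₂ _+ℚ_
            (∑-cong (T 1 κ) (λ A → trans (∑-cong (T 1 κ) (λ B → NSum-1 A B (I m))) (∑-swap (T 1 κ) (T 1 A) _)))
            (∑-cong (T 2 κ) (λ A → ∑-cong (T 2 κ) (λ B → NSum-0 A B (I m)))) ⟩
      ∑ (T 1 κ) (λ A → ∑ (T 1 A) h) +ℚ ∑ (T 2 κ) g
        ≡⟨ cong₂ _+ℚ_ (κ>1>1 {h} (∑T1-Antiˡ κ m)) (κ>2 {g} (λ P a b Q → trans (∑-cong (T 2 κ) (λ B → I-Antiˡ m B P a b Q)) (∑-neg (T 2 κ) _))) ⟩
      _ ∎
    conclude : (∑ ε h ≡ fromℕ 0 × -ℚ ∑ ε g ≡ fromℕ 0) ⊎ (∑ ε h ≡ fromℕ 1 × -ℚ ∑ ε g ≡ fromℕ 1) → fromℕ 4 ≤ℚ NSum 2 κ κ (I m)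
    conclude (inj₁ (x , y)) = ℚₚ.≤-reflexive (fromℕ-cancel 1 _ _ (trans (sym (fromℕ-* 2 4)) (sym (trans double
      (trans (cong₂ _+ℚ_ (fromℕ-5 1 2 2 1 0 hα hβ hβ hγ x) (fromℕ-5 1 0 1 0 0 gα refl gγ refl y)) (sym (fromℕ-+ 6 2)))))))
    conclude (inj₂ (x , y)) = ℚₚ.≤-trans (fromℕ-mono {4} {5} (s≤s (s≤s (s≤s (s≤s z≤n))))) (ℚₚ.≤-reflexive (fromℕ-cancel 1 _ _ (trans (sym (fromℕ-* 2 5)) (sym (trans double
      (trans (cong₂ _+ℚ_ (fromℕ-5 1 2 2 1 1 hα hβ hβ hγ x) (fromℕ-5 1 0 1 0 1 gα refl gγ refl y)) (sym (fromℕ-+ 7 3))))))))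

  bound : fromℕ 2 ≤ℚ NSum 2 κ κ (I m) +ℚ -ℚ NSum 1 κ κ (I (suc m))
  bound = ℚₚ.≤-trans (ℚₚ.≤-reflexive two) (ℚₚ.+-mono-≤ (four ε≢) (ℚₚ.≤-reflexive (cong -ℚ_ (sym N-1))))
    where
    two : fromℕ 2 ≡ fromℕ 4 +ℚ -ℚ fromℕ 2
    two = sym (trans (cong (_+ℚ -ℚ fromℕ 2) (fromℕ-+ 2 2)) (trans (ℚₚ.+-assoc (fromℕ 2) _ _) (+-zeroʳ (fromℕ 2) (ℚₚ.+-inverseʳ _))))
    four : (ε ≡ [] ⊎ (∃ λ x → ε ≡ x ∷ [] × α ≢ x × β ≢ x × γ ≢ x)) → fromℕ 4 ≤ℚ NSum 2 κ κ (I m)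
    four (inj₁ refl) = N-2 (inj₁ (refl , ℚₚ.neg-zero)) [] [] []
    four (inj₂ (x , refl , a , b , c)) = N-2 (inj₂ (hx , gx)) (a ∷ []) (b ∷ []) (c ∷ [])
      where
      x∈ : x ∈ α ∷ β ∷ γ ∷ x ∷ []
      x∈ = there (there (there (here refl)))
      hx : h x +ℚ 0ℚ ≡ fromℕ 1
      hx = trans (ℚₚ.+-identityʳ _) (trans (h≡ x) (fromℕ-5 0 0 0 0 1 (δ₂ x∈ α∈ (flipped a)) (δ₂ x∈ β∈ (flipped b)) (δ₂ x∈ β∈ (flipped b)) (δ₂ x∈ γ∈ (flipped c)) (trans (ℚₚ.+-identityʳ _) (n₂ x∈))))
      gx : -ℚ (g x +ℚ 0ℚ) ≡ fromℕ 1
      gx = trans (cong -ℚ_ (trans (ℚₚ.+-identityʳ _) (trans (g≡ x) (+-zeroˡ _ (fromℕ-4 (δ₂ x∈ α∈ (flipped a)) (δ₂ x∈ γ∈ (flipped c)))))))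
             (trans (ℚₚ.neg-involutive _) (trans (ℚₚ.+-identityʳ _) (n₂ x∈)))
        where
        fromℕ-4 : ∀ {s t} → s ≡ 0ℚ → t ≡ 0ℚ → (s +ℚ 0ℚ) +ℚ (t +ℚ 0ℚ) ≡ 0ℚ
        fromℕ-4 refl refl = trans (cong₂ _+ℚ_ (ℚₚ.+-identityʳ 0ℚ) (ℚₚ.+-identityʳ 0ℚ)) (ℚₚ.+-identityʳ 0ℚ)

-- The beta-list of a rectangle with a shorter last row.
module Shape (m L k c : ℕ) (c<k : suc (suc c) < k) where
  k₂ = suc (suc k)
  c₂ = suc (suc c)

  -- With a single full row no vertical domino can be removed, so `ε` is empty.
  two-corners₀ : sum (k₂ ∷ c₂ ∷ []) ≡ suc (suc m) + tri 2 →
    fromℕ 2 ≤ℚ NSum 2 (k₂ ∷ c₂ ∷ []) (k₂ ∷ c₂ ∷ []) (I m) +ℚ -ℚ NSum 1 (k₂ ∷ c₂ ∷ []) (k₂ ∷ c₂ ∷ []) (I (suc m))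
  two-corners₀ sm = C.bound
    where
    lists₁ = (suc k ∷ c₂ ∷ []) ∷ (k₂ ∷ suc c ∷ []) ∷ []
    lists₂ = (k ∷ c₂ ∷ []) ∷ (suc k ∷ suc c ∷ []) ∷ (k₂ ∷ c ∷ []) ∷ []
    Good : ℕ → List ℕ → Set
    Good m A = Strict A × length A ≡ 2 × sum A ≡ m + 1
    sm' : k + (c + 0) + 4 ≡ suc (suc m) + 1
    sm' = trans (solve 2 (λ k c → k :+ (c :+ con 0) :+ con 4 := con 2 :+ k :+ (con 2 :+ c :+ con 0)) refl k c) sm
    s₂ : k + (c + 0) + 2 ≡ m + 1
    s₂ = ℕₚ.suc-injective (ℕₚ.suc-injective (trans (solve 1 (λ s → con 2 :+ (s :+ con 2) := s :+ con 4) refl (k + (c + 0))) sm'))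
    s₁ : k + (c + 0) + 3 ≡ suc m + 1
    s₁ = ℕₚ.suc-injective (trans (solve 1 (λ s → con 1 :+ (s :+ con 3) := s :+ con 4) refl (k + (c + 0))) sm')
    good₁ : All (Good (suc m)) lists₁
    good₁ = ((ℕₚ.m≤n⇒m≤1+n c<k ∷ [-]) , refl , trans (solve 2 (λ k c → con 1 :+ k :+ (con 2 :+ c :+ con 0) := k :+ (c :+ con 0) :+ con 3) refl k c) s₁) ∷
            ((ℕₚ.m≤n⇒m≤1+n (ℕₚ.m≤n⇒m≤1+n (ℕₚ.<⇒≤ c<k)) ∷ [-]) , refl , trans (solve 2 (λ k c → con 2 :+ k :+ (con 1 :+ c :+ con 0) := k :+ (c :+ con 0) :+ con 3) refl k c) s₁) ∷ []
    good₂ : All (Good m) lists₂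
    good₂ = ((c<k ∷ [-]) , refl , trans (solve 2 (λ k c → k :+ (con 2 :+ c :+ con 0) := k :+ (c :+ con 0) :+ con 2) refl k c) s₂) ∷
            ((ℕₚ.m≤n⇒m≤1+n (ℕₚ.<⇒≤ c<k) ∷ [-]) , refl , trans (solve 2 (λ k c → con 1 :+ k :+ (con 1 :+ c :+ con 0) := k :+ (c :+ con 0) :+ con 2) refl k c) s₂) ∷
            ((ℕₚ.m≤n⇒m≤1+n (ℕₚ.m≤n⇒m≤1+n (ℕₚ.≤-trans (ℕₚ.n≤1+n _) (ℕₚ.<⇒≤ c<k))) ∷ [-]) , refl , trans (solve 2 (λ k c → con 2 :+ k :+ (c :+ con 0) := k :+ (c :+ con 0) :+ con 2) refl k c) s₂) ∷ []
    δ : ∀ m {Ls} → All (Good m) Ls → ∀ {A B} → A ∈ Ls → B ∈ Ls → A ≢ B → I m A B ≡ 0ℚ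
    δ m gs {A} {B} i j ne with All.lookup gs i | All.lookup gs j
    ... | s , l , _ | s' , l' , _ = I-≢′ m A B s s' (trans l (sym l')) ne
    nn : ∀ m {Ls} → All (Good m) Ls → ∀ {A} → A ∈ Ls → I m A A ≡ fromℕ 1
    nn m gs {A} i with All.lookup gs i
    ... | s , l , t = trans (I-refl m A s (trans t (cong (λ x → m + tri x) (sym l)))) (sym (ℚₚ.+-identityʳ 1ℚ))
    module C = Corners m (k₂ ∷ c₂ ∷ []) (suc k ∷ c₂ ∷ []) (k₂ ∷ suc c ∷ []) (k ∷ c₂ ∷ []) (suc k ∷ suc c ∷ []) (k₂ ∷ c ∷ []) []
      (λ {f} _ → cong (f (suc k ∷ c₂ ∷ []) +ℚ_) (ℚₚ.+-identityʳ _))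
      (λ {f} _ → trans (cong₂ _+ℚ_ (cong (f (k ∷ c₂ ∷ []) +ℚ_) (ℚₚ.+-identityʳ _)) (trans (ℚₚ.+-identityʳ _) (cong (f (suc k ∷ suc c ∷ []) +ℚ_) (ℚₚ.+-identityʳ _)))) (sym (ℚₚ.+-identityʳ _)))
      (λ {f} _ → sym (trans (+-zeroʳ _ ℚₚ.neg-zero) (cong (_+ℚ (f (k₂ ∷ c ∷ []) +ℚ 0ℚ)) (ℚₚ.+-identityʳ _))))
      (δ (suc m) good₁) (δ m good₂) (nn (suc m) good₁) (nn m good₂)
      (λ e → n≢1+n (Listₚ.∷-injectiveˡ e)) (λ e → n≢1+n (Listₚ.∷-injectiveˡ e)) (λ e → ℕₚ.<⇒≢ (ℕₚ.m≤n⇒m≤1+n (ℕₚ.n<1+n k)) (Listₚ.∷-injectiveˡ e)) (λ e → n≢1+n (Listₚ.∷-injectiveˡ e))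
      (inj₁ refl)

  -- With at least two full rows the upper corner admits a vertical domino. It enters p_2 with sign
  -- -1, visible here as one transposition of beta numbers.
  two-corners : let κ = run L (suc (suc k₂)) ++ suc k₂ ∷ k₂ ∷ c₂ ∷ [] in
    sum κ ≡ suc (suc m) + tri (length κ) → fromℕ 2 ≤ℚ NSum 2 κ κ (I m) +ℚ -ℚ NSum 1 κ κ (I (suc m))
  two-corners sm = C.bound
    where
    R = run L (suc (suc k₂))
    κ = R ++ suc k₂ ∷ k₂ ∷ c₂ ∷ []
    l = length κ
    t : ℕ → ℕ → ℕ → List ℕ
    t x y w = R ++ x ∷ y ∷ w ∷ []
    Good : ℕ → List ℕ → Set
    Good m A = Strict A × length A ≡ l × sum A ≡ m + tri l
    len : ∀ x y w → length (t x y w) ≡ l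
    len x y w = trans (Listₚ.length-++ R) (sym (Listₚ.length-++ R))
    strict : ∀ x y w → x ≤ suc k₂ → y < x → w < y → Strict (t x y w)
    strict x y w p p' p″ = run-Strict L (suc (suc k₂)) (s≤s p ∷ s≤s (ℕₚ.≤-trans (ℕₚ.<⇒≤ p') p) ∷ s≤s (ℕₚ.≤-trans (ℕₚ.<⇒≤ p″) (ℕₚ.≤-trans (ℕₚ.<⇒≤ p') p)) ∷ []) (p' ∷ p″ ∷ [-])
    total : ∀ d m₁ x y w → x + y + w + d ≡ suc k₂ + k₂ + c₂ → m₁ + d ≡ suc (suc m) → sum (t x y w) ≡ m₁ + tri l
    total d m₁ x y w p p' = ℕₚ.+-cancelʳ-≡ d _ _ (begin
      sum (t x y w) + d                   ≡⟨ cong (_+ d) (sum-++ R _) ⟩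
      sum R + (x + (y + (w + 0))) + d     ≡⟨ solve 5 (λ r x y w d → r :+ (x :+ (y :+ (w :+ con 0))) :+ d := r :+ (x :+ y :+ w :+ d)) refl (sum R) x y w d ⟩
      sum R + (x + y + w + d)             ≡⟨ cong (sum R +_) p ⟩
      sum R + (suc k₂ + k₂ + c₂)          ≡⟨ solve 4 (λ r x y w → r :+ (x :+ y :+ w) := r :+ (x :+ (y :+ (w :+ con 0)))) refl (sum R) (suc k₂) k₂ c₂ ⟩
      sum R + (suc k₂ + (k₂ + (c₂ + 0)))  ≡⟨ sym (sum-++ R _) ⟩
      sum κ                               ≡⟨ sm ⟩
      suc (suc m) + tri l                 ≡⟨ cong (_+ tri l) (sym p') ⟩
      m₁ + d + tri l                      ≡⟨ solve 3 (λ m d t → m :+ d :+ t := m :+ t :+ d) refl m₁ d (tri l) ⟩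
      m₁ + tri l + d                      ∎)
    u₁ = t (suc k₂) (suc k) c₂
    v₁ = t (suc k₂) k₂ (suc c)
    α = t (suc k₂) k c₂
    β = t (suc k₂) (suc k) (suc c)
    γ = t (suc k₂) k₂ c
    ε = t k₂ (suc k) c₂
    e₁ : suc m + 1 ≡ suc (suc m)
    e₁ = ℕₚ.+-comm (suc m) 1
    e₂ : m + 2 ≡ suc (suc m)
    e₂ = ℕₚ.+-comm m 2
    good₁ : All (Good (suc m)) (u₁ ∷ v₁ ∷ [])
    good₁ =
      (strict (suc k₂) (suc k) c₂ ℕₚ.≤-refl (ℕₚ.m≤n⇒m≤1+n ℕₚ.≤-refl) (ℕₚ.m≤n⇒m≤1+n c<k) , len _ _ _ , total 1 (suc m) (suc k₂) (suc k) c₂ (solve 2 (λ k c → con 3 :+ k :+ (con 1 :+ k) :+ (con 2 :+ c) :+ con 1 := con 3 :+ k :+ (con 2 :+ k) :+ (con 2 :+ c)) refl k c) e₁) ∷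
      (strict (suc k₂) k₂ (suc c) ℕₚ.≤-refl ℕₚ.≤-refl (ℕₚ.m≤n⇒m≤1+n (ℕₚ.m≤n⇒m≤1+n (ℕₚ.<⇒≤ c<k))) , len _ _ _ , total 1 (suc m) (suc k₂) k₂ (suc c) (solve 2 (λ k c → con 3 :+ k :+ (con 2 :+ k) :+ (con 1 :+ c) :+ con 1 := con 3 :+ k :+ (con 2 :+ k) :+ (con 2 :+ c)) refl k c) e₁) ∷ []
    good₂ : All (Good m) (α ∷ β ∷ γ ∷ ε ∷ [])
    good₂ =
      (strict (suc k₂) k c₂ ℕₚ.≤-refl (ℕₚ.m≤n⇒m≤1+n (ℕₚ.m≤n⇒m≤1+n ℕₚ.≤-refl)) c<k , len _ _ _ , total 2 m (suc k₂) k c₂ (solve 2 (λ k c → con 3 :+ k :+ k :+ (con 2 :+ c) :+ con 2 := con 3 :+ k :+ (con 2 :+ k) :+ (con 2 :+ c)) refl k c) e₂) ∷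
      (strict (suc k₂) (suc k) (suc c) ℕₚ.≤-refl (ℕₚ.m≤n⇒m≤1+n ℕₚ.≤-refl) (ℕₚ.m≤n⇒m≤1+n (ℕₚ.<⇒≤ c<k)) , len _ _ _ , total 2 m (suc k₂) (suc k) (suc c) (solve 2 (λ k c → con 3 :+ k :+ (con 1 :+ k) :+ (con 1 :+ c) :+ con 2 := con 3 :+ k :+ (con 2 :+ k) :+ (con 2 :+ c)) refl k c) e₂) ∷
      (strict (suc k₂) k₂ c ℕₚ.≤-refl ℕₚ.≤-refl (ℕₚ.m≤n⇒m≤1+n (ℕₚ.m≤n⇒m≤1+n (ℕₚ.≤-trans (ℕₚ.n≤1+n _) (ℕₚ.<⇒≤ c<k)))) , len _ _ _ , total 2 m (suc k₂) k₂ c (solve 2 (λ k c → con 3 :+ k :+ (con 2 :+ k) :+ c :+ con 2 := con 3 :+ k :+ (con 2 :+ k) :+ (con 2 :+ c)) refl k c) e₂) ∷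
      (strict k₂ (suc k) c₂ (ℕₚ.n≤1+n k₂) ℕₚ.≤-refl (ℕₚ.m≤n⇒m≤1+n c<k) , len _ _ _ , total 2 m k₂ (suc k) c₂ (solve 2 (λ k c → con 2 :+ k :+ (con 1 :+ k) :+ (con 2 :+ c) :+ con 2 := con 3 :+ k :+ (con 2 :+ k) :+ (con 2 :+ c)) refl k c) e₂) ∷ []
    δ : ∀ m {Ls} → All (Good m) Ls → ∀ {A B} → A ∈ Ls → B ∈ Ls → A ≢ B → I m A B ≡ 0ℚ
    δ m gs {A} {B} i j ne with All.lookup gs i | All.lookup gs j
    ... | s , q , _ | s' , q' , _ = I-≢′ m A B s s' (trans q (sym q')) ne
    nn : ∀ m {Ls} → All (Good m) Ls → ∀ {A} → A ∈ Ls → I m A A ≡ fromℕ 1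
    nn m gs {A} i with All.lookup gs i
    ... | s , q , r = trans (I-refl m A s (trans r (cong (λ x → m + tri x) (sym q)))) (sym (ℚₚ.+-identityʳ 1ℚ))
    κ>1 : ∀ {f} → Anti f → ∑ (T 1 κ) f ≡ f u₁ +ℚ f v₁
    κ>1 {f} af = trans (∑T1-run L (suc k₂) (k₂ ∷ c₂ ∷ []) {f} af)
      (trans (+-zeroˡ _ (Anti-dup {f} af R k₂ [] (c₂ ∷ []))) (cong (f u₁ +ℚ_) (ℚₚ.+-identityʳ _)))
    κ>1>1 : ∀ {f} → Anti f → ∑ (T 1 κ) (λ A → ∑ (T 1 A) f) ≡ ((f α +ℚ f β) +ℚ (f β +ℚ f γ)) +ℚ ∑ (ε ∷ []) f
    κ>1>1 {f} af = begin
      ∑ (T 1 κ) (λ A → ∑ (T 1 A) f)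
        ≡⟨ κ>1 {λ A → ∑ (T 1 A) f} (∑T-Anti 1 {f} af) ⟩
      ∑ (T 1 u₁) f +ℚ ∑ (T 1 v₁) f
        ≡⟨ cong₂ _+ℚ_ (∑T1-run L (suc k₂) (suc k ∷ c₂ ∷ []) {f} af) (trans (∑T1-run L (suc k₂) (k₂ ∷ suc c ∷ []) {f} af)
             (trans (+-zeroˡ _ (Anti-dup {f} af R k₂ [] (suc c ∷ []))) (cong (f β +ℚ_) (ℚₚ.+-identityʳ _)))) ⟩
      (f ε +ℚ (f α +ℚ (f β +ℚ 0ℚ))) +ℚ (f β +ℚ f γ)
        ≡⟨ cong (λ z' → (f ε +ℚ (f α +ℚ z')) +ℚ (f β +ℚ f γ)) (ℚₚ.+-identityʳ _) ⟩
      (f ε +ℚ (f α +ℚ f β)) +ℚ (f β +ℚ f γ)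
        ≡⟨ trans (ℚₚ.+-assoc (f ε) _ _) (trans (ℚₚ.+-comm (f ε) _) (cong (((f α +ℚ f β) +ℚ (f β +ℚ f γ)) +ℚ_) (sym (ℚₚ.+-identityʳ _)))) ⟩
      ((f α +ℚ f β) +ℚ (f β +ℚ f γ)) +ℚ (f ε +ℚ 0ℚ) ∎
    κ>2 : ∀ {f} → Anti f → ∑ (T 2 κ) f ≡ ((f α +ℚ 0ℚ) +ℚ (f γ +ℚ 0ℚ)) +ℚ -ℚ ∑ (ε ∷ []) f
    κ>2 {f} af = begin
      ∑ (T 2 κ) f
        ≡⟨ ∑T2-run L k₂ (c₂ ∷ []) {f} af ⟩
      f (t (suc k) k₂ c₂) +ℚ (f α +ℚ (f γ +ℚ 0ℚ))
        ≡⟨ cong₂ _+ℚ_ (af R (suc k) k₂ (c₂ ∷ [])) (cong (_+ℚ (f γ +ℚ 0ℚ)) (sym (ℚₚ.+-identityʳ (f α)))) ⟩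
      -ℚ f ε +ℚ ((f α +ℚ 0ℚ) +ℚ (f γ +ℚ 0ℚ))
        ≡⟨ trans (ℚₚ.+-comm _ _) (cong (λ z' → ((f α +ℚ 0ℚ) +ℚ (f γ +ℚ 0ℚ)) +ℚ -ℚ z') (sym (ℚₚ.+-identityʳ (f ε)))) ⟩
      ((f α +ℚ 0ℚ) +ℚ (f γ +ℚ 0ℚ)) +ℚ -ℚ (f ε +ℚ 0ℚ) ∎
    second : ∀ {x y y' w w'} → y ≢ y' → t x y w ≢ t x y' w'
    second ne e = ne (Listₚ.∷-injectiveˡ (Listₚ.∷-injectiveʳ (Listₚ.++-cancelˡ R _ _ e)))
    k<k₂ : k ≢ k₂
    k<k₂ e = ℕₚ.<⇒≢ (ℕₚ.m≤n⇒m≤1+n (ℕₚ.n<1+n k)) e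
    top≢ : ∀ {y y' w w'} → t (suc k₂) y w ≢ t k₂ y' w'
    top≢ = ≢-at R (λ e → n≢1+n (sym e))
    module C = Corners m κ u₁ v₁ α β γ (ε ∷ []) κ>1 κ>1>1 κ>2 (δ (suc m) good₁) (δ m good₂) (nn (suc m) good₁) (nn m good₂)
      (second n≢1+n) (second n≢1+n) (second k<k₂) (second n≢1+n) (inj₂ (ε , refl , top≢ , top≢ , top≢))

-- `last-row` with j = 2 and j = 1 absorbs the new row, and `∑hS-rectangle` takes its boxes from the
-- last row of the rectangle. Both sides become `κ`, and N_2 - N_1 of `κ` with itself remains. The
-- bound on `c` is what `last-row` requires.
rectangle : ∀ m L c y → let k = suc (suc c) + suc (suc y) ; A = run (suc L) (suc k) ++ k ∷ [] in
  suc (suc (suc (suc y))) ≤ suc (suc c) →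
  sum A ≡ suc (suc (suc (suc y))) + m + tri (length A) →
  fromℕ 2 ≤ℚ D (suc (suc (suc y))) m A (map suc (run (suc L) (suc k) ++ suc (suc c) ∷ []) ++ suc (suc y) ∷ [])
rectangle m L c y big sm = ℚₚ.≤-trans (corners L κ refl sκ) (ℚₚ.≤-reflexive (sym (cong₂ (λ s t → s +ℚ -ℚ t) (N 2 m) (N₁))))
  where
  c₂ = suc (suc c)
  y₂ = suc (suc y)
  k = c₂ + y₂
  R = run (suc L) (suc k)
  A = R ++ k ∷ []
  κ = R ++ c₂ ∷ []
  len : length A ≡ length κ
  len = trans (Listₚ.length-++ R) (sym (Listₚ.length-++ R))
  large : ∀ j → j ≤ 2 → All (y₂ + j ≤_) κ
  large j j≤2 = Allₚ.++⁺ (All.map (λ h → ℕₚ.≤-trans y≤k (ℕₚ.≤-trans (ℕₚ.n≤1+n k) h)) (run-All (suc L) (suc k))) (y≤c ∷ [])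
    where
    y≤c : y₂ + j ≤ c₂
    y≤c = ℕₚ.≤-trans (ℕₚ.+-monoʳ-≤ y₂ j≤2) (ℕₚ.≤-trans (ℕₚ.≤-reflexive (ℕₚ.+-comm y₂ 2)) big)
    y≤k : y₂ + j ≤ k
    y≤k = ℕₚ.≤-trans y≤c (ℕₚ.m≤m+n c₂ y₂)
  N' : ∀ j m → j ≤ 2 → NSum (y₂ + j) A (map suc κ ++ y₂ ∷ []) (I m) ≡ NSum j κ κ (I m)
  N' j m j≤2 = trans (last-row m j y₂ A κ len (large j j≤2)) (∑hS-rectangle (suc L) c₂ y₂ {λ C → NSum j C κ (I m)} (NSum-Antiˡ j κ {I m} (I-Antiˡ m)))
  N : ∀ j m → NSum (2 + y₂) A (map suc κ ++ y₂ ∷ []) (I m) ≡ NSum 2 κ κ (I m)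
  N j m = trans (cong (λ p → NSum p A (map suc κ ++ y₂ ∷ []) (I m)) (ℕₚ.+-comm 2 y₂)) (N' 2 m ℕₚ.≤-refl)
  N₁ : NSum (1 + y₂) A (map suc κ ++ y₂ ∷ []) (I (suc m)) ≡ NSum 1 κ κ (I (suc m))
  N₁ = trans (cong (λ p → NSum p A (map suc κ ++ y₂ ∷ []) (I (suc m))) (ℕₚ.+-comm 1 y₂)) (N' 1 (suc m) (s≤s z≤n))
  sκ : sum κ ≡ suc (suc m) + tri (length κ)
  sκ = ℕₚ.+-cancelʳ-≡ y₂ _ _ (begin
    sum κ + y₂                                ≡⟨ cong (_+ y₂) (sum-++ R _) ⟩
    sum R + (c₂ + 0) + y₂                     ≡⟨ solve 3 (λ r c y → r :+ (c :+ con 0) :+ y := r :+ (c :+ y :+ con 0)) refl (sum R) c₂ y₂ ⟩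
    sum R + (k + 0)                           ≡⟨ sym (sum-++ R _) ⟩
    sum A                                     ≡⟨ sm ⟩
    suc (suc y₂) + m + tri (length A)         ≡⟨ cong (λ l → suc (suc y₂) + m + tri l) len ⟩
    suc (suc y₂) + m + tri (length κ)         ≡⟨ solve 3 (λ y m t → con 2 :+ y :+ m :+ t := con 2 :+ m :+ t :+ y) refl y₂ m (tri (length κ)) ⟩
    suc (suc m) + tri (length κ) + y₂         ∎)
  run-snoc : ∀ L h → run (suc L) h ≡ run L (suc h) ++ h ∷ []
  run-snoc zero    h = cong (_∷ []) (ℕₚ.+-identityʳ h)
  run-snoc (suc L) h = cong₂ _∷_ (ℕₚ.+-suc h L) (run-snoc L h)
  k₁ = suc c + y₂
  -- The full rows exceed the last one by `y₂`, at least 2, so two boxes can be removed from the row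
  -- of the upper corner.
  c<k : c₂ < k₁
  c<k = s≤s (ℕₚ.≤-trans (s≤s (s≤s (ℕₚ.m≤m+n c y))) (ℕₚ.≤-reflexive (solve 2 (λ c y → con 2 :+ (c :+ y) := c :+ (con 2 :+ y)) refl c y)))
  corners : ∀ L κ → κ ≡ run (suc L) (suc k) ++ c₂ ∷ [] → sum κ ≡ suc (suc m) + tri (length κ) →
    fromℕ 2 ≤ℚ NSum 2 κ κ (I m) +ℚ -ℚ NSum 1 κ κ (I (suc m))
  corners zero    κ e sm = subst (λ κ → sum κ ≡ suc (suc m) + tri (length κ) → fromℕ 2 ≤ℚ NSum 2 κ κ (I m) +ℚ -ℚ NSum 1 κ κ (I (suc m)))
    (sym (trans e (cong (λ x → x ∷ c₂ ∷ []) (ℕₚ.+-identityʳ (suc k))))) (Shape.two-corners₀ m 0 k₁ c c<k) sm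
  corners (suc L) κ e sm = subst (λ κ → sum κ ≡ suc (suc m) + tri (length κ) → fromℕ 2 ≤ℚ NSum 2 κ κ (I m) +ℚ -ℚ NSum 1 κ κ (I (suc m)))
    (sym (trans e shape)) (Shape.two-corners m L k₁ c c<k) sm
    where
    shape : run (suc (suc L)) (suc k) ++ c₂ ∷ [] ≡ run L (suc (suc (suc k))) ++ suc (suc k) ∷ suc k ∷ c₂ ∷ []
    shape = trans (cong (_++ c₂ ∷ []) (trans (run-snoc (suc L) (suc k)) (cong (_++ suc k ∷ []) (run-snoc L (suc (suc k))))))
      (trans (Listₚ.++-assoc (run L (suc (suc (suc k))) ++ suc (suc k) ∷ []) _ _) (Listₚ.++-assoc (run L (suc (suc (suc k)))) _ _))

-- Counting positions and sums indexed by positions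

cnt : ℕ → (ℕ → Bool) → ℕ
cnt zero    Q = 0
cnt (suc N) Q = (if Q 0 then 1 else 0) + cnt N (λ i → Q (suc i))

cnt-cong : ∀ N {P Q : ℕ → Bool} → (∀ i → i < N → P i ≡ Q i) → cnt N P ≡ cnt N Q
cnt-cong zero    h = refl
cnt-cong (suc N) h = cong₂ _+_ (cong (λ b → if b then 1 else 0) (h 0 (s≤s z≤n))) (cnt-cong N (λ i p → h (suc i) (s≤s p)))

cnt-+ : ∀ M N Q → cnt (M + N) Q ≡ cnt M Q + cnt N (λ i → Q (M + i))
cnt-+ zero    N Q = refl
cnt-+ (suc M) N Q = trans (cong ((if Q 0 then 1 else 0) +_) (cnt-+ M N (λ i → Q (suc i)))) (sym (ℕₚ.+-assoc (if Q 0 then 1 else 0) _ _))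

cnt-false : ∀ N {Q : ℕ → Bool} → (∀ i → i < N → Q i ≡ false) → cnt N Q ≡ 0
cnt-false zero    h = refl
cnt-false (suc N) h rewrite h 0 (s≤s z≤n) = cnt-false N (λ i p → h (suc i) (s≤s p))

cnt-not : ∀ N Q → cnt N Q + cnt N (λ i → not (Q i)) ≡ N
cnt-not zero    Q = refl
cnt-not (suc N) Q with Q 0
... | true  = cong suc (cnt-not N (λ i → Q (suc i)))
... | false = trans (ℕₚ.+-suc _ _) (cong suc (cnt-not N (λ i → Q (suc i))))

cnt-snoc : ∀ N Q → cnt (suc N) Q ≡ cnt N Q + (if Q N then 1 else 0)
cnt-snoc zero    Q = ℕₚ.+-comm _ 0
cnt-snoc (suc N) Q = trans (cong ((if Q 0 then 1 else 0) +_) (cnt-snoc N (λ i → Q (suc i)))) (sym (ℕₚ.+-assoc (if Q 0 then 1 else 0) _ _))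

cnt-reverse : ∀ N Q → cnt N Q ≡ cnt N (λ i → Q (N ∸ suc i))
cnt-reverse zero    Q = refl
cnt-reverse (suc N) Q = trans (cnt-snoc N Q) (trans (ℕₚ.+-comm (cnt N Q) _) (cong ((if Q N then 1 else 0) +_) (cnt-reverse N Q)))

cnt-∨ : ∀ N P Q → (∀ i → P i ∧ Q i ≡ false) → cnt N (λ i → P i ∨ Q i) ≡ cnt N P + cnt N Q
cnt-∨ zero    P Q h = refl
cnt-∨ (suc N) P Q h with P 0 | Q 0 | h 0
... | true  | false | _ = cong suc (cnt-∨ N _ _ (λ i → h (suc i)))
... | false | true  | _ = trans (cong suc (cnt-∨ N _ _ (λ i → h (suc i)))) (sym (ℕₚ.+-suc _ _))
... | false | false | _ = cnt-∨ N _ _ (λ i → h (suc i))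

cnt-≡ : ∀ N c P → c < N → cnt N (λ i → (c ≡ᵇ i) ∧ P i) ≡ (if P c then 1 else 0)
cnt-≡ (suc N) zero    P _       = trans (cong ((if P 0 then 1 else 0) +_) (cnt-false N (λ _ _ → refl))) (ℕₚ.+-identityʳ _)
cnt-≡ (suc N) (suc c) P (s≤s h) = cnt-≡ N c (λ i → P (suc i)) h

memb-≢ : ∀ {x} B → All (x ≢_) B → memb x B ≡ false
memb-≢ []      []       = refl
memb-≢ (c ∷ B) (n ∷ ns) rewrite ≡ᵇ-≢ (λ e → n (sym e)) = memb-≢ B ns

head-disjoint : ∀ c B → All (c ≢_) B → ∀ i → (c ≡ᵇ i) ∧ memb i B ≡ false
head-disjoint c B h i with c ℕₚ.≟ i
... | yes refl rewrite ≡ᵇ-refl c = memb-≢ B h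
... | no ne    rewrite ≡ᵇ-≢ ne = refl

count-cnt : ∀ N P B → Unique B → All (_< N) B → countᵇ P B ≡ cnt N (λ i → memb i B ∧ P i)
count-cnt N P []      _       _        = sym (cnt-false N (λ _ _ → refl))
count-cnt N P (c ∷ B) (n ∷ U) (c<N ∷ h) = begin
  countᵇ P (c ∷ B)                                                   ≡⟨ lhs ⟩
  (if P c then 1 else 0) + countᵇ P B                                ≡⟨ cong₂ _+_ (sym (cnt-≡ N c P c<N)) (count-cnt N P B U h) ⟩
  cnt N (λ i → (c ≡ᵇ i) ∧ P i) + cnt N (λ i → memb i B ∧ P i)        ≡⟨ sym (cnt-∨ N _ _ (λ i → disj i)) ⟩
  cnt N (λ i → ((c ≡ᵇ i) ∧ P i) ∨ (memb i B ∧ P i))                  ≡⟨ cnt-cong N (λ i _ → sym (Boolₚ.∧-distribʳ-∨ (P i) (c ≡ᵇ i) (memb i B))) ⟩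
  cnt N (λ i → memb i (c ∷ B) ∧ P i)                                 ∎
  where
  lhs : countᵇ P (c ∷ B) ≡ (if P c then 1 else 0) + countᵇ P B
  lhs with P c
  ... | true  = refl
  ... | false = refl
  disj : ∀ i → ((c ≡ᵇ i) ∧ P i) ∧ (memb i B ∧ P i) ≡ false
  disj i with c ≡ᵇ i | memb i B | P i | head-disjoint c B n i
  ... | true  | false | true  | _ = refl
  ... | true  | false | false | _ = refl
  ... | false | _     | _     | _ = refl

∑-range : ∀ N B (g : ℕ → ℚ) → Unique B → All (_< N) B → ∑ B g ≡ ∑< N (λ i → if memb i B then g i else 0ℚ)
∑-range N []      g _       _         = sym (∑<-0 N (λ _ → refl))
∑-range N (c ∷ B) g (n ∷ U) (c<N ∷ h) = begin
  g c +ℚ ∑ B g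
    ≡⟨ cong₂ _+ℚ_ (sym (single N c g c<N)) (∑-range N B g U h) ⟩
  ∑< N (λ i → if c ≡ᵇ i then g i else 0ℚ) +ℚ ∑< N (λ i → if memb i B then g i else 0ℚ)
    ≡⟨ sym (∑<-+ N _ _) ⟩
  ∑< N (λ i → (if c ≡ᵇ i then g i else 0ℚ) +ℚ (if memb i B then g i else 0ℚ))
    ≡⟨ ∑<-cong N union ⟩
  ∑< N (λ i → if memb i (c ∷ B) then g i else 0ℚ) ∎
  where
  single : ∀ N c (g : ℕ → ℚ) → c < N → ∑< N (λ i → if c ≡ᵇ i then g i else 0ℚ) ≡ g c
  single (suc N) zero    g _       = trans (∑<-suc N _) (+-zeroʳ _ (∑<-0 N (λ _ → refl)))
  single (suc N) (suc c) g (s≤s h) = trans (∑<-suc N _) (trans (+-zeroˡ _ refl) (single N c (λ i → g (suc i)) h))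
  union : ∀ i → (if c ≡ᵇ i then g i else 0ℚ) +ℚ (if memb i B then g i else 0ℚ) ≡ (if memb i (c ∷ B) then g i else 0ℚ)
  union i with c ≡ᵇ i | memb i B | head-disjoint c B n i
  ... | true  | false | _ = ℚₚ.+-identityʳ _
  ... | false | true  | _ = ℚₚ.+-identityˡ _
  ... | false | false | _ = ℚₚ.+-identityˡ _

∑<-drop : ∀ r M (g : ℕ → ℚ) → (∀ i → i < r → g i ≡ 0ℚ) → ∑< (r + M) g ≡ ∑< M (λ x → g (r + x))
∑<-drop zero    M g h = refl
∑<-drop (suc r) M g h = trans (∑<-suc (r + M) g) (trans (+-zeroˡ _ (h 0 (s≤s z≤n))) (∑<-drop r M (λ i → g (suc i)) (λ i p → h (suc i) (s≤s p))))

∑<-cong-< : ∀ N {f g : ℕ → ℚ} → (∀ i → i < N → f i ≡ g i) → ∑< N f ≡ ∑< N g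
∑<-cong-< zero    h = trans (∑<-zero _) (sym (∑<-zero _))
∑<-cong-< (suc N) h = trans (∑<-suc N _) (trans (cong₂ _+ℚ_ (h 0 (s≤s z≤n)) (∑<-cong-< N (λ i p → h (suc i) (s≤s p)))) (sym (∑<-suc N _)))

∑<-reverse : ∀ N (f : ℕ → ℚ) → ∑< N f ≡ ∑< N (λ i → f (N ∸ suc i))
∑<-reverse zero    f = trans (∑<-zero _) (sym (∑<-zero _))
∑<-reverse (suc N) f = trans (∑<-snoc N f) (trans (ℚₚ.+-comm _ _) (trans (cong (f N +ℚ_) (∑<-reverse N f)) (sym (∑<-suc N _))))

-- Complementary beta-sets

-- Reflecting a beta-set inside {0, ..., N - 1} and exchanging beads with gaps gives a beta-set of
-- the conjugate partition.
record Compl (N : ℕ) (B B' : List ℕ) : Set where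
  field
    unique  : Unique B
    unique' : Unique B'
    bound   : All (_< N) B
    bound'  : All (_< N) B'
    compl   : ∀ x → x < N → memb x B' ≡ not (memb (N ∸ suc x) B)

∸∸-suc : ∀ N x → x < N → N ∸ suc (N ∸ suc x) ≡ x
∸∸-suc (suc N) x (s≤s h) = ℕₚ.m∸[m∸n]≡n h

memb-++ : ∀ x P Q → memb x (P ++ Q) ≡ memb x P ∨ memb x Q
memb-++ x []      Q = refl
memb-++ x (p ∷ P) Q = trans (cong ((p ≡ᵇ x) ∨_) (memb-++ x P Q)) (sym (Boolₚ.∨-assoc (p ≡ᵇ x) _ _))

memb-split : ∀ b B → memb b B ≡ true → Unique B → ∃ λ P → ∃ λ Q → B ≡ P ++ b ∷ Q × All (_≢ b) P × All (_≢ b) Q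
memb-split b B h U with memb-∈ b B h
... | P , Q , refl = P , Q , refl , Unique-mid P U

memb-replace : ∀ b b' B → Unique B → memb b B ≡ true → b ≢ b' → ∀ x →
  memb x (replaceβ b b' B) ≡ (if b ≡ᵇ x then false else (if b' ≡ᵇ x then true else memb x B))
memb-replace b b' B U h ne x with memb-split b B h U
... | P , Q , refl , nP , nQ rewrite replaceβ-mid b b' P Q nP nQ | memb-++ x P (b' ∷ Q) | memb-++ x P (b ∷ Q) with b ℕₚ.≟ x
...   | yes refl rewrite ≡ᵇ-refl b | memb-≢ P (All.map (λ n e → n (sym e)) nP) | memb-≢ Q (All.map (λ n e → n (sym e)) nQ) | ≡ᵇ-≢ (λ e → ne (sym e)) = refl
...   | no b≢x rewrite ≡ᵇ-≢ b≢x with b' ≡ᵇ x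
...     | true  = Boolₚ.∨-zeroʳ (memb x P)
...     | false = refl

Unique-replaceβ : ∀ b b' B → Unique B → memb b B ≡ true → memb b' B ≡ false → Unique (replaceβ b b' B)
Unique-replaceβ b b' B U h h' with memb-split b B h U
... | P , Q , refl , nP , nQ rewrite replaceβ-mid b b' P Q nP nQ =
  Unique-replace P U (Allₚ.++⁻ˡ P (memb-∉ b' (P ++ b ∷ Q) h')) (All.tail (Allₚ.++⁻ʳ P (memb-∉ b' (P ++ b ∷ Q) h')))

All-replaceβ : ∀ {N} b b' B → b' < N → All (_< N) B → All (_< N) (replaceβ b b' B)
All-replaceβ b b' []      h []       = []
All-replaceβ b b' (c ∷ B) h (p ∷ ps) with c ≡ᵇ b
... | true  = h ∷ All-replaceβ b b' B h ps
... | false = p ∷ All-replaceβ b b' B h ps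

sgn-parity : ∀ n → ι (pm (isEven n)) ≡ sgn n
sgn-parity zero    = ι-1
sgn-parity (suc n) = trans (cong (λ b → ι (pm b)) (isEven-suc n)) (trans (ι-pm (isEven n)) (trans (cong -ℚ_ (sgn-parity n)) (sym (neg-* (sgn n)))))

sgn-+ : ∀ a b → sgn (a + b) ≡ sgn a *ℚ sgn b
sgn-+ zero    b = sym (ℚₚ.*-identityˡ _)
sgn-+ (suc a) b = trans (cong (-ℚ 1ℚ *ℚ_) (sgn-+ a b)) (sym (ℚₚ.*-assoc (-ℚ 1ℚ) _ _))

between : ∀ N r x k B → Unique B → All (_< N) B → N ≡ suc x + (r + k) →
  countᵇ (λ c → (x <ᵇ c) ∧ (c <ᵇ suc r + x)) B ≡ cnt r (λ i → memb (suc x + i) B)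
between N r x k B U h refl = begin
  countᵇ P B                                            ≡⟨ count-cnt N P B U h ⟩
  cnt (suc x + (r + k)) Q                               ≡⟨ cnt-+ (suc x) (r + k) Q ⟩
  cnt (suc x) Q + cnt (r + k) (λ i → Q (suc x + i))     ≡⟨ cong₂ _+_ (cnt-false (suc x) low) (cnt-+ r k _) ⟩
  cnt r (λ i → Q (suc x + i)) + cnt k (λ i → Q (suc x + (r + i)))
                                                        ≡⟨ cong₂ _+_ (cnt-cong r mid) (cnt-false k high) ⟩
  cnt r (λ i → memb (suc x + i) B) + 0                  ≡⟨ ℕₚ.+-identityʳ _ ⟩
  cnt r (λ i → memb (suc x + i) B)                      ∎
  where
  P Q : ℕ → Bool
  P c = (x <ᵇ c) ∧ (c <ᵇ suc r + x)
  Q c = memb c B ∧ P c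
  low : ∀ i → i < suc x → Q i ≡ false
  low i (s≤s p) rewrite <ᵇ-false p = Boolₚ.∧-zeroʳ (memb i B)
  mid : ∀ i → i < r → Q (suc x + i) ≡ memb (suc x + i) B
  mid i p rewrite <ᵇ-true {x} {suc (x + i)} (s≤s (ℕₚ.m≤m+n x i)) | <ᵇ-true {x + i} {r + x} (subst (x + i <_) (ℕₚ.+-comm x r) (ℕₚ.+-monoʳ-< x p)) = Boolₚ.∧-identityʳ _
  high : ∀ i → i < k → Q (suc x + (r + i)) ≡ false
  high i p rewrite <ᵇ-false {x + (r + i)} {r + x} (subst (_≤ x + (r + i)) (ℕₚ.+-comm x r) (ℕₚ.+-monoʳ-≤ x (ℕₚ.m≤m+n r i))) =
    trans (cong (memb (suc (x + (r + i))) B ∧_) (Boolₚ.∧-zeroʳ (x <ᵇ suc (x + (r + i))))) (Boolₚ.∧-zeroʳ (memb (suc (x + (r + i))) B))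

-- The sign character on the class of cycle type `ρ`.
eps : List ℕ → ℚ
eps []      = 1ℚ
eps (r ∷ ρ) = sgn (r ∸ 1) *ℚ eps ρ

eps-sq : ∀ ρ → eps ρ *ℚ eps ρ ≡ 1ℚ
eps-sq []      = ℚₚ.*-identityˡ 1ℚ
eps-sq (r ∷ ρ) = trans (exch (sgn (r ∸ 1)) (eps ρ) (sgn (r ∸ 1)) (eps ρ)) (trans (cong₂ _*ℚ_ (sgn-sq (r ∸ 1)) (eps-sq ρ)) (ℚₚ.*-identityˡ 1ℚ))
  where
  exch : ∀ x y u v → x *ℚ y *ℚ (u *ℚ v) ≡ x *ℚ u *ℚ (y *ℚ v)
  exch x y u v = trans (ℚₚ.*-assoc x y _) (trans (cong (x *ℚ_) (trans (sym (ℚₚ.*-assoc y u v)) (trans (cong (_*ℚ v) (ℚₚ.*-comm y u)) (ℚₚ.*-assoc u y v)))) (sym (ℚₚ.*-assoc x u _)))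

summand : ℕ → List ℕ → List ℕ → ℕ → ℚ
summand r ρ B x = if memb (suc r + x) B ∧ not (memb x B) then
  sgn (cnt r (λ i → memb (suc x + i) B)) *ℚ ι (chiβ (replaceβ (suc r + x) x B) ρ) else 0ℚ

if-∧ : ∀ (a b : Bool) (x : ℚ) → (if a then (if b then x else 0ℚ) else 0ℚ) ≡ (if a ∧ b then x else 0ℚ)
if-∧ true  b x = refl
if-∧ false b x = refl

-- The Murnaghan–Nakayama sum indexed by the target position x of the moved bead.
chiβ-range : ∀ r M ρ B → Unique B → All (_< suc r + M) B →
  ι (chiβ B (suc r ∷ ρ)) ≡ ∑< M (summand r ρ B)
chiβ-range r M ρ B U h = begin
  ι (chiβ B (suc r ∷ ρ))                                                ≡⟨ ι-sumℤ term B ⟩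
  ∑ B (λ b → ι (term b))                                                ≡⟨ ∑-range (suc r + M) B _ U h ⟩
  ∑< (suc r + M) (λ i → if memb i B then ι (term i) else 0ℚ)            ≡⟨ ∑<-drop (suc r) M _ small ⟩
  ∑< M (λ x → if memb (suc r + x) B then ι (term (suc r + x)) else 0ℚ)  ≡⟨ ∑<-cong-< M each ⟩
  ∑< M (summand r ρ B)                                                  ∎
  where
  term : ℕ → ℤ
  term b = if (suc r ≤ᵇ b) ∧ not (memb (b ∸ suc r) B)
           then signβ b (suc r) B *ℤ chiβ (replaceβ b (b ∸ suc r) B) ρ
           else pos 0
  small : ∀ i → i < suc r → (if memb i B then ι (term i) else 0ℚ) ≡ 0ℚ
  small i p rewrite ≤ᵇ-false p with memb i B
  ... | true  = ι-0
  ... | false = refl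
  each : ∀ x → x < M → (if memb (suc r + x) B then ι (term (suc r + x)) else 0ℚ) ≡ summand r ρ B x
  each x x<M rewrite ≤ᵇ-true (ℕₚ.m≤m+n (suc r) x) | ℕₚ.m+n∸m≡n r x =
    trans (cong (λ t → if memb (suc r + x) B then t else 0ℚ) inner) (if-∧ (memb (suc r + x) B) (not (memb x B)) _)
    where
    sign : ι (pm (isEven (countᵇ (λ c → (x <ᵇ c) ∧ (c <ᵇ suc r + x)) B))) ≡ sgn (cnt r (λ i → memb (suc x + i) B))
    sign = trans (sgn-parity (countᵇ (λ c → (x <ᵇ c) ∧ (c <ᵇ suc r + x)) B)) (cong sgn (between (suc r + M) r x (M ∸ x) B U h
      (trans (cong (suc r +_) (sym (ℕₚ.m+[n∸m]≡n (ℕₚ.<⇒≤ x<M)))) (cong suc (trans (sym (ℕₚ.+-assoc r x _)) (trans (cong (_+ (M ∸ x)) (ℕₚ.+-comm r x)) (ℕₚ.+-assoc x r _)))))))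
    inner : ι (if not (memb x B) then pm (isEven (countᵇ (λ c → (x <ᵇ c) ∧ (c <ᵇ suc r + x)) B)) *ℤ chiβ (replaceβ (suc r + x) x B) ρ else pos 0) ≡
            (if not (memb x B) then sgn (cnt r (λ i → memb (suc x + i) B)) *ℚ ι (chiβ (replaceβ (suc r + x) x B) ρ) else 0ℚ)
    inner with not (memb x B)
    ... | true  = trans (ι-* (pm (isEven (countᵇ (λ c → (x <ᵇ c) ∧ (c <ᵇ suc r + x)) B))) _) (cong (_*ℚ ι (chiβ (replaceβ (suc r + x) x B) ρ)) sign)
    ... | false = ι-0

module _ {N B B'} (C : Compl N B B') (r M : ℕ) (N≡ : N ≡ suc r + M) (x : ℕ) (x<M : x < M) where
  open Compl C

  private
    x' = M ∸ suc x

  x'<M : x' < M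
  x'<M = ℕₚ.≤-trans (ℕₚ.≤-reflexive (sym (ℕₚ.+-∸-assoc 1 x<M))) (ℕₚ.m∸n≤m M x)

  mirror₁ : N ∸ suc (suc r + x') ≡ x
  mirror₁ = trans (cong (_∸ suc (suc r + x')) N≡) (trans (cong (suc r + M ∸_) (sym (ℕₚ.+-suc (suc r) x')))
    (trans (ℕₚ.[m+n]∸[m+o]≡n∸o (suc r) M (suc x')) (∸∸-suc M x x<M)))

  mirror₂ : N ∸ suc x' ≡ suc r + x
  mirror₂ = trans (cong (_∸ suc x') N≡) (trans (ℕₚ.+-∸-assoc (suc r) x'<M) (cong (suc r +_) (∸∸-suc M x x<M)))

  x'<N : suc r + x' < N
  x'<N = subst (suc r + x' <_) (sym N≡) (ℕₚ.+-monoʳ-< (suc r) x'<M)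

  -- Under reflection and exchange, a bead moving down into a gap becomes again a bead moving down
  -- by the same distance.
  Compl-move : memb (suc r + x) B ≡ true → memb x B ≡ false →
    Compl N (replaceβ (suc r + x) x B) (replaceβ (suc r + x') x' B')
  Compl-move h h' = record
    { unique  = Unique-replaceβ (suc r + x) x B unique h h'
    ; unique' = Unique-replaceβ (suc r + x') x' B' unique' k k'
    ; bound   = All-replaceβ (suc r + x) x B (subst (x <_) (sym N≡) (ℕₚ.<-≤-trans x<M (ℕₚ.m≤n+m M (suc r)))) bound
    ; bound'  = All-replaceβ (suc r + x') x' B' (ℕₚ.≤-<-trans (ℕₚ.m≤n+m x' (suc r)) x'<N) bound'
    ; compl   = cases
    }
    where
    k : memb (suc r + x') B' ≡ true
    k = trans (compl (suc r + x') x'<N) (cong not (trans (cong (λ t → memb t B) mirror₁) h'))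
    k' : memb x' B' ≡ false
    k' = trans (compl x' (ℕₚ.≤-<-trans (ℕₚ.m≤n+m x' (suc r)) x'<N)) (cong not (trans (cong (λ t → memb t B) mirror₂) h))
    ne : ∀ x → suc r + x ≢ x
    ne x e = ℕₚ.<⇒≢ (s≤s (ℕₚ.m≤n+m x r)) (sym e)
    m₁ : ∀ y → y < N → x' ≢ y → suc r + x ≢ N ∸ suc y
    m₁ y y<N n₂ e = n₂ (trans (sym (∸∸-suc N x' (ℕₚ.≤-<-trans (ℕₚ.m≤n+m x' (suc r)) x'<N))) (trans (cong (λ t → N ∸ suc t) (trans mirror₂ e)) (∸∸-suc N y y<N)))
    m₂ : ∀ y → y < N → suc r + x' ≢ y → x ≢ N ∸ suc y
    m₂ y y<N n₁ e = n₁ (trans (sym (∸∸-suc N (suc r + x') x'<N)) (trans (cong (λ t → N ∸ suc t) (trans mirror₁ e)) (∸∸-suc N y y<N)))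
    cases : ∀ y → y < N → memb y (replaceβ (suc r + x') x' B') ≡ not (memb (N ∸ suc y) (replaceβ (suc r + x) x B))
    cases y y<N rewrite memb-replace (suc r + x') x' B' unique' k (ne x') y | memb-replace (suc r + x) x B unique h (ne x) (N ∸ suc y)
      with suc r + x' ℕₚ.≟ y
    ... | yes refl rewrite mirror₁ | ≡ᵇ-refl (r + x') | ≡ᵇ-≢ (ne x) | ≡ᵇ-refl x = refl
    ... | no n₁ with x' ℕₚ.≟ y
    ...   | yes refl rewrite mirror₂ | ≡ᵇ-≢ (ne x') | ≡ᵇ-refl x' | ≡ᵇ-refl (r + x) = refl
    ...   | no n₂ rewrite ≡ᵇ-≢ n₁ | ≡ᵇ-≢ n₂ | ≡ᵇ-≢ (m₁ y y<N n₂) | ≡ᵇ-≢ (m₂ y y<N n₁) = compl y y<N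

  -- Each of the `r` positions strictly between start and target carries a bead in exactly one of
  -- the two sets.
  gaps : cnt r (λ i → memb (suc x + i) B) + cnt r (λ i → memb (suc x' + i) B') ≡ r
  gaps = trans (cong (cnt r (λ i → memb (suc x + i) B) +_) (trans (cnt-cong r (λ i p → trans (compl (suc x' + i) (inside i p)) (cong (λ t → not (memb t B)) (mirror i p))))
      (sym (cnt-reverse r (λ i → not (memb (suc x + i) B)))))) (cnt-not r (λ i → memb (suc x + i) B))
    where
    M≡ : M ≡ suc x' + x
    M≡ = trans (sym (ℕₚ.m∸n+n≡m x<M)) (ℕₚ.+-suc x' x)
    inside : ∀ i → i < r → suc x' + i < N
    inside i p = ℕₚ.≤-<-trans (subst (suc x' + i ≤_) (ℕₚ.+-comm x' (suc r)) (subst (_≤ x' + suc r) (ℕₚ.+-suc x' i) (ℕₚ.+-monoʳ-≤ x' (s≤s (ℕₚ.<⇒≤ p))))) x'<N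
    mirror : ∀ i → i < r → N ∸ suc (suc x' + i) ≡ suc x + (r ∸ suc i)
    mirror i p = trans (cong (_∸ suc (suc x' + i)) (trans N≡ (trans (cong₂ (λ s t → suc s + t) (sym (ℕₚ.m∸n+n≡m p)) M≡)
      (solve 4 (λ d i x' x → con 1 :+ (d :+ (con 1 :+ i)) :+ (con 1 :+ x' :+ x) := con 1 :+ (con 1 :+ x' :+ i) :+ (con 1 :+ x :+ d)) refl (r ∸ suc i) i x' x))))
      (ℕₚ.m+n∸m≡n (suc (suc x' + i)) _)

-- Corresponding moves pass over c and r - c beads by `gaps`. Their signs differ by (-1)^r, the sign
-- of a cycle of length r + 1.
chiβ-Compl : ∀ ρ {N B B'} → Compl N B B' → All (0 <_) ρ → ι (chiβ B' ρ) ≡ eps ρ *ℚ ι (chiβ B ρ)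
chiβ-Compl []          C []      = sym (ℚₚ.*-identityˡ _)
chiβ-Compl (suc r ∷ ρ) {N} {B} {B'} C (_ ∷ h) with suc r ℕₚ.≤? N
... | no r≰N = trans (none B' (Compl.unique' C) (Compl.bound' C)) (sym (trans (cong (eps (suc r ∷ ρ) *ℚ_) (none B (Compl.unique C) (Compl.bound C))) (ℚₚ.*-zeroʳ _)))
  where
  none : ∀ B → Unique B → All (_< N) B → ι (chiβ B (suc r ∷ ρ)) ≡ 0ℚ
  none B U p = trans (chiβ-range r 0 ρ B U (All.map (λ q → ℕₚ.<-≤-trans q (ℕₚ.≤-trans (ℕₚ.<⇒≤ (ℕₚ.≰⇒> r≰N)) (ℕₚ.≤-reflexive (sym (ℕₚ.+-identityʳ (suc r)))))) p)) (∑<-zero _)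
... | yes r≤N = begin
  ι (chiβ B' (suc r ∷ ρ))
    ≡⟨ chiβ-range r M ρ B' (Compl.unique' C) (subst (λ n → All (_< n) B') N≡ (Compl.bound' C)) ⟩
  ∑< M (summand r ρ B')
    ≡⟨ ∑<-reverse M _ ⟩
  ∑< M (λ x → summand r ρ B' (M ∸ suc x))
    ≡⟨ ∑<-cong-< M each ⟩
  ∑< M (λ x → (sgn r *ℚ eps ρ) *ℚ summand r ρ B x)
    ≡⟨ sym (∑<-*ˡ (sgn r *ℚ eps ρ) M _) ⟩
  (sgn r *ℚ eps ρ) *ℚ ∑< M (summand r ρ B)
    ≡⟨ cong ((sgn r *ℚ eps ρ) *ℚ_) (sym (chiβ-range r M ρ B (Compl.unique C) (subst (λ n → All (_< n) B) N≡ (Compl.bound C)))) ⟩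
  (sgn r *ℚ eps ρ) *ℚ ι (chiβ B (suc r ∷ ρ)) ∎
  where
  M = N ∸ suc r
  N≡ : N ≡ suc r + M
  N≡ = sym (ℕₚ.m+[n∸m]≡n r≤N)
  each : ∀ x → x < M → summand r ρ B' (M ∸ suc x) ≡ (sgn r *ℚ eps ρ) *ℚ summand r ρ B x
  each x x<M = go (memb (suc r + x) B) (memb x B) refl refl
    where
    x' = M ∸ suc x
    m₁ : memb (suc r + x') B' ≡ not (memb x B)
    m₁ = trans (Compl.compl C (suc r + x') (x'<N C r M N≡ x x<M)) (cong (λ t → not (memb t B)) (mirror₁ C r M N≡ x x<M))
    m₂ : memb x' B' ≡ not (memb (suc r + x) B)
    m₂ = trans (Compl.compl C x' (ℕₚ.≤-<-trans (ℕₚ.m≤n+m x' (suc r)) (x'<N C r M N≡ x x<M))) (cong (λ t → not (memb t B)) (mirror₂ C r M N≡ x x<M))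
    zero-case : ∀ {s t : ℚ} (a b a' b' : Bool) → a ∧ not b ≡ false → a' ∧ not b' ≡ false →
      (if a' ∧ not b' then s else 0ℚ) ≡ (sgn r *ℚ eps ρ) *ℚ (if a ∧ not b then t else 0ℚ)
    zero-case a b a' b' e e' rewrite e | e' = sym (ℚₚ.*-zeroʳ _)
    go : ∀ a b → memb (suc r + x) B ≡ a → memb x B ≡ b → summand r ρ B' x' ≡ (sgn r *ℚ eps ρ) *ℚ summand r ρ B x
    go true true e₁ e₂ = zero-case (memb (suc r + x) B) (memb x B) (memb (suc r + x') B') (memb x' B')
      (cong₂ (λ a b → a ∧ not b) e₁ e₂) (cong₂ (λ a b → a ∧ not b) (trans m₁ (cong not e₂)) (trans m₂ (cong not e₁)))
    go false b e₁ e₂ = zero-case (memb (suc r + x) B) (memb x B) (memb (suc r + x') B') (memb x' B')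
      (cong₂ (λ a b → a ∧ not b) e₁ e₂) (trans (cong₂ (λ a b → a ∧ not b) (trans m₁ (cong not e₂)) (trans m₂ (cong not e₁))) (Boolₚ.∧-zeroʳ (not b)))
    go true false e₁ e₂ = begin
      summand r ρ B' x'
        ≡⟨ cong₂ (λ a b → if a ∧ not b then s' else 0ℚ) (trans m₁ (cong not e₂)) (trans m₂ (cong not e₁)) ⟩
      sgn (cnt r (λ i → memb (suc x' + i) B')) *ℚ ι (chiβ (replaceβ (suc r + x') x' B') ρ)
        ≡⟨ cong₂ _*ℚ_ signs (chiβ-Compl ρ (Compl-move C r M N≡ x x<M e₁ e₂) h) ⟩
      (sgn r *ℚ sgn c) *ℚ (eps ρ *ℚ ι (chiβ (replaceβ (suc r + x) x B) ρ))
        ≡⟨ exch (sgn r) (sgn c) (eps ρ) _ ⟩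
      (sgn r *ℚ eps ρ) *ℚ (sgn c *ℚ ι (chiβ (replaceβ (suc r + x) x B) ρ))
        ≡⟨ cong ((sgn r *ℚ eps ρ) *ℚ_) (sym (cong₂ (λ a b → if a ∧ not b then sgn c *ℚ ι (chiβ (replaceβ (suc r + x) x B) ρ) else 0ℚ) e₁ e₂)) ⟩
      (sgn r *ℚ eps ρ) *ℚ summand r ρ B x ∎
      where
      c = cnt r (λ i → memb (suc x + i) B)
      c' = cnt r (λ i → memb (suc x' + i) B')
      s' = sgn c' *ℚ ι (chiβ (replaceβ (suc r + x') x' B') ρ)
      exch : ∀ x y u v → x *ℚ y *ℚ (u *ℚ v) ≡ x *ℚ u *ℚ (y *ℚ v)
      exch x y u v = trans (ℚₚ.*-assoc x y _) (trans (cong (x *ℚ_) (trans (sym (ℚₚ.*-assoc y u v)) (trans (cong (_*ℚ v) (ℚₚ.*-comm y u)) (ℚₚ.*-assoc u y v)))) (sym (ℚₚ.*-assoc x u _)))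
      signs : sgn c' ≡ sgn r *ℚ sgn c
      signs = sym (begin
        sgn r *ℚ sgn c                    ≡⟨ cong (λ t → sgn t *ℚ sgn c) (sym (trans (ℕₚ.+-comm c' c) (gaps C r M N≡ x x<M))) ⟩
        sgn (c' + c) *ℚ sgn c             ≡⟨ cong (_*ℚ sgn c) (sgn-+ c' c) ⟩
        sgn c' *ℚ sgn c *ℚ sgn c          ≡⟨ ℚₚ.*-assoc (sgn c') _ _ ⟩
        sgn c' *ℚ (sgn c *ℚ sgn c)        ≡⟨ cong (sgn c' *ℚ_) (sgn-sq c) ⟩
        sgn c' *ℚ 1ℚ                      ≡⟨ ℚₚ.*-identityʳ _ ⟩
        sgn c'                            ∎)

-- Boundary words of partitions: false is a horizontal and true a vertical step, starting at the bottom left.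

beads : ℕ → List Bool → List ℕ
beads i []          = []
beads i (false ∷ w) = beads (suc i) w
beads i (true ∷ w)  = beads (suc i) w ++ i ∷ []

parts : ℕ → List Bool → List ℕ
parts g []          = []
parts g (false ∷ w) = parts (suc g) w
parts g (true ∷ w)  = parts g w ++ g ∷ []

betas-∷ʳ : ∀ xs g → betas (xs ++ g ∷ []) ≡ map suc (betas xs) ++ g ∷ []
betas-∷ʳ []       g = cong (_∷ []) (ℕₚ.+-identityʳ g)
betas-∷ʳ (x ∷ xs) g = cong₂ _∷_ (trans (cong (x +_) (trans (Listₚ.length-++ xs) (ℕₚ.+-comm (length xs) 1))) (ℕₚ.+-suc x (length xs))) (betas-∷ʳ xs g)

-- After `g` horizontal and `k` vertical steps the position is `g + k`. A vertical step there
-- belongs to a row of length `g` with `k` rows below it, so its position is the beta number of that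
-- row.
beads-betas : ∀ g k w → beads (g + k) w ≡ map (k +_) (betas (parts g w))
beads-betas g k []          = refl
beads-betas g k (false ∷ w) = beads-betas (suc g) k w
beads-betas g k (true ∷ w)  = begin
  beads (suc (g + k)) w ++ (g + k) ∷ []                            ≡⟨ cong₂ (λ s t → s ++ t ∷ []) (trans (cong (λ i → beads i w) (sym (ℕₚ.+-suc g k))) (beads-betas g (suc k) w)) (ℕₚ.+-comm g k) ⟩
  map (suc k +_) (betas (parts g w)) ++ (k + g) ∷ []               ≡⟨ cong (_++ (k + g) ∷ []) (trans (Listₚ.map-cong (λ x → sym (ℕₚ.+-suc k x)) (betas (parts g w))) (Listₚ.map-∘ (betas (parts g w)))) ⟩
  map (k +_) (map suc (betas (parts g w))) ++ (k + g) ∷ []         ≡⟨ sym (Listₚ.map-++ (k +_) (map suc (betas (parts g w))) (g ∷ [])) ⟩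
  map (k +_) (map suc (betas (parts g w)) ++ g ∷ [])               ≡⟨ cong (map (k +_)) (sym (betas-∷ʳ (parts g w) g)) ⟩
  map (k +_) (betas (parts g w ++ g ∷ []))                         ∎

betas-parts : ∀ w → betas (parts 0 w) ≡ beads 0 w
betas-parts w = sym (trans (beads-betas 0 0 w) (Listₚ.map-id _))

beads-≥ : ∀ i w → All (i ≤_) (beads i w)
beads-≥ i []          = []
beads-≥ i (false ∷ w) = All.map ℕₚ.<⇒≤ (beads-≥ (suc i) w)
beads-≥ i (true ∷ w)  = Allₚ.++⁺ (All.map ℕₚ.<⇒≤ (beads-≥ (suc i) w)) (ℕₚ.≤-refl ∷ [])

beads-< : ∀ i w → All (_< i + length w) (beads i w)
beads-< i []          = []
beads-< i (false ∷ w) = subst (λ t → All (_< t) (beads (suc i) w)) (sym (ℕₚ.+-suc i (length w))) (beads-< (suc i) w)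
beads-< i (true ∷ w)  = Allₚ.++⁺ (subst (λ t → All (_< t) (beads (suc i) w)) (sym (ℕₚ.+-suc i (length w))) (beads-< (suc i) w))
  (subst (i <_) (sym (ℕₚ.+-suc i (length w))) (s≤s (ℕₚ.m≤m+n i (length w))) ∷ [])

Strict-∷ʳ : ∀ {xs i} → Strict xs → All (i <_) xs → Strict (xs ++ i ∷ [])
Strict-∷ʳ {[]}     s p        = [-]
Strict-∷ʳ {x ∷ xs} s (p ∷ ps) = Strict-∷ (Allₚ.++⁺ (Strict-head s) (p ∷ [])) (Strict-∷ʳ (tail-Strict s) ps)

beads-Strict : ∀ i w → Strict (beads i w)
beads-Strict i []          = []
beads-Strict i (false ∷ w) = beads-Strict (suc i) w
beads-Strict i (true ∷ w)  = Strict-∷ʳ (beads-Strict (suc i) w) (beads-≥ (suc i) w)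

nth : List Bool → ℕ → Bool
nth []      x       = false
nth (b ∷ w) zero    = b
nth (b ∷ w) (suc x) = nth w x

memb-beads : ∀ i w x → memb (i + x) (beads i w) ≡ nth w x
memb-beads i []          x       = refl
memb-beads i (false ∷ w) zero    = memb-≢ (beads (suc i) w) (All.map (λ h e → ℕₚ.<⇒≢ (subst (_< _) (sym (ℕₚ.+-identityʳ i)) h) e) (beads-≥ (suc i) w))
memb-beads i (false ∷ w) (suc x) = trans (cong (λ t → memb t (beads (suc i) w)) (ℕₚ.+-suc i x)) (memb-beads (suc i) w x)
memb-beads i (true ∷ w)  zero    = trans (memb-++ (i + 0) (beads (suc i) w) (i ∷ []))
  (trans (cong (memb (i + 0) (beads (suc i) w) ∨_) (cong (_∨ false) (trans (cong (i ≡ᵇ_) (ℕₚ.+-identityʳ i)) (≡ᵇ-refl i)))) (Boolₚ.∨-zeroʳ _))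
memb-beads i (true ∷ w)  (suc x) = trans (memb-++ (i + suc x) (beads (suc i) w) (i ∷ []))
  (trans (cong (memb (i + suc x) (beads (suc i) w) ∨_) (cong (_∨ false) (≡ᵇ-≢ {i} {i + suc x} (λ e → ℕₚ.<⇒≢ (subst (i <_) (sym (ℕₚ.+-suc i x)) (s≤s (ℕₚ.m≤m+n i x))) e))))
    (trans (Boolₚ.∨-identityʳ _) (trans (cong (λ t → memb t (beads (suc i) w)) (ℕₚ.+-suc i x)) (memb-beads (suc i) w x))))

-- Reading the boundary backwards with the two kinds of steps exchanged gives the boundary of the
-- conjugate.
flipw : List Bool → List Bool
flipw []      = []
flipw (b ∷ w) = flipw w ++ not b ∷ []

length-flipw : ∀ w → length (flipw w) ≡ length w
length-flipw []      = refl
length-flipw (b ∷ w) = trans (Listₚ.length-++ (flipw w)) (trans (ℕₚ.+-comm (length (flipw w)) 1) (cong suc (length-flipw w)))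

flipw-∷ʳ : ∀ w b → flipw (w ++ b ∷ []) ≡ not b ∷ flipw w
flipw-∷ʳ []      b = refl
flipw-∷ʳ (a ∷ w) b = cong (_++ not a ∷ []) (flipw-∷ʳ w b)

nth-++ˡ : ∀ u v x → x < length u → nth (u ++ v) x ≡ nth u x
nth-++ˡ (b ∷ u) v zero    _       = refl
nth-++ˡ (b ∷ u) v (suc x) (s≤s h) = nth-++ˡ u v x h

nth-∷ʳ : ∀ u c → nth (u ++ c ∷ []) (length u) ≡ c
nth-∷ʳ []      c = refl
nth-∷ʳ (b ∷ u) c = nth-∷ʳ u c

nth-flipw : ∀ w x → x < length w → nth (flipw w) x ≡ not (nth w (length w ∸ suc x))
nth-flipw (b ∷ w) x (s≤s x≤) with ℕₚ.m≤n⇒m<n∨m≡n x≤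
... | inj₁ x< = trans (nth-++ˡ (flipw w) _ x (subst (x <_) (sym (length-flipw w)) x<)) (trans (nth-flipw w x x<)
  (cong (λ t → not (nth (b ∷ w) t)) (sym (ℕₚ.+-∸-assoc 1 x<))))
... | inj₂ refl = trans (cong (nth (flipw w ++ not b ∷ [])) (sym (length-flipw w))) (trans (nth-∷ʳ (flipw w) (not b)) (cong (λ t → not (nth (b ∷ w) t)) (sym (ℕₚ.n∸n≡0 (length w)))))

Compl-flipw : ∀ w → Compl (length w) (beads 0 w) (beads 0 (flipw w))
Compl-flipw w = record
  { unique  = Strict-Unique (beads-Strict 0 w)
  ; unique' = Strict-Unique (beads-Strict 0 (flipw w))
  ; bound   = beads-< 0 w
  ; bound'  = subst (λ t → All (_< t) (beads 0 (flipw w))) (length-flipw w) (beads-< 0 (flipw w))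
  ; compl   = λ x h → trans (memb-beads 0 (flipw w) x) (trans (nth-flipw w x h) (cong not (sym (memb-beads 0 w (length w ∸ suc x)))))
  }

-- `nt` counts rows and `nf` columns. `inv` counts the pairs of a horizontal step before a vertical
-- one, that is, the boxes.
nt nf inv : List Bool → ℕ
nt []          = 0
nt (true ∷ w)  = suc (nt w)
nt (false ∷ w) = nt w
nf []          = 0
nf (true ∷ w)  = nf w
nf (false ∷ w) = suc (nf w)
inv []          = 0
inv (true ∷ w)  = inv w
inv (false ∷ w) = nt w + inv w

nt-++ : ∀ u v → nt (u ++ v) ≡ nt u + nt v
nt-++ []          v = refl
nt-++ (true ∷ u)  v = cong suc (nt-++ u v)
nt-++ (false ∷ u) v = nt-++ u v

nf-++ : ∀ u v → nf (u ++ v) ≡ nf u + nf v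
nf-++ []          v = refl
nf-++ (true ∷ u)  v = nf-++ u v
nf-++ (false ∷ u) v = cong suc (nf-++ u v)

nf-flipw : ∀ w → nf (flipw w) ≡ nt w
nf-flipw []          = refl
nf-flipw (true ∷ w)  = trans (nf-++ (flipw w) _) (trans (ℕₚ.+-comm _ 1) (cong suc (nf-flipw w)))
nf-flipw (false ∷ w) = trans (nf-++ (flipw w) _) (trans (ℕₚ.+-identityʳ _) (nf-flipw w))

nt-flipw : ∀ w → nt (flipw w) ≡ nf w
nt-flipw []          = refl
nt-flipw (false ∷ w) = trans (nt-++ (flipw w) _) (trans (ℕₚ.+-comm _ 1) (cong suc (nt-flipw w)))
nt-flipw (true ∷ w)  = trans (nt-++ (flipw w) _) (trans (ℕₚ.+-identityʳ _) (nt-flipw w))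

inv-∷ʳ-true : ∀ w → inv (w ++ true ∷ []) ≡ nf w + inv w
inv-∷ʳ-true []          = refl
inv-∷ʳ-true (true ∷ w)  = inv-∷ʳ-true w
inv-∷ʳ-true (false ∷ w) = trans (cong₂ _+_ (trans (nt-++ w _) (ℕₚ.+-comm (nt w) 1)) (inv-∷ʳ-true w))
  (cong suc (solve 3 (λ t f i → t :+ (f :+ i) := f :+ (t :+ i)) refl (nt w) (nf w) (inv w)))

inv-∷ʳ-false : ∀ w → inv (w ++ false ∷ []) ≡ inv w
inv-∷ʳ-false []          = refl
inv-∷ʳ-false (true ∷ w)  = inv-∷ʳ-false w
inv-∷ʳ-false (false ∷ w) = cong₂ _+_ (trans (nt-++ w _) (ℕₚ.+-identityʳ _)) (inv-∷ʳ-false w)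

inv-flipw : ∀ w → inv (flipw w) ≡ inv w
inv-flipw []          = refl
inv-flipw (true ∷ w)  = trans (inv-∷ʳ-false (flipw w)) (inv-flipw w)
inv-flipw (false ∷ w) = trans (inv-∷ʳ-true (flipw w)) (cong₂ _+_ (nf-flipw w) (inv-flipw w))

sum-parts : ∀ g w → sum (parts g w) ≡ g * nt w + inv w
sum-parts g []          = sym (trans (ℕₚ.+-identityʳ _) (ℕₚ.*-zeroʳ g))
sum-parts g (false ∷ w) = trans (sum-parts (suc g) w) (solve 3 (λ g t i → t :+ g :* t :+ i := g :* t :+ (t :+ i)) refl g (nt w) (inv w))
sum-parts g (true ∷ w)  = trans (sum-++ (parts g w) (g ∷ [])) (trans (cong (_+ (g + 0)) (sum-parts g w))
  (solve 3 (λ g t i → g :* t :+ i :+ (g :+ con 0) := g :* (con 1 :+ t) :+ i) refl g (nt w) (inv w)))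

length-parts : ∀ g w → length (parts g w) ≡ nt w
length-parts g []          = refl
length-parts g (false ∷ w) = length-parts (suc g) w
length-parts g (true ∷ w)  = trans (Listₚ.length-++ (parts g w)) (trans (ℕₚ.+-comm _ 1) (cong suc (length-parts g w)))

parts-≥ : ∀ g w → All (g ≤_) (parts g w)
parts-≥ g []          = []
parts-≥ g (false ∷ w) = All.map ℕₚ.<⇒≤ (parts-≥ (suc g) w)
parts-≥ g (true ∷ w)  = Allₚ.++⁺ (parts-≥ g w) (ℕₚ.≤-refl ∷ [])

Decr : List ℕ → Set
Decr = Linked (λ a b → b ≤ a)

Decr-∷ʳ : ∀ {xs g} → Decr xs → All (g ≤_) xs → Decr (xs ++ g ∷ [])
Decr-∷ʳ {[]}         d p       = [-]
Decr-∷ʳ {x ∷ []}     d (p ∷ _) = p ∷ [-]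
Decr-∷ʳ {x ∷ y ∷ xs} (h ∷ d) (_ ∷ p) = h ∷ Decr-∷ʳ d p

parts-Decr : ∀ g w → Decr (parts g w)
parts-Decr g []          = []
parts-Decr g (false ∷ w) = parts-Decr (suc g) w
parts-Decr g (true ∷ w)  = Decr-∷ʳ (parts-Decr g w) (parts-≥ g w)

parts-∷ʳ-true : ∀ g w → parts g (w ++ true ∷ []) ≡ (g + nf w) ∷ parts g w
parts-∷ʳ-true g []          = cong (_∷ []) (sym (ℕₚ.+-identityʳ g))
parts-∷ʳ-true g (false ∷ w) = trans (parts-∷ʳ-true (suc g) w) (cong (_∷ parts (suc g) w) (sym (ℕₚ.+-suc g (nf w))))
parts-∷ʳ-true g (true ∷ w)  = cong (_++ g ∷ []) (parts-∷ʳ-true g w)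

parts-false : ∀ g w d → parts g (w ++ replicate d false) ≡ parts g w
parts-false g []          zero    = refl
parts-false g []          (suc d) = parts-false (suc g) [] d
parts-false g (false ∷ w) d       = parts-false (suc g) w d
parts-false g (true ∷ w)  d       = cong (_++ g ∷ []) (parts-false g w d)

nf-replicate : ∀ d → nf (replicate d false) ≡ d
nf-replicate zero    = refl
nf-replicate (suc d) = cong suc (nf-replicate d)

hd : List ℕ → ℕ
hd []      = 0
hd (x ∷ _) = x

word : List ℕ → List Bool
word []       = []
word (x ∷ xs) = (word xs ++ replicate (x ∸ hd xs) false) ++ true ∷ []

hd-≤ : ∀ {x xs} → Decr (x ∷ xs) → hd xs ≤ x
hd-≤ [-]     = z≤n
hd-≤ (h ∷ _) = h

Decr-tail : ∀ {x xs} → Decr (x ∷ xs) → Decr xs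
Decr-tail [-]     = []
Decr-tail (_ ∷ d) = d

nf-word : ∀ xs → Decr xs → nf (word xs) ≡ hd xs
nf-word []       d = refl
nf-word (x ∷ xs) d = trans (nf-++ (word xs ++ replicate (x ∸ hd xs) false) _) (trans (ℕₚ.+-identityʳ _)
  (trans (nf-++ (word xs) _) (trans (cong₂ _+_ (nf-word xs (Decr-tail d)) (nf-replicate (x ∸ hd xs))) (ℕₚ.m+[n∸m]≡n (hd-≤ d)))))

parts-word : ∀ xs → Decr xs → parts 0 (word xs) ≡ xs
parts-word []       d = refl
parts-word (x ∷ xs) d = trans (parts-∷ʳ-true 0 (word xs ++ replicate (x ∸ hd xs) false))
  (cong₂ _∷_ (trans (nf-++ (word xs) _) (trans (cong₂ _+_ (nf-word xs (Decr-tail d)) (nf-replicate (x ∸ hd xs))) (ℕₚ.m+[n∸m]≡n (hd-≤ d))))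
    (trans (parts-false 0 (word xs) (x ∸ hd xs)) (parts-word xs (Decr-tail d))))

-- A boundary that starts horizontally and ends vertically has no empty row or column; after `flipw`
-- this makes all parts of the conjugate positive.
word-proper : ∀ x xs → All (0 <_) (x ∷ xs) → ∃ λ v → word (x ∷ xs) ≡ false ∷ v ++ true ∷ []
word-proper (suc x) []       (p ∷ _)  = replicate x false , refl
word-proper x       (y ∷ ys) (_ ∷ ps) with word-proper y ys ps
... | v , e = (v ++ true ∷ []) ++ replicate (x ∸ y) false , cong (λ t → (t ++ replicate (x ∸ y) false) ++ true ∷ []) e

conjugate : ∀ {n x xs} → IsPartition n (x ∷ xs) →
  ∃ λ λ' → IsPartition n λ' × length λ' ≡ x × hd λ' ≡ length (x ∷ xs) ×
    (∀ ρ → All (0 <_) ρ → ι (χ λ' ρ) ≡ eps ρ *ℚ ι (χ (x ∷ xs) ρ))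
conjugate {n} {x} {xs} (s , p , d) = parts 0 w' ,
  (trans (sum-parts 0 w') (trans (inv-flipw w) (trans (sym (sum-parts 0 w)) (trans (cong sum pw) s))) , positive , parts-Decr 0 w') ,
  trans (length-parts 0 w') (trans (nt-flipw w) (nf-word (x ∷ xs) d)) ,
  head , chars
  where
  w = word (x ∷ xs)
  w' = flipw w
  pw : parts 0 w ≡ x ∷ xs
  pw = parts-word (x ∷ xs) d
  v = proj₁ (word-proper x xs p)
  we : w ≡ false ∷ v ++ true ∷ []
  we = proj₂ (word-proper x xs p)
  w'e : w' ≡ false ∷ (flipw v ++ true ∷ [])
  w'e = trans (cong flipw we) (cong (_++ true ∷ []) (flipw-∷ʳ v true))
  positive : All (0 <_) (parts 0 w')
  positive = subst (λ t → All (0 <_) (parts 0 t)) (sym w'e) (parts-≥ 1 (flipw v ++ true ∷ []))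
  head : hd (parts 0 w') ≡ length (x ∷ xs)
  head = begin
    hd (parts 0 w')                             ≡⟨ cong (λ t → hd (parts 0 t)) w'e ⟩
    hd (parts 0 ((false ∷ flipw v) ++ true ∷ []))  ≡⟨ cong hd (parts-∷ʳ-true 0 (false ∷ flipw v)) ⟩
    suc (nf (flipw v))                          ≡⟨ cong suc (nf-flipw v) ⟩
    suc (nt v)                                  ≡⟨ sym (trans (nt-++ v _) (ℕₚ.+-comm (nt v) 1)) ⟩
    nt (false ∷ v ++ true ∷ [])                 ≡⟨ cong nt (sym we) ⟩
    nt w                                        ≡⟨ sym (length-parts 0 w) ⟩
    length (parts 0 w)                          ≡⟨ cong length pw ⟩
    length (x ∷ xs)                             ∎
  chars : ∀ ρ → All (0 <_) ρ → ι (χ (parts 0 w') ρ) ≡ eps ρ *ℚ ι (χ (x ∷ xs) ρ)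
  chars ρ h = trans (cong (λ B → ι (chiβ B ρ)) (betas-parts w')) (trans (chiβ-Compl ρ (Compl-flipw w) h)
    (cong (λ B → eps ρ *ℚ ι (chiβ B ρ)) (trans (sym (betas-parts w)) (cong betas pw))))

-- From partitions to beta-lists and back

length-betas : ∀ λ' → length (betas λ') ≡ length λ'
length-betas []       = refl
length-betas (x ∷ xs) = cong suc (length-betas xs)

sum-betas : ∀ λ' → sum (betas λ') ≡ sum λ' + tri (length λ')
sum-betas []       = refl
sum-betas (x ∷ xs) = trans (cong (x + length xs +_) (sum-betas xs))
  (solve 4 (λ x l s t → x :+ l :+ (s :+ t) := x :+ s :+ (l :+ t)) refl x (length xs) (sum xs) (tri (length xs)))

betas-Strict : ∀ {λ'} → Decr λ' → Strict (betas λ')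
betas-Strict []  = []
betas-Strict [-] = [-]
betas-Strict {x ∷ y ∷ xs} (h ∷ d) = subst (suc (y + length xs) ≤_) (sym (ℕₚ.+-suc x (length xs))) (s≤s (ℕₚ.+-monoˡ-≤ (length xs) h)) ∷ betas-Strict d

betas-positive : ∀ {λ'} → All (0 <_) λ' → All (0 <_) (betas λ')
betas-positive []                = []
betas-positive {x ∷ xs} (p ∷ ps) = ℕₚ.≤-trans p (ℕₚ.m≤m+n x (length xs)) ∷ betas-positive ps

IsPartition⇒Rep : ∀ {n λ'} → IsPartition n λ' → Rep n λ' (betas λ')
IsPartition⇒Rep {n} {λ'} (s , _ , d) = Rep-betas λ' (betas-Strict d) (trans (sum-betas λ') (cong₂ _+_ s (cong tri (sym (length-betas λ')))))

unbeta : List ℕ → List ℕ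
unbeta []      = []
unbeta (b ∷ B) = (b ∸ length B) ∷ unbeta B

length-unbeta : ∀ B → length (unbeta B) ≡ length B
length-unbeta []      = refl
length-unbeta (b ∷ B) = cong suc (length-unbeta B)

betas-unbeta : ∀ B → Strict B → betas (unbeta B) ≡ B
betas-unbeta []      s = refl
betas-unbeta (b ∷ B) s = cong₂ _∷_ (trans (cong (b ∸ length B +_) (length-unbeta B)) (ℕₚ.m∸n+n≡m (Strict-length s))) (betas-unbeta B (tail-Strict s))

unbeta-Decr : ∀ B → Strict B → Decr (unbeta B)
unbeta-Decr []          s = []
unbeta-Decr (b ∷ [])    s = [-]
unbeta-Decr (suc b ∷ c ∷ B) (s≤s h ∷ s) = ℕₚ.∸-monoˡ-≤ (length B) h ∷ unbeta-Decr (c ∷ B) s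

trim : ∀ xs → Decr xs → ∃ λ ys → ∃ λ k → xs ≡ ys ++ replicate k 0 × All (0 <_) ys × Decr ys
trim []           d = [] , 0 , refl , [] , []
trim (zero ∷ xs)  d with trim xs (Decr-tail d)
... | []     , k , e , p , d' = [] , suc k , cong (0 ∷_) e , [] , []
... | y ∷ ys , k , refl , (p ∷ _) , _ with d
...   | h ∷ _ = ⊥-elim (ℕₚ.<⇒≱ p h)
trim (suc x ∷ xs) d with trim xs (Decr-tail d)
... | []     , k , e , p , d' = suc x ∷ [] , k , cong (suc x ∷_) e , s≤s z≤n ∷ [] , [-]
... | y ∷ ys , k , refl , p , d' with d
...   | h ∷ _ = suc x ∷ y ∷ ys , k , refl , s≤s z≤n ∷ p , h ∷ d'

pad^ : ℕ → List ℕ → List ℕ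
pad^ zero    A = A
pad^ (suc k) A = pad^ k (pad A)

betas-zeros : ∀ k xs → betas (xs ++ replicate k 0) ≡ pad^ k (betas xs)
betas-zeros zero    xs = cong betas (Listₚ.++-identityʳ xs)
betas-zeros (suc k) xs = trans (cong betas (sym (Listₚ.++-assoc xs (0 ∷ []) (replicate k 0))))
  (trans (betas-zeros k (xs ++ 0 ∷ [])) (cong (pad^ k) (betas-∷ʳ xs 0)))

Rep-pad^ : ∀ k {n λ' A} → Rep n λ' A → Rep n λ' (pad^ k A)
Rep-pad^ zero    h = h
Rep-pad^ (suc k) {n} {λ'} {A} h = Rep-pad^ k {n} {λ'} {pad A} (Rep-pad {n} {λ'} {A} h)

sum-zeros : ∀ k ys → sum (ys ++ replicate k 0) ≡ sum ys
sum-zeros k ys = trans (sum-++ ys _) (trans (cong (sum ys +_) (zeros k)) (ℕₚ.+-identityʳ _))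
  where
  zeros : ∀ k → sum (replicate k 0) ≡ 0
  zeros zero    = refl
  zeros (suc k) = zeros k

-- Trailing empty rows are trimmed to obtain a partition; padding its beta-list restores `B` without
-- changing the character.
represented : ∀ n B → Strict B → sum B ≡ n + tri (length B) → ∃ λ ν → IsPartition n ν × Rep n ν B
represented n B s sm with trim (unbeta B) (unbeta-Decr B s)
... | ys , k , e , p , d = ys , part , subst (Rep n ys) eq (Rep-pad^ k {n} {ys} {betas ys} (IsPartition⇒Rep part))
  where
  eq : pad^ k (betas ys) ≡ B
  eq = trans (sym (betas-zeros k ys)) (trans (cong betas (sym e)) (betas-unbeta B s))
  total : sum ys ≡ n
  total = ℕₚ.+-cancelʳ-≡ (tri (length B)) _ _ (begin
    sum ys + tri (length B)                          ≡⟨ cong₂ _+_ (trans (sym (sum-zeros k ys)) (cong sum (sym e))) (cong tri (sym (length-unbeta B))) ⟩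
    sum (unbeta B) + tri (length (unbeta B))         ≡⟨ sym (sum-betas (unbeta B)) ⟩
    sum (betas (unbeta B))                           ≡⟨ cong sum (betas-unbeta B s) ⟩
    sum B                                            ≡⟨ sm ⟩
    n + tri (length B)                               ∎)
  part : IsPartition n ys
  part = total , p , d

new-row-sum : ∀ n κ y → sum κ + y ≡ n + tri (length κ) → sum (map suc κ ++ y ∷ []) ≡ n + tri (length (map suc κ ++ y ∷ []))
new-row-sum n κ y h = begin
  sum (map suc κ ++ y ∷ [])                      ≡⟨ sum-++ (map suc κ) (y ∷ []) ⟩
  sum (map suc κ) + (y + 0)                      ≡⟨ cong₂ _+_ (shifted κ) (ℕₚ.+-identityʳ y) ⟩
  length κ + sum κ + y                           ≡⟨ ℕₚ.+-assoc (length κ) _ _ ⟩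
  length κ + (sum κ + y)                         ≡⟨ cong (length κ +_) h ⟩
  length κ + (n + tri (length κ))                ≡⟨ solve 3 (λ l n t → l :+ (n :+ t) := n :+ (l :+ t)) refl (length κ) n (tri (length κ)) ⟩
  n + tri (suc (length κ))                       ≡⟨ cong (λ l → n + tri l) (sym (trans (Listₚ.length-++ (map suc κ)) (trans (ℕₚ.+-comm _ 1) (cong suc (Listₚ.length-map suc κ))))) ⟩
  n + tri (length (map suc κ ++ y ∷ []))         ∎
  where
  shifted : ∀ X → sum (map suc X) ≡ length X + sum X
  shifted []      = refl
  shifted (x ∷ X) = cong suc (trans (cong (x +_) (shifted X)) (solve 3 (λ x l s → x :+ (l :+ s) := l :+ (x :+ s)) refl x (length X) (sum X)))

-- Partitions at least as wide as they are long

opaque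
  unfolding 0ℚ

  2≰0 : ¬ (fromℕ 2 ≤ℚ ℚ.0ℚ)
  2≰0 = toWitnessFalse {a? = fromℕ 2 ℚₚ₀.≤? ℚ.0ℚ} _

  2≰1 : ¬ (fromℕ 2 ≤ℚ ℚ.1ℚ)
  2≰1 = toWitnessFalse {a? = fromℕ 2 ℚₚ₀.≤? ℚ.1ℚ} _

  0ℚ≡ : 0ℚ ≡ ℚ.0ℚ
  0ℚ≡ = refl

  1ℚ≡ : 1ℚ ≡ ℚ.1ℚ
  1ℚ≡ = refl

module Wide (q m : ℕ) (st : Strict (suc m ∷ suc (suc q) ∷ [])) where
  private
    Q = suc q
    n = suc Q + m
    μ : List ℕ
    μ = m ∷ suc Q ∷ []

  -- Stated for beta-lists, so that empty rows may occur; `represented` supplies the partition.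
  Witness : List ℕ → Set
  Witness A = ∃ λ B → Strict B × sum B ≡ n + tri (length B) × fromℕ 2 ≤ℚ D Q m A B

  refute : ∀ {λ'} A → Rep n λ' A → MultiplicityFree n μ λ' → ¬ Witness A
  refute {λ'} A rA mf (B , sB , smB , big) = contradict (represented n B sB smB)
    where
    contradict : (∃ λ ν → IsPartition n ν × Rep n ν B) → ⊥
    contradict (ν , pν , rB) = [ (λ e → 2≰0 (subst (fromℕ 2 ≤ℚ_) (trans (sym (kron-NSum Q m λ' ν A B rA rB st)) e) big))
                               , (λ e → 2≰1 (subst (fromℕ 2 ≤ℚ_) (trans (sym (kron-NSum Q m λ' ν A B rA rB st)) e) big)) ]′ (mf ν pν)

  Result⇒Witness : ∀ a A' → Strict (a ∷ A') → sum (a ∷ A') ≡ n + tri (suc (length A')) → Result q m a A' → Witness (a ∷ A')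
  Result⇒Witness a A' s sm (K , i , sK , big) = (a + suc q) ∷ K ,
    Strict-∷ (All.map (λ h → ℕₚ.<-≤-trans h (ℕₚ.m≤m+n a (suc q))) (Strict-head (Itl-Strict i))) (tail-Strict (Itl-Strict i)) ,
    trans (solve 3 (λ a q k → a :+ q :+ k := a :+ (k :+ q)) refl a (suc q) (sum K)) (trans (cong (a +_) sK) (trans sm (cong (λ l → n + tri (suc l)) (Itl-∷-tail i)))) , big

  -- An entry minus the number of rows below it is a row length. Thus `u` is the lowest row longer
  -- than `Q`, and a row `v` below it has length at most `Q`.
  split-rows : ∀ y ys → Strict (y ∷ ys) → Q + length ys < y →
    ∃ λ P → ∃ λ u → ∃ λ V → y ∷ ys ≡ P ++ u ∷ V × Q + length V < u × (V ≡ [] ⊎ (∃ λ v → ∃ λ V₁ → V ≡ v ∷ V₁ × v ≤ Q + length V₁))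
  split-rows y []       s h = [] , y , [] , refl , h , inj₁ refl
  split-rows y (v ∷ ys) s h with Q + length ys ℕₚ.<? v
  ... | no ¬h = [] , y , v ∷ ys , refl , h , inj₂ (v , ys , refl , ℕₚ.≮⇒≥ ¬h)
  ... | yes h' with split-rows v ys (tail-Strict s) h'
  ...   | P , u , V , e , hu , r = y ∷ P , u , V , cong (y ∷_) e , hu , r

  consecutive : ∀ a P u → Strict (a ∷ P ++ u ∷ []) → a ≡ u + suc (length P) → a ∷ P ++ u ∷ [] ≡ run (suc (length P)) (suc u) ++ u ∷ []
  consecutive a []      u s e = cong (λ t → t ∷ u ∷ []) (trans e (ℕₚ.+-suc u 0))
  consecutive a (p ∷ P) u s e = cong₂ _∷_ (trans e (ℕₚ.+-suc u _)) (consecutive p P u (tail-Strict s) (ℕₚ.≤-antisym upper (lower p P (tail-Strict s))))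
    where
    lower : ∀ p P → Strict (p ∷ P ++ u ∷ []) → u + suc (length P) ≤ p
    lower p []      (h ∷ _) = subst (_≤ p) (ℕₚ.+-comm 1 u) h
    lower p (x ∷ P) (h ∷ s) = subst (_≤ p) (sym (ℕₚ.+-suc u (suc (length P)))) (ℕₚ.≤-trans (s≤s (lower x P s)) h)
    upper : p ≤ u + suc (length P)
    upper = ℕₚ.≤-pred (ℕₚ.≤-trans (All.head (Strict-head s)) (ℕₚ.≤-reflexive (trans e (ℕₚ.+-suc u (suc (length P))))))

  rectangle-witness : 2 ≤ q → ∀ L u → 2 * Q ≤ u → let A = run (suc L) (suc u) ++ u ∷ [] in sum A ≡ n + tri (length A) → Witness A
  -- The new row has q = y + 2 = p - 2 boxes. They are split off the last row, whose length is u =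
  -- (c + 2) + (y + 2).
  rectangle-witness (s≤s (s≤s {n = y} z≤n)) L u big sm = go (u ∸ (4 + y)) (sym (ℕₚ.m+[n∸m]≡n u≥))
    where
    u≥ : 4 + y ≤ u
    u≥ = ℕₚ.≤-trans (subst (4 + y ≤_) (solve 1 (λ y → con 4 :+ y :+ (con 2 :+ y) := con 2 :* (con 3 :+ y)) refl y) (ℕₚ.m≤m+n (4 + y) (2 + y))) big
    go : ∀ c → u ≡ 4 + y + c → Witness (run (suc L) (suc u) ++ u ∷ [])
    go c e = subst (λ t → Witness (run (suc L) (suc t) ++ t ∷ [])) (sym e') (B , sB , smB , rectangle m L c y c≥ sm')
      where
      k = suc (suc c) + suc (suc y)
      e' : u ≡ k
      e' = trans e (solve 2 (λ y c → con 4 :+ y :+ c := con 2 :+ c :+ (con 2 :+ y)) refl y c)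
      A = run (suc L) (suc k) ++ k ∷ []
      κ = run (suc L) (suc k) ++ suc (suc c) ∷ []
      B = map suc κ ++ suc (suc y) ∷ []
      sm' : sum A ≡ suc (suc (suc (suc y))) + m + tri (length A)
      sm' = subst (λ t → sum (run (suc L) (suc t) ++ t ∷ []) ≡ n + tri (length (run (suc L) (suc t) ++ t ∷ []))) e' sm
      c≥ : 4 + y ≤ 2 + c
      c≥ = ℕₚ.+-cancelʳ-≤ (2 + y) _ _ (ℕₚ.≤-trans (ℕₚ.≤-reflexive (solve 1 (λ y → con 4 :+ y :+ (con 2 :+ y) := con 2 :* (con 3 :+ y)) refl y)) (ℕₚ.≤-trans big (ℕₚ.≤-reflexive e')))
      sκ : Strict κ
      sκ = run-Strict (suc L) (suc k) (s≤s (ℕₚ.m≤m+n (suc (suc c)) (suc (suc y))) ∷ []) [-]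
      Strict-suc : ∀ {X} → Strict X → Strict (map suc X)
      Strict-suc []      = []
      Strict-suc [-]     = [-]
      Strict-suc (h ∷ s) = s≤s h ∷ Strict-suc s
      sB : Strict B
      sB = Strict-∷ʳ (Strict-suc sκ) (Allₚ.map⁺ (Allₚ.++⁺ (All.map (λ h → s≤s (ℕₚ.≤-trans (ℕₚ.m≤n+m (suc (suc y)) (suc (suc c))) (ℕₚ.≤-trans (ℕₚ.n≤1+n k) h))) (run-All (suc L) (suc k)))
             (s≤s (ℕₚ.≤-trans (ℕₚ.m≤n+m (2 + y) 2) c≥) ∷ [])))
      R = run (suc L) (suc k)
      len : length A ≡ length κ
      len = trans (Listₚ.length-++ R) (sym (Listₚ.length-++ R))
      smB : sum B ≡ n + tri (length B)
      smB = new-row-sum n κ (suc (suc y)) (begin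
        sum κ + suc (suc y)                             ≡⟨ cong (_+ suc (suc y)) (sum-++ R _) ⟩
        sum R + (suc (suc c) + 0) + suc (suc y)         ≡⟨ solve 3 (λ r c y → r :+ (c :+ con 0) :+ y := r :+ (c :+ y :+ con 0)) refl (sum R) (suc (suc c)) (suc (suc y)) ⟩
        sum R + (k + 0)                                 ≡⟨ sym (sum-++ R _) ⟩
        sum A                                           ≡⟨ sm' ⟩
        n + tri (length A)                              ≡⟨ cong (λ l → n + tri l) len ⟩
        n + tri (length κ)                              ∎)

  lastView-≡ : ∀ {Y} → LastView Y → ∃ λ R → ∃ λ w → Y ≡ R ++ suc w ∷ []
  lastView-≡ (snoc R w) = R , w , refl

  first-gap-of-two : ∀ x₁ b → let b₂ = suc (suc b) in b₂ + suc (2 * Q) ≤ x₁ → sum (x₁ ∷ b₂ ∷ []) ≡ n → Witness (pad (betas (x₁ ∷ b₂ ∷ [])))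
  first-gap-of-two x₁ b gap s = subst Witness (sym eqA) (B , sB , smB , subst (fromℕ 2 ≤ℚ_) (D-sym Q m B ((a + Q) ∷ suc b₂ ∷ 0 ∷ [])) (long-first-of-two q m a b gap' smB))
    where
    b₂ = suc (suc b)
    a = suc (suc x₁) ∸ Q
    Q≤ : Q ≤ suc (suc x₁)
    Q≤ = ℕₚ.≤-trans (ℕₚ.≤-trans (ℕₚ.m≤m+n Q (1 * Q)) (ℕₚ.≤-trans (ℕₚ.n≤1+n _) (ℕₚ.m≤n+m (suc (2 * Q)) b₂))) (ℕₚ.≤-trans gap (ℕₚ.≤-trans (ℕₚ.n≤1+n x₁) (ℕₚ.n≤1+n _)))
    aQ : a + Q ≡ suc (suc x₁)
    aQ = ℕₚ.m∸n+n≡m Q≤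
    B = a ∷ (b₂ + Q) ∷ 1 ∷ []
    eqA : pad (betas (x₁ ∷ b₂ ∷ [])) ≡ (a + Q) ∷ suc b₂ ∷ 0 ∷ []
    eqA = cong₂ (λ s t → s ∷ suc t ∷ 0 ∷ []) (trans (cong suc (ℕₚ.+-comm x₁ 1)) (sym aQ)) (ℕₚ.+-identityʳ b₂)
    gap' : suc (b₂ + Q) < a
    gap' = ℕₚ.+-cancelʳ-≤ Q _ _ (ℕₚ.≤-trans (ℕₚ.≤-reflexive (solve 2 (λ b q → con 2 :+ (b :+ q) :+ q := con 1 :+ (b :+ (con 1 :+ con 2 :* q))) refl b₂ Q))
      (ℕₚ.≤-trans (s≤s gap) (ℕₚ.≤-trans (ℕₚ.n≤1+n _) (ℕₚ.≤-reflexive (sym aQ)))))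
    sB : Strict B
    sB = ℕₚ.≤-trans (ℕₚ.n≤1+n _) gap' ∷ s≤s (s≤s z≤n) ∷ [-]
    smB : sum B ≡ n + 3
    smB = trans (solve 3 (λ a b q → a :+ (b :+ q :+ (con 1 :+ con 0)) := a :+ q :+ b :+ con 1) refl a b₂ Q) (trans (cong (λ t → t + b₂ + 1) aQ)
      (trans (solve 2 (λ x b → con 2 :+ x :+ b :+ con 1 := x :+ (b :+ con 0) :+ con 3) refl x₁ b₂) (cong (_+ 3) s)))

  -- The gap 2Q + 1 leaves the first row at least one box longer than the second after Q boxes have
  -- moved down, so it can lose one more.
  first-gap : ∀ x₁ x₂ R w l → Strict ((x₂ + l) ∷ R ++ suc w ∷ []) → x₂ + suc (2 * Q) ≤ x₁ →
    let A = (x₁ + suc l) ∷ (x₂ + l) ∷ R ++ suc w ∷ [] in sum A ≡ n + tri (length A) → Witness A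
  first-gap x₁ x₂ R w l s gap sm = subst (λ t → Witness (t ∷ b ∷ W)) aQ (B , sB , smB , subst (fromℕ 2 ≤ℚ_) (D-sym Q m B ((a + Q) ∷ b ∷ W)) (long-first-row q m a b R w s gap' smB))
    where
    b = x₂ + l
    W = R ++ suc w ∷ []
    x = x₁ + suc l
    a = x ∸ Q
    B = a ∷ (b + Q) ∷ W
    x≥ : b + (2 + 2 * Q) ≤ x
    x≥ = ℕₚ.≤-trans (ℕₚ.≤-reflexive (solve 3 (λ x l q → x :+ l :+ (con 2 :+ con 2 :* q) := x :+ (con 1 :+ con 2 :* q) :+ (con 1 :+ l)) refl x₂ l Q)) (ℕₚ.+-monoˡ-≤ (suc l) gap)
    aQ : a + Q ≡ x
    aQ = ℕₚ.m∸n+n≡m (ℕₚ.≤-trans (subst (Q ≤_) (solve 2 (λ b q → q :+ (b :+ (con 2 :+ q)) := b :+ (con 2 :+ con 2 :* q)) refl b Q) (ℕₚ.m≤m+n Q _)) x≥)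
    gap' : suc (b + Q) < a
    gap' = ℕₚ.+-cancelʳ-≤ Q _ _ (ℕₚ.≤-trans (ℕₚ.≤-reflexive (solve 2 (λ b q → con 2 :+ (b :+ q) :+ q := b :+ (con 2 :+ con 2 :* q)) refl b Q)) (ℕₚ.≤-trans x≥ (ℕₚ.≤-reflexive (sym aQ))))
    sB : Strict B
    sB = ℕₚ.≤-trans (ℕₚ.n≤1+n _) gap' ∷ Strict-∷ (All.map (λ h → ℕₚ.<-≤-trans h (ℕₚ.m≤m+n b Q)) (Strict-head s)) (tail-Strict s)
    smB : sum B ≡ n + tri (length B)
    smB = trans (solve 4 (λ a b q w → a :+ (b :+ q :+ w) := a :+ q :+ (b :+ w)) refl a b Q (sum W)) (trans (cong (_+ (b + sum W)) aQ) sm)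

  long-rows-of-two : ∀ x₁ x₂ → x₂ < x₁ → 2 * Q < x₂ → sum (x₁ ∷ x₂ ∷ []) ≡ n → Witness (betas (x₁ ∷ x₂ ∷ []))
  long-rows-of-two x₁ x₂ lt big s = subst Witness (sym eqA) (B , sB , smB , two-rows q m (suc x₁) c c> gap smA)
    where
    c = x₂ ∸ Q
    cQ : c + Q ≡ x₂
    cQ = ℕₚ.m∸n+n≡m (ℕₚ.≤-trans (ℕₚ.m≤m+n Q (1 * Q)) (ℕₚ.<⇒≤ big))
    A = suc x₁ ∷ (c + Q) ∷ []
    B = suc (suc x₁) ∷ suc c ∷ Q ∷ []
    eqA : betas (x₁ ∷ x₂ ∷ []) ≡ A
    eqA = cong₂ (λ s t → s ∷ t ∷ []) (ℕₚ.+-comm x₁ 1) (trans (ℕₚ.+-identityʳ x₂) (sym cQ))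
    c> : Q < c
    c> = ℕₚ.+-cancelʳ-< Q _ _ (ℕₚ.<-≤-trans (subst (_< x₂) (solve 1 (λ q → con 2 :* q := q :+ q) refl Q) big) (ℕₚ.≤-reflexive (sym cQ)))
    gap : suc (c + Q) < suc x₁
    gap = s≤s (subst (_< x₁) (sym cQ) lt)
    smA : sum A ≡ n + 1
    smA = trans (cong (λ t → suc x₁ + (t + 0)) cQ) (trans (ℕₚ.+-comm 1 _) (cong (_+ 1) s))
    sB : Strict B
    sB = s≤s (ℕₚ.≤-trans (s≤s (ℕₚ.m≤m+n c Q)) (ℕₚ.<⇒≤ gap)) ∷ ℕₚ.m≤n⇒m≤1+n c> ∷ [-]
    smB : sum B ≡ n + 3
    smB = trans (solve 3 (λ x c q → con 2 :+ x :+ (con 1 :+ c :+ (q :+ con 0)) := con 1 :+ x :+ (c :+ q :+ con 0) :+ con 2) refl x₁ c Q) (trans (cong (_+ 2) smA) (ℕₚ.+-assoc n 1 2))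

  -- The strip is taken at the lowest row `u` longer than `Q`. If `u` is the last row, the shape is
  -- a rectangle or `long-last-row` applies. Otherwise the distance to the next row decides between
  -- `wide-gap` and `narrow-gap`.
  long-rows : 2 ≤ q → ∀ a y z ys → Strict (a ∷ y ∷ z ∷ ys) → All (0 <_) (y ∷ z ∷ ys) → Q + suc (length ys) < y → 2 * Q + suc (suc (length ys)) < a →
    let A = a ∷ y ∷ z ∷ ys in sum A ≡ n + tri (length A) → Witness A
  long-rows q≥2 a y z' ys s positive hy ha sm with split-rows y (z' ∷ ys) (tail-Strict s) hy
  ... | P , u , V , e , hu , shape = subst (λ Y → Witness (a ∷ Y)) (sym e) (go P u V (subst (λ Y → Strict (a ∷ Y)) e s) (subst (All (0 <_)) e positive) hu
        (subst (λ l → 2 * Q + l < a) (cong length e) ha) (subst (λ Y → sum (a ∷ Y) ≡ n + tri (suc (length Y))) e sm) (λ { refl refl → absurd (cong length e) }) shape)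
    where
    absurd : ∀ {k : ℕ} → suc (suc k) ≡ 1 → ⊥
    absurd ()
    go : ∀ P u V → Strict (a ∷ P ++ u ∷ V) → All (0 <_) (P ++ u ∷ V) → Q + length V < u → 2 * Q + length (P ++ u ∷ V) < a →
      sum (a ∷ P ++ u ∷ V) ≡ n + tri (suc (length (P ++ u ∷ V))) → (P ≡ [] → V ≡ [] → ⊥) →
      (V ≡ [] ⊎ (∃ λ v → ∃ λ V₁ → V ≡ v ∷ V₁ × v ≤ Q + length V₁)) → Witness (a ∷ P ++ u ∷ V)
    go P u .[] s positive hu ha sm ne (inj₁ refl) with a ℕₚ.≟ u + suc (length P)
    ... | yes e = subst Witness (sym eq) (rectangle-witness q≥2 (length P) u u≥ (subst (λ A → sum A ≡ n + tri (length A)) eq sm))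
      where
      eq = consecutive a P u s e
      u≥ : 2 * Q ≤ u
      u≥ = ℕₚ.+-cancelʳ-≤ (suc (length P)) _ _ (ℕₚ.≤-trans (ℕₚ.≤-reflexive (cong (2 * Q +_) (sym (trans (Listₚ.length-++ P) (ℕₚ.+-comm (length P) 1))))) (ℕₚ.≤-trans (ℕₚ.<⇒≤ ha) (ℕₚ.≤-reflexive e)))
    ... | no a≢ = long P s sm (find-drop a P u [] s a≢) (λ e → ne e refl)
      where
      u₀ = u ∸ suc Q
      u≡ : suc u₀ + Q ≡ u
      u≡ = trans (sym (ℕₚ.+-suc u₀ Q)) (ℕₚ.m∸n+n≡m (subst (_< u) (ℕₚ.+-identityʳ Q) hu))
      snocView : ∀ (p : ℕ) P → ∃ λ P' → ∃ λ y → p ∷ P ≡ P' ++ y ∷ []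
      snocView p []       = [] , p , refl
      snocView p (x ∷ P) with snocView x P
      ... | P' , y , e = p ∷ P' , y , cong (p ∷_) e
      long : ∀ P → Strict (a ∷ P ++ u ∷ []) → sum (a ∷ P ++ u ∷ []) ≡ n + tri (suc (length (P ++ u ∷ []))) → Drop a P (u ∷ []) → P ≢ [] → Witness (a ∷ P ++ u ∷ [])
      long []      s sm dr ne = ⊥-elim (ne refl)
      long (p ∷ P) s sm dr ne = step (snocView p P)
        where
        step : (∃ λ P' → ∃ λ y → p ∷ P ≡ P' ++ y ∷ []) → Witness (a ∷ (p ∷ P) ++ u ∷ [])
        step (P' , y , e) = subst (λ Y → Witness (a ∷ Y)) (sym e')
          (Result⇒Witness a A' s' sm' (long-last-row q m a P' y u₀ s' sm' (subst₂ (Drop a) e (cong (_∷ []) (sym u≡)) dr)))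
          where
          A' = P' ++ y ∷ (suc u₀ + Q) ∷ []
          e' : (p ∷ P) ++ u ∷ [] ≡ A'
          e' = trans (cong₂ (λ X t → X ++ t ∷ []) e (sym u≡)) (Listₚ.++-assoc P' (y ∷ []) _)
          s' = subst (λ Y → Strict (a ∷ Y)) e' s
          sm' = subst (λ Y → sum (a ∷ Y) ≡ n + tri (suc (length Y))) e' sm
    go P u .(v ∷ V₁) s positive hu ha sm ne (inj₂ (v , V₁ , refl , v≤)) with suc v + Q ℕₚ.<? u
    ... | yes gap = subst (λ t → Witness (a ∷ P ++ t ∷ v ∷ V₁)) u≡ (Result⇒Witness a (P ++ (u' + Q) ∷ v ∷ V₁) s' sm'
            (wide-gap q m a P u' v V₁ (v ∷ V₁) refl view s' (ℕₚ.+-cancelʳ-< Q _ _ (subst (suc v + Q <_) (sym u≡) gap)) sm'))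
      where
      u' = u ∸ Q
      u≡ : u' + Q ≡ u
      u≡ = ℕₚ.m∸n+n≡m (ℕₚ.≤-trans (ℕₚ.m≤n+m Q (suc v)) (ℕₚ.<⇒≤ gap))
      s' = subst (λ t → Strict (a ∷ P ++ t ∷ v ∷ V₁)) (sym u≡) s
      sm' = subst (λ t → sum (a ∷ P ++ t ∷ v ∷ V₁) ≡ n + tri (suc (length (P ++ t ∷ v ∷ V₁)))) (sym u≡) sm
      view = last-view v V₁ (All.tail (Allₚ.++⁻ʳ P positive))
    ... | no ¬gap = narrow u refl
      where
      u≤ : u ≤ suc v + Q
      u≤ = ℕₚ.≮⇒≥ ¬gap
      view = last-view v V₁ (All.tail (Allₚ.++⁻ʳ P positive))
      l = length V₁
      -- Row `v` has at most Q boxes and row `u` at most Q more, hence at most 2Q. The first row is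
      -- longer, so the rows down to `u` are not all equal.
      a≢ : a ≢ u + suc (length P)
      a≢ e = ℕₚ.<⇒≱ ha (ℕₚ.≤-trans (ℕₚ.≤-reflexive e) (ℕₚ.≤-trans (ℕₚ.+-monoˡ-≤ (suc (length P)) (ℕₚ.≤-trans u≤ (s≤s (ℕₚ.+-monoˡ-≤ Q v≤))))
        (ℕₚ.≤-reflexive (trans (solve 3 (λ q l p → con 1 :+ (q :+ l :+ q) :+ (con 1 :+ p) := con 2 :* q :+ (p :+ (con 2 :+ l))) refl Q l (length P)) (cong (2 * Q +_) (sym (Listₚ.length-++ P)))))))
      narrow : ∀ u' → u ≡ u' → Witness (a ∷ P ++ u ∷ v ∷ V₁)
      narrow zero     e = ⊥-elim (ℕₚ.n≮0 (subst (Q + suc l <_) e hu))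
      narrow (suc u₀) refl = Result⇒Witness a (P ++ suc u₀ ∷ v ∷ V₁) s sm
          (narrow-gap q m a P u₀ v V₁ V₁ x refl (inj₂ view) s v<x x≤u sx sm (find-drop a P (suc u₀) (v ∷ V₁) s a≢))
        where
        -- Moving up the rows below `u` removes v - l boxes, the length of row `v`; row `u` has to
        -- give the other Q - (v - l).
        x = (u₀ + v) ∸ (l + Q)
        u₀≥ : suc (l + Q) ≤ u₀
        u₀≥ = ℕₚ.≤-pred (subst (_< suc u₀) (trans (ℕₚ.+-suc Q l) (cong suc (ℕₚ.+-comm Q l))) hu)
        lQ≤ : l + Q ≤ u₀ + v
        lQ≤ = ℕₚ.≤-trans (ℕₚ.≤-trans (ℕₚ.n≤1+n _) u₀≥) (ℕₚ.m≤m+n u₀ v)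
        x≡ : x + (l + Q) ≡ u₀ + v
        x≡ = ℕₚ.m∸n+n≡m lQ≤
        sx : suc x + (l + Q) ≡ suc u₀ + v
        sx = cong suc x≡
        v<x : v < x
        v<x = ℕₚ.+-cancelʳ-< (l + Q) _ _ (subst (v + (l + Q) <_) (sym x≡) (subst (_≤ u₀ + v) (cong suc (ℕₚ.+-comm (l + Q) v)) (ℕₚ.+-monoˡ-≤ v u₀≥)))
        x≤u : x ≤ u₀
        x≤u = ℕₚ.+-cancelʳ-≤ (l + Q) _ _ (subst (_≤ u₀ + (l + Q)) (sym x≡) (ℕₚ.+-monoʳ-≤ u₀ (ℕₚ.≤-trans v≤ (ℕₚ.≤-reflexive (ℕₚ.+-comm Q l)))))

-- Consequences of the bound on n

sum-≤ : ∀ {x xs} → Decr (x ∷ xs) → sum (x ∷ xs) ≤ length (x ∷ xs) * x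
sum-≤ {x} {xs} d = ℕₚ.+-monoʳ-≤ x (go xs (hd-≤ d) (Decr-tail d))
  where
  go : ∀ xs → hd xs ≤ x → Decr xs → sum xs ≤ length xs * x
  go []       _ _ = z≤n
  go (y ∷ ys) h d = ℕₚ.+-mono-≤ h (go ys (ℕₚ.≤-trans (hd-≤ d) h) (Decr-tail d))

module Large (q m : ℕ) (q≥2 : 2 ≤ q) (big : (2 * suc q) * (2 * suc q) < suc (suc q) + m) where
  Q = suc q
  n = suc Q + m
  μ : List ℕ
  μ = m ∷ suc Q ∷ []

  Q≥2 : 2 ≤ Q
  Q≥2 = ℕₚ.≤-trans q≥2 (ℕₚ.n≤1+n q)

  2Q≤QQ : 2 * Q ≤ Q * Q
  2Q≤QQ = ℕₚ.*-monoˡ-≤ Q Q≥2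

  4QQ : (2 * Q) * (2 * Q) ≡ 4 * (Q * Q)
  4QQ = solve 1 (λ q → con 2 :* q :* (con 2 :* q) := con 4 :* (q :* q)) refl Q

  Q<m : suc Q < m
  Q<m = ℕₚ.+-cancelˡ-≤ (suc Q) (suc (suc Q)) m (ℕₚ.≤-trans (ℕₚ.≤-reflexive (ℕₚ.+-suc (suc Q) (suc Q)))
      (ℕₚ.≤-trans (s≤s (ℕₚ.≤-trans (ℕₚ.+-mono-≤ 1+Q≤ 1+Q≤) (ℕₚ.≤-trans (ℕₚ.≤-reflexive (solve 1 (λ q → con 2 :* q :+ con 2 :* q := con 2 :* (con 2 :* q)) refl Q))
        (ℕₚ.*-monoˡ-≤ (2 * Q) (ℕₚ.≤-trans Q≥2 (ℕₚ.m≤m+n Q (1 * Q))))))) big))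
    where
    1+Q≤ : suc Q ≤ 2 * Q
    1+Q≤ = ℕₚ.≤-trans (ℕₚ.+-monoˡ-≤ Q (s≤s z≤n)) (ℕₚ.≤-reflexive (solve 1 (λ q → q :+ q := con 2 :* q) refl Q))

  st : Strict (suc m ∷ suc Q ∷ [])
  st = s≤s (ℕₚ.<⇒≤ Q<m) ∷ [-]

  open Wide q m st hiding (consecutive)

  module Long {x₁ xs} (part : IsPartition n (x₁ ∷ xs)) (wide : length (x₁ ∷ xs) ≤ x₁) where
    n≡ = proj₁ part
    dec = proj₂ (proj₂ part)

    -- Otherwise n ≤ length · x₁ ≤ (2Q)^2.
    x₁> : 2 * Q < x₁
    x₁> = ℕₚ.≰⇒> (λ h → ℕₚ.<⇒≱ big (ℕₚ.≤-trans (ℕₚ.≤-reflexive (sym n≡)) (ℕₚ.≤-trans (sum-≤ dec) (ℕₚ.*-mono-≤ (ℕₚ.≤-trans wide h) h))))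

    -- If x₂ ≤ Q, then x₁ ≤ 3Q, and at most 3Q - 1 further rows have at most Q boxes each. Hence n ≤
    -- 2Q + 3Q^2 ≤ (2Q)^2.
    second> : ∀ {x₂ ys} → xs ≡ x₂ ∷ ys → x₁ ≤ x₂ + 2 * Q → Q < x₂
    second> {x₂} {ys} refl h = ℕₚ.≰⇒> (λ x₂≤Q → ℕₚ.<⇒≱ big (ℕₚ.+-cancelʳ-≤ Q _ _ (bound x₂≤Q)))
      where
      t = length (x₂ ∷ ys)
      bound : x₂ ≤ Q → n + Q ≤ (2 * Q) * (2 * Q) + Q
      bound x₂≤Q = ℕₚ.≤-trans (ℕₚ.≤-reflexive (cong (_+ Q) (sym n≡)))
        (ℕₚ.≤-trans (ℕₚ.+-monoˡ-≤ Q (ℕₚ.+-mono-≤ x₁≤ (ℕₚ.≤-trans (sum-≤ (Decr-tail dec)) (ℕₚ.*-monoʳ-≤ t x₂≤Q))))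
        (ℕₚ.≤-trans (ℕₚ.≤-reflexive (solve 2 (λ q t → con 3 :* q :+ t :* q :+ q := con 3 :* q :+ (con 1 :+ t) :* q) refl Q t))
        (ℕₚ.≤-trans (ℕₚ.+-monoʳ-≤ (3 * Q) (ℕₚ.*-monoˡ-≤ Q (ℕₚ.≤-trans wide x₁≤)))
        (ℕₚ.≤-trans (ℕₚ.≤-reflexive (solve 1 (λ q → con 3 :* q :+ con 3 :* q :* q := con 2 :* q :+ (q :+ con 3 :* (q :* q))) refl Q))
        (ℕₚ.≤-trans (ℕₚ.+-monoˡ-≤ (Q + 3 * (Q * Q)) 2Q≤QQ)
        (ℕₚ.≤-reflexive (solve 1 (λ q → q :* q :+ (q :+ con 3 :* (q :* q)) := con 2 :* q :* (con 2 :* q) :+ q) refl Q)))))))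
        where
        x₁≤ : x₁ ≤ 3 * Q
        x₁≤ = ℕₚ.≤-trans h (ℕₚ.≤-trans (ℕₚ.+-monoˡ-≤ (2 * Q) x₂≤Q) (ℕₚ.≤-reflexive (solve 1 (λ q → q :+ con 2 :* q := con 3 :* q) refl Q)))

    -- If x₂ ≤ 2Q, then n ≤ 6Q ≤ (2Q)^2. Two rows need this stronger bound because the second, after
    -- losing Q boxes, must still exceed the new row of size Q.
    two-second> : ∀ {x₂} → xs ≡ x₂ ∷ [] → x₁ ≤ x₂ + 2 * Q → 2 * Q < x₂
    two-second> {x₂} refl h = ℕₚ.≰⇒> (λ x₂≤ → ℕₚ.<⇒≱ big (ℕₚ.≤-trans (ℕₚ.≤-reflexive (sym n≡)) (bound x₂≤)))
      where
      bound : x₂ ≤ 2 * Q → x₁ + (x₂ + 0) ≤ (2 * Q) * (2 * Q)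
      bound x₂≤ = ℕₚ.≤-trans (ℕₚ.+-mono-≤ (ℕₚ.≤-trans h (ℕₚ.+-monoˡ-≤ (2 * Q) x₂≤)) (ℕₚ.+-monoˡ-≤ 0 x₂≤))
        (ℕₚ.≤-trans (ℕₚ.≤-trans (ℕₚ.m≤m+n _ (2 * Q)) (ℕₚ.≤-reflexive (solve 1 (λ q → con 2 :* q :+ con 2 :* q :+ (con 2 :* q :+ con 0) :+ con 2 :* q := con 4 :* (con 2 :* q)) refl Q)))
        (ℕₚ.≤-trans (ℕₚ.*-monoʳ-≤ 4 2Q≤QQ) (ℕₚ.≤-reflexive (sym 4QQ))))

  module Betas {λ'} (part : IsPartition n λ') where
    rep : Rep n λ' (betas λ')
    rep = IsPartition⇒Rep part
    sβ : Strict (betas λ')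
    sβ = betas-Strict (proj₂ (proj₂ part))
    smβ : sum (betas λ') ≡ n + tri (length (betas λ'))
    smβ = trans (sum-betas λ') (cong₂ _+_ (proj₁ part) (cong tri (sym (length-betas λ'))))
    pβ : All (0 <_) (betas λ')
    pβ = betas-positive (proj₁ (proj₂ part))

  -- A third row, or a second row with at least two boxes, yields a witness; a single box in the
  -- second row is the surviving partition.
  gap-case : ∀ x₁ x₂ xs → let λ' = x₁ ∷ x₂ ∷ xs in IsPartition n λ' → MultiplicityFree n μ λ' → x₂ + suc (2 * Q) ≤ x₁ → λ' ≡ (n ∸ 1) ∷ 1 ∷ []
  gap-case x₁ zero          []       (s , p , d) mf g = ⊥-elim (ℕₚ.n≮0 (All.head (All.tail p)))
  gap-case x₁ (suc zero)    []       (s , p , d) mf g = cong (λ t → t ∷ 1 ∷ []) (sym (cong (_∸ 1) (trans (sym s) (ℕₚ.+-comm x₁ 1))))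
  gap-case x₁ (suc (suc b)) []       part@(s , _) mf g =
    ⊥-elim (refute (pad (betas λ')) (Rep-pad {n} {λ'} {betas λ'} (Betas.rep part)) mf (first-gap-of-two x₁ b g s))
    where λ' = x₁ ∷ suc (suc b) ∷ []
  gap-case x₁ x₂            (y ∷ ys) part mf g =
    ⊥-elim (refute (betas λ') rep mf (go (lastView-≡ (last-view (y + length ys) (betas ys) (All.tail (All.tail pβ))))))
    where
    λ' = x₁ ∷ x₂ ∷ y ∷ ys
    open Betas part
    go : (∃ λ R → ∃ λ v → betas (y ∷ ys) ≡ R ++ suc v ∷ []) → Witness (betas λ')
    go (R , v , e) = subst (λ Y → Witness ((x₁ + suc (suc (length ys))) ∷ (x₂ + suc (length ys)) ∷ Y)) (sym e)
      (first-gap x₁ x₂ R v (suc (length ys)) (subst (λ Y → Strict ((x₂ + suc (length ys)) ∷ Y)) e (tail-Strict sβ)) g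
        (subst (λ Y → let A = (x₁ + suc (suc (length ys))) ∷ (x₂ + suc (length ys)) ∷ Y in sum A ≡ n + tri (length A)) e smβ))

  no-small-first-gap : ∀ x₁ x₂ xs → let λ' = x₁ ∷ x₂ ∷ xs in IsPartition n λ' → length λ' ≤ x₁ → MultiplicityFree n μ λ' → x₁ ≤ x₂ + 2 * Q → ⊥
  no-small-first-gap x₁ x₂ []       part w mf h = [ different , equal ]′ (ℕₚ.m≤n⇒m<n∨m≡n (hd-≤ (proj₂ (proj₂ part))))
    where
    open Betas part
    module L = Long part w
    different : x₂ < x₁ → ⊥
    different lt = refute (betas (x₁ ∷ x₂ ∷ [])) rep mf (long-rows-of-two x₁ x₂ lt (L.two-second> refl h) (proj₁ part))
    equal : x₂ ≡ x₁ → ⊥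
    equal e = refute (betas (x₁ ∷ x₂ ∷ [])) rep mf (subst Witness (sym eq) (rectangle-witness q≥2 0 x₁ (ℕₚ.<⇒≤ L.x₁>) (subst (λ A → sum A ≡ n + tri (length A)) eq smβ)))
      where
      eq : betas (x₁ ∷ x₂ ∷ []) ≡ run 1 (suc x₁) ++ x₁ ∷ []
      eq = cong₂ (λ s t → s ∷ t ∷ []) (trans (ℕₚ.+-comm x₁ 1) (sym (ℕₚ.+-identityʳ (suc x₁)))) (trans (ℕₚ.+-identityʳ x₂) e)
  no-small-first-gap x₁ x₂ (y ∷ ys) part w mf h = refute (betas (x₁ ∷ x₂ ∷ y ∷ ys)) rep mf
    (long-rows q≥2 (x₁ + suc (suc (length ys))) (x₂ + suc (length ys)) (y + length ys) (betas ys) sβ (All.tail pβ)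
      (subst (λ l → Q + suc l < x₂ + suc (length ys)) (sym (length-betas ys)) (ℕₚ.+-monoˡ-< (suc (length ys)) (L.second> refl h)))
      (subst (λ l → 2 * Q + suc (suc l) < x₁ + suc (suc (length ys))) (sym (length-betas ys)) (ℕₚ.+-monoˡ-< (suc (suc (length ys))) L.x₁>)) smβ)
    where
    open Betas part
    module L = Long part w

  wide⇒one-row : ∀ λ' → IsPartition n λ' → length λ' ≤ hd λ' → MultiplicityFree n μ λ' → λ' ≡ n ∷ [] ⊎ λ' ≡ (n ∸ 1) ∷ 1 ∷ []
  wide⇒one-row []             (() , _) w mf
  wide⇒one-row (x₁ ∷ [])      (s , _)  w mf = inj₁ (cong (_∷ []) (trans (sym (ℕₚ.+-identityʳ x₁)) s))
  wide⇒one-row (x₁ ∷ x₂ ∷ xs) part     w mf with x₂ + suc (2 * Q) ℕₚ.≤? x₁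
  ... | yes g = inj₂ (gap-case x₁ x₂ xs part mf g)
  ... | no ¬g = ⊥-elim (no-small-first-gap x₁ x₂ xs part w mf (ℕₚ.≤-pred (subst (suc x₁ ≤_) (ℕₚ.+-suc x₂ (2 * Q)) (ℕₚ.≰⇒> ¬g))))

-- Multiplicity-free products

X-one : ∀ ρ → X (sum ρ ∷ []) ρ ≡ 1ℚ
X-one []      = ℚₚ.*-identityˡ 1ℚ
X-one (r ∷ ρ) = trans (∑T r (r + sum ρ) [] _) (trans (ℚₚ.+-identityʳ _)
  (trans (cong (λ l → ∑ l (λ a → X (a ∷ []) ρ)) (sub-+ r (sum ρ))) (trans (ℚₚ.+-identityʳ _) (X-one ρ))))

Binary : ℚ → Set
Binary x = x ≡ 0ℚ ⊎ x ≡ 1ℚ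

binary : ∀ {x} → Binary x → x ≡ ℚ.0ℚ ⊎ x ≡ ℚ.1ℚ
binary (inj₁ e) = inj₁ (trans e 0ℚ≡)
binary (inj₂ e) = inj₂ (trans e 1ℚ≡)

I-binary : ∀ m A B → Strict A → Strict B → length A ≡ length B → sum A ≡ m + tri (length A) → Binary (I m A B)
I-binary m A B s s' l sm with Listₚ.≡-dec ℕₚ._≟_ A B
... | yes refl = inj₂ (I-refl m A s sm)
... | no ne    = inj₁ (I-≢ m A B s s' l sm ne)

pad^-length : ∀ k A → length (pad^ k A) ≡ k + length A
pad^-length zero    A = refl
pad^-length (suc k) A = trans (pad^-length k (pad A)) (trans (cong (k +_) (length-pad A)) (ℕₚ.+-suc k (length A)))

pad^-Strict : ∀ k {A} → Strict A → Strict (pad^ k A)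
pad^-Strict zero    s = s
pad^-Strict (suc k) s = pad^-Strict k (pad-Strict s)

pad^-sum : ∀ k n A → sum A ≡ n + tri (length A) → sum (pad^ k A) ≡ n + tri (length (pad^ k A))
pad^-sum zero    n A h = h
pad^-sum (suc k) n A h = pad^-sum k n (pad A) (trans (sum-pad A) (trans (cong (length A +_) h)
  (trans (solve 3 (λ l n t → l :+ (n :+ t) := n :+ (l :+ t)) refl (length A) n (tri (length A))) (cong (λ l → n + tri l) (sym (length-pad A))))))

run-pad : ∀ j → pad (run j 0) ≡ run (suc j) 0
run-pad zero    = refl
run-pad (suc j) = cong (suc j ∷_) (run-pad j)

pad^-two : ∀ k j x y → pad^ k ((x + j) ∷ (y + j) ∷ run j 0) ≡ (x + (k + j)) ∷ (y + (k + j)) ∷ run (k + j) 0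
pad^-two zero    j x y = refl
pad^-two (suc k) j x y = trans (cong (pad^ k) (trans (cong (λ l → suc (x + j) ∷ suc (y + j) ∷ l) (run-pad j))
    (cong₂ (λ s t → s ∷ t ∷ run (suc j) 0) (sym (ℕₚ.+-suc x j)) (sym (ℕₚ.+-suc y j)))))
  (trans (pad^-two k (suc j) x y) (cong (λ t → (x + t) ∷ (y + t) ∷ run t 0) (ℕₚ.+-suc k j)))

∑T1-run₀ : ∀ j {f} → Anti f → ∑ (T 1 (run j 0)) f ≡ 0ℚ
∑T1-run₀ zero          af = refl
∑T1-run₀ (suc zero)    af = refl
∑T1-run₀ (suc (suc j)) {f} af = trans (∑T 1 (suc j) (run (suc j) 0) f) (trans (+-zeroˡ _ (trans (ℚₚ.+-identityʳ _) (Anti-dup {f} af [] j [] (run j 0))))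
  (∑T1-run₀ (suc j) {λ A → f (suc j ∷ A)} (Anti-∷ {f} af (suc j))))

T1-Unique : ∀ A → Unique (T 1 A)
T1-Unique []          = []
T1-Unique (zero ∷ A)  = Uniqueₚ.map⁺ Listₚ.∷-injectiveʳ (T1-Unique A)
T1-Unique (suc a ∷ A) = Allₚ.map⁺ (All.universal (λ A' e → n≢1+n (Listₚ.∷-injectiveˡ e)) (T 1 A)) ∷ Uniqueₚ.map⁺ Listₚ.∷-injectiveʳ (T1-Unique A)

∑-only : ∀ {V : Set} (xs : List V) {f : V → ℚ} {x} → Unique xs → x ∈ xs → (∀ {y} → y ∈ xs → x ≢ y → f y ≡ 0ℚ) → ∑ xs f ≡ f x
∑-only (x ∷ xs) {f} (n ∷ U) (here refl) h = +-zeroʳ (f x) (∑-0 xs (λ i → h (there i) (All.lookup n i)))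
∑-only (y ∷ xs) {f} {x} (n ∷ U) (there i) h = trans (+-zeroˡ _ (h (here refl) (λ e → All.lookup n i (sym e)))) (∑-only xs U i (λ j → h (there j)))

module _ (m : ℕ) (C B : List ℕ) (sC : Strict C) (sB : Strict B) (l : length C ≡ length B) (sm : sum C ≡ m + tri (length C)) where

  T1-off : ∀ {B'} → B' ∈ T 1 B → C ≢ B' → I m C B' ≡ 0ℚ
  T1-off {B'} i ne with T1-Strict B sB i
  ... | inj₁ s' = I-≢ m C B' sC s' (trans l (sym (T-length 1 B i))) sm ne
  ... | inj₂ z' = z' {I m C} (I-Antiʳ m C)

  T1-in : C ∈ T 1 B → ∑ (T 1 B) (I m C) ≡ 1ℚ
  T1-in i = trans (∑-only (T 1 B) (T1-Unique B) i T1-off) (I-refl m C sC sm)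

  T1-out : ¬ (C ∈ T 1 B) → ∑ (T 1 B) (I m C) ≡ 0ℚ
  T1-out ni = ∑-0 (T 1 B) (λ i → T1-off i (λ { refl → ni i }))

-- Adding a box to either list must give `B`; the only common possibility is the union of both
-- diagrams.
two-corners-meet : ∀ x y R B → x ∷ suc y ∷ R ∈ T 1 B → suc x ∷ y ∷ R ∈ T 1 B → suc x ∷ suc y ∷ R ≡ B
two-corners-meet x y R (b ∷ B) i j with T-∈⁻ 1 b B i | T-∈⁻ 1 b B j
... | inj₁ (b' , k , refl) | _ = cong (_∷ suc y ∷ R) (trans (ℕₚ.+-comm 1 x) (sub-∈ 1 b k))
... | inj₂ (_ , _ , refl) | inj₁ (b' , k , refl) = ⊥-elim (ℕₚ.<⇒≢ (s≤s (ℕₚ.n≤1+n x)) (sym (trans (ℕₚ.+-comm 1 (suc x)) (sub-∈ 1 b k))))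
... | inj₂ (_ , _ , refl) | inj₂ (_ , _ , e) = ⊥-elim (n≢1+n (sym (Listₚ.∷-injectiveˡ e)))

module Converse (q m : ℕ) (q<m : suc q < m) where
  private
    n = suc q + m
    μ : List ℕ
    μ = m ∷ suc q ∷ []

  μ-part : IsPartition n μ
  μ-part = trans (cong (m +_) (ℕₚ.+-identityʳ (suc q))) (ℕₚ.+-comm m (suc q)) , (ℕₚ.≤-trans (s≤s z≤n) q<m ∷ s≤s z≤n ∷ []) , (ℕₚ.<⇒≤ q<m ∷ [-])

  sμ : Strict (betas μ)
  sμ = betas-Strict (proj₂ (proj₂ μ-part))

  smμ : sum (betas μ) ≡ n + tri (length (betas μ))
  smμ = trans (sum-betas μ) (cong (_+ tri 2) (proj₁ μ-part))

  one-row : MultiplicityFree n μ (n ∷ [])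
  one-row ν pν = binary (subst Binary (sym value) (I-binary n A B (pad^-Strict j sμ) (pad^-Strict k (betas-Strict (proj₂ (proj₂ pν))))
      (trans (pad^-length j (betas μ)) (trans (ℕₚ.+-comm j 2) (trans (cong (2 +_) (sym (length-betas ν))) (sym (pad^-length 2 (betas ν))))))
      (pad^-sum j n (betas μ) smμ)))
    where
    j = length ν
    k = 2
    -- Orthogonality compares lists of equal length, so both are padded to 2 + `length ν`.
    A = pad^ j (betas μ)
    B = pad^ k (betas ν)
    rA = Rep-pad^ j {n} {μ} {betas μ} (IsPartition⇒Rep μ-part)
    rB = Rep-pad^ k {n} {ν} {betas ν} (IsPartition⇒Rep pν)
    ρ-one : ∀ ρ → sum ρ ≡ n → All (0 <_) ρ → ι (χ (n ∷ []) ρ) ≡ 1ℚ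
    ρ-one ρ s h = trans (IsPartition⇒Rep {n} {n ∷ []} (ℕₚ.+-identityʳ n , (s≤s z≤n ∷ []) , [-]) ρ s h)
      (trans (cong (λ t → X (t ∷ []) ρ) (trans (ℕₚ.+-identityʳ n) (sym s))) (X-one ρ))
    value : kron n μ (n ∷ []) ν ≡ I n A B
    value = trans (kron-S n μ (n ∷ []) ν) (S-cong-∈ n (λ ρ s h → cong₂ _*ℚ_ (rA ρ s h) (trans (cong₂ _*ℚ_ (ρ-one ρ s h) (rB ρ s h)) (ℚₚ.*-identityˡ _))))

  near-one-row : MultiplicityFree n μ ((n ∸ 1) ∷ 1 ∷ [])
  near-one-row ν pν = binary (subst Binary (sym value) (by-equality (Listₚ.≡-dec ℕₚ._≟_ A B)))
    where
    j = length ν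
    R = run j 0
    x = m + 1 + j
    y = q + j
    A = x ∷ suc y ∷ R
    B = pad^ 2 (betas ν)
    A≡ : pad^ j (betas μ) ≡ A
    A≡ = trans (cong (pad^ j) (cong₂ (λ s t → s ∷ t ∷ []) (sym (ℕₚ.+-identityʳ (m + 1))) refl))
      (trans (pad^-two j 0 (m + 1) (suc q)) (cong (λ t → (m + 1 + t) ∷ (suc q + t) ∷ run t 0) (ℕₚ.+-identityʳ j)))
    rA : Rep n μ A
    rA = subst (Rep n μ) A≡ (Rep-pad^ j {n} {μ} {betas μ} (IsPartition⇒Rep μ-part))
    rB = Rep-pad^ 2 {n} {ν} {betas ν} (IsPartition⇒Rep pν)
    sA : Strict A
    sA = subst Strict A≡ (pad^-Strict j sμ)
    sB : Strict B
    sB = pad^-Strict 2 (betas-Strict (proj₂ (proj₂ pν)))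
    smA : sum A ≡ n + tri (length A)
    smA = subst (λ A → sum A ≡ n + tri (length A)) A≡ (pad^-sum j n (betas μ) smμ)
    len : length A ≡ length B
    len = trans (cong length (sym A≡)) (trans (pad^-length j (betas μ)) (trans (ℕₚ.+-comm j 2) (trans (cong (2 +_) (sym (length-betas ν))) (sym (pad^-length 2 (betas ν))))))
    m' = q + m
    -- Exchanging the first two factors makes (n - 1, 1) the two-rowed partition of `kron-NSum`, so
    -- that only N_1 and N_0 occur.
    value : kron n μ ((n ∸ 1) ∷ 1 ∷ []) ν ≡ ∑ (T 1 A) (λ A' → ∑ (T 1 B) (I m' A')) +ℚ -ℚ I n A B
    value = trans (kron-S n μ (m' ∷ 1 ∷ []) ν) (trans (S-cong n (λ ρ → swap _ _ _)) (trans (sym (kron-S n (m' ∷ 1 ∷ []) μ ν))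
      (trans (kron-NSum 0 m' μ ν A B rA rB (s≤s (ℕₚ.≤-trans (ℕₚ.≤-trans (s≤s z≤n) (ℕₚ.<⇒≤ q<m)) (ℕₚ.m≤n+m m q)) ∷ [-]))
        (cong₂ (λ s t → s +ℚ -ℚ t) (NSum-1 A B (I m')) (NSum-0 A B (I n))))))
      where
      swap : ∀ a b c → a *ℚ (b *ℚ c) ≡ b *ℚ (a *ℚ c)
      swap a b c = trans (sym (ℚₚ.*-assoc a b c)) (trans (cong (_*ℚ c) (ℚₚ.*-comm a b)) (ℚₚ.*-assoc b a c))
    x₀ = m + j
    x≡ : x ≡ suc x₀
    x≡ = solve 2 (λ m j → m :+ con 1 :+ j := con 1 :+ (m :+ j)) refl m j
    -- `a₁` and `a₂` remove the two corners of μ; the first row may lose a box because `suc q < m`.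
    a₁ = x₀ ∷ suc y ∷ R
    a₂ = suc x₀ ∷ y ∷ R
    A₀ = suc x₀ ∷ suc y ∷ R
    A≡A₀ : A ≡ A₀
    A≡A₀ = cong (_∷ suc y ∷ R) x≡
    R<y : All (_< suc y) R
    R<y = run-< j 0 (ℕₚ.≤-trans (ℕₚ.m≤n+m j q) (ℕₚ.n≤1+n y))
    sR : Strict R
    sR = tail-Strict (tail-Strict sA)
    s₁ : Strict a₁
    s₁ = ℕₚ.+-monoˡ-< j q<m ∷ Strict-∷ R<y sR
    s₂ : Strict a₂
    s₂ = s≤s (ℕₚ.+-monoˡ-≤ j (ℕₚ.≤-trans (ℕₚ.n≤1+n q) (ℕₚ.<⇒≤ q<m))) ∷ Strict-∷ (run-< j 0 (ℕₚ.m≤n+m j q)) sR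
    T1A : ∀ {f} → Anti f → ∑ (T 1 A) f ≡ f a₁ +ℚ f a₂
    T1A {f} af = trans (cong (λ t → ∑ (T 1 t) f) A≡A₀) (trans (∑T 1 (suc x₀) (suc y ∷ R) f) (cong₂ _+ℚ_ (ℚₚ.+-identityʳ _)
      (trans (∑T 1 (suc y) R _) (trans (+-zeroʳ _ (∑T1-run₀ j {λ A → f (suc x₀ ∷ suc y ∷ A)} (Anti-++ {f} af (suc x₀ ∷ suc y ∷ [])))) (ℚₚ.+-identityʳ _)))))
    sum₀ : sum A₀ ≡ suc m' + tri (length A)
    sum₀ = trans (cong sum (sym A≡A₀)) smA
    sum₁ : sum a₁ ≡ m' + tri (length A)
    sum₁ = ℕₚ.suc-injective sum₀
    sum₂ : sum a₂ ≡ m' + tri (length A)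
    sum₂ = ℕₚ.suc-injective (trans (cong suc (sym (ℕₚ.+-suc x₀ (y + sum R)))) sum₀)
    total : ∑ (T 1 A) (λ A' → ∑ (T 1 B) (I m' A')) ≡ ∑ (T 1 B) (I m' a₁) +ℚ ∑ (T 1 B) (I m' a₂)
    total = T1A {λ A' → ∑ (T 1 B) (I m' A')} (λ P a b Q → trans (∑-cong (T 1 B) (λ B' → I-Antiˡ m' B' P a b Q)) (∑-neg (T 1 B) _))
    in₁ = T1-in m' a₁ B s₁ sB len sum₁
    in₂ = T1-in m' a₂ B s₂ sB len sum₂
    out₁ = T1-out m' a₁ B s₁ sB len sum₁
    out₂ = T1-out m' a₂ B s₂ sB len sum₂
    -- Distinct partitions share at most one subdiagram with one box removed
    different : A ≢ B → Binary (∑ (T 1 A) (λ A' → ∑ (T 1 B) (I m' A')))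
    different ne = subst Binary (sym total) (go (a₁ ∈? T 1 B) (a₂ ∈? T 1 B))
      where
      open DecMembership (Listₚ.≡-dec ℕₚ._≟_) using (_∈?_)
      go : Dec (a₁ ∈ T 1 B) → Dec (a₂ ∈ T 1 B) → Binary (∑ (T 1 B) (I m' a₁) +ℚ ∑ (T 1 B) (I m' a₂))
      go (yes i) (yes k) = ⊥-elim (ne (trans A≡A₀ (two-corners-meet x₀ y R B i k)))
      go (yes i) (no k)  = inj₂ (trans (cong₂ _+ℚ_ (in₁ i) (out₂ k)) (ℚₚ.+-identityʳ 1ℚ))
      go (no i)  (yes k) = inj₂ (trans (cong₂ _+ℚ_ (out₁ i) (in₂ k)) (ℚₚ.+-identityˡ 1ℚ))
      go (no i)  (no k)  = inj₁ (trans (cong₂ _+ℚ_ (out₁ i) (out₂ k)) (ℚₚ.+-identityˡ 0ℚ))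
    by-equality : Dec (A ≡ B) → Binary (∑ (T 1 A) (λ A' → ∑ (T 1 B) (I m' A')) +ℚ -ℚ I n A B)
    by-equality (no ne)  = subst Binary (sym (+-zeroʳ _ (neg≡0 (I-≢ n A B sA sB len smA ne)))) (different ne)
    by-equality (yes e)  = inj₂ (begin
      ∑ (T 1 A) (λ A' → ∑ (T 1 B) (I m' A')) +ℚ -ℚ I n A B
        ≡⟨ cong₂ (λ s t → s +ℚ -ℚ t) (trans total (cong₂ _+ℚ_ (in₁ (mem (T1-∈ [] x₀ (suc y ∷ R)))) (in₂ (mem (T1-∈ (suc x₀ ∷ []) y R)))))
             (trans (cong (I n A) (sym e)) (I-refl n A sA smA)) ⟩
      1ℚ +ℚ 1ℚ +ℚ -ℚ 1ℚ      ≡⟨ ℚₚ.+-assoc 1ℚ 1ℚ _ ⟩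
      1ℚ +ℚ (1ℚ +ℚ -ℚ 1ℚ)    ≡⟨ +-zeroʳ 1ℚ (ℚₚ.+-inverseʳ 1ℚ) ⟩
      1ℚ                     ∎)
      where
      mem : ∀ {C} → C ∈ T 1 A₀ → C ∈ T 1 B
      mem {C} = subst (λ Y → C ∈ T 1 Y) (trans (sym A≡A₀) e)

-- Conjugation

module _ {n x xs} (μ : List ℕ) (part : IsPartition n (x ∷ xs)) where
  private
    λ₀ = x ∷ xs
    λ* = proj₁ (conjugate part)
    chars : ∀ ρ → All (0 <_) ρ → ι (χ λ* ρ) ≡ eps ρ *ℚ ι (χ λ₀ ρ)
    chars = proj₂ (proj₂ (proj₂ (proj₂ (conjugate part))))

    nonempty : ∀ ν → IsPartition n ν → ∃ λ y → ∃ λ ys → ν ≡ y ∷ ys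
    nonempty []       (s , _) = ⊥-elim (ℕₚ.<⇒≢ (ℕₚ.≤-trans (All.head (proj₁ (proj₂ part))) (ℕₚ.m≤m+n x (sum xs))) (trans s (sym (proj₁ part))))
    nonempty (y ∷ ys) _       = y , ys , refl

    conj : ∀ ν → IsPartition n ν → ∃ λ ν' → IsPartition n ν' × (∀ ρ → All (0 <_) ρ → ι (χ ν' ρ) ≡ eps ρ *ℚ ι (χ ν ρ))
    conj ν pν with nonempty ν pν
    ... | y , ys , refl = proj₁ (conjugate pν) , proj₁ (proj₂ (conjugate pν)) , proj₂ (proj₂ (proj₂ (proj₂ (conjugate pν))))

    mul : ∀ a b c → (a *ℚ b) *ℚ c ≡ b *ℚ (a *ℚ c)
    mul a b c = trans (cong (_*ℚ c) (ℚₚ.*-comm a b)) (ℚₚ.*-assoc b a c)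

  -- The sign character can be moved from one factor to another: g(μ, λ*, ν) = g(μ, λ, ν*).
  MF-conj : MultiplicityFree n μ λ₀ → MultiplicityFree n μ λ*
  MF-conj mf ν pν = subst (λ k → k ≡ ℚ.0ℚ ⊎ k ≡ ℚ.1ℚ) eq (mf ν' pν')
    where
    ν' = proj₁ (conj ν pν)
    pν' = proj₁ (proj₂ (conj ν pν))
    eq : kron n μ λ₀ ν' ≡ kron n μ λ* ν
    eq = trans (kron-S n μ λ₀ ν') (trans (S-cong-∈ n (λ ρ _ h → cong (ι (χ μ ρ) *ℚ_)
      (trans (cong (ι (χ λ₀ ρ) *ℚ_) (proj₂ (proj₂ (conj ν pν)) ρ h)) (trans (sym (mul (eps ρ) (ι (χ λ₀ ρ)) (ι (χ ν ρ)))) (cong (_*ℚ ι (χ ν ρ)) (sym (chars ρ h)))))))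
      (sym (kron-S n μ λ* ν)))

  -- Conjugating both λ and ν multiplies the integrand by the square of the sign: g(μ, λ*, ν*) =
  -- g(μ, λ, ν).
  MF-conj⁻ : MultiplicityFree n μ λ* → MultiplicityFree n μ λ₀
  MF-conj⁻ mf ν pν = subst (λ k → k ≡ ℚ.0ℚ ⊎ k ≡ ℚ.1ℚ) eq (mf ν' pν')
    where
    ν' = proj₁ (conj ν pν)
    pν' = proj₁ (proj₂ (conj ν pν))
    eq : kron n μ λ* ν' ≡ kron n μ λ₀ ν
    eq = trans (kron-S n μ λ* ν') (trans (S-cong-∈ n (λ ρ _ h → cong (ι (χ μ ρ) *ℚ_)
      (trans (cong₂ _*ℚ_ (chars ρ h) (proj₂ (proj₂ (conj ν pν)) ρ h)) (cancel ρ (ι (χ λ₀ ρ)) (ι (χ ν ρ)))))) (sym (kron-S n μ λ₀ ν)))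
      where
      cancel : ∀ ρ a b → (eps ρ *ℚ a) *ℚ (eps ρ *ℚ b) ≡ a *ℚ b
      cancel ρ a b = trans (mul (eps ρ) a (eps ρ *ℚ b)) (cong (a *ℚ_) (trans (sym (ℚₚ.*-assoc (eps ρ) (eps ρ) b)) (trans (cong (_*ℚ b) (eps-sq ρ)) (ℚₚ.*-identityˡ b))))

all-ones : ∀ xs → All (0 <_) xs → sum xs ≤ length xs → xs ≡ replicate (sum xs) 1
all-ones []       _        _ = refl
all-ones (x ∷ xs) (p ∷ ps) h = cong₂ _∷_ x≡1 (all-ones xs ps (ℕₚ.≤-pred (subst (λ t → t + sum xs ≤ suc (length xs)) x≡1 h))) ∙ cong (λ t → replicate (t + sum xs) 1) (sym x≡1)
  where
  infixl 4 _∙_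
  _∙_ : ∀ {a b c : List ℕ} → a ≡ b → b ≡ c → a ≡ c
  _∙_ = trans
  length≤sum : ∀ xs → All (0 <_) xs → length xs ≤ sum xs
  length≤sum []       _        = z≤n
  length≤sum (x ∷ xs) (p ∷ ps) = ℕₚ.+-mono-≤ p (length≤sum xs ps)
  x≡1 : x ≡ 1
  x≡1 = ℕₚ.≤-antisym (ℕₚ.+-cancelʳ-≤ (length xs) x 1 (ℕₚ.≤-trans (ℕₚ.+-monoʳ-≤ x (length≤sum xs ps)) h)) p

Special : ℕ → List ℕ → Set
Special n λ' = λ' ≡ n ∷ [] ⊎ (λ' ≡ replicate n 1 ⊎ (λ' ≡ (n ∸ 1) ∷ 1 ∷ [] ⊎ λ' ≡ 2 ∷ replicate (n ∸ 2) 1))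

module Classification (q m : ℕ) (q≥2 : 2 ≤ q) (big : (2 * suc q) * (2 * suc q) < suc (suc q) + m) where
  open Large q m q≥2 big using (wide⇒one-row; Q<m; Q; n; μ)

  special : ∀ λ' → IsPartition n λ' → MultiplicityFree n μ λ' → Special n λ'
  special []       (() , _) mf
  special (x ∷ xs) part mf with length (x ∷ xs) ℕₚ.≤? x
  ... | yes w = [ inj₁ , (λ e → inj₂ (inj₂ (inj₁ e))) ]′ (wide⇒one-row (x ∷ xs) part w mf)
  -- The conjugate is wide, and the two wide solutions conjugate back to (1^n) and (2, 1^(n-2)).
  ... | no ¬w = tall (conjugate part) (MF-conj μ part mf)
    where
    tall : (C : ∃ λ λ' → IsPartition n λ' × length λ' ≡ x × hd λ' ≡ length (x ∷ xs) × (∀ ρ → All (0 <_) ρ → ι (χ λ' ρ) ≡ eps ρ *ℚ ι (χ (x ∷ xs) ρ))) →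
      MultiplicityFree n μ (proj₁ C) → Special n (x ∷ xs)
    tall (λ* , part* , len , head , _) mf* = [ as-column , as-near-column ]′ (wide⇒one-row λ* part* (subst₂ _≤_ (sym len) (sym head) (ℕₚ.<⇒≤ (ℕₚ.≰⇒> ¬w))) mf*)
      where
      as-column : λ* ≡ n ∷ [] → Special n (x ∷ xs)
      as-column e = inj₂ (inj₁ (trans (all-ones (x ∷ xs) (proj₁ (proj₂ part)) (ℕₚ.≤-reflexive (trans (proj₁ part) (trans (sym (cong hd e)) head)))) (cong (λ t → replicate t 1) (proj₁ part))))
      as-near-column : λ* ≡ (n ∸ 1) ∷ 1 ∷ [] → Special n (x ∷ xs)
      as-near-column e = inj₂ (inj₂ (inj₂ (cong₂ _∷_ x≡2 (trans (all-ones xs (All.tail (proj₁ (proj₂ part))) (ℕₚ.≤-reflexive rest)) (cong (λ t → replicate t 1) (trans rest len-xs))))))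
        where
        x≡2 : x ≡ 2
        x≡2 = trans (sym len) (cong length e)
        len' : suc Q + m ∸ 1 ≡ suc (length xs)
        len' = trans (sym (cong hd e)) head
        len-xs : length xs ≡ n ∸ 2
        len-xs = sym (cong (_∸ 1) len')
        rest : sum xs ≡ length xs
        rest = ℕₚ.suc-injective (ℕₚ.suc-injective (trans (cong (_+ sum xs) (sym x≡2)) (trans (proj₁ part) (cong suc len'))))

  private
    module C = Converse Q m Q<m

  free : ∀ λ' → IsPartition n λ' → Special n λ' → MultiplicityFree n μ λ'
  free λ' part (inj₁ refl)                = C.one-row
  free λ' part (inj₂ (inj₂ (inj₁ refl)))  = C.near-one-row
  free λ' part (inj₂ (inj₁ e))            = as-column λ' part e
    where
    as-column : ∀ λ' → IsPartition n λ' → λ' ≡ replicate n 1 → MultiplicityFree n μ λ'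
    as-column []       (() , _) e
    as-column (x ∷ xs) part e = MF-conj⁻ μ part (subst (MultiplicityFree n μ) (sym (shape (proj₁ (conjugate part)) (proj₁ (proj₂ (conjugate part))) (trans (proj₁ (proj₂ (proj₂ (conjugate part)))) (Listₚ.∷-injectiveˡ e)))) C.one-row)
      where
      shape : ∀ λ* → IsPartition n λ* → length λ* ≡ 1 → λ* ≡ n ∷ []
      shape (y ∷ []) (s , _) _ = cong (_∷ []) (trans (sym (ℕₚ.+-identityʳ y)) s)
  free λ' part (inj₂ (inj₂ (inj₂ e)))     = as-near-column λ' part e
    where
    as-near-column : ∀ λ' → IsPartition n λ' → λ' ≡ 2 ∷ replicate (n ∸ 2) 1 → MultiplicityFree n μ λ'
    as-near-column (x ∷ xs) part e = MF-conj⁻ μ part (subst (MultiplicityFree n μ) (sym (shape (proj₁ (conjugate part)) (proj₁ (proj₂ (conjugate part)))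
        (trans (proj₁ (proj₂ (proj₂ (conjugate part)))) (Listₚ.∷-injectiveˡ e)) (trans (proj₁ (proj₂ (proj₂ (proj₂ (conjugate part))))) (cong length e)))) C.near-one-row)
      where
      shape : ∀ λ* → IsPartition n λ* → length λ* ≡ 2 → hd λ* ≡ suc (length (replicate (n ∸ 2) 1)) → λ* ≡ (n ∸ 1) ∷ 1 ∷ []
      shape (y ∷ y' ∷ []) (s , _) _ h = cong₂ (λ a b → a ∷ b ∷ []) y≡ (ℕₚ.+-cancelˡ-≡ y y' 1 (trans (cong (y +_) (sym (ℕₚ.+-identityʳ y'))) (trans s (trans (cong suc (sym y≡)) (ℕₚ.+-comm 1 y)))))
        where
        y≡ : y ≡ n ∸ 1
        y≡ = trans h (cong suc (Listₚ.length-replicate (n ∸ 2)))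

theorem4p9 : (p n : ℕ) → 4 ≤ p → (2 * p ∸ 2) * (2 * p ∸ 2) < n →
    (λ' : List ℕ) → IsPartition n λ' →
    MultiplicityFree n ((n ∸ p) ∷ p ∷ []) λ' ⇔
    (λ' ≡ n ∷ [] ⊎ (λ' ≡ replicate n 1 ⊎
    (λ' ≡ (n ∸ 1) ∷ 1 ∷ [] ⊎ λ' ≡ 2 ∷ replicate (n ∸ 2) 1)))
theorem4p9 (suc (suc q)) n (s≤s (s≤s q≥2)) big λ' part = statement (n ∸ suc (suc q)) (sym (ℕₚ.m+[n∸m]≡n p≤n)) refl
  where
  -- With p = q + 2 and Q = q + 1 the given bound is (2Q)^2, and p ≥ 4 becomes `2 ≤ q`.
  2Q≡ : 2 * suc (suc q) ∸ 2 ≡ 2 * suc q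
  2Q≡ = cong (_∸ 2) (ℕₚ.*-suc 2 (suc q))
  big' : (2 * suc q) * (2 * suc q) < n
  big' = subst (λ t → t * t < n) 2Q≡ big
  p≤n : suc (suc q) ≤ n
  p≤n = ℕₚ.≤-trans (ℕₚ.≤-trans (subst (_≤ 2 * suc q) (ℕₚ.+-comm (suc q) 1) (ℕₚ.+-monoʳ-≤ (suc q) (s≤s z≤n))) (ℕₚ.m≤m*n (2 * suc q) (2 * suc q))) (ℕₚ.<⇒≤ big')
  statement : ∀ m → n ≡ suc (suc q) + m → m ≡ n ∸ suc (suc q) → MultiplicityFree n ((n ∸ suc (suc q)) ∷ suc (suc q) ∷ []) λ' ⇔ Special n λ'
  statement m refl e = subst (λ t → MultiplicityFree n (t ∷ suc (suc q) ∷ []) λ' ⇔ Special n λ') e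
    (mk⇔ (Classification.special q m q≥2 big' λ' part) (Classification.free q m q≥2 big' λ' part))
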